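{- Let $\mathbf{G}\sim G(n,1/2)$ and let $\mu_{\mathbf{G}}$ be the hardcore model on $\mathbf{G}$ at fugacity $\lambda=1$. For an integer $k\ge 0$, let $\mu^{\mathrm{Glauber}}_k(\mathbf{G})$ be the distribution of the state of the Glauber dynamics Markov chain on $\mathbf{G}$ started from the empty set and run until the stopping time $\tau = \min\{100\,(\log n)\,2^k,\ \tau_k\}$, where $\tau_k$ is the first time the Markov chain hits an independent set of size $k$. Then for $k = \log n - 30\log\log n$, with probability $1-o_n(1)$ over $\mathbf{G}$, $$w_2\left(\mu_{\mathbf{G}},\ \mu^{\mathrm{Glauber}}_{k}(\mathbf{G})\right) = o_n(1).$$ That is, there is a deterministic sequence $\varepsilon_n\to 0$ such that $\Pr_{\mathbf{G}}\left[w_2(\mu_{\mathbf{G}},\mu^{\mathrm{Glauber}}_{k}(\mathbf{G}))\le \varepsilon_n\right]\ge 1-\varepsilon_n$ for all sufficiently large $n$.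
   Context: $\log=\log_2$. $G(n,1/2)$ is the Erdős–Rényi random graph on $[n]=\{1,\dots,n\}$ with edge probability $1/2$. The quantity $\log n - 30\log\log n$ is understood as rounded to the nearest integer, and the time bound $100(\log n)2^k$ as rounded to an integer. The hardcore model on a graph $G$ with vertex set $[n]$ at fugacity $\lambda=1$ is the uniform distribution $\mu_G$ over all independent sets of $G$ (including $\emptyset$). Distributions over subsets of $[n]$ are regarded as probability measures on $\{0,1\}^n\subset\mathbb{R}^n$ via indicator vectors. Glauber dynamics on $G$ (for $\lambda=1$) is the Markov chain $(S_t)_{t\ge0}$ on independent sets of $G$ defined as follows: given $S_{t-1}$, sample $v\in[n]$ uniformly at random; if $S_{t-1}\cup\{v\}$ is not an independent set, set $S_t=S_{t-1}$; otherwise let $S_t$ be uniformly distributed on the two options $S_{t-1}\cup\{v\}$ and $S_{t-1}\setminus\{v\}$. Here $S_0=\emptyset$. For probability measures $\mu,\nu$ on a Euclidean space with norm $\|\cdot\|$, the normalized $2$-Wasserstein distance is $$w_2(\mu,\nu) = \inf_{\pi \in C(\mu,\nu)} \sqrt{ \mathbb{E}_{(X,Y)\sim\pi} \left\| \frac{X}{\sqrt{\mathbb{E}_{X\sim\mu}\|X\|^2}} - \frac{Y}{\sqrt{\mathbb{E}_{Y\sim\nu}\|Y\|^2}} \right\|^2 },$$ where $C(\mu,\nu)$ is the set of all couplings of $\mu$ and $\nu$. -}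

module Defs where

import Algebra.Properties.Semiring.Exp as Exp
open import Algebra.Bundles using (CommutativeRing)
open import Data.Bool.Base using (Bool; true; false; if_then_else_)
import Data.Bool.Properties as Bool
open import Data.Empty using (⊥)
open import Data.Fin.Base using (Fin; zero; suc)
open import Data.Fin.Properties using (all?)
open import Data.Fin.Subset as Subset using (Subset; inside; outside; _∈_; ⁅_⁆; _∪_)
open import Data.Fin.Subset.Properties using (_∈?_)
open import Data.Integer.Base as ℤ using (ℤ; +_; +[1+_])
import Data.Integer.Properties as ℤ
open import Data.List.Base as List using (List; []; _∷_; _++_; allFin; concatMap; filter; foldr; length; map)
open import Data.Nat.Base as ℕ using (ℕ; zero; suc; z≤n; s≤s)
import Data.Nat.Properties as ℕ
import Data.Nat.Solver
open import Data.Product.Base using (Σ; Σ-syntax; ∃; _×_; _,_)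
open import Data.Rational.Base as ℚ using (ℚ; 0ℚ; 1ℚ; ½)
import Data.Rational.Properties as ℚ
open import Data.Rational.Solver using (module +-*-Solver)
import Data.Rational.Unnormalised.Base as ℚᵘ
import Data.Rational.Unnormalised.Properties as ℚᵘ
open import Data.Sum.Base using (inj₁; inj₂)
open import Data.Vec.Base as Vec using (Vec; []; _∷_; lookup)
import Data.Vec.Properties as Vec
open import Relation.Binary.PropositionalEquality
open import Relation.Nullary using (¬_; Dec; does; yes; no; ¬?; _→-dec_)
open import Relation.Unary using (Decidable)

module ℚ^ = Exp (CommutativeRing.semiring ℚ.+-*-commutativeRing)

open ℚ^ using (_^_)
open Data.Nat.Solver.+-*-Solver using ()
  renaming (solve to solveℕ; _:=_ to _≐_; _:+_ to _⊕_; _:*_ to _⊗_; con to nat)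
open +-*-Solver using (solve; _:=_; _:+_; _:*_; _:-_; con)

2ℚ : ℚ
2ℚ = + 2 ℚ./ 1

frac : ℕ → ℕ → ℚ
frac j m = + j ℚ./ suc m

*-monoʳ : ∀ {p q r} → 0ℚ ℚ.≤ r → p ℚ.≤ q → p ℚ.* r ℚ.≤ q ℚ.* r
*-monoʳ {r = r} 0≤r = ℚ.*-monoʳ-≤-nonNeg r {{ℚ.nonNegative 0≤r}}

*-mono : ∀ {p q r s} → 0ℚ ℚ.≤ r → 0ℚ ℚ.≤ q → p ℚ.≤ q → r ℚ.≤ s → p ℚ.* r ℚ.≤ q ℚ.* s
*-mono {q = q} 0≤r 0≤q p≤q r≤s =
  ℚ.≤-trans (*-monoʳ 0≤r p≤q) (ℚ.*-monoˡ-≤-nonNeg q {{ℚ.nonNegative 0≤q}} r≤s)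

0≤* : ∀ {p q} → 0ℚ ℚ.≤ p → 0ℚ ℚ.≤ q → 0ℚ ℚ.≤ p ℚ.* q
0≤* {p} {q} 0≤p 0≤q = subst (ℚ._≤ p ℚ.* q) (ℚ.*-zeroˡ q) (*-monoʳ 0≤q 0≤p)

0<* : ∀ {p q} → 0ℚ ℚ.< p → 0ℚ ℚ.< q → 0ℚ ℚ.< p ℚ.* q
0<* {p} {q} 0<p 0<q =
  subst (ℚ._< p ℚ.* q) (ℚ.*-zeroˡ q) (ℚ.*-monoˡ-<-pos q {{ℚ.positive 0<q}} 0<p)

p≤p+q : ∀ {p q} → 0ℚ ℚ.≤ q → p ℚ.≤ p ℚ.+ q
p≤p+q {p} {q} 0≤q = subst (ℚ._≤ p ℚ.+ q) (ℚ.+-identityʳ p) (ℚ.+-monoʳ-≤ p 0≤q)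

p≤∣p∣ : ∀ p → p ℚ.≤ ℚ.∣ p ∣
p≤∣p∣ p with ℚ.≤-total 0ℚ p
... | inj₁ 0≤p = ℚ.≤-reflexive (sym (ℚ.0≤p⇒∣p∣≡p 0≤p))
... | inj₂ p≤0 = ℚ.≤-trans p≤0 (ℚ.0≤∣p∣ p)

∣p-q∣≡∣q-p∣ : ∀ p q → ℚ.∣ p ℚ.- q ∣ ≡ ℚ.∣ q ℚ.- p ∣
∣p-q∣≡∣q-p∣ p q = trans (sym (ℚ.∣-p∣≡∣p∣ (p ℚ.- q)))
  (cong ℚ.∣_∣ (solve 2 (λ p q → con 0ℚ :- (p :- q) := q :- p) refl p q ▹))
  where
  _▹ : ∀ {r s} → 0ℚ ℚ.- r ≡ s → ℚ.- r ≡ s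
  _▹ {r} eq = trans (sym (ℚ.+-identityˡ (ℚ.- r))) eq

half : ∀ {δ} → 0ℚ ℚ.< δ → 0ℚ ℚ.< δ ℚ.* ½
half 0<δ = 0<* 0<δ (ℚ.positive⁻¹ ½)

half+half : ∀ δ → δ ℚ.* ½ ℚ.+ δ ℚ.* ½ ≡ δ
half+half = solve 1 (λ δ → δ :* con ½ :+ δ :* con ½ := δ) refl

dist⇒≤ : ∀ {p q δ} → ℚ.∣ p ℚ.- q ∣ ℚ.≤ δ → p ℚ.≤ q ℚ.+ δ
dist⇒≤ {p} {q} d = subst (ℚ._≤ _) (solve 2 (λ p q → q :+ (p :- q) := p) refl p q)
  (ℚ.+-monoʳ-≤ q (ℚ.≤-trans (p≤∣p∣ (p ℚ.- q)) d))

≤⇒diff : ∀ {p q δ} → p ℚ.≤ q ℚ.+ δ → p ℚ.- q ℚ.≤ δ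
≤⇒diff {p} {q} {δ} h =
  subst (p ℚ.- q ℚ.≤_) (solve 2 (λ q δ → (q :+ δ) :- q := δ) refl q δ)
    (ℚ.+-monoˡ-≤ (ℚ.- q) h)

≤⇒dist : ∀ {p q δ} → p ℚ.≤ q ℚ.+ δ → q ℚ.≤ p ℚ.+ δ → ℚ.∣ p ℚ.- q ∣ ℚ.≤ δ
≤⇒dist {p} {q} {δ} h h′ with ℚ.≤-total 0ℚ (p ℚ.- q)
... | inj₁ 0≤ = subst (ℚ._≤ δ) (sym (ℚ.0≤p⇒∣p∣≡p 0≤)) (≤⇒diff h)
... | inj₂ ≤0 = subst (ℚ._≤ δ)
        (trans (sym (ℚ.0≤p⇒∣p∣≡p 0≤q-p)) (∣p-q∣≡∣q-p∣ q p)) (≤⇒diff h′)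
  where
  0≤q-p : 0ℚ ℚ.≤ q ℚ.- p
  0≤q-p = subst₂ ℚ._≤_ (solve 2 (λ p q → (p :- q) :+ (q :- p) := con 0ℚ) refl p q)
            (ℚ.+-identityˡ (q ℚ.- p)) (ℚ.+-monoˡ-≤ (q ℚ.- p) ≤0)

⊔-close : ∀ c {p q δ} → 0ℚ ℚ.≤ δ → p ℚ.≤ q ℚ.+ δ → c ℚ.⊔ p ℚ.≤ c ℚ.⊔ q ℚ.+ δ
⊔-close c {p} {q} {δ} 0≤δ h = ℚ.⊔-lub
  (ℚ.≤-trans (ℚ.p≤p⊔q c q) (p≤p+q 0≤δ))
  (ℚ.≤-trans h (ℚ.+-monoˡ-≤ δ (ℚ.p≤q⊔p c q)))

frac-toℚᵘ : ∀ j m → ℚ.toℚᵘ (frac j m) ℚᵘ.≃ ℚᵘ.mkℚᵘ (+ j) m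
frac-toℚᵘ j m = ℚ.toℚᵘ-fromℚᵘ (ℚᵘ.mkℚᵘ (+ j) m)

frac-+ : ∀ i m j n → frac i m ℚ.+ frac j n ≡ frac (i ℕ.* suc n ℕ.+ j ℕ.* suc m) (n ℕ.+ m ℕ.* suc n)
frac-+ i m j n = ℚ.toℚᵘ-injective (begin
  ℚ.toℚᵘ (frac i m ℚ.+ frac j n)              ≈⟨ ℚ.toℚᵘ-homo-+ (frac i m) (frac j n) ⟩
  ℚ.toℚᵘ (frac i m) ℚᵘ.+ ℚ.toℚᵘ (frac j n)    ≈⟨ ℚᵘ.+-cong (frac-toℚᵘ i m) (frac-toℚᵘ j n) ⟩
  ℚᵘ.mkℚᵘ (+ i) m ℚᵘ.+ ℚᵘ.mkℚᵘ (+ j) n        ≈⟨ ℚᵘ.≃-reflexive (cong (λ z → ℚᵘ.mkℚᵘ z _) eq) ⟩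
  ℚᵘ.mkℚᵘ (+ (i ℕ.* suc n ℕ.+ j ℕ.* suc m)) _ ≈⟨ ℚᵘ.≃-sym (frac-toℚᵘ _ (n ℕ.+ m ℕ.* suc n)) ⟩
  ℚ.toℚᵘ (frac (i ℕ.* suc n ℕ.+ j ℕ.* suc m) (n ℕ.+ m ℕ.* suc n)) ∎)
  where
  open ℚᵘ.≃-Reasoning
  eq : + i ℤ.* + suc n ℤ.+ + j ℤ.* + suc m ≡ + (i ℕ.* suc n ℕ.+ j ℕ.* suc m)
  eq = cong₂ ℤ._+_ (sym (ℤ.pos-* i (suc n))) (sym (ℤ.pos-* j (suc m)))

frac-mono : ∀ {i m j n} → i ℕ.* suc n ℕ.≤ j ℕ.* suc m → frac i m ℚ.≤ frac j n
frac-mono {i} {m} {j} {n} h = ℚ.toℚᵘ-cancel-≤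
  (ℚᵘ.≤-respˡ-≃ (ℚᵘ.≃-sym (frac-toℚᵘ i m)) (ℚᵘ.≤-respʳ-≃ (ℚᵘ.≃-sym (frac-toℚᵘ j n))
    (ℚᵘ.*≤* (subst₂ ℤ._≤_ (ℤ.pos-* i (suc n)) (ℤ.pos-* j (suc m)) (ℤ.+≤+ h)))))

frac-cancel : ∀ {i m j n} → frac i m ℚ.≤ frac j n → i ℕ.* suc n ℕ.≤ j ℕ.* suc m
frac-cancel {i} {m} {j} {n} h with
  ℚᵘ.≤-respˡ-≃ (frac-toℚᵘ i m) (ℚᵘ.≤-respʳ-≃ (frac-toℚᵘ j n) (ℚ.toℚᵘ-mono-≤ h))
... | ℚᵘ.*≤* h′ = ℤ.drop‿+≤+
  (subst₂ ℤ._≤_ (sym (ℤ.pos-* i (suc n))) (sym (ℤ.pos-* j (suc m))) h′)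

archimedean : ∀ c {δ} → 0ℚ ℚ.< δ → ∃ λ N → ∀ n → N ℕ.≤ n → frac c n ℚ.≤ δ
archimedean c {δ} 0<δ with δ | ℚ.positive 0<δ
... | ℚ.mkℚ +[1+ a ] b _ | _ = c ℕ.* suc b , λ n N≤n → ℚ.toℚᵘ-cancel-≤
  (ℚᵘ.≤-respˡ-≃ (ℚᵘ.≃-sym (frac-toℚᵘ c n))
    (ℚᵘ.*≤* (subst₂ ℤ._≤_ (ℤ.pos-* c (suc b)) (ℤ.pos-* (suc a) (suc n))
      (ℤ.+≤+ (ℕ.≤-trans N≤n (ℕ.≤-trans (ℕ.n≤1+n n) (ℕ.m≤m+n (suc n) _)))))))

numer : ℚ → ℕ
numer q = ℤ.∣ ℚ.↥ q ∣

q≤numer : ∀ q → q ℚ.≤ frac (numer q) 0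
q≤numer q@(ℚ.mkℚ n d _) = ℚ.toℚᵘ-cancel-≤
  (ℚᵘ.≤-respʳ-≃ (ℚᵘ.≃-sym (frac-toℚᵘ (numer q) 0)) (ℚᵘ.*≤* (aux n)))
  where
  aux : ∀ n → n ℤ.* + 1 ℤ.≤ + ℤ.∣ n ∣ ℤ.* + suc d
  aux (+ n) = subst₂ ℤ._≤_ (ℤ.pos-* n 1) (ℤ.pos-* n (suc d)) (ℤ.+≤+ (ℕ.*-monoʳ-≤ n (s≤s z≤n)))
  aux ℤ.-[1+ n ] = ℤ.≤-trans ℤ.-≤+ (ℤ.≤-reflexive (ℤ.pos-* (suc n) (suc d)))

0≤1 : 0ℚ ℚ.≤ 1ℚ
0≤1 = ℚ.nonNegative⁻¹ 1ℚ

0≤^ : ∀ {p} n → 0ℚ ℚ.≤ p → 0ℚ ℚ.≤ p ^ n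
0≤^ zero    0≤p = 0≤1
0≤^ (suc n) 0≤p = 0≤* 0≤p (0≤^ n 0≤p)

^-mono : ∀ {p q} n → 0ℚ ℚ.≤ p → p ℚ.≤ q → p ^ n ℚ.≤ q ^ n
^-mono zero    0≤p p≤q = ℚ.≤-refl
^-mono (suc n) 0≤p p≤q = *-mono (0≤^ n 0≤p) (ℚ.≤-trans 0≤p p≤q) p≤q (^-mono n 0≤p p≤q)

0<2^ : ∀ n → 0ℚ ℚ.< 2ℚ ^ n
0<2^ zero    = ℚ.positive⁻¹ 1ℚ
0<2^ (suc n) = 0<* (ℚ.positive⁻¹ 2ℚ) (0<2^ n)

2^-step : ∀ n → 2ℚ ^ n ℚ.< 2ℚ ^ suc n
2^-step n = subst₂ ℚ._<_ (ℚ.+-identityʳ (2ℚ ^ n))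
  (solve 1 (λ x → x :+ x := con 2ℚ :* x) refl (2ℚ ^ n))
  (ℚ.+-monoʳ-< (2ℚ ^ n) (0<2^ n))

2^-mono : ∀ {m n} → m ℕ.≤′ n → 2ℚ ^ m ℚ.≤ 2ℚ ^ n
2^-mono (ℕ.≤′-reflexive refl) = ℚ.≤-refl
2^-mono (ℕ.≤′-step {n} m≤n)    = ℚ.≤-trans (2^-mono m≤n) (ℚ.<⇒≤ (2^-step n))

2^-cancel : ∀ {m n} → 2ℚ ^ m ℚ.≤ 2ℚ ^ n → m ℕ.≤ n
2^-cancel {m} {n} h = ℕ.≮⇒≥ λ n<m →
  ℚ.<-irrefl refl (ℚ.<-≤-trans (2^-step n) (ℚ.≤-trans (2^-mono (ℕ.≤⇒≤′ n<m)) h))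

frac-suc : ∀ j m → frac (suc j) m ≡ frac j m ℚ.+ frac 1 m
frac-suc j m = trans
  (ℚ.≤-antisym (frac-mono {suc j} {m} {i} {n} (ℕ.≤-reflexive eq))
               (frac-mono {i} {n} {suc j} {m} (ℕ.≤-reflexive (sym eq))))
  (sym (frac-+ j m 1 m))
  where
  i = j ℕ.* suc m ℕ.+ 1 ℕ.* suc m
  n = m ℕ.+ m ℕ.* suc m
  eq : suc j ℕ.* suc (m ℕ.+ m ℕ.* suc m) ≡ (j ℕ.* suc m ℕ.+ 1 ℕ.* suc m) ℕ.* suc m
  eq = solveℕ 2 (λ j m → 
         (nat 1 ⊕ j) ⊗ (nat 1 ⊕ (m ⊕ m ⊗ (nat 1 ⊕ m)))
         ≐ (j ⊗ (nat 1 ⊕ m) ⊕ nat 1 ⊗ (nat 1 ⊕ m)) ⊗ (nat 1 ⊕ m)) refl j m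

0≤frac : ∀ j m → 0ℚ ℚ.≤ frac j m
0≤frac j m = frac-mono {0} {0} {j} {m} z≤n

0<frac1 : ∀ m → 0ℚ ℚ.< frac 1 m
0<frac1 m = ℚ.≰⇒> λ h → ℕ.1+n≰n (frac-cancel {1} {m} {0} {0} h)

frac≤2^ : ∀ c → frac c 0 ℚ.≤ 2ℚ ^ c
frac≤2^ zero    = 0≤1
frac≤2^ (suc c) = subst₂ ℚ._≤_ (sym (frac-suc c 0))
  (solve 1 (λ x → x :+ x := con 2ℚ :* x) refl (2ℚ ^ c))
  (ℚ.+-mono-≤ (frac≤2^ c) (2^-mono {0} {c} (ℕ.≤⇒≤′ z≤n)))

½^*2^ : ∀ n → ½ ^ n ℚ.* 2ℚ ^ n ≡ 1ℚ
½^*2^ zero    = refl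
½^*2^ (suc n) = trans
  (solve 2 (λ x y → (con ½ :* x) :* (con 2ℚ :* y) := x :* y) refl (½ ^ n) (2ℚ ^ n)) (½^*2^ n)

½^≤1 : ∀ n → ½ ^ n ℚ.≤ 1ℚ
½^≤1 zero    = ℚ.≤-refl
½^≤1 (suc n) = *-mono {½} {1ℚ} {½ ^ n} {1ℚ} (0≤^ n (ℚ.nonNegative⁻¹ ½)) 0≤1 (ℚ.<⇒≤ ½<1) (½^≤1 n)
  where
  ½<1 : ½ ℚ.< 1ℚ
  ½<1 = ℚ.*<* (ℤ.+<+ (s≤s (s≤s z≤n)))

-- (1 + t)ⁿ ≤ 1 + (2ⁿ - 1) t for 0 ≤ t ≤ 1
1+t^ : ∀ {t} n → 0ℚ ℚ.≤ t → t ℚ.≤ 1ℚ → (1ℚ ℚ.+ t) ^ n ℚ.≤ 1ℚ ℚ.+ (2ℚ ^ n ℚ.- 1ℚ) ℚ.* t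
1+t^ {t} zero 0≤t t≤1 =
  ℚ.≤-reflexive (solve 1 (λ t → con 1ℚ := con 1ℚ :+ (con 1ℚ :- con 1ℚ) :* t) refl t)
1+t^ {t} (suc n) 0≤t t≤1 = begin
  (1ℚ ℚ.+ t) ℚ.* (1ℚ ℚ.+ t) ^ n
    ≤⟨ ℚ.*-monoˡ-≤-nonNeg (1ℚ ℚ.+ t) {{ℚ.nonNegative (ℚ.≤-trans 0≤1 (p≤p+q 0≤t))}} (1+t^ n 0≤t t≤1) ⟩
  (1ℚ ℚ.+ t) ℚ.* (1ℚ ℚ.+ c ℚ.* t)
    ≡⟨ solve 2 (λ t c → (con 1ℚ :+ t) :* (con 1ℚ :+ c :* t)
                     := (con 1ℚ :+ t :+ c :* t) :+ (c :* t) :* t) refl t c ⟩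
  (1ℚ ℚ.+ t ℚ.+ c ℚ.* t) ℚ.+ (c ℚ.* t) ℚ.* t
    ≤⟨ ℚ.+-monoʳ-≤ (1ℚ ℚ.+ t ℚ.+ c ℚ.* t)
         (ℚ.*-monoˡ-≤-nonNeg (c ℚ.* t) {{ℚ.nonNegative (0≤* 0≤c 0≤t)}} t≤1) ⟩
  (1ℚ ℚ.+ t ℚ.+ c ℚ.* t) ℚ.+ (c ℚ.* t) ℚ.* 1ℚ
    ≡⟨ solve 2 (λ t x → (con 1ℚ :+ t :+ (x :- con 1ℚ) :* t) :+ ((x :- con 1ℚ) :* t) :* con 1ℚ
                     := con 1ℚ :+ (con 2ℚ :* x :- con 1ℚ) :* t) refl t (2ℚ ^ n) ⟩
  1ℚ ℚ.+ (2ℚ ^ suc n ℚ.- 1ℚ) ℚ.* t ∎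
  where
  open ℚ.≤-Reasoning
  c = 2ℚ ^ n ℚ.- 1ℚ
  0≤c : 0ℚ ℚ.≤ c
  0≤c = ℚ.+-monoˡ-≤ (ℚ.- 1ℚ) {1ℚ} {2ℚ ^ n} (2^-mono {0} {n} (ℕ.≤⇒≤′ z≤n))

[1+½ⁿ]ⁿ≤2 : ∀ n → (1ℚ ℚ.+ ½ ^ n) ^ n ℚ.≤ 2ℚ
[1+½ⁿ]ⁿ≤2 n = begin
  (1ℚ ℚ.+ ½ ^ n) ^ n                      ≤⟨ 1+t^ n 0≤½ⁿ (½^≤1 n) ⟩
  1ℚ ℚ.+ (2ℚ ^ n ℚ.- 1ℚ) ℚ.* ½ ^ n        ≡⟨ solve 2 (λ x h → con 1ℚ :+ (x :- con 1ℚ) :* h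
                                                := (con 1ℚ :+ h :* x) :- h) refl (2ℚ ^ n) (½ ^ n) ⟩
  (1ℚ ℚ.+ ½ ^ n ℚ.* 2ℚ ^ n) ℚ.- ½ ^ n     ≡⟨ cong (λ z → (1ℚ ℚ.+ z) ℚ.- ½ ^ n) (½^*2^ n) ⟩
  2ℚ ℚ.- ½ ^ n                            ≤⟨ ℚ.+-monoʳ-≤ 2ℚ (ℚ.neg-antimono-≤ 0≤½ⁿ) ⟩
  2ℚ ℚ.- 0ℚ                               ≡⟨⟩
  2ℚ                                      ∎
  where
  open ℚ.≤-Reasoning
  0≤½ⁿ : 0ℚ ℚ.≤ ½ ^ n
  0≤½ⁿ = 0≤^ n (ℚ.nonNegative⁻¹ ½)

-- The largest j ≤ b satisfying P, or 0 if there is none.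
greatest : {P : ℕ → Set} → Decidable P → ℕ → ℕ
greatest P? zero    = zero
greatest P? (suc b) with P? (suc b)
... | yes _ = suc b
... | no  _ = greatest P? b

module _ {P : ℕ → Set} (P? : Decidable P) where

  greatest-holds : ∀ b → P 0 → P (greatest P? b)
  greatest-holds zero    p₀ = p₀
  greatest-holds (suc b) p₀ with P? (suc b)
  ... | yes p = p
  ... | no  _ = greatest-holds b p₀

  greatest-maximal : ∀ b → ¬ P (suc b) → ¬ P (suc (greatest P? b))
  greatest-maximal zero    ¬p = ¬p
  greatest-maximal (suc b) ¬p with P? (suc b)
  ... | yes _  = ¬p
  ... | no  ¬q = greatest-maximal b ¬q

Cauchy : (ℕ → ℚ) → Set
Cauchy s = ∀ δ → 0ℚ ℚ.< δ → ∃ λ N → ∀ m n → N ℕ.≤ m → N ℕ.≤ n → ℚ.∣ s m ℚ.- s n ∣ ℚ.≤ δ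

-- Reals are Cauchy sequences of rationals with a modulus of convergence; the
-- arithmetic operations act pointwise on approximations, and equality is _≈_.
record ℝ : Set where
  constructor real
  field
    approx : ℕ → ℚ
    cauchy : Cauchy approx

open ℝ public

-- By symmetry in m and n, a one-sided estimate suffices.
one-sided : ∀ s →
  (∀ δ → 0ℚ ℚ.< δ → ∃ λ N → ∀ m n → N ℕ.≤ m → N ℕ.≤ n → s m ℚ.≤ s n ℚ.+ δ) → Cauchy s
one-sided s h δ 0<δ with h δ 0<δ
... | N , close = N , λ m n N≤m N≤n → ≤⇒dist (close m n N≤m N≤n) (close n m N≤n N≤m)

fromℚ : ℚ → ℝ
fromℚ q = real (λ _ → q) λ δ 0<δ → 0 , λ _ _ _ _ →
  ℚ.≤-trans (ℚ.≤-reflexive (cong ℚ.∣_∣ (ℚ.+-inverseʳ q))) (ℚ.<⇒≤ 0<δ)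

fromℕ : ℕ → ℝ
fromℕ n = fromℚ (+ n ℚ./ 1)

infix  8 -_
infixl 7 _*_
infixl 6 _+_ _-_
infix  4 _≤_ _<_ _≈_

_+_ : ℝ → ℝ → ℝ
real x cx + real y cy = real (λ n → x n ℚ.+ y n) λ δ 0<δ →
  let N , hx = cx (δ ℚ.* ½) (half 0<δ)
      M , hy = cy (δ ℚ.* ½) (half 0<δ)
  in N ℕ.⊔ M , λ m n ≤m ≤n → begin
    ℚ.∣ (x m ℚ.+ y m) ℚ.- (x n ℚ.+ y n) ∣
      ≡⟨ cong ℚ.∣_∣ (solve 4 (λ a b c d → (a :+ b) :- (c :+ d) := (a :- c) :+ (b :- d))
           refl (x m) (y m) (x n) (y n)) ⟩
    ℚ.∣ (x m ℚ.- x n) ℚ.+ (y m ℚ.- y n) ∣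
      ≤⟨ ℚ.∣p+q∣≤∣p∣+∣q∣ (x m ℚ.- x n) (y m ℚ.- y n) ⟩
    ℚ.∣ x m ℚ.- x n ∣ ℚ.+ ℚ.∣ y m ℚ.- y n ∣
      ≤⟨ ℚ.+-mono-≤ (hx m n (ℕ.m⊔n≤o⇒m≤o N M ≤m) (ℕ.m⊔n≤o⇒m≤o N M ≤n))
                    (hy m n (ℕ.m⊔n≤o⇒n≤o N M ≤m) (ℕ.m⊔n≤o⇒n≤o N M ≤n)) ⟩
    δ ℚ.* ½ ℚ.+ δ ℚ.* ½  ≡⟨ half+half δ ⟩
    δ ∎
  where open ℚ.≤-Reasoning

-_ : ℝ → ℝ
- real x cx = real (λ n → ℚ.- x n) λ δ 0<δ →
  let N , hx = cx δ 0<δ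
  in N , λ m n ≤m ≤n → subst (ℚ._≤ δ)
       (cong ℚ.∣_∣ (neg-diff (x n) (x m))) (hx n m ≤n ≤m)
  where
  neg-diff : ∀ a b → a ℚ.- b ≡ (ℚ.- b) ℚ.- (ℚ.- a)
  neg-diff = solve 2 (λ a b → a :- b := (+-*-Solver.:- b) :- (+-*-Solver.:- a)) refl

_-_ : ℝ → ℝ → ℝ
x - y = x + - y

bounded : ∀ {s} → Cauchy s →
  ∃ λ B → 0ℚ ℚ.< B × ∃ λ N → ∀ n → N ℕ.≤ n → ℚ.∣ s n ∣ ℚ.≤ B
bounded {s} cs with cs 1ℚ (ℚ.positive⁻¹ 1ℚ)
... | N , h = ℚ.∣ s N ∣ ℚ.+ 1ℚ
            , ℚ.<-≤-trans (ℚ.positive⁻¹ 1ℚ)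
                (subst (ℚ._≤ ℚ.∣ s N ∣ ℚ.+ 1ℚ) (ℚ.+-identityˡ 1ℚ) (ℚ.+-monoˡ-≤ 1ℚ (ℚ.0≤∣p∣ (s N))))
            , N , λ n N≤n → begin
    ℚ.∣ s n ∣                          ≡⟨ cong ℚ.∣_∣ (solve 2 (λ a b → a := b :+ (a :- b)) refl (s n) (s N)) ⟩
    ℚ.∣ s N ℚ.+ (s n ℚ.- s N) ∣        ≤⟨ ℚ.∣p+q∣≤∣p∣+∣q∣ (s N) (s n ℚ.- s N) ⟩
    ℚ.∣ s N ∣ ℚ.+ ℚ.∣ s n ℚ.- s N ∣    ≤⟨ ℚ.+-monoʳ-≤ ℚ.∣ s N ∣ (h n N N≤n ℕ.≤-refl) ⟩
    ℚ.∣ s N ∣ ℚ.+ 1ℚ                   ∎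
  where open ℚ.≤-Reasoning

_*_ : ℝ → ℝ → ℝ
real x cx * real y cy = real (λ n → x n ℚ.* y n) λ δ 0<δ →
  let Bx , 0<Bx , Nx , bx = bounded {x} cx
      By , 0<By , Ny , by = bounded {y} cy
      C   = Bx ℚ.+ By
      instance C⁺ : ℚ.Positive C
               C⁺ = ℚ.positive (ℚ.+-mono-< 0<Bx 0<By)
               C≢0 : ℚ.NonZero C
               C≢0 = ℚ.pos⇒nonZero C
      ε   = δ ℚ.* ℚ.1/ C
      0<ε = 0<* 0<δ (ℚ.positive⁻¹ (ℚ.1/ C) {{ℚ.1/pos⇒pos C}})
      N , hx = cx ε 0<ε
      M , hy = cy ε 0<ε
      K = (Nx ℕ.⊔ Ny) ℕ.⊔ (N ℕ.⊔ M)
      Nx≤ = λ {m} (le : K ℕ.≤ m) → ℕ.m⊔n≤o⇒m≤o Nx Ny (ℕ.m⊔n≤o⇒m≤o (Nx ℕ.⊔ Ny) (N ℕ.⊔ M) le)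
      Ny≤ = λ {m} (le : K ℕ.≤ m) → ℕ.m⊔n≤o⇒n≤o Nx Ny (ℕ.m⊔n≤o⇒m≤o (Nx ℕ.⊔ Ny) (N ℕ.⊔ M) le)
      N≤  = λ {m} (le : K ℕ.≤ m) → ℕ.m⊔n≤o⇒m≤o N M (ℕ.m⊔n≤o⇒n≤o (Nx ℕ.⊔ Ny) (N ℕ.⊔ M) le)
      M≤  = λ {m} (le : K ℕ.≤ m) → ℕ.m⊔n≤o⇒n≤o N M (ℕ.m⊔n≤o⇒n≤o (Nx ℕ.⊔ Ny) (N ℕ.⊔ M) le)
  in K , λ m n ≤m ≤n → begin
    ℚ.∣ x m ℚ.* y m ℚ.- x n ℚ.* y n ∣
      ≡⟨ cong ℚ.∣_∣ (solve 4 (λ a b c d → a :* b :- c :* d := a :* (b :- d) :+ d :* (a :- c))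
           refl (x m) (y m) (x n) (y n)) ⟩
    ℚ.∣ x m ℚ.* (y m ℚ.- y n) ℚ.+ y n ℚ.* (x m ℚ.- x n) ∣
      ≤⟨ ℚ.∣p+q∣≤∣p∣+∣q∣ (x m ℚ.* (y m ℚ.- y n)) (y n ℚ.* (x m ℚ.- x n)) ⟩
    ℚ.∣ x m ℚ.* (y m ℚ.- y n) ∣ ℚ.+ ℚ.∣ y n ℚ.* (x m ℚ.- x n) ∣
      ≡⟨ cong₂ ℚ._+_ (ℚ.∣p*q∣≡∣p∣*∣q∣ (x m) (y m ℚ.- y n)) (ℚ.∣p*q∣≡∣p∣*∣q∣ (y n) (x m ℚ.- x n)) ⟩
    ℚ.∣ x m ∣ ℚ.* ℚ.∣ y m ℚ.- y n ∣ ℚ.+ ℚ.∣ y n ∣ ℚ.* ℚ.∣ x m ℚ.- x n ∣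
      ≤⟨ ℚ.+-mono-≤
           (*-mono (ℚ.0≤∣p∣ (y m ℚ.- y n)) (ℚ.<⇒≤ 0<Bx) (bx m (Nx≤ ≤m)) (hy m n (M≤ ≤m) (M≤ ≤n)))
           (*-mono (ℚ.0≤∣p∣ (x m ℚ.- x n)) (ℚ.<⇒≤ 0<By) (by n (Ny≤ ≤n)) (hx m n (N≤ ≤m) (N≤ ≤n))) ⟩
    Bx ℚ.* ε ℚ.+ By ℚ.* ε
      ≡⟨ solve 4 (λ a b d i → a :* (d :* i) :+ b :* (d :* i) := d :* ((a :+ b) :* i))
           refl Bx By δ (ℚ.1/ C) ⟩
    δ ℚ.* (C ℚ.* ℚ.1/ C)
      ≡⟨ cong (δ ℚ.*_) (ℚ.*-inverseʳ C) ⟩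
    δ ℚ.* 1ℚ
      ≡⟨ ℚ.*-identityʳ δ ⟩
    δ ∎
  where open ℚ.≤-Reasoning

∣_∣ : ℝ → ℝ
∣ real x cx ∣ = real (λ n → ℚ.∣ x n ∣) (one-sided (λ n → ℚ.∣ x n ∣) λ δ 0<δ →
  let N , hx = cx δ 0<δ
  in N , λ m n ≤m ≤n → begin
    ℚ.∣ x m ∣                        ≡⟨ cong ℚ.∣_∣ (solve 2 (λ a b → a := b :+ (a :- b)) refl (x m) (x n)) ⟩
    ℚ.∣ x n ℚ.+ (x m ℚ.- x n) ∣      ≤⟨ ℚ.∣p+q∣≤∣p∣+∣q∣ (x n) (x m ℚ.- x n) ⟩
    ℚ.∣ x n ∣ ℚ.+ ℚ.∣ x m ℚ.- x n ∣  ≤⟨ ℚ.+-monoʳ-≤ ℚ.∣ x n ∣ (hx m n ≤m ≤n) ⟩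
    ℚ.∣ x n ∣ ℚ.+ δ                  ∎)
  where open ℚ.≤-Reasoning

_≤_ : ℝ → ℝ → Set
x ≤ y = ∀ δ → 0ℚ ℚ.< δ → ∃ λ N → ∀ n → N ℕ.≤ n → approx x n ℚ.≤ approx y n ℚ.+ δ

_<_ : ℝ → ℝ → Set
x < y = ∃ λ δ → 0ℚ ℚ.< δ × ∃ λ N → ∀ n → N ℕ.≤ n → approx x n ℚ.+ δ ℚ.≤ approx y n

_≈_ : ℝ → ℝ → Set
x ≈ y = x ≤ y × y ≤ x

0ℝ 1ℝ : ℝ
0ℝ = fromℚ 0ℚ
1ℝ = fromℚ 1ℚ

recip : ∀ c → 0ℚ ℚ.< c → ℚ → ℚ
recip c 0<c q = (ℚ.1/ (c ℚ.⊔ q)) {{ℚ.>-nonZero (ℚ.<-≤-trans 0<c (ℚ.p≤p⊔q c q))}}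

-- i and j play the roles of 1/u and 1/v.
reciprocals-close : ∀ {u v i j δ} → 0ℚ ℚ.≤ i → 0ℚ ℚ.≤ j → u ℚ.* i ≡ 1ℚ → v ℚ.* j ≡ 1ℚ →
  v ℚ.≤ u ℚ.+ δ ℚ.* (u ℚ.* v) → i ℚ.≤ j ℚ.+ δ
reciprocals-close {u} {v} {i} {j} {δ} 0≤i 0≤j ui≡1 vj≡1 v≤ = begin
  i                                        ≡⟨ ℚ.*-identityʳ i ⟨
  i ℚ.* 1ℚ                                 ≡⟨ cong (i ℚ.*_) vj≡1 ⟨
  i ℚ.* (v ℚ.* j)                          ≡⟨ solve 3 (λ i v j → i :* (v :* j) := v :* (i :* j)) refl i v j ⟩
  v ℚ.* (i ℚ.* j)                          ≤⟨ *-monoʳ (0≤* 0≤i 0≤j) v≤ ⟩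
  (u ℚ.+ δ ℚ.* (u ℚ.* v)) ℚ.* (i ℚ.* j)
    ≡⟨ solve 5 (λ u v i j δ → (u :+ δ :* (u :* v)) :* (i :* j)
                           := (u :* i) :* j :+ δ :* ((u :* i) :* (v :* j))) refl u v i j δ ⟩
  (u ℚ.* i) ℚ.* j ℚ.+ δ ℚ.* ((u ℚ.* i) ℚ.* (v ℚ.* j))
    ≡⟨ cong₂ (λ a b → a ℚ.* j ℚ.+ δ ℚ.* (a ℚ.* b)) ui≡1 vj≡1 ⟩
  1ℚ ℚ.* j ℚ.+ δ ℚ.* (1ℚ ℚ.* 1ℚ)
    ≡⟨ solve 2 (λ j δ → con 1ℚ :* j :+ δ :* (con 1ℚ :* con 1ℚ) := j :+ δ) refl j δ ⟩
  j ℚ.+ δ                                  ∎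
  where open ℚ.≤-Reasoning

recip-nonNeg : ∀ c (0<c : 0ℚ ℚ.< c) q → 0ℚ ℚ.≤ recip c 0<c q
recip-nonNeg c 0<c q =
  ℚ.<⇒≤ (ℚ.positive⁻¹ _ {{ℚ.1/pos⇒pos (c ℚ.⊔ q) {{ℚ.positive (ℚ.<-≤-trans 0<c (ℚ.p≤p⊔q c q))}}}})

recip-inverse : ∀ c (0<c : 0ℚ ℚ.< c) q → (c ℚ.⊔ q) ℚ.* recip c 0<c q ≡ 1ℚ
recip-inverse c 0<c q = ℚ.*-inverseʳ (c ℚ.⊔ q) {{ℚ.>-nonZero (ℚ.<-≤-trans 0<c (ℚ.p≤p⊔q c q))}}

recip-cauchy : ∀ {s} c (0<c : 0ℚ ℚ.< c) → Cauchy s → Cauchy (λ n → recip c 0<c (s n))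
recip-cauchy {s} c 0<c cs = one-sided (λ n → recip c 0<c (s n)) λ δ 0<δ →
  let 0<c² = 0<* 0<c 0<c
      N , h = cs (δ ℚ.* (c ℚ.* c)) (0<* 0<δ 0<c²)
  in N , λ m n ≤m ≤n →
    let c≤u = ℚ.p≤p⊔q c (s m)
    in reciprocals-close {c ℚ.⊔ s m} {c ℚ.⊔ s n} (recip-nonNeg c 0<c (s m)) (recip-nonNeg c 0<c (s n))
         (recip-inverse c 0<c (s m)) (recip-inverse c 0<c (s n))
         (ℚ.≤-trans
           (⊔-close c (ℚ.<⇒≤ (0<* 0<δ 0<c²)) (dist⇒≤ (h n m ≤n ≤m)))
           (ℚ.+-monoʳ-≤ (c ℚ.⊔ s m) (ℚ.*-monoˡ-≤-nonNeg δ {{ℚ.nonNegative (ℚ.<⇒≤ 0<δ)}}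
             (*-mono (ℚ.<⇒≤ 0<c) (ℚ.≤-trans (ℚ.<⇒≤ 0<c) c≤u) c≤u (ℚ.p≤p⊔q c (s n))))))

-- The witness of 0 < x contains a rational c > 0 with c ≤ x n eventually, so
-- replacing x n by c ⊔ x n does not change the limit.
inv : (x : ℝ) → 0ℝ < x → ℝ
inv (real x cx) (c , 0<c , _) = real (λ n → recip c 0<c (x n)) (recip-cauchy c 0<c cx)

-- The n-th approximation of √ x is the largest multiple of 1/(n+1) whose square
-- is at most max(0, x n); thus √ x is the usual square root when x ≥ 0, and 0
-- when x ≤ 0.
√-P? : ∀ (q : ℚ) m → Decidable (λ j → frac j m ℚ.* frac j m ℚ.≤ 0ℚ ℚ.⊔ q)
√-P? q m j = frac j m ℚ.* frac j m ℚ.≤? 0ℚ ℚ.⊔ q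

√-index : ℕ → ℚ → ℕ
√-index m q = greatest (√-P? q m) (suc m ℕ.* suc (numer q))

√-lower : ∀ m q → frac (√-index m q) m ℚ.* frac (√-index m q) m ℚ.≤ 0ℚ ℚ.⊔ q
√-lower m q = greatest-holds (√-P? q m) (suc m ℕ.* suc (numer q))
  (subst (λ z → z ℚ.* z ℚ.≤ 0ℚ ℚ.⊔ q) (ℚ.≤-antisym (0≤frac 0 m) (frac-mono {0} {m} {0} {0} z≤n))
    (ℚ.p≤p⊔q 0ℚ q))

√-upper : ∀ m q → 0ℚ ℚ.⊔ q ℚ.≤ (frac (√-index m q) m ℚ.+ frac 1 m) ℚ.* (frac (√-index m q) m ℚ.+ frac 1 m)
√-upper m q = subst (λ z → 0ℚ ℚ.⊔ q ℚ.≤ z ℚ.* z) (frac-suc (√-index m q) m)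
  (ℚ.<⇒≤ (ℚ.≰⇒> (greatest-maximal (√-P? q m) b λ h → ℚ.<-irrefl refl (ℚ.<-≤-trans big h))))
  where
  c = numer q
  b = suc m ℕ.* suc c
  q<1+c : 0ℚ ℚ.⊔ q ℚ.< frac (suc c) 0
  q<1+c = ℚ.≤-<-trans (ℚ.⊔-lub (0≤frac c 0) (q≤numer q))
    (subst₂ ℚ._<_ (ℚ.+-identityʳ (frac c 0)) (sym (frac-suc c 0)) (ℚ.+-monoʳ-< (frac c 0) (0<frac1 0)))
  1+c≤ : frac (suc c) 0 ℚ.≤ frac (suc b) m
  1+c≤ = frac-mono {suc c} {0} {suc b} {m}
    (subst (ℕ._≤ suc b ℕ.* 1) (ℕ.*-comm (suc m) (suc c)) (subst (b ℕ.≤_) (sym (ℕ.*-identityʳ (suc b))) (ℕ.n≤1+n b)))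
  1≤1+c : 1ℚ ℚ.≤ frac (suc c) 0
  1≤1+c = frac-mono {1} {0} {suc c} {0} (s≤s z≤n)
  big : 0ℚ ℚ.⊔ q ℚ.< frac (suc b) m ℚ.* frac (suc b) m
  big = ℚ.<-≤-trans q<1+c (subst (ℚ._≤ frac (suc b) m ℚ.* frac (suc b) m) (ℚ.*-identityʳ _)
    (*-mono 0≤1 (0≤frac (suc b) m) 1+c≤ (ℚ.≤-trans 1≤1+c 1+c≤)))

√-close : ∀ {a a′ r r′ e d} → 0ℚ ℚ.≤ r′ → 0ℚ ℚ.≤ e → e ℚ.≤ d → 0ℚ ℚ.< d →
  r ℚ.* r ℚ.≤ a → a ℚ.≤ a′ ℚ.+ d ℚ.* d → a′ ℚ.≤ (r′ ℚ.+ e) ℚ.* (r′ ℚ.+ e) →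
  r ℚ.≤ r′ ℚ.+ (d ℚ.+ d)
√-close {a} {a′} {r} {r′} {e} {d} 0≤r′ 0≤e e≤d 0<d lo a≤ hi =
  ℚ.≮⇒≥ λ far → ℚ.<-irrefl refl (ℚ.<-≤-trans (below far) (ℚ.≤-trans step enough))
  where
  open ℚ.≤-Reasoning
  0≤d = ℚ.<⇒≤ 0<d
  0≤r′+e : 0ℚ ℚ.≤ r′ ℚ.+ e
  0≤r′+e = ℚ.+-mono-≤ 0≤r′ 0≤e
  0≤r′+d : 0ℚ ℚ.≤ r′ ℚ.+ d
  0≤r′+d = ℚ.+-mono-≤ 0≤r′ 0≤d
  0<s : 0ℚ ℚ.< r′ ℚ.+ (d ℚ.+ d)
  0<s = ℚ.+-mono-≤-< 0≤r′ (ℚ.+-mono-< 0<d 0<d)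
  e-step : r′ ℚ.+ e ℚ.≤ r′ ℚ.+ d
  e-step = ℚ.+-monoʳ-≤ r′ e≤d
  step : r ℚ.* r ℚ.≤ (r′ ℚ.+ d) ℚ.* (r′ ℚ.+ d) ℚ.+ d ℚ.* d
  step = ℚ.≤-trans lo (ℚ.≤-trans a≤ (ℚ.+-monoˡ-≤ (d ℚ.* d)
           (ℚ.≤-trans hi (*-mono 0≤r′+e 0≤r′+d e-step e-step))))
  below : r′ ℚ.+ (d ℚ.+ d) ℚ.< r → (r′ ℚ.+ (d ℚ.+ d)) ℚ.* (r′ ℚ.+ (d ℚ.+ d)) ℚ.< r ℚ.* r
  below far = ℚ.<-≤-trans
    (ℚ.*-monoʳ-<-pos (r′ ℚ.+ (d ℚ.+ d)) {{ℚ.positive 0<s}} far)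
    (*-monoʳ (ℚ.<⇒≤ (ℚ.<-trans 0<s far)) (ℚ.<⇒≤ far))
  enough : (r′ ℚ.+ d) ℚ.* (r′ ℚ.+ d) ℚ.+ d ℚ.* d ℚ.≤ (r′ ℚ.+ (d ℚ.+ d)) ℚ.* (r′ ℚ.+ (d ℚ.+ d))
  enough = begin
    (r′ ℚ.+ d) ℚ.* (r′ ℚ.+ d) ℚ.+ d ℚ.* d
      ≤⟨ p≤p+q (0≤* 0≤d (ℚ.+-mono-≤ 0≤r′+d 0≤r′+d)) ⟩
    (r′ ℚ.+ d) ℚ.* (r′ ℚ.+ d) ℚ.+ d ℚ.* d ℚ.+ d ℚ.* ((r′ ℚ.+ d) ℚ.+ (r′ ℚ.+ d))
      ≡⟨ solve 2 (λ r d → (r :+ d) :* (r :+ d) :+ d :* d :+ d :* ((r :+ d) :+ (r :+ d))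
                       := (r :+ (d :+ d)) :* (r :+ (d :+ d))) refl r′ d ⟩
    (r′ ℚ.+ (d ℚ.+ d)) ℚ.* (r′ ℚ.+ (d ℚ.+ d)) ∎

√ : ℝ → ℝ
√ (real x cx) = real r (one-sided r λ δ 0<δ →
  let d = δ ℚ.* ½
      0<d = half 0<δ
      N , hx = cx (d ℚ.* d) (0<* 0<d 0<d)
      M , ha = archimedean 1 0<d
  in N ℕ.⊔ M , λ m n ≤m ≤n → subst (λ z → r m ℚ.≤ r n ℚ.+ z) (half+half δ)
       (√-close {0ℚ ℚ.⊔ x m} {0ℚ ℚ.⊔ x n} {r m} {r n} {frac 1 n} {d}
         (0≤frac (√-index n (x n)) n) (0≤frac 1 n) (ha n (ℕ.m⊔n≤o⇒n≤o N M ≤n)) 0<d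
         (√-lower m (x m))
         (⊔-close 0ℚ {x m} {x n} (ℚ.<⇒≤ (0<* 0<d 0<d))
           (dist⇒≤ {x m} {x n} (hx m n (ℕ.m⊔n≤o⇒m≤o N M ≤m) (ℕ.m⊔n≤o⇒m≤o N M ≤n))))
         (√-upper n (x n))))
  where
  r : ℕ → ℚ
  r m = frac (√-index m (x m)) m

-- The n-th approximation of log₂ x is the largest fraction j/(n+1) with
-- 2 ^ j ≤ max(1, x n) ^ (n+1); thus log₂ x is the usual binary logarithm when
-- x ≥ 1, and 0 when x ≤ 1.  Only the range x ≥ 1 is used: both n and log₂ n
-- are at least 1 as soon as n ≥ 2.
log-P? : ∀ (q : ℚ) m → Decidable (λ j → 2ℚ ^ j ℚ.≤ (1ℚ ℚ.⊔ q) ^ suc m)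
log-P? q m j = 2ℚ ^ j ℚ.≤? (1ℚ ℚ.⊔ q) ^ suc m

log-index : ℕ → ℚ → ℕ
log-index m q = greatest (log-P? q m) (suc (numer q) ℕ.* suc m)

1≤^ : ∀ {p} n → 1ℚ ℚ.≤ p → 1ℚ ℚ.≤ p ^ n
1≤^ zero    1≤p = ℚ.≤-refl
1≤^ (suc n) 1≤p = *-mono {1ℚ} {_} {1ℚ} 0≤1 (ℚ.≤-trans 0≤1 1≤p) 1≤p (1≤^ n 1≤p)

log-lower : ∀ m q → 2ℚ ^ log-index m q ℚ.≤ (1ℚ ℚ.⊔ q) ^ suc m
log-lower m q = greatest-holds (log-P? q m) (suc (numer q) ℕ.* suc m) (1≤^ (suc m) (ℚ.p≤p⊔q 1ℚ q))

log-upper : ∀ m q → (1ℚ ℚ.⊔ q) ^ suc m ℚ.≤ 2ℚ ^ suc (log-index m q)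
log-upper m q = ℚ.<⇒≤ (ℚ.≰⇒> (greatest-maximal (log-P? q m) b
  λ h → ℚ.<-irrefl refl (ℚ.<-≤-trans (2^-step b) (ℚ.≤-trans h big))))
  where
  c = suc (numer q)
  b = c ℕ.* suc m
  q≤c : 1ℚ ℚ.⊔ q ℚ.≤ 2ℚ ^ c
  q≤c = ℚ.≤-trans (ℚ.⊔-lub (frac-mono {1} {0} {c} {0} (s≤s z≤n))
    (ℚ.≤-trans (q≤numer q) (frac-mono {numer q} {0} {c} {0} (ℕ.*-monoˡ-≤ 1 (ℕ.n≤1+n (numer q))))))
    (frac≤2^ c)
  big : (1ℚ ℚ.⊔ q) ^ suc m ℚ.≤ 2ℚ ^ b
  big = subst ((1ℚ ℚ.⊔ q) ^ suc m ℚ.≤_) (ℚ^.^-assocʳ 2ℚ c (suc m))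
    (^-mono (suc m) (ℚ.≤-trans 0≤1 (ℚ.p≤p⊔q 1ℚ q)) q≤c)

*-^ : ∀ p q n → (p ℚ.* q) ^ n ≡ p ^ n ℚ.* q ^ n
*-^ p q zero    = refl
*-^ p q (suc n) = trans (cong (p ℚ.* q ℚ.*_) (*-^ p q n))
  (solve 4 (λ p q x y → (p :* q) :* (x :* y) := (p :* x) :* (q :* y)) refl p q (p ^ n) (q ^ n))

-- If a ≤ a′ + 2⁻ᴷ, 2ʲ ≤ aᴹ and a′ᴹ′ ≤ 2ʲ′⁺¹ with K ≤ M′ then j/M ≤ j′/M′ + 2/K.
log-close : ∀ {a a′} j j′ M M′ K → 1ℚ ℚ.≤ a′ → 0ℚ ℚ.≤ a → a ℚ.≤ a′ ℚ.+ ½ ^ K →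
  2ℚ ^ j ℚ.≤ a ^ M → a′ ^ M′ ℚ.≤ 2ℚ ^ suc j′ → K ℕ.≤ M′ →
  j ℕ.* (M′ ℕ.* K) ℕ.≤ j′ ℕ.* (M ℕ.* K) ℕ.+ 2 ℕ.* (M ℕ.* M′)
log-close {a} {a′} j j′ M M′ K 1≤a′ 0≤a a≤ lo hi K≤M′ = ℕ.≤-trans (2^-cancel chain) exps
  where
  t = ½ ^ K
  0≤t : 0ℚ ℚ.≤ t
  0≤t = 0≤^ K (ℚ.nonNegative⁻¹ ½)
  0≤a′ = ℚ.≤-trans 0≤1 1≤a′
  E = M ℕ.* (M′ ℕ.* K)
  a≤′ : a ℚ.≤ a′ ℚ.* (1ℚ ℚ.+ t)
  a≤′ = ℚ.≤-trans a≤ (subst (a′ ℚ.+ t ℚ.≤_)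
    (solve 2 (λ a t → a :+ a :* t := a :* (con 1ℚ :+ t)) refl a′ t)
    (ℚ.+-monoʳ-≤ a′ (subst (ℚ._≤ a′ ℚ.* t) (ℚ.*-identityˡ t) (*-monoʳ 0≤t 1≤a′))))
  E₁ : E ≡ M′ ℕ.* (M ℕ.* K)
  E₁ = solveℕ 3 (λ M M′ K → M ⊗ (M′ ⊗ K) ≐ M′ ⊗ (M ⊗ K)) refl M M′ K
  E₂ : E ≡ K ℕ.* (M ℕ.* M′)
  E₂ = solveℕ 3 (λ M M′ K → M ⊗ (M′ ⊗ K) ≐ K ⊗ (M ⊗ M′)) refl M M′ K
  open ℚ.≤-Reasoning
  a′^E : a′ ^ E ℚ.≤ 2ℚ ^ (suc j′ ℕ.* (M ℕ.* K))
  a′^E = begin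
    a′ ^ E                          ≡⟨ cong (a′ ^_) E₁ ⟩
    a′ ^ (M′ ℕ.* (M ℕ.* K))         ≡⟨ ℚ^.^-assocʳ a′ M′ (M ℕ.* K) ⟨
    (a′ ^ M′) ^ (M ℕ.* K)           ≤⟨ ^-mono (M ℕ.* K) (0≤^ M′ 0≤a′) hi ⟩
    (2ℚ ^ suc j′) ^ (M ℕ.* K)       ≡⟨ ℚ^.^-assocʳ 2ℚ (suc j′) (M ℕ.* K) ⟩
    2ℚ ^ (suc j′ ℕ.* (M ℕ.* K))     ∎
  t^E : (1ℚ ℚ.+ t) ^ E ℚ.≤ 2ℚ ^ (M ℕ.* M′)
  t^E = begin
    (1ℚ ℚ.+ t) ^ E                  ≡⟨ cong ((1ℚ ℚ.+ t) ^_) E₂ ⟩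
    (1ℚ ℚ.+ t) ^ (K ℕ.* (M ℕ.* M′)) ≡⟨ ℚ^.^-assocʳ (1ℚ ℚ.+ t) K (M ℕ.* M′) ⟨
    ((1ℚ ℚ.+ t) ^ K) ^ (M ℕ.* M′)   ≤⟨ ^-mono (M ℕ.* M′) (0≤^ K (ℚ.≤-trans 0≤1 (p≤p+q 0≤t))) ([1+½ⁿ]ⁿ≤2 K) ⟩
    2ℚ ^ (M ℕ.* M′)                 ∎
  chain : 2ℚ ^ (j ℕ.* (M′ ℕ.* K)) ℚ.≤ 2ℚ ^ (suc j′ ℕ.* (M ℕ.* K) ℕ.+ M ℕ.* M′)
  chain = begin
    2ℚ ^ (j ℕ.* (M′ ℕ.* K))         ≡⟨ ℚ^.^-assocʳ 2ℚ j (M′ ℕ.* K) ⟨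
    (2ℚ ^ j) ^ (M′ ℕ.* K)           ≤⟨ ^-mono (M′ ℕ.* K) (ℚ.<⇒≤ (0<2^ j)) lo ⟩
    (a ^ M) ^ (M′ ℕ.* K)            ≡⟨ ℚ^.^-assocʳ a M (M′ ℕ.* K) ⟩
    a ^ E                           ≤⟨ ^-mono E 0≤a a≤′ ⟩
    (a′ ℚ.* (1ℚ ℚ.+ t)) ^ E         ≡⟨ *-^ a′ (1ℚ ℚ.+ t) E ⟩
    a′ ^ E ℚ.* (1ℚ ℚ.+ t) ^ E       ≤⟨ *-mono (0≤^ E (ℚ.≤-trans 0≤1 (p≤p+q 0≤t))) (ℚ.<⇒≤ (0<2^ (suc j′ ℕ.* (M ℕ.* K)))) a′^E t^E ⟩
    2ℚ ^ (suc j′ ℕ.* (M ℕ.* K)) ℚ.* 2ℚ ^ (M ℕ.* M′)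
                                    ≡⟨ ℚ^.^-homo-* 2ℚ (suc j′ ℕ.* (M ℕ.* K)) (M ℕ.* M′) ⟨
    2ℚ ^ (suc j′ ℕ.* (M ℕ.* K) ℕ.+ M ℕ.* M′) ∎
  exps : suc j′ ℕ.* (M ℕ.* K) ℕ.+ M ℕ.* M′ ℕ.≤ j′ ℕ.* (M ℕ.* K) ℕ.+ 2 ℕ.* (M ℕ.* M′)
  exps = subst₂ ℕ._≤_
    (solveℕ 3 (λ p x y → p ⊕ (x ⊕ y) ≐ (x ⊕ p) ⊕ y) refl
      (j′ ℕ.* (M ℕ.* K)) (M ℕ.* K) (M ℕ.* M′))
    (cong (j′ ℕ.* (M ℕ.* K) ℕ.+_) (solveℕ 1 (λ y → y ⊕ y ≐ nat 2 ⊗ y) refl (M ℕ.* M′)))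
    (ℕ.+-monoʳ-≤ (j′ ℕ.* (M ℕ.* K)) (ℕ.+-monoˡ-≤ (M ℕ.* M′) (ℕ.*-monoʳ-≤ M K≤M′)))

frac-≤-+ : ∀ j m j′ n k →
  j ℕ.* (suc n ℕ.* suc k) ℕ.≤ j′ ℕ.* (suc m ℕ.* suc k) ℕ.+ 2 ℕ.* (suc m ℕ.* suc n) →
  frac j m ℚ.≤ frac j′ n ℚ.+ frac 2 k
frac-≤-+ j m j′ n k h = subst (frac j m ℚ.≤_) (sym (frac-+ j′ n 2 k))
  (frac-mono {j} {m} {j′ ℕ.* suc k ℕ.+ 2 ℕ.* suc n} {k ℕ.+ n ℕ.* suc k} (subst (j ℕ.* (suc n ℕ.* suc k) ℕ.≤_)
    (solveℕ 4 (λ j m n k → 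
        j ⊗ (m ⊗ k) ⊕ nat 2 ⊗ (m ⊗ n) ≐ (j ⊗ k ⊕ nat 2 ⊗ n) ⊗ m) refl j′ (suc m) (suc n) (suc k)) h))

log₂ : ℝ → ℝ
log₂ (real x cx) = real (λ m → frac (log-index m (x m)) m) (one-sided (λ m → frac (log-index m (x m)) m) λ δ 0<δ →
  let k , hk = archimedean 2 0<δ
      t = ½ ^ suc k
      0<t : 0ℚ ℚ.< t
      0<t = ℚ.≰⇒> λ h → ℚ.<-irrefl refl (ℚ.<-≤-trans (ℚ.positive⁻¹ 1ℚ)
              (subst₂ ℚ._≤_ (½^*2^ (suc k)) (ℚ.*-zeroˡ (2ℚ ^ suc k)) (*-monoʳ (ℚ.<⇒≤ (0<2^ (suc k))) h)))
      N , hx = cx t 0<t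
  in N ℕ.⊔ k , λ m n ≤m ≤n → ℚ.≤-trans
       (frac-≤-+ (log-index m (x m)) m (log-index n (x n)) n k
         (log-close (log-index m (x m)) (log-index n (x n)) (suc m) (suc n) (suc k)
           (ℚ.p≤p⊔q 1ℚ (x n)) (ℚ.≤-trans 0≤1 (ℚ.p≤p⊔q 1ℚ (x m)))
           (⊔-close 1ℚ {x m} {x n} (ℚ.<⇒≤ 0<t) (dist⇒≤ {x m} {x n} (hx m n (ℕ.m⊔n≤o⇒m≤o N k ≤m) (ℕ.m⊔n≤o⇒m≤o N k ≤n))))
           (log-lower m (x m)) (log-upper n (x n)) (s≤s (ℕ.m⊔n≤o⇒n≤o N k ≤n))))
       (ℚ.+-monoʳ-≤ (frac (log-index n (x n)) n) (hk k ℕ.≤-refl)))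

∑ : {A : Set} → List A → (A → ℝ) → ℝ
∑ xs f = foldr (λ x s → f x + s) 0ℝ xs

_⟶0 : (ℕ → ℝ) → Set
ε ⟶0 = ∀ δ → 0ℝ < δ → ∃ λ N → ∀ n → N ℕ.≤ n → ∣ ε n ∣ ≤ δ

-- inf f ≤ c for a family f of reals, without assuming that the infimum exists
-- as a Cauchy real.
Inf_≤_ : {I : Set} → (I → ℝ) → ℝ → Set
Inf f ≤ c = ∀ δ → 0ℝ < δ → ∃ λ i → f i ≤ c + δ

_NearestTo_ : ℕ → ℝ → Set
k NearestTo x = ∣ x - fromℕ k ∣ ≤ fromℚ ½

-- Allows rounding down, up, or to the nearest integer.
_RoundingOf_ : ℕ → ℝ → Set
m RoundingOf x = ∣ x - fromℕ m ∣ < 1ℝ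

-- Finitely supported distributions: outcomes with weights.  An outcome may be
-- listed several times, in which case its weights add up.
Dist : Set → Set
Dist A = List (A × ℚ)

return : {A : Set} → A → Dist A
return a = (a , 1ℚ) ∷ []

_>>=_ : {A B : Set} → Dist A → (A → Dist B) → Dist B
d >>= f = concatMap (λ (a , p) → map (λ (b , q) → b , p ℚ.* q) (f a)) d

uniform : {A : Set} → List A → Dist A
uniform []          = []
uniform xs@(_ ∷ ys) = map (λ x → x , + 1 ℚ./ suc (length ys)) xs

Pr : {A : Set} → Dist A → (A → Bool) → ℚ
Pr d E = foldr (λ (a , p) s → if E a then p ℚ.+ s else s) 0ℚ d

-- Pr[P] ≥ r for a property P that is not given with a decision procedure.
ProbAtLeast : {A : Set} → Dist A → (A → Set) → ℝ → Set
ProbAtLeast {A} d P r =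
  Σ[ E ∈ (A → Bool) ] (∀ a → E a ≡ true → P a) × r ≤ fromℚ (Pr d E)

subsets : ∀ n → List (Subset n)
subsets zero    = [] ∷ []
subsets (suc n) = map (outside ∷_) (subsets n) ++ map (inside ∷_) (subsets n)

law : ∀ {n} → Dist (Subset n) → Subset n → ℝ
law d S = fromℚ (Pr d λ S′ → does (Vec.≡-dec Bool._≟_ S′ S))

-- N ∷ G adds to G a new vertex, numbered zero, with neighbourhood N; the old
-- vertices are shifted by one.  So a graph is one bit per unordered pair of
-- distinct vertices.
data Graph : ℕ → Set where
  []  : Graph 0
  _∷_ : ∀ {n} → Subset n → Graph n → Graph (suc n)

Adjacent : ∀ {n} → Graph n → Fin n → Fin n → Set
Adjacent (N ∷ G) zero    zero    = ⊥
Adjacent (N ∷ G) zero    (suc j) = j ∈ N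
Adjacent (N ∷ G) (suc i) zero    = i ∈ N
Adjacent (N ∷ G) (suc i) (suc j) = Adjacent G i j

adjacent? : ∀ {n} (G : Graph n) i j → Dec (Adjacent G i j)
adjacent? (N ∷ G) zero    zero    = no λ ()
adjacent? (N ∷ G) zero    (suc j) = j ∈? N
adjacent? (N ∷ G) (suc i) zero    = i ∈? N
adjacent? (N ∷ G) (suc i) (suc j) = adjacent? G i j

Independent : ∀ {n} → Graph n → Subset n → Set
Independent G S = ∀ i j → i ∈ S → j ∈ S → ¬ Adjacent G i j

independent? : ∀ {n} (G : Graph n) → Decidable (Independent G)
independent? G S =
  all? λ i → all? λ j → (i ∈? S) →-dec ((j ∈? S) →-dec ¬? (adjacent? G i j))

randomSubset : ∀ n → Dist (Subset n)
randomSubset zero    = return []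
randomSubset (suc n) = do
  b ← uniform (inside ∷ outside ∷ [])
  S ← randomSubset n
  return (b ∷ S)

G[_,½] : ∀ n → Dist (Graph n)
G[ zero  ,½] = return []
G[ suc n ,½] = do
  N ← randomSubset n
  G ← G[ n ,½]
  return (N ∷ G)

hardcore : ∀ {n} → Graph n → Dist (Subset n)
hardcore {n} G = uniform (filter (independent? G) (subsets n))

glauberStep : ∀ {n} → Graph n → Subset n → Dist (Subset n)
glauberStep {n} G S = do
  v ← uniform (allFin n)
  if does (independent? G (S ∪ ⁅ v ⁆))
    then uniform ((S ∪ ⁅ v ⁆) ∷ (S Subset.- v) ∷ [])
    else return S

-- The joint distribution of (S₀ , … , S_T) with S₀ = S.
glauberPath : ∀ {n} → Graph n → Subset n → ∀ T → Dist (Vec (Subset n) (suc T))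
glauberPath G S zero    = return (S ∷ [])
glauberPath G S (suc T) = do
  S′   ← glauberStep G S
  path ← glauberPath G S′ T
  return (S ∷ path)

-- min{T , τ_k}, where τ_k is the first t with ∣ S_t ∣ = k.
stoppingTime : ∀ {n T} → ℕ → Vec (Subset n) (suc T) → Fin (suc T)
stoppingTime {T = zero}  k (S ∷ _)    = zero
stoppingTime {T = suc T} k (S ∷ path) =
  if Subset.∣ S ∣ ℕ.≡ᵇ k then zero else suc (stoppingTime k path)

glauber : ∀ {n} → Graph n → (k T : ℕ) → Dist (Subset n)
glauber G k T = do
  path ← glauberPath G Subset.⊥ T
  return (lookup path (stoppingTime k path))

indicator : ∀ {n} → Subset n → Fin n → ℝ
indicator S i = if lookup S i then 1ℝ else 0ℝ

‖_‖² : ∀ {n} → (Fin n → ℝ) → ℝ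
‖_‖² {n} x = ∑ (allFin n) λ i → x i * x i

record Coupling {n : ℕ} (μ ν : Subset n → ℝ) : Set where
  field
    joint     : Subset n → Subset n → ℝ
    nonneg    : ∀ S S′ → 0ℝ ≤ joint S S′
    marginalˡ : ∀ S → ∑ (subsets n) (λ S′ → joint S S′) ≈ μ S
    marginalʳ : ∀ S′ → ∑ (subsets n) (λ S → joint S S′) ≈ ν S′

-- The root mean square √(E‖X‖²) of the indicator vector X of a random subset.
rms : ∀ {n} → (Subset n → ℝ) → ℝ
rms {n} μ = √ (∑ (subsets n) λ S → μ S * ‖ indicator S ‖²)

transportCost : ∀ {n} (μ ν : Subset n → ℝ) → 0ℝ < rms μ → 0ℝ < rms ν → Coupling μ ν → ℝ
transportCost {n} μ ν 0<rmsμ 0<rmsν π =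
  √ (∑ (subsets n) λ S → ∑ (subsets n) λ S′ →
       Coupling.joint π S S′ *
       ‖ (λ i → indicator S i * inv (rms μ) 0<rmsμ - indicator S′ i * inv (rms ν) 0<rmsν) ‖²)

-- w₂ μ ν ≤ c.  That the normalizations are by positive numbers is part of the
-- assertion.
w₂[_,_]≤_ : ∀ {n} → (μ ν : Subset n → ℝ) → ℝ → Set
w₂[ μ , ν ]≤ c =
  Σ[ 0<rmsμ ∈ 0ℝ < rms μ ] Σ[ 0<rmsν ∈ 0ℝ < rms ν ] Inf (transportCost μ ν 0<rmsμ 0<rmsν) ≤ c

-- All laws are compared with deterministic weights. Let vol m be the expected number
-- of independent m-sets of G(n,1/2) and deg m the expected number of vertices that can
-- be added to one of them. A planted second moment computation shows that, summed over
-- the independent m-sets S and normalized by vol m, the deviation of free G S from deg m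
-- has expectation of order deg m ^ (-1/2); call this normalized deviation Δ m. Since
-- deg m is about n / 2ᵐ, the Δ m decrease geometrically away from m = log₂ n, and their
-- sum up to log₂ n - ½ log₂ log₂ n is a negative power of log₂ n on average.
--
-- Removing a random vertex from a uniform independent (m+1)-set gives a uniform
-- independent m-set up to an error Δ m. Hence a random k-subset Y of X ∼ μ_G is nearly
-- uniform on the independent k-sets, as the size of X is concentrated a little below log₂ n.
-- The Glauber dynamics, with its removal steps discarded, is up to ∑ Δ j a pure birth
-- chain on sizes, which reaches k within the time bound, and stays uniform on each
-- level. So Y also has nearly the law of the stopped dynamics, and this yields a
-- coupling of both laws with Y ⊆ X for most of the mass.
--
-- Its normalized cost is 2 - 2 E∣X ∩ Y∣ / √(E∣X∣ E∣Y∣), which is small because k and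
-- the typical size of X agree to leading order. The exceptional graphs are controlled
-- by Markov's inequality for ∑ Δ j.

module Submission where

open import Defs hiding (_+_; _*_; _-_; -_; _≤_; _<_; _≈_; ∣_∣; ∑)

open import Data.Bool.Base as Bool using (Bool; true; false; if_then_else_)
import Data.Bool.Properties as Bool
open import Data.Empty using (⊥-elim)
open import Data.Fin.Base using (Fin; zero; suc)
import Data.Fin.Properties as Fin
open import Data.Fin.Subset as Subset using (Subset; inside; outside; _∈_; _∉_; _⊆_; ⁅_⁆; _∪_; _∩_)
import Data.Fin.Subset
import Data.Fin.Subset.Properties as Subset
open import Data.List.Base as List using (List; []; _∷_; _++_; allFin; downFrom; filter; length; map)
import Data.List.Properties as List
open import Data.List.Relation.Unary.All as All using (All; []; _∷_)
import Data.List.Relation.Unary.All.Properties as All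
open import Data.List.Relation.Unary.AllPairs as AllPairs using (AllPairs; []; _∷_)
import Data.List.Relation.Unary.AllPairs.Properties as AllPairs
open import Data.Nat.Base as ℕ using (ℕ; zero; suc; z≤n; s≤s; _∸_)
import Data.Nat.Properties as ℕ
import Data.Nat.Tactic.RingSolver as ℕ-Solver
open import Data.Product.Base using (∃; _×_; _,_; proj₁; proj₂)
import Data.Rational.Base
open import Data.Rational.Base as ℚ using (ℚ; 0ℚ; 1ℚ; ½)
import Data.Rational.Properties as ℚ
open import Data.Sum.Base using (_⊎_; inj₁; inj₂)
open import Data.Vec.Base as Vec using (Vec; []; _∷_; lookup; here; there)
import Data.Vec.Properties as Vec
open import Function.Base using (_∘_)
open import Level using (0ℓ)
open import Relation.Binary.Definitions using (tri<; tri≈; tri>)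
open import Relation.Binary.PropositionalEquality
open import Relation.Nullary using (¬_; Dec; does; yes; no; ¬?; _→-dec_; _×-dec_)
open import Relation.Nullary.Decidable using (dec⇒maybe; dec-true; dec-false)
open import Tactic.RingSolver.Core.AlmostCommutativeRing using (AlmostCommutativeRing; fromCommutativeRing)
open ℚ^ using (_^_)

-- Dividing by expected rather than actual numbers of independent sets makes the total error a sum
-- of nonnegative functions of `G` with fixed coefficients, so one first-moment bound replaces
-- concentration at every size. All comparisons are one-sided: it suffices that a subcoupling of the
-- hardcore law and the law of the dynamics both give each `Y` mass at least `lower Y`, of total
-- `1 - η`; lower bounds survive discarding removals. These cost about `∑ j / deg j`, as the birth
-- chain spends at most `1 / birth j` expected steps at size `j`.
--
-- With `l ≈ log₂ n` and `s ≈ ½ log₂ log₂ n`, `k` is about `l - 60 s`, hardcore sizes cluster near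
-- `l - 2 s`, and sizes are cut off at `l - s`: far enough beyond the typical size for volumes to
-- shrink by a factor of order `2⁻ˢ` per level, far enough below `l` for `∑ Δ j` to be small.
--
-- The bases `½`, `¾`, `⅞`, `15/16` of the errors are each at most the square of the next. Each
-- passage pays for one square root: Cauchy-Schwarz, replaced by AM-GM with a free parameter; the
-- threshold in Markov's inequality; and `w₂`.

-- Rational arithmetic, indicators and finite sums.

module Rational where

  open Data.Rational.Base using (_+_; _*_; _-_; -_; _≤_; _<_)

  ring : AlmostCommutativeRing 0ℓ 0ℓ
  ring = fromCommutativeRing ℚ.+-*-commutativeRing λ q → dec⇒maybe (0ℚ ℚ.≟ q)

  open import Tactic.RingSolver.NonReflective ring public
    using (solve; Κ; _⊕_; _⊗_; ⊝_; Expr) renaming (_⊜_ to infix 4 _⊜_)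

  infixl 6 _⊖_
  _⊖_ : ∀ {n} → Expr ℚ n → Expr ℚ n → Expr ℚ n
  x ⊖ y = x ⊕ (⊝ y)

  ≤-by : ∀ {p q} d → 0ℚ ≤ d → p + d ≡ q → p ≤ q
  ≤-by {p} d 0≤d eq = subst (p ≤_) eq (p≤p+q 0≤d)

  0≤+ : ∀ {p q} → 0ℚ ≤ p → 0ℚ ≤ q → 0ℚ ≤ p + q
  0≤+ 0≤p 0≤q = ℚ.≤-trans 0≤p (p≤p+q 0≤q)

  *-monoˡ : ∀ r {p q} → 0ℚ ≤ r → p ≤ q → r * p ≤ r * q
  *-monoˡ r 0≤r = ℚ.*-monoˡ-≤-nonNeg r {{ℚ.nonNegative 0≤r}}

  0≤½ : 0ℚ ≤ ½
  0≤½ = ℚ.nonNegative⁻¹ ½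

  ≤⇒0≤- : ∀ {p q} → p ≤ q → 0ℚ ≤ q - p
  ≤⇒0≤- {p} {q} p≤q = subst (_≤ q - p) (ℚ.+-inverseʳ p) (ℚ.+-monoˡ-≤ (- p) p≤q)

  0≤-⇒≤ : ∀ {p q} → 0ℚ ≤ q - p → p ≤ q
  0≤-⇒≤ {p} {q} h = ≤-by (q - p) h (lemma p q)
    where
    lemma : ∀ p q → p + (q - p) ≡ q
    lemma = solve 2 (λ p q → p ⊕ (q ⊖ p) ⊜ q) refl

  -≤ : ∀ {p q} → 0ℚ ≤ q → p - q ≤ p
  -≤ {p} {q} 0≤q = ≤-by q 0≤q (lemma p q)
    where
    lemma : ∀ p q → p - q + q ≡ p
    lemma = solve 2 (λ p q → p ⊖ q ⊕ q ⊜ p) refl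

  ≤+⇒-≤ : ∀ p q r → p ≤ q + r → p - r ≤ q
  ≤+⇒-≤ p q r h = subst (p - r ≤_) (lemma q r) (ℚ.+-monoˡ-≤ (- r) h)
    where
    lemma : ∀ q r → q + r - r ≡ q
    lemma = solve 2 (λ q r → q ⊕ r ⊖ r ⊜ q) refl

  neg-mono : ∀ r {p q} → p ≤ q → r - q ≤ r - p
  neg-mono r p≤q = ℚ.+-monoʳ-≤ r (ℚ.neg-antimono-≤ p≤q)

  0≤² : ∀ p → 0ℚ ≤ p * p
  0≤² p with ℚ.≤-total 0ℚ p
  ... | inj₁ 0≤p = 0≤* 0≤p 0≤p
  ... | inj₂ p≤0 = subst (0ℚ ≤_) (lemma p) (0≤* (ℚ.neg-antimono-≤ p≤0) (ℚ.neg-antimono-≤ p≤0))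
    where
    lemma : ∀ p → (- p) * (- p) ≡ p * p
    lemma = solve 1 (λ p → (⊝ p) ⊗ (⊝ p) ⊜ p ⊗ p) refl

  ∣∣²≡ : ∀ p → ℚ.∣ p ∣ * ℚ.∣ p ∣ ≡ p * p
  ∣∣²≡ p = trans (sym (ℚ.∣p*q∣≡∣p∣*∣q∣ p p)) (ℚ.0≤p⇒∣p∣≡p (0≤² p))

  abstract
    infix 9 _⁻¹

    -- Equal to 0 unless q is positive.
    _⁻¹ : ℚ → ℚ
    q ⁻¹ with 0ℚ ℚ.<? q
    ... | yes 0<q = (ℚ.1/ q) {{ℚ.>-nonZero 0<q}}
    ... | no  _   = 0ℚ

    *-⁻¹ : ∀ {q} → 0ℚ < q → q * q ⁻¹ ≡ 1ℚ
    *-⁻¹ {q} 0<q with 0ℚ ℚ.<? q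
    ... | yes 0<q′ = ℚ.*-inverseʳ q {{ℚ.>-nonZero 0<q′}}
    ... | no  0≮q  = ⊥-elim (0≮q 0<q)

    0≤⁻¹ : ∀ q → 0ℚ ≤ q ⁻¹
    0≤⁻¹ q with 0ℚ ℚ.<? q
    ... | yes 0<q = ℚ.<⇒≤ (ℚ.positive⁻¹ _ {{ℚ.1/pos⇒pos q {{ℚ.positive 0<q}}}})
    ... | no  _   = ℚ.≤-refl

  ⁻¹-unique : ∀ {p q} → 0ℚ < p → p * q ≡ 1ℚ → q ≡ p ⁻¹
  ⁻¹-unique {p} {q} 0<p eq = begin
    q               ≡⟨ ℚ.*-identityʳ q ⟨
    q * 1ℚ          ≡⟨ cong (q *_) (*-⁻¹ 0<p) ⟨
    q * (p * p ⁻¹)  ≡⟨ lemma q p (p ⁻¹) ⟩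
    p * q * p ⁻¹    ≡⟨ cong (_* p ⁻¹) eq ⟩
    1ℚ * p ⁻¹       ≡⟨ ℚ.*-identityˡ (p ⁻¹) ⟩
    p ⁻¹            ∎
    where
    open ≡-Reasoning
    lemma : ∀ q p r → q * (p * r) ≡ p * q * r
    lemma = solve 3 (λ q p r → q ⊗ (p ⊗ r) ⊜ p ⊗ q ⊗ r) refl

  *⁻¹-cancel : ∀ {p} q → 0ℚ < p → q * p * p ⁻¹ ≡ q
  *⁻¹-cancel {p} q 0<p = trans (ℚ.*-assoc q p (p ⁻¹)) (trans (cong (q *_) (*-⁻¹ 0<p)) (ℚ.*-identityʳ q))

  ≤⇒*⁻¹≤ : ∀ {p q r} → 0ℚ < r → p ≤ q * r → p * r ⁻¹ ≤ q
  ≤⇒*⁻¹≤ {p} {q} {r} 0<r h = subst (p * r ⁻¹ ≤_) (*⁻¹-cancel q 0<r) (*-monoʳ (0≤⁻¹ r) h)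

  ≤⇒≤*⁻¹ : ∀ {p q r} → 0ℚ < r → q * r ≤ p → q ≤ p * r ⁻¹
  ≤⇒≤*⁻¹ {p} {q} {r} 0<r h = subst (_≤ p * r ⁻¹) (*⁻¹-cancel q 0<r) (*-monoʳ (0≤⁻¹ r) h)

  0<⁻¹ : ∀ {q} → 0ℚ < q → 0ℚ < q ⁻¹
  0<⁻¹ {q} 0<q = ℚ.≰⇒> λ h → ℚ.<-irrefl refl (ℚ.<-≤-trans (ℚ.positive⁻¹ 1ℚ)
    (subst₂ _≤_ (*-⁻¹ 0<q) (ℚ.*-zeroʳ q) (*-monoˡ q (ℚ.<⇒≤ 0<q) h)))

  ⁻¹-antimono : ∀ {p q} → 0ℚ < p → p ≤ q → q ⁻¹ ≤ p ⁻¹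
  ⁻¹-antimono {p} {q} 0<p p≤q = subst₂ _≤_ (trans (cong (_* q ⁻¹) (*-⁻¹ 0<p)) (ℚ.*-identityˡ _))
    (trans (lemma q (p ⁻¹) (q ⁻¹)) (trans (cong (p ⁻¹ *_) (*-⁻¹ (ℚ.<-≤-trans 0<p p≤q))) (ℚ.*-identityʳ _)))
    (*-monoʳ (0≤⁻¹ q) (*-monoʳ (0≤⁻¹ p) p≤q))
    where
    lemma : ∀ q r s → q * r * s ≡ r * (q * s)
    lemma = solve 3 (λ q r s → q ⊗ r ⊗ s ⊜ r ⊗ (q ⊗ s)) refl

  cancel-≤ : ∀ {p q r} → 0ℚ < r → p * r ≤ q * r → p ≤ q
  cancel-≤ {r = r} 0<r = ℚ.*-cancelʳ-≤-pos r {{ℚ.positive 0<r}}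

  cancel-≡ : ∀ {p q r} → 0ℚ < r → p * r ≡ q * r → p ≡ q
  cancel-≡ {p} {q} {r} 0<r eq =
    trans (sym (*⁻¹-cancel p 0<r)) (trans (cong (_* r ⁻¹) eq) (*⁻¹-cancel q 0<r))

  -- Recursive, unlike `frac n 0`, so that lengths and sizes that grow by `suc` unfold to
  -- `1ℚ + nat n`, a form suited to induction and to the ring solver.
  nat : ℕ → ℚ
  nat zero    = 0ℚ
  nat (suc n) = 1ℚ + nat n

  0≤nat : ∀ n → 0ℚ ≤ nat n
  0≤nat zero    = ℚ.≤-refl
  0≤nat (suc n) = 0≤+ 0≤1 (0≤nat n)

  0<nat : ∀ n → 0ℚ < nat (suc n)
  0<nat n = ℚ.<-≤-trans (ℚ.positive⁻¹ 1ℚ) (p≤p+q (0≤nat n))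

  nat-pos : ∀ {n} → 0 ℕ.< n → 0ℚ < nat n
  nat-pos {suc n} _ = 0<nat n

  nat-mono : ∀ {m n} → m ℕ.≤ n → nat m ≤ nat n
  nat-mono {n = n} z≤n = 0≤nat n
  nat-mono (s≤s m≤n)   = ℚ.+-monoʳ-≤ 1ℚ (nat-mono m≤n)

  nat-+ : ∀ m n → nat (m ℕ.+ n) ≡ nat m + nat n
  nat-+ zero    n = sym (ℚ.+-identityˡ (nat n))
  nat-+ (suc m) n = trans (cong (1ℚ +_) (nat-+ m n)) (sym (ℚ.+-assoc 1ℚ (nat m) (nat n)))

  nat-* : ∀ m n → nat (m ℕ.* n) ≡ nat m * nat n
  nat-* zero    n = sym (ℚ.*-zeroˡ (nat n))
  nat-* (suc m) n = trans (nat-+ n (m ℕ.* n)) (trans (cong (_+_ (nat n)) (nat-* m n)) (lemma (nat m) (nat n)))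
    where
    lemma : ∀ a b → b + a * b ≡ (1ℚ + a) * b
    lemma = solve 2 (λ a b → b ⊕ a ⊗ b ⊜ (Κ 1ℚ ⊕ a) ⊗ b) refl

  nat-^ : ∀ b n → nat (b ℕ.^ n) ≡ nat b ^ n
  nat-^ b zero    = refl
  nat-^ b (suc n) = trans (nat-* b (b ℕ.^ n)) (cong (nat b *_) (nat-^ b n))

  nat≡frac : ∀ n → nat n ≡ frac n 0
  nat≡frac zero    = refl
  nat≡frac (suc n) = trans (trans (cong (1ℚ +_) (nat≡frac n)) (ℚ.+-comm 1ℚ (frac n 0))) (sym (frac-suc n 0))

  0<^ : ∀ {p} n → 0ℚ < p → 0ℚ < p ^ n
  0<^ zero    _   = ℚ.positive⁻¹ 1ℚ
  0<^ (suc n) 0<p = 0<* 0<p (0<^ n 0<p)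

  0<½ : 0ℚ < ½
  0<½ = ℚ.positive⁻¹ ½

  ½^+ : ∀ m n → ½ ^ (m ℕ.+ n) ≡ ½ ^ m * ½ ^ n
  ½^+ = ℚ^.^-homo-* ½

  -- Looks only at `does`, hence agrees by computation with the Boolean events measured by `Pr`.
  𝟙 : ∀ {P : Set} → Dec P → ℚ
  𝟙 d = if does d then 1ℚ else 0ℚ

  module _ {P : Set} where

    𝟙-yes : (d : Dec P) → P → 𝟙 d ≡ 1ℚ
    𝟙-yes d p = cong (if_then 1ℚ else 0ℚ) (dec-true d p)

    𝟙-no : (d : Dec P) → ¬ P → 𝟙 d ≡ 0ℚ
    𝟙-no d ¬p = cong (if_then 1ℚ else 0ℚ) (dec-false d ¬p)

    0≤𝟙 : (d : Dec P) → 0ℚ ≤ 𝟙 d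
    0≤𝟙 (yes _) = 0≤1
    0≤𝟙 (no  _) = ℚ.≤-refl

    𝟙≤1 : (d : Dec P) → 𝟙 d ≤ 1ℚ
    𝟙≤1 (yes _) = ℚ.≤-refl
    𝟙≤1 (no  _) = 0≤1

    𝟙-idem : (d : Dec P) → 𝟙 d * 𝟙 d ≡ 𝟙 d
    𝟙-idem (yes _) = refl
    𝟙-idem (no  _) = refl

    𝟙-cong : (d : Dec P) → ∀ {x y} → (P → x ≡ y) → 𝟙 d * x ≡ 𝟙 d * y
    𝟙-cong (yes p) h = cong (1ℚ *_) (h p)
    𝟙-cong (no  _) {x} {y} _ = trans (ℚ.*-zeroˡ x) (sym (ℚ.*-zeroˡ y))

    𝟙-mono : (d : Dec P) → ∀ {x y} → (P → x ≤ y) → 𝟙 d * x ≤ 𝟙 d * y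
    𝟙-mono (yes p) h = *-monoˡ 1ℚ 0≤1 (h p)
    𝟙-mono (no  _) {x} {y} _ = ℚ.≤-reflexive (trans (ℚ.*-zeroˡ x) (sym (ℚ.*-zeroˡ y)))

  𝟙-⇔ : ∀ {P Q : Set} (d : Dec P) (e : Dec Q) → (P → Q) → (Q → P) → 𝟙 d ≡ 𝟙 e
  𝟙-⇔ (yes p) e f g = sym (𝟙-yes e (f p))
  𝟙-⇔ (no ¬p) e f g = sym (𝟙-no e (¬p ∘ g))

  sum : {A : Set} → List A → (A → ℚ) → ℚ
  sum []       f = 0ℚ
  sum (x ∷ xs) f = f x + sum xs f

  module _ {A : Set} where

    sum-congᴬ : ∀ {xs : List A} {f g} → All (λ x → f x ≡ g x) xs → sum xs f ≡ sum xs g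
    sum-congᴬ []       = refl
    sum-congᴬ (e ∷ es) = cong₂ _+_ e (sum-congᴬ es)

    sum-cong : ∀ (xs : List A) {f g} → (∀ x → f x ≡ g x) → sum xs f ≡ sum xs g
    sum-cong xs h = sum-congᴬ (All.universal h xs)

    sum-monoᴬ : ∀ {xs : List A} {f g} → All (λ x → f x ≤ g x) xs → sum xs f ≤ sum xs g
    sum-monoᴬ []       = ℚ.≤-refl
    sum-monoᴬ (e ∷ es) = ℚ.+-mono-≤ e (sum-monoᴬ es)

    sum-mono : ∀ (xs : List A) {f g} → (∀ x → f x ≤ g x) → sum xs f ≤ sum xs g
    sum-mono xs h = sum-monoᴬ (All.universal h xs)

    sum-0 : ∀ (xs : List A) → sum xs (λ _ → 0ℚ) ≡ 0ℚ
    sum-0 []       = refl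
    sum-0 (_ ∷ xs) = trans (ℚ.+-identityˡ _) (sum-0 xs)

    0≤sum : ∀ (xs : List A) {f} → (∀ x → 0ℚ ≤ f x) → 0ℚ ≤ sum xs f
    0≤sum []       h = ℚ.≤-refl
    0≤sum (x ∷ xs) h = 0≤+ (h x) (0≤sum xs h)

    sum-+ : ∀ (xs : List A) (f g : A → ℚ) → sum xs (λ x → f x + g x) ≡ sum xs f + sum xs g
    sum-+ []       f g = refl
    sum-+ (x ∷ xs) f g = trans (cong (_+_ (f x + g x)) (sum-+ xs f g)) (lemma (f x) (g x) (sum xs f) (sum xs g))
      where
      lemma : ∀ a b c d → a + b + (c + d) ≡ a + c + (b + d)
      lemma = solve 4 (λ a b c d → a ⊕ b ⊕ (c ⊕ d) ⊜ a ⊕ c ⊕ (b ⊕ d)) refl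

    sum-*ˡ : ∀ (xs : List A) c (f : A → ℚ) → sum xs (λ x → c * f x) ≡ c * sum xs f
    sum-*ˡ []       c f = sym (ℚ.*-zeroʳ c)
    sum-*ˡ (x ∷ xs) c f = trans (cong (_+_ (c * f x)) (sum-*ˡ xs c f)) (sym (ℚ.*-distribˡ-+ c (f x) (sum xs f)))

    sum-*ʳ : ∀ (xs : List A) c (f : A → ℚ) → sum xs (λ x → f x * c) ≡ sum xs f * c
    sum-*ʳ xs c f = trans (sum-cong xs λ x → ℚ.*-comm (f x) c) (trans (sum-*ˡ xs c f) (ℚ.*-comm c (sum xs f)))

    sum-- : ∀ (xs : List A) (f g : A → ℚ) → sum xs (λ x → f x - g x) ≡ sum xs f - sum xs g
    sum-- xs f g = trans (sum-cong xs λ x → lemma (f x) (g x)) (trans (sum-+ xs f (λ x → - 1ℚ * g x))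
      (trans (cong (_+_ (sum xs f)) (sum-*ˡ xs (- 1ℚ) g)) (sym (lemma (sum xs f) (sum xs g)))))
      where
      lemma : ∀ a b → a - b ≡ a + - 1ℚ * b
      lemma = solve 2 (λ a b → a ⊖ b ⊜ a ⊕ ⊝ Κ 1ℚ ⊗ b) refl

    sum-const : ∀ (xs : List A) c → sum xs (λ _ → c) ≡ nat (length xs) * c
    sum-const []       c = sym (ℚ.*-zeroˡ c)
    sum-const (_ ∷ xs) c = trans (cong (_+_ c) (sum-const xs c)) (lemma c (nat (length xs)))
      where
      lemma : ∀ c l → c + l * c ≡ (1ℚ + l) * c
      lemma = solve 2 (λ c l → c ⊕ l ⊗ c ⊜ (Κ 1ℚ ⊕ l) ⊗ c) refl

    sum-++ : ∀ (xs ys : List A) (f : A → ℚ) → sum (xs ++ ys) f ≡ sum xs f + sum ys f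
    sum-++ []       ys f = sym (ℚ.+-identityˡ _)
    sum-++ (x ∷ xs) ys f = trans (cong (_+_ (f x)) (sum-++ xs ys f)) (sym (ℚ.+-assoc (f x) (sum xs f) (sum ys f)))

    sum-map : ∀ {B : Set} (h : B → A) xs (f : A → ℚ) → sum (map h xs) f ≡ sum xs (f ∘ h)
    sum-map h []       f = refl
    sum-map h (x ∷ xs) f = cong (_+_ (f (h x))) (sum-map h xs f)

    sum-concatMap : ∀ {B : Set} (h : B → List A) xs (f : A → ℚ) →
      sum (List.concatMap h xs) f ≡ sum xs λ x → sum (h x) f
    sum-concatMap h []       f = refl
    sum-concatMap h (x ∷ xs) f =
      trans (sum-++ (h x) (List.concatMap h xs) f) (cong (_+_ (sum (h x) f)) (sum-concatMap h xs f))

  sum-swap : ∀ {A B : Set} (xs : List A) (ys : List B) (f : A → B → ℚ) →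
    sum xs (λ x → sum ys (f x)) ≡ sum ys λ y → sum xs λ x → f x y
  sum-swap []       ys f = sym (sum-0 ys)
  sum-swap (x ∷ xs) ys f = trans (cong (_+_ (sum ys (f x))) (sum-swap xs ys f)) (sym (sum-+ ys (f x) (λ y → sum xs λ x → f x y)))

  ≤sum : ∀ {A : Set} {xs : List A} {f} → (∀ x → 0ℚ ≤ f x) → All (λ x → f x ≤ sum xs f) xs
  ≤sum {xs = []}     h = []
  ≤sum {xs = x ∷ xs} {f} h = p≤p+q (0≤sum xs h)
    ∷ All.map (λ {y} le → ℚ.≤-trans le (subst (sum xs f ≤_) (ℚ.+-comm (sum xs f) (f x)) (p≤p+q (h x)))) (≤sum h)

  downFrom-< : ∀ b → All (ℕ._< b) (downFrom b)
  downFrom-< zero    = []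
  downFrom-< (suc b) = ℕ.≤-refl ∷ All.map ℕ.m<n⇒m<1+n (downFrom-< b)

  -- The second moment of a sum of weakly correlated variables; e gives the weights
  -- of the expectation.
  sum-square : ∀ {A I : Set} (is : List I) (e : I → ℚ) (a : A → I → ℚ) (b c : ℚ) (xs : List A) →
    All (λ x → sum is (λ i → e i * (a x i * a x i)) ≤ b) xs →
    AllPairs (λ x y → sum is (λ i → e i * (a x i * a y i)) ≤ c) xs →
    sum is (λ i → e i * (sum xs (λ x → a x i) * sum xs (λ x → a x i)))
      ≤ nat (length xs) * (nat (length xs) - 1ℚ) * c + nat (length xs) * b
  sum-square is e a b c [] _ _ = ℚ.≤-reflexive (trans (trans
    (sum-cong is (λ i → ℚ.*-zeroʳ (e i))) (sum-0 is)) (sym (lemma b c)))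
    where
    lemma : ∀ b c → 0ℚ * (0ℚ - 1ℚ) * c + 0ℚ * b ≡ 0ℚ
    lemma = solve 2 (λ b c → Κ 0ℚ ⊗ (Κ 0ℚ ⊖ Κ 1ℚ) ⊗ c ⊕ Κ 0ℚ ⊗ b ⊜ Κ 0ℚ) refl
  sum-square is e a b c (x ∷ xs) (h ∷ hs) (p ∷ ps) = begin
    sum is (λ i → e i * ((a x i + s i) * (a x i + s i)))
      ≡⟨ sum-cong is (λ i → lemma₁ (e i) (a x i) (s i)) ⟩
    sum is (λ i → e i * (a x i * a x i) + (1ℚ + 1ℚ) * (e i * (a x i * s i)) + e i * (s i * s i))
      ≡⟨ sum-+ is (λ i → e i * (a x i * a x i) + (1ℚ + 1ℚ) * (e i * (a x i * s i))) (λ i → e i * (s i * s i)) ⟩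
    sum is (λ i → e i * (a x i * a x i) + (1ℚ + 1ℚ) * (e i * (a x i * s i))) + sum is (λ i → e i * (s i * s i))
      ≡⟨ cong (_+ sum is (λ i → e i * (s i * s i)))
           (trans (sum-+ is (λ i → e i * (a x i * a x i)) (λ i → (1ℚ + 1ℚ) * (e i * (a x i * s i))))
             (cong (_+_ (sum is λ i → e i * (a x i * a x i))) (sum-*ˡ is (1ℚ + 1ℚ) (λ i → e i * (a x i * s i))))) ⟩
    sum is (λ i → e i * (a x i * a x i)) + (1ℚ + 1ℚ) * sum is (λ i → e i * (a x i * s i)) + sum is (λ i → e i * (s i * s i))
      ≤⟨ ℚ.+-mono-≤ (ℚ.+-mono-≤ h (*-monoˡ (1ℚ + 1ℚ) (0≤+ 0≤1 0≤1) cross)) (sum-square is e a b c xs hs ps) ⟩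
    b + (1ℚ + 1ℚ) * (l * c) + (l * (l - 1ℚ) * c + l * b)
      ≡⟨ lemma₂ b c l ⟩
    (1ℚ + l) * (1ℚ + l - 1ℚ) * c + (1ℚ + l) * b ∎
    where
    open ℚ.≤-Reasoning
    l = nat (length xs)
    s = λ i → sum xs λ y → a y i
    lemma₁ : ∀ e a s → e * ((a + s) * (a + s)) ≡ e * (a * a) + (1ℚ + 1ℚ) * (e * (a * s)) + e * (s * s)
    lemma₁ = solve 3 (λ e a s →
      e ⊗ ((a ⊕ s) ⊗ (a ⊕ s)) ⊜
      e ⊗ (a ⊗ a) ⊕ (Κ 1ℚ ⊕ Κ 1ℚ) ⊗ (e ⊗ (a ⊗ s)) ⊕ e ⊗ (s ⊗ s)) refl
    lemma₂ : ∀ b c l → b + (1ℚ + 1ℚ) * (l * c) + (l * (l - 1ℚ) * c + l * b)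
                     ≡ (1ℚ + l) * (1ℚ + l - 1ℚ) * c + (1ℚ + l) * b
    lemma₂ = solve 3 (λ b c l →
      b ⊕ (Κ 1ℚ ⊕ Κ 1ℚ) ⊗ (l ⊗ c) ⊕ (l ⊗ (l ⊖ Κ 1ℚ) ⊗ c ⊕ l ⊗ b) ⊜
      (Κ 1ℚ ⊕ l) ⊗ (Κ 1ℚ ⊕ l ⊖ Κ 1ℚ) ⊗ c ⊕ (Κ 1ℚ ⊕ l) ⊗ b) refl
    cross : sum is (λ i → e i * (a x i * s i)) ≤ l * c
    cross = begin
      sum is (λ i → e i * (a x i * s i))
        ≡⟨ sum-cong is (λ i → trans (cong (e i *_) (sym (sum-*ˡ xs (a x i) (λ y → a y i)))) (sym (sum-*ˡ xs (e i) (λ y → a x i * a y i)))) ⟩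
      sum is (λ i → sum xs λ y → e i * (a x i * a y i))
        ≡⟨ sum-swap is xs (λ i y → e i * (a x i * a y i)) ⟩
      sum xs (λ y → sum is λ i → e i * (a x i * a y i))
        ≤⟨ sum-monoᴬ p ⟩
      sum xs (λ _ → c)
        ≡⟨ sum-const xs c ⟩
      l * c ∎

open Rational

-- Subsets, their sizes, and double counting between neighbouring sizes.

module Subsets where

  open Data.Rational.Base using (_+_; _*_; _-_; -_; _≤_; _<_)
  open Data.Fin.Subset using (∣_∣)

  -- The neighbours of a set in the Hasse diagram of the cube: one element added, one element
  -- removed.
  ups downs : ∀ {n} → Subset n → List (Subset n)
  ups []            = []
  ups (outside ∷ S) = (inside ∷ S) ∷ map (outside ∷_) (ups S)
  ups (inside  ∷ S) = map (inside ∷_) (ups S)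

  downs []            = []
  downs (outside ∷ S) = map (outside ∷_) (downs S)
  downs (inside  ∷ S) = (outside ∷ S) ∷ map (inside ∷_) (downs S)

  sum-subsets : ∀ n (f : Subset (suc n) → ℚ) → sum (subsets (suc n)) f
    ≡ sum (subsets n) (f ∘ (outside ∷_)) + sum (subsets n) (f ∘ (inside ∷_))
  sum-subsets n f = trans (sum-++ (map (outside ∷_) (subsets n)) (map (inside ∷_) (subsets n)) f)
    (cong₂ _+_ (sum-map (outside ∷_) (subsets n) f) (sum-map (inside ∷_) (subsets n) f))

  all-subsets : ∀ {n} (S : Subset n) {P : Subset n → Set} → All P (subsets n) → P S
  all-subsets []            (p ∷ []) = p
  all-subsets {suc n} (outside ∷ S) ps = all-subsets S (All.map⁻ (All.++⁻ˡ (map (outside ∷_) (subsets n)) ps))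
  all-subsets {suc n} (inside  ∷ S) ps = all-subsets S (All.map⁻ (All.++⁻ʳ (map (outside ∷_) (subsets n)) ps))

  -- Both sides run over the edges of the cube, grouped by lower or by upper end; in the induction
  -- `d` collects the edges that change the first coordinate. Volumes, kernels and the transposition
  -- of the dynamics all rest on this exchange.
  double-counting : ∀ n (φ : Subset n → Subset n → ℚ) →
    sum (subsets n) (λ S → sum (ups S) (φ S)) ≡ sum (subsets n) (λ S → sum (downs S) λ S′ → φ S′ S)
  double-counting zero    φ = refl
  double-counting (suc n) φ = begin
    sum (subsets (suc n)) (λ S → sum (ups S) (φ S))
      ≡⟨ sum-subsets n (λ S → sum (ups S) (φ S)) ⟩
    sum Ss (λ S → φ (outside ∷ S) (inside ∷ S) + sum (map (outside ∷_) (ups S)) (φ (outside ∷ S)))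
      + sum Ss (λ S → sum (map (inside ∷_) (ups S)) (φ (inside ∷ S)))
      ≡⟨ cong₂ _+_ (trans
           (sum-cong Ss λ S → cong (_+_ (φ (outside ∷ S) (inside ∷ S))) (sum-map (outside ∷_) (ups S) (φ (outside ∷ S))))
           (sum-+ Ss (λ S → φ (outside ∷ S) (inside ∷ S)) (λ S → sum (ups S) (φ₀ S))))
           (sum-cong Ss λ S → sum-map (inside ∷_) (ups S) (φ (inside ∷ S))) ⟩
    d + sum Ss (λ S → sum (ups S) (φ₀ S)) + sum Ss (λ S → sum (ups S) (φ₁ S))
      ≡⟨ cong₂ (λ x y → d + x + y) (double-counting n φ₀) (double-counting n φ₁) ⟩
    d + x + y
      ≡⟨ lemma d x y ⟩
    x + (d + y)
      ≡⟨ cong₂ _+_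
           (sum-cong Ss λ S → sum-map (outside ∷_) (downs S) (λ S′ → φ S′ (outside ∷ S)))
           (trans
             (sum-cong Ss λ S → cong (_+_ (φ (outside ∷ S) (inside ∷ S))) (sum-map (inside ∷_) (downs S) (λ S′ → φ S′ (inside ∷ S))))
             (sum-+ Ss (λ S → φ (outside ∷ S) (inside ∷ S)) (λ S → sum (downs S) λ S′ → φ₁ S′ S))) ⟨
    sum Ss (λ S → sum (map (outside ∷_) (downs S)) λ S′ → φ S′ (outside ∷ S))
      + sum Ss (λ S → φ (outside ∷ S) (inside ∷ S) + sum (map (inside ∷_) (downs S)) λ S′ → φ S′ (inside ∷ S))
      ≡⟨ sum-subsets n (λ S → sum (downs S) λ S′ → φ S′ S) ⟨
    sum (subsets (suc n)) (λ S → sum (downs S) λ S′ → φ S′ S) ∎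
    where
    open ≡-Reasoning
    Ss = subsets n
    φ₀ = λ S S′ → φ (outside ∷ S) (outside ∷ S′)
    φ₁ = λ S S′ → φ (inside ∷ S) (inside ∷ S′)
    d = sum Ss λ S → φ (outside ∷ S) (inside ∷ S)
    x = sum Ss λ S → sum (downs S) λ S′ → φ₀ S′ S
    y = sum Ss λ S → sum (downs S) λ S′ → φ₁ S′ S
    lemma : ∀ d x y → d + x + y ≡ x + (d + y)
    lemma = solve 3 (λ d x y → d ⊕ x ⊕ y ⊜ x ⊕ (d ⊕ y)) refl

  ups-⊆ : ∀ {n} (S : Subset n) → All (S ⊆_) (ups S)
  ups-⊆ []            = []
  ups-⊆ (outside ∷ S) = Subset.out⊆ Subset.⊆-refl ∷ All.map⁺ (All.map Subset.s⊆s (ups-⊆ S))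
  ups-⊆ (inside  ∷ S) = All.map⁺ (All.map Subset.s⊆s (ups-⊆ S))

  ups-size : ∀ {n} (S : Subset n) → All (λ S′ → ∣ S′ ∣ ≡ suc ∣ S ∣) (ups S)
  ups-size []            = []
  ups-size (outside ∷ S) = refl ∷ All.map⁺ (ups-size S)
  ups-size (inside  ∷ S) = All.map⁺ (All.map (cong suc) (ups-size S))

  ups-length : ∀ {n} (S : Subset n) → length (ups S) ℕ.+ ∣ S ∣ ≡ n
  ups-length []            = refl
  ups-length (outside ∷ S) = cong suc (trans (cong (ℕ._+ ∣ S ∣) (List.length-map (outside ∷_) (ups S))) (ups-length S))
  ups-length (inside  ∷ S) = trans (ℕ.+-suc (length (map (inside ∷_) (ups S))) ∣ S ∣)
    (cong suc (trans (cong (ℕ._+ ∣ S ∣) (List.length-map (inside ∷_) (ups S))) (ups-length S)))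

  downs-⊆ : ∀ {n} (S : Subset n) → All (_⊆ S) (downs S)
  downs-⊆ []            = []
  downs-⊆ (outside ∷ S) = All.map⁺ (All.map Subset.s⊆s (downs-⊆ S))
  downs-⊆ (inside  ∷ S) = Subset.out⊆ Subset.⊆-refl ∷ All.map⁺ (All.map Subset.s⊆s (downs-⊆ S))

  downs-size : ∀ {n} (S : Subset n) → All (λ S′ → ∣ S ∣ ≡ suc ∣ S′ ∣) (downs S)
  downs-size []            = []
  downs-size (outside ∷ S) = All.map⁺ (downs-size S)
  downs-size (inside  ∷ S) = refl ∷ All.map⁺ (All.map (cong suc) (downs-size S))

  downs-length : ∀ {n} (S : Subset n) → length (downs S) ≡ ∣ S ∣
  downs-length []            = refl
  downs-length (outside ∷ S) = trans (List.length-map (outside ∷_) (downs S)) (downs-length S)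
  downs-length (inside  ∷ S) = cong suc (trans (List.length-map (inside ∷_) (downs S)) (downs-length S))

  sum-ups-cong : ∀ {n} (S : Subset n) {f g : Subset n → ℚ} →
    (∀ S′ → S ⊆ S′ → ∣ S′ ∣ ≡ suc ∣ S ∣ → f S′ ≡ g S′) → sum (ups S) f ≡ sum (ups S) g
  sum-ups-cong S h = sum-congᴬ (All.zipWith (λ {S′} (S⊆S′ , e) → h S′ (λ {x} → S⊆S′ {x}) e) (ups-⊆ S , ups-size S))

  sum-downs-cong : ∀ {n} (S : Subset n) {f g : Subset n → ℚ} →
    (∀ S′ → S′ ⊆ S → ∣ S ∣ ≡ suc ∣ S′ ∣ → f S′ ≡ g S′) → sum (downs S) f ≡ sum (downs S) g
  sum-downs-cong S h = sum-congᴬ (All.zipWith (λ {S′} (S′⊆S , e) → h S′ (λ {x} → S′⊆S {x}) e) (downs-⊆ S , downs-size S))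

  sum-downs-mono : ∀ {n} (S : Subset n) {f g : Subset n → ℚ} →
    (∀ S′ → S′ ⊆ S → ∣ S ∣ ≡ suc ∣ S′ ∣ → f S′ ≤ g S′) → sum (downs S) f ≤ sum (downs S) g
  sum-downs-mono S h = sum-monoᴬ (All.zipWith (λ {S′} (S′⊆S , e) → h S′ (λ {x} → S′⊆S {x}) e) (downs-⊆ S , downs-size S))

  ∣S∩S∣ : ∀ {n} (S : Subset n) → ∣ S ∩ S ∣ ≡ ∣ S ∣
  ∣S∩S∣ []            = refl
  ∣S∩S∣ (outside ∷ S) = ∣S∩S∣ S
  ∣S∩S∣ (inside  ∷ S) = cong suc (∣S∩S∣ S)

  ups-∩ : ∀ {n} (S : Subset n) → All (λ S′ → ∣ S ∩ S′ ∣ ≡ ∣ S ∣) (ups S)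
  ups-∩ []            = []
  ups-∩ (outside ∷ S) = ∣S∩S∣ S ∷ All.map⁺ (ups-∩ S)
  ups-∩ (inside  ∷ S) = All.map⁺ (All.map (cong suc) (ups-∩ S))

  -- Two different one-point extensions of `S` meet exactly in `S`. This overlap is what the second
  -- moment of `free` needs.
  ups-pairs : ∀ {n} (S : Subset n) → AllPairs (λ S′ S″ → ∣ S′ ∩ S″ ∣ ≡ ∣ S ∣) (ups S)
  ups-pairs []            = []
  ups-pairs (outside ∷ S) = All.map⁺ (ups-∩ S) ∷ AllPairs.map⁺ (ups-pairs S)
  ups-pairs (inside  ∷ S) = AllPairs.map⁺ (AllPairs.map (cong suc) (ups-pairs S))

  _≟ₛ_ : ∀ {n} (S S′ : Subset n) → Dec (S ≡ S′)
  _≟ₛ_ = Vec.≡-dec Bool._≟_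

  δ : ∀ {n} → Subset n → Subset n → ℚ
  δ S S′ = 𝟙 (S ≟ₛ S′)

  δ-sym : ∀ {n} (S S′ : Subset n) → δ S S′ ≡ δ S′ S
  δ-sym S S′ = 𝟙-⇔ (S ≟ₛ S′) (S′ ≟ₛ S) sym sym

  δ-cons : ∀ {n} b (S S′ : Subset n) → δ (b ∷ S) (b ∷ S′) ≡ δ S S′
  δ-cons b S S′ = 𝟙-⇔ ((b ∷ S) ≟ₛ (b ∷ S′)) (S ≟ₛ S′) Vec.∷-injectiveʳ (cong (b ∷_))

  sum-δ : ∀ {n} (S : Subset n) (f : Subset n → ℚ) → sum (subsets n) (λ S′ → δ S S′ * f S′) ≡ f S
  sum-δ [] f = lemma (f [])
    where
    lemma : ∀ x → 1ℚ * x + 0ℚ ≡ x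
    lemma = solve 1 (λ x → Κ 1ℚ ⊗ x ⊕ Κ 0ℚ ⊜ x) refl
  sum-δ {suc n} (outside ∷ S) f = trans (sum-subsets n (λ S′ → δ (outside ∷ S) S′ * f S′)) (trans (cong₂ _+_
    (trans (sum-cong (subsets n) λ S′ → cong (_* f (outside ∷ S′)) (δ-cons outside S S′)) (sum-δ S (f ∘ (outside ∷_))))
    (trans (sum-cong (subsets n) λ S′ → trans (cong (_* f (inside ∷ S′)) (𝟙-no ((outside ∷ S) ≟ₛ (inside ∷ S′)) λ ())) (ℚ.*-zeroˡ (f (inside ∷ S′))))
      (sum-0 (subsets n))))
    (ℚ.+-identityʳ _))
  sum-δ {suc n} (inside ∷ S) f = trans (sum-subsets n (λ S′ → δ (inside ∷ S) S′ * f S′)) (trans (cong₂ _+_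
    (trans (sum-cong (subsets n) λ S′ → trans (cong (_* f (outside ∷ S′)) (𝟙-no ((inside ∷ S) ≟ₛ (outside ∷ S′)) λ ())) (ℚ.*-zeroˡ (f (outside ∷ S′))))
      (sum-0 (subsets n)))
    (trans (sum-cong (subsets n) λ S′ → cong (_* f (inside ∷ S′)) (δ-cons inside S S′)) (sum-δ S (f ∘ (inside ∷_)))))
    (ℚ.+-identityˡ _))

  sum-δˡ : ∀ {n} (S : Subset n) → sum (subsets n) (δ S) ≡ 1ℚ
  sum-δˡ {n} S = trans (sum-cong (subsets n) λ S′ → sym (ℚ.*-identityʳ (δ S S′))) (sum-δ S (λ _ → 1ℚ))

  sum-δʳ : ∀ {n} (S : Subset n) (f : Subset n → ℚ) → sum (subsets n) (λ S′ → δ S′ S * f S′) ≡ f S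
  sum-δʳ {n} S f = trans (sum-cong (subsets n) λ S′ → cong (_* f S′) (δ-sym S′ S)) (sum-δ S f)

  χ : ∀ {n} → ℕ → Subset n → ℚ
  χ m S = 𝟙 (∣ S ∣ ℕ.≟ m)

  below : ∀ {n} → ℕ → Subset n → ℚ
  below m S = 𝟙 (∣ S ∣ ℕ.<? m)

  below-suc : ∀ {n} m (S : Subset n) → below (suc m) S ≡ χ m S + below m S
  below-suc m S with ℕ.<-cmp ∣ S ∣ m
  ... | tri< l ¬e _ = trans (𝟙-yes (∣ S ∣ ℕ.<? suc m) (ℕ.m<n⇒m<1+n l))
                        (sym (cong₂ _+_ (𝟙-no (∣ S ∣ ℕ.≟ m) ¬e) (𝟙-yes (∣ S ∣ ℕ.<? m) l)))
  ... | tri≈ ¬l e _ = trans (𝟙-yes (∣ S ∣ ℕ.<? suc m) (s≤s (ℕ.≤-reflexive e)))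
                        (sym (cong₂ _+_ (𝟙-yes (∣ S ∣ ℕ.≟ m) e) (𝟙-no (∣ S ∣ ℕ.<? m) ¬l)))
  ... | tri> ¬l ¬e g = trans (𝟙-no (∣ S ∣ ℕ.<? suc m) (ℕ.<⇒≱ (s≤s g)))
                        (sym (cong₂ _+_ (𝟙-no (∣ S ∣ ℕ.≟ m) ¬e) (𝟙-no (∣ S ∣ ℕ.<? m) ¬l)))

  below-levels : ∀ {n} m (S : Subset n) → below m S ≡ sum (downFrom m) (λ j → χ j S)
  below-levels zero    S = 𝟙-no (∣ S ∣ ℕ.<? 0) λ ()
  below-levels (suc m) S = trans (below-suc m S) (cong (_+_ (χ m S)) (below-levels m S))

  sum-below : ∀ {n} m (f : Subset n → ℚ) →
    sum (subsets n) (λ S → below m S * f S) ≡ sum (downFrom m) λ j → sum (subsets n) λ S → χ j S * f S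
  sum-below {n} m f = begin
    sum Ss (λ S → below m S * f S)
      ≡⟨ sum-cong Ss (λ S → trans (cong (_* f S) (below-levels m S)) (sym (sum-*ʳ (downFrom m) (f S) (λ j → χ j S)))) ⟩
    sum Ss (λ S → sum (downFrom m) λ j → χ j S * f S)
      ≡⟨ sum-swap Ss (downFrom m) (λ S j → χ j S * f S) ⟩
    sum (downFrom m) (λ j → sum Ss λ S → χ j S * f S) ∎
    where
    open ≡-Reasoning
    Ss = subsets n

  sum-levels : ∀ {n} (f : Subset n → ℚ) →
    sum (subsets n) f ≡ sum (downFrom (suc n)) λ j → sum (subsets n) λ S → χ j S * f S
  sum-levels {n} f = trans (sum-cong (subsets n) λ S → sym (trans
      (cong (_* f S) (𝟙-yes (∣ S ∣ ℕ.<? suc n) (s≤s (Subset.∣p∣≤n S)))) (ℚ.*-identityˡ (f S))))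
    (sum-below (suc n) f)

  χ-cong : ∀ {n} m (S : Subset n) (h : ℕ → ℚ) → χ m S * h ∣ S ∣ ≡ χ m S * h m
  χ-cong m S h = 𝟙-cong (∣ S ∣ ℕ.≟ m) (cong h)

  -- An edge whose lower end has size `m` is one whose upper end has size `suc m`, so the
  -- restriction to a level can move from one end to the other.
  levels : ∀ {n} m (φ : Subset n → Subset n → ℚ) →
    sum (subsets n) (λ S → χ m S * sum (ups S) (φ S))
      ≡ sum (subsets n) (λ S → χ (suc m) S * sum (downs S) λ S′ → φ S′ S)
  levels {n} m φ = begin
    sum Ss (λ S → χ m S * sum (ups S) (φ S))
      ≡⟨ sum-cong Ss (λ S → sum-*ˡ (ups S) (χ m S) (φ S)) ⟨
    sum Ss (λ S → sum (ups S) λ S′ → χ m S * φ S S′)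
      ≡⟨ double-counting n (λ S S′ → χ m S * φ S S′) ⟩
    sum Ss (λ S → sum (downs S) λ S′ → χ m S′ * φ S′ S)
      ≡⟨ sum-cong Ss (λ S → sum-downs-cong S λ S′ _ e → cong (_* φ S′ S) (shift S S′ e)) ⟩
    sum Ss (λ S → sum (downs S) λ S′ → χ (suc m) S * φ S′ S)
      ≡⟨ sum-cong Ss (λ S → sum-*ˡ (downs S) (χ (suc m) S) (λ S′ → φ S′ S)) ⟩
    sum Ss (λ S → χ (suc m) S * sum (downs S) λ S′ → φ S′ S) ∎
    where
    open ≡-Reasoning
    Ss = subsets n
    shift : ∀ S S′ → ∣ S ∣ ≡ suc ∣ S′ ∣ → χ m S′ ≡ χ (suc m) S
    shift S S′ e = 𝟙-⇔ (∣ S′ ∣ ℕ.≟ m) (∣ S ∣ ℕ.≟ suc m) (λ e′ → trans e (cong suc e′))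
      (λ e′ → ℕ.suc-injective (trans (sym e) e′))

open Subsets

-- First and second moments over the random graph.

module RandomGraph where

  open Data.Rational.Base using (_+_; _*_; _-_; -_; _≤_; _<_)
  open Data.Fin.Subset using (∣_∣)

  𝔼 : {A : Set} → Dist A → (A → ℚ) → ℚ
  𝔼 d f = sum d λ (a , p) → p * f a

  module _ {A : Set} where

    𝔼-cong : ∀ (d : Dist A) {f g} → (∀ a → f a ≡ g a) → 𝔼 d f ≡ 𝔼 d g
    𝔼-cong d h = sum-cong d λ (a , p) → cong (p *_) (h a)

    𝔼-+ : ∀ (d : Dist A) (f g : A → ℚ) → 𝔼 d (λ a → f a + g a) ≡ 𝔼 d f + 𝔼 d g
    𝔼-+ d f g = trans (sum-cong d λ (a , p) → ℚ.*-distribˡ-+ p (f a) (g a)) (sum-+ d _ _)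

    𝔼-*ˡ : ∀ (d : Dist A) c (f : A → ℚ) → 𝔼 d (λ a → c * f a) ≡ c * 𝔼 d f
    𝔼-*ˡ d c f = trans (sum-cong d λ (a , p) → lemma p c (f a)) (sum-*ˡ d c _)
      where
      lemma : ∀ p c x → p * (c * x) ≡ c * (p * x)
      lemma = solve 3 (λ p c x → p ⊗ (c ⊗ x) ⊜ c ⊗ (p ⊗ x)) refl

    𝔼-*ʳ : ∀ (d : Dist A) c (f : A → ℚ) → 𝔼 d (λ a → f a * c) ≡ 𝔼 d f * c
    𝔼-*ʳ d c f = trans (𝔼-cong d λ a → ℚ.*-comm (f a) c) (trans (𝔼-*ˡ d c f) (ℚ.*-comm c (𝔼 d f)))

    𝔼-sum : ∀ {B : Set} (d : Dist A) (ys : List B) (f : A → B → ℚ) →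
      𝔼 d (λ a → sum ys (f a)) ≡ sum ys λ y → 𝔼 d λ a → f a y
    𝔼-sum d ys f = trans (sum-cong d λ (a , p) → sym (sum-*ˡ ys p (f a))) (sum-swap d ys _)

    𝔼-return : ∀ (a : A) f → 𝔼 (return a) f ≡ f a
    𝔼-return a f = lemma (f a)
      where
      lemma : ∀ x → 1ℚ * x + 0ℚ ≡ x
      lemma = solve 1 (λ x → Κ 1ℚ ⊗ x ⊕ Κ 0ℚ ⊜ x) refl

    𝔼->>= : ∀ {B : Set} (d : Dist A) (g : A → Dist B) f → 𝔼 (d >>= g) f ≡ 𝔼 d λ a → 𝔼 (g a) f
    𝔼->>= d g f = trans (sum-concatMap (λ (a , p) → map (λ (b , q) → b , p * q) (g a)) d _)
      (sum-cong d λ (a , p) → trans (sum-map (λ (b , q) → b , p * q) (g a) _)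
        (trans (sum-cong (g a) λ (b , q) → ℚ.*-assoc p q (f b)) (sum-*ˡ (g a) p _)))

    Pr≡𝔼 : ∀ (d : Dist A) E → Pr d E ≡ 𝔼 d λ a → if E a then 1ℚ else 0ℚ
    Pr≡𝔼 []            E = refl
    Pr≡𝔼 ((a , p) ∷ d) E with E a
    ... | true  = cong₂ _+_ (sym (ℚ.*-identityʳ p)) (Pr≡𝔼 d E)
    ... | false = trans (Pr≡𝔼 d E) (sym (trans (cong (_+ 𝔼 d _) (ℚ.*-zeroʳ p)) (ℚ.+-identityˡ _)))

    NonNeg : Dist A → Set
    NonNeg = All λ (a , p) → 0ℚ ≤ p

    𝔼-mono : ∀ {d : Dist A} {f g} → NonNeg d → (∀ a → f a ≤ g a) → 𝔼 d f ≤ 𝔼 d g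
    𝔼-mono nn h = sum-monoᴬ (All.map (λ {(a , p)} 0≤p → *-monoˡ p 0≤p (h a)) nn)

    NonNeg-return : ∀ (a : A) → NonNeg (return a)
    NonNeg-return a = 0≤1 ∷ []

    NonNeg->>= : ∀ {B : Set} {d : Dist A} {g : A → List (B × ℚ)} → NonNeg d →
      (∀ a → All (λ (b , p) → 0ℚ ≤ p) (g a)) → All (λ (b , p) → 0ℚ ≤ p) (d >>= g)
    NonNeg->>= []                       h = []
    NonNeg->>= (_∷_ {x = a , p} 0≤p nn) h = All.++⁺ (All.map⁺ (All.map (0≤* 0≤p) (h a))) (NonNeg->>= nn h)

    NonNeg-uniform : ∀ (xs : List A) → NonNeg (uniform xs)
    NonNeg-uniform []          = []
    NonNeg-uniform xs@(_ ∷ ys) = All.map⁺ (All.universal (λ _ → 0≤frac 1 (length ys)) xs)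

  NonNeg-randomSubset : ∀ n → NonNeg (randomSubset n)
  NonNeg-randomSubset zero    = NonNeg-return []
  NonNeg-randomSubset (suc n) = NonNeg->>= (NonNeg-uniform (inside ∷ outside ∷ [])) λ b →
    NonNeg->>= (NonNeg-randomSubset n) λ S → NonNeg-return (b ∷ S)

  NonNeg-G : ∀ n → NonNeg G[ n ,½]
  NonNeg-G zero    = NonNeg-return []
  NonNeg-G (suc n) = NonNeg->>= (NonNeg-randomSubset n) λ N →
    NonNeg->>= (NonNeg-G n) λ G → NonNeg-return (N ∷ G)

  𝔼-coin : ∀ n (f : Subset (suc n) → ℚ) → 𝔼 (randomSubset (suc n)) f
    ≡ ½ * 𝔼 (randomSubset n) (f ∘ (inside ∷_)) + ½ * 𝔼 (randomSubset n) (f ∘ (outside ∷_))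
  𝔼-coin n f = trans (𝔼->>= (uniform (inside ∷ outside ∷ [])) next f)
    (trans (cong (_+_ (½ * 𝔼 (next inside) f)) (ℚ.+-identityʳ (½ * 𝔼 (next outside) f)))
      (cong₂ (λ x y → ½ * x + ½ * y) (eq inside) (eq outside)))
    where
    next = λ b → randomSubset n >>= λ S → return (b ∷ S)
    eq : ∀ b → 𝔼 (next b) f ≡ 𝔼 (randomSubset n) (f ∘ (b ∷_))
    eq b = trans (𝔼->>= (randomSubset n) (λ S → return (b ∷ S)) f)
      (𝔼-cong (randomSubset n) λ S → 𝔼-return (b ∷ S) f)

  𝔼-vertex : ∀ n (f : Graph (suc n) → ℚ) →
    𝔼 G[ suc n ,½] f ≡ 𝔼 (randomSubset n) λ N → 𝔼 G[ n ,½] λ G → f (N ∷ G)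
  𝔼-vertex n f = trans (𝔼->>= (randomSubset n) (λ N → G[ n ,½] >>= λ G → return (N ∷ G)) f)
    (𝔼-cong (randomSubset n) λ N → trans (𝔼->>= G[ n ,½] (λ G → return (N ∷ G)) f)
      (𝔼-cong G[ n ,½] λ G → 𝔼-return (N ∷ G) f))

  𝔼-randomSubset-1 : ∀ n → 𝔼 (randomSubset n) (λ _ → 1ℚ) ≡ 1ℚ
  𝔼-randomSubset-1 zero    = refl
  𝔼-randomSubset-1 (suc n) = trans (𝔼-coin n (λ _ → 1ℚ)) (cong (λ x → ½ * x + ½ * x) (𝔼-randomSubset-1 n))

  𝔼-G-1 : ∀ n → 𝔼 G[ n ,½] (λ _ → 1ℚ) ≡ 1ℚ
  𝔼-G-1 zero    = refl
  𝔼-G-1 (suc n) = trans (𝔼-vertex n (λ _ → 1ℚ)) (trans (𝔼-cong (randomSubset n) λ _ → 𝔼-G-1 n) (𝔼-randomSubset-1 n))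

  disjoint? : ∀ {n} (N S : Subset n) → Dec (∀ j → j ∈ S → j ∉ N)
  disjoint? N S = Fin.all? λ j → (j Subset.∈? S) →-dec ¬? (j Subset.∈? N)

  disj : ∀ {n} → Subset n → Subset n → ℚ
  disj N S = 𝟙 (disjoint? N S)

  disj-outsideˡ : ∀ {n} b (N S : Subset n) → disj (outside ∷ N) (b ∷ S) ≡ disj N S
  disj-outsideˡ b N S = 𝟙-⇔ (disjoint? (outside ∷ N) (b ∷ S)) (disjoint? N S)
    (λ h j j∈S j∈N → h (suc j) (there j∈S) (there j∈N))
    (λ { h (suc j) (there j∈S) (there j∈N) → h j j∈S j∈N })

  disj-outsideʳ : ∀ {n} (N S : Subset n) → disj (inside ∷ N) (outside ∷ S) ≡ disj N S
  disj-outsideʳ N S = 𝟙-⇔ (disjoint? (inside ∷ N) (outside ∷ S)) (disjoint? N S)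
    (λ h j j∈S j∈N → h (suc j) (there j∈S) (there j∈N))
    (λ { h (suc j) (there j∈S) (there j∈N) → h j j∈S j∈N })

  disj-inside : ∀ {n} (N S : Subset n) → disj (inside ∷ N) (inside ∷ S) ≡ 0ℚ
  disj-inside N S = 𝟙-no (disjoint? (inside ∷ N) (inside ∷ S)) λ h → h zero here here

  ind : ∀ {n} → Graph n → Subset n → ℚ
  ind G S = 𝟙 (independent? G S)

  ind-idem : ∀ {n} (G : Graph n) S → ind G S * ind G S ≡ ind G S
  ind-idem G S = 𝟙-idem (independent? G S)

  ind-⊆ : ∀ {n} (G : Graph n) {S S′} → S ⊆ S′ → ind G S * ind G S′ ≡ ind G S′
  ind-⊆ G {S} {S′} S⊆S′ = begin
    ind G S * ind G S′    ≡⟨ ℚ.*-comm (ind G S) (ind G S′) ⟩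
    ind G S′ * ind G S    ≡⟨ 𝟙-cong (independent? G S′) (λ h → 𝟙-yes (independent? G S) (λ i j i∈S j∈S → h i j (S⊆S′ i∈S) (S⊆S′ j∈S))) ⟩
    ind G S′ * 1ℚ         ≡⟨ ℚ.*-identityʳ (ind G S′) ⟩
    ind G S′              ∎
    where open ≡-Reasoning

  ind-outside : ∀ {n} N (G : Graph n) S → ind (N ∷ G) (outside ∷ S) ≡ ind G S
  ind-outside N G S = 𝟙-⇔ (independent? (N ∷ G) (outside ∷ S)) (independent? G S)
    (λ h i j i∈S j∈S → h (suc i) (suc j) (there i∈S) (there j∈S))
    (λ { h (suc i) (suc j) (there i∈S) (there j∈S) → h i j i∈S j∈S })

  -- The two factors use separate randomness, `N` and `G`; this is why moments factor when vertices
  -- are added one at a time.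
  ind-inside : ∀ {n} N (G : Graph n) S → ind (N ∷ G) (inside ∷ S) ≡ disj N S * ind G S
  ind-inside N G S = trans
    (𝟙-⇔ (independent? (N ∷ G) (inside ∷ S)) (disjoint? N S ×-dec independent? G S)
      (λ h → (λ j j∈S → h zero (suc j) here (there j∈S))
           , (λ i j i∈S j∈S → h (suc i) (suc j) (there i∈S) (there j∈S)))
      (λ { (h , h′) zero    zero    _           _           → λ ()
         ; (h , h′) zero    (suc j) _           (there j∈S) → h j j∈S
         ; (h , h′) (suc i) zero    (there i∈S) _           → h i i∈S
         ; (h , h′) (suc i) (suc j) (there i∈S) (there j∈S) → h′ i j i∈S j∈S }))
    (𝟙-× (disjoint? N S) (independent? G S))
    where
    𝟙-× : ∀ {P Q : Set} (d : Dec P) (e : Dec Q) → 𝟙 (d ×-dec e) ≡ 𝟙 d * 𝟙 e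
    𝟙-× (yes _) e = sym (ℚ.*-identityˡ (𝟙 e))
    𝟙-× (no _)  e = sym (ℚ.*-zeroˡ (𝟙 e))

  𝔼-disj : ∀ {n} (S : Subset n) → 𝔼 (randomSubset n) (λ N → disj N S) ≡ ½ ^ ∣ S ∣
  𝔼-disj []            = refl
  𝔼-disj {suc n} (outside ∷ S) = begin
    𝔼 (randomSubset (suc n)) (λ N → disj N (outside ∷ S))
      ≡⟨ 𝔼-coin n (λ N → disj N (outside ∷ S)) ⟩
    ½ * 𝔼 (randomSubset n) (λ N → disj (inside ∷ N) (outside ∷ S)) + ½ * 𝔼 (randomSubset n) (λ N → disj (outside ∷ N) (outside ∷ S))
      ≡⟨ cong₂ (λ x y → ½ * x + ½ * y) (𝔼-cong (randomSubset n) λ N → disj-outsideʳ N S) (𝔼-cong (randomSubset n) λ N → disj-outsideˡ outside N S) ⟩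
    ½ * E + ½ * E
      ≡⟨ lemma E ⟩
    E ≡⟨ 𝔼-disj S ⟩
    ½ ^ ∣ S ∣ ∎
    where
    open ≡-Reasoning
    E = 𝔼 (randomSubset n) λ N → disj N S
    lemma : ∀ x → ½ * x + ½ * x ≡ x
    lemma = solve 1 (λ x → Κ ½ ⊗ x ⊕ Κ ½ ⊗ x ⊜ x) refl
  𝔼-disj {suc n} (inside ∷ S) = begin
    𝔼 (randomSubset (suc n)) (λ N → disj N (inside ∷ S))
      ≡⟨ 𝔼-coin n (λ N → disj N (inside ∷ S)) ⟩
    ½ * 𝔼 (randomSubset n) (λ N → disj (inside ∷ N) (inside ∷ S)) + ½ * 𝔼 (randomSubset n) (λ N → disj (outside ∷ N) (inside ∷ S))
      ≡⟨ cong₂ (λ x y → ½ * x + ½ * y)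
           (trans (𝔼-cong (randomSubset n) λ N → trans (disj-inside N S) (sym (ℚ.*-zeroˡ 0ℚ))) (𝔼-*ˡ (randomSubset n) 0ℚ (λ _ → 0ℚ)))
           (𝔼-cong (randomSubset n) λ N → disj-outsideˡ inside N S) ⟩
    ½ * (0ℚ * 𝔼 (randomSubset n) (λ _ → 0ℚ)) + ½ * E
      ≡⟨ lemma (𝔼 (randomSubset n) (λ _ → 0ℚ)) E ⟩
    ½ * E ≡⟨ cong (½ *_) (𝔼-disj S) ⟩
    ½ * ½ ^ ∣ S ∣ ∎
    where
    open ≡-Reasoning
    E = 𝔼 (randomSubset n) λ N → disj N S
    lemma : ∀ z x → ½ * (0ℚ * z) + ½ * x ≡ ½ * x
    lemma = solve 2 (λ z x → Κ ½ ⊗ (Κ 0ℚ ⊗ z) ⊕ Κ ½ ⊗ x ⊜ Κ ½ ⊗ x) refl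

  -- `N` has to miss every vertex of the union, and `∣ S ∣ + ∣ S′ ∣` counts the common vertices
  -- twice. The factor on the left corrects this without a division.
  𝔼-disj² : ∀ {n} (S S′ : Subset n) →
    𝔼 (randomSubset n) (λ N → disj N S * disj N S′) * ½ ^ ∣ S ∩ S′ ∣ ≡ ½ ^ ∣ S ∣ * ½ ^ ∣ S′ ∣
  𝔼-disj² [] [] = refl
  𝔼-disj² {suc n} (b ∷ S) (b′ ∷ S′) = trans (cong (_* ½ ^ ∣ (b ∷ S) ∩ (b′ ∷ S′) ∣) split) (cases b b′)
    where
    E = 𝔼 (randomSubset n) λ N → disj N S * disj N S′
    E₁ = 𝔼 (randomSubset n) λ N → disj (inside ∷ N) (b ∷ S) * disj (inside ∷ N) (b′ ∷ S′)
    split : 𝔼 (randomSubset (suc n)) (λ N → disj N (b ∷ S) * disj N (b′ ∷ S′)) ≡ ½ * E₁ + ½ * E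
    split = trans (𝔼-coin n (λ N → disj N (b ∷ S) * disj N (b′ ∷ S′)))
      (cong (λ x → ½ * E₁ + ½ * x) (𝔼-cong (randomSubset n) λ N → cong₂ _*_ (disj-outsideˡ b N S) (disj-outsideˡ b′ N S′)))
    vanish : ∀ (f : Subset n → ℚ) → (∀ N → f N ≡ 0ℚ) → 𝔼 (randomSubset n) f ≡ 0ℚ
    vanish f h = trans (sum-cong (randomSubset n) λ (N , p) → trans (cong (p *_) (h N)) (ℚ.*-zeroʳ p)) (sum-0 (randomSubset n))
    ih = 𝔼-disj² S S′
    c = ½ ^ ∣ S ∩ S′ ∣
    kill : ∀ {z} → z ≡ 0ℚ → ½ * z + ½ * E ≡ ½ * E
    kill refl = ℚ.+-identityˡ (½ * E)
    lemma₁ : ∀ x → ½ * x + ½ * x ≡ x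
    lemma₁ = solve 1 (λ x → Κ ½ ⊗ x ⊕ Κ ½ ⊗ x ⊜ x) refl
    lemma₂ : ∀ a b → ½ * (a * b) ≡ ½ * a * b
    lemma₂ = solve 2 (λ a b → Κ ½ ⊗ (a ⊗ b) ⊜ Κ ½ ⊗ a ⊗ b) refl
    lemma₃ : ∀ a b → ½ * (a * b) ≡ a * (½ * b)
    lemma₃ = solve 2 (λ a b → Κ ½ ⊗ (a ⊗ b) ⊜ a ⊗ (Κ ½ ⊗ b)) refl
    lemma₄ : ∀ x c → ½ * x * (½ * c) ≡ ½ * (½ * (x * c))
    lemma₄ = solve 2 (λ x c → Κ ½ ⊗ x ⊗ (Κ ½ ⊗ c) ⊜ Κ ½ ⊗ (Κ ½ ⊗ (x ⊗ c))) refl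
    lemma₅ : ∀ a b → ½ * (½ * (a * b)) ≡ ½ * a * (½ * b)
    lemma₅ = solve 2 (λ a b → Κ ½ ⊗ (Κ ½ ⊗ (a ⊗ b)) ⊜ Κ ½ ⊗ a ⊗ (Κ ½ ⊗ b)) refl
    cases : ∀ b b′ → (½ * 𝔼 (randomSubset n) (λ N → disj (inside ∷ N) (b ∷ S) * disj (inside ∷ N) (b′ ∷ S′)) + ½ * E)
      * ½ ^ ∣ (b ∷ S) ∩ (b′ ∷ S′) ∣ ≡ ½ ^ ∣ b ∷ S ∣ * ½ ^ ∣ b′ ∷ S′ ∣
    cases outside outside = trans (cong (_* c) (trans (cong (λ x → ½ * x + ½ * E)
      (𝔼-cong (randomSubset n) λ N → cong₂ _*_ (disj-outsideʳ N S) (disj-outsideʳ N S′))) (lemma₁ E))) ih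
    cases inside outside = trans (cong (_* c) (kill (vanish _ λ N →
      trans (cong (_* disj (inside ∷ N) (outside ∷ S′)) (disj-inside N S)) (ℚ.*-zeroˡ (disj (inside ∷ N) (outside ∷ S′))))))
      (trans (sym (lemma₂ E c)) (trans (cong (½ *_) ih) (lemma₂ (½ ^ ∣ S ∣) (½ ^ ∣ S′ ∣))))
    cases outside inside = trans (cong (_* c) (kill (vanish _ λ N →
      trans (cong (disj (inside ∷ N) (outside ∷ S) *_) (disj-inside N S′)) (ℚ.*-zeroʳ (disj (inside ∷ N) (outside ∷ S))))))
      (trans (sym (lemma₂ E c)) (trans (cong (½ *_) ih) (lemma₃ (½ ^ ∣ S ∣) (½ ^ ∣ S′ ∣))))
    cases inside inside = trans (cong (_* (½ * c)) (kill (vanish _ λ N →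
      trans (cong (_* disj (inside ∷ N) (inside ∷ S′)) (disj-inside N S)) (ℚ.*-zeroˡ (disj (inside ∷ N) (inside ∷ S′))))))
      (trans (lemma₄ E c) (trans (cong (λ x → ½ * (½ * x)) ih) (lemma₅ (½ ^ ∣ S ∣) (½ ^ ∣ S′ ∣))))

  -- The binomial coefficient `m (m - 1) / 2`: the number of edges that must be absent for a set of
  -- size `m` to be independent.
  tri : ℕ → ℕ
  tri zero    = 0
  tri (suc m) = m ℕ.+ tri m

  -- Inclusion–exclusion for the pairs inside S or inside S′, in multiplicative form.
  𝔼-ind² : ∀ {n} (S S′ : Subset n) →
    𝔼 G[ n ,½] (λ G → ind G S * ind G S′) * ½ ^ tri ∣ S ∩ S′ ∣ ≡ ½ ^ tri ∣ S ∣ * ½ ^ tri ∣ S′ ∣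
  𝔼-ind² [] [] = refl
  𝔼-ind² {suc n} (b ∷ S) (b′ ∷ S′) = trans
    (cong (_* ½ ^ tri ∣ (b ∷ S) ∩ (b′ ∷ S′) ∣) (𝔼-vertex n (λ G → ind G (b ∷ S) * ind G (b′ ∷ S′)))) (cases b b′)
    where
    E = 𝔼 G[ n ,½] λ G → ind G S * ind G S′
    c = ½ ^ tri ∣ S ∩ S′ ∣
    s = ½ ^ tri ∣ S ∣
    s′ = ½ ^ tri ∣ S′ ∣
    ih : E * c ≡ s * s′
    ih = 𝔼-ind² S S′
    factor : ∀ b b′ (h : Subset n → ℚ) →
      (∀ N G → ind (N ∷ G) (b ∷ S) * ind (N ∷ G) (b′ ∷ S′) ≡ h N * (ind G S * ind G S′)) →
      𝔼 (randomSubset n) (λ N → 𝔼 G[ n ,½] λ G → ind (N ∷ G) (b ∷ S) * ind (N ∷ G) (b′ ∷ S′))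
        ≡ 𝔼 (randomSubset n) h * E
    factor b b′ h eq = trans (𝔼-cong (randomSubset n) λ N → trans (𝔼-cong G[ n ,½] (eq N))
      (𝔼-*ˡ G[ n ,½] (h N) (λ G → ind G S * ind G S′))) (𝔼-*ʳ (randomSubset n) E h)
    lemma₁ : ∀ d x c → d * x * c ≡ d * (x * c)
    lemma₁ = solve 3 (λ d x c → d ⊗ x ⊗ c ⊜ d ⊗ (x ⊗ c)) refl
    lemma₂ : ∀ d x y → d * (x * y) ≡ x * (d * y)
    lemma₂ = solve 3 (λ d x y → d ⊗ (x ⊗ y) ⊜ x ⊗ (d ⊗ y)) refl
    lemma₃ : ∀ d e x c → d * x * (e * c) ≡ d * e * (x * c)
    lemma₃ = solve 4 (λ d e x c → d ⊗ x ⊗ (e ⊗ c) ⊜ d ⊗ e ⊗ (x ⊗ c)) refl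
    lemma₄ : ∀ d e x c → d * e * (x * c) ≡ d * x * (e * c)
    lemma₄ = solve 4 (λ d e x c → d ⊗ e ⊗ (x ⊗ c) ⊜ d ⊗ x ⊗ (e ⊗ c)) refl
    cases : ∀ b b′ →
      𝔼 (randomSubset n) (λ N → 𝔼 G[ n ,½] λ G → ind (N ∷ G) (b ∷ S) * ind (N ∷ G) (b′ ∷ S′))
        * ½ ^ tri ∣ (b ∷ S) ∩ (b′ ∷ S′) ∣ ≡ ½ ^ tri ∣ b ∷ S ∣ * ½ ^ tri ∣ b′ ∷ S′ ∣
    cases outside outside = trans (cong (_* c) (trans (factor outside outside (λ _ → 1ℚ) λ N G →
        trans (cong₂ _*_ (ind-outside N G S) (ind-outside N G S′)) (sym (ℚ.*-identityˡ _)))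
      (trans (cong (_* E) (𝔼-randomSubset-1 n)) (ℚ.*-identityˡ E)))) ih
    cases inside outside = trans (cong (_* c) (trans (factor inside outside (λ N → disj N S) λ N G →
        trans (cong₂ _*_ (ind-inside N G S) (ind-outside N G S′)) (ℚ.*-assoc (disj N S) (ind G S) (ind G S′)))
      (cong (_* E) (𝔼-disj S))))
      (trans (lemma₁ (½ ^ ∣ S ∣) E c) (trans (cong (½ ^ ∣ S ∣ *_) ih)
        (trans (sym (lemma₁ (½ ^ ∣ S ∣) s s′)) (cong (_* s′) (sym (½^+ ∣ S ∣ (tri ∣ S ∣)))))))
    cases outside inside = trans (cong (_* c) (trans (factor outside inside (λ N → disj N S′) λ N G →
        trans (cong₂ _*_ (ind-outside N G S) (ind-inside N G S′)) (sym (lemma₂ (disj N S′) (ind G S) (ind G S′))))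
      (cong (_* E) (𝔼-disj S′))))
      (trans (lemma₁ (½ ^ ∣ S′ ∣) E c) (trans (cong (½ ^ ∣ S′ ∣ *_) ih)
        (trans (lemma₂ (½ ^ ∣ S′ ∣) s s′) (cong (s *_) (sym (½^+ ∣ S′ ∣ (tri ∣ S′ ∣)))))))
    cases inside inside = trans (cong₂ _*_ (factor inside inside (λ N → disj N S * disj N S′) λ N G →
        trans (cong₂ _*_ (ind-inside N G S) (ind-inside N G S′)) (lemma₃ (disj N S) (disj N S′) (ind G S) (ind G S′)))
        (½^+ ∣ S ∩ S′ ∣ (tri ∣ S ∩ S′ ∣)))
      (trans (lemma₃ (𝔼 (randomSubset n) λ N → disj N S * disj N S′) (½ ^ ∣ S ∩ S′ ∣) E c)
        (trans (cong₂ _*_ (𝔼-disj² S S′) ih)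
          (trans (lemma₄ (½ ^ ∣ S ∣) (½ ^ ∣ S′ ∣) s s′)
            (sym (cong₂ _*_ (½^+ ∣ S ∣ (tri ∣ S ∣)) (½^+ ∣ S′ ∣ (tri ∣ S′ ∣)))))))

  0≤ind : ∀ {n} (G : Graph n) S → 0ℚ ≤ ind G S
  0≤ind G S = 0≤𝟙 (independent? G S)

  -- The diagonal case `S′ = S` of `𝔼-ind²`, with one factor cancelled.
  𝔼-ind : ∀ {n} (S : Subset n) → 𝔼 G[ n ,½] (λ G → ind G S) ≡ ½ ^ tri ∣ S ∣
  𝔼-ind {n} S = cancel-≡ (0<^ (tri ∣ S ∣) 0<½) (trans
    (cong₂ _*_ (𝔼-cong G[ n ,½] λ G → sym (ind-idem G S)) (cong (λ j → ½ ^ tri j) (sym (∣S∩S∣ S)))) (𝔼-ind² S S))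

  -- The number of vertices that can be added to S, for independent S, and 0 otherwise.
  free : ∀ {n} → Graph n → Subset n → ℚ
  free G S = sum (ups S) (ind G)

  0≤free : ∀ {n} (G : Graph n) S → 0ℚ ≤ free G S
  0≤free G S = 0≤sum (ups S) (0≤ind G)

  ind*free : ∀ {n} (G : Graph n) S → ind G S * free G S ≡ free G S
  ind*free G S = trans (sym (sum-*ˡ (ups S) (ind G S) (ind G))) (sum-ups-cong S λ S′ S⊆S′ _ → ind-⊆ G S⊆S′)

  -- The expectation of free G S, conditionally on the independence of a set S of size m.
  deg : ℕ → ℕ → ℚ
  deg n m = nat (n ∸ m) * ½ ^ m

  0≤deg : ∀ n m → 0ℚ ≤ deg n m
  0≤deg n m = 0≤* (0≤nat (n ∸ m)) (0≤^ m 0≤½)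

  length-ups : ∀ {n} (S : Subset n) → length (ups S) ≡ n ∸ ∣ S ∣
  length-ups {n} S = trans (sym (ℕ.m+n∸n≡m (length (ups S)) ∣ S ∣)) (cong (_∸ ∣ S ∣) (ups-length S))

  -- An added vertex forbids `∣ S ∣` further edges, since `tri (suc m)` is `m + tri m`, and there
  -- are `n ∸ ∣ S ∣` vertices to add.
  𝔼-free : ∀ {n} (S : Subset n) → 𝔼 G[ n ,½] (λ G → free G S) ≡ ½ ^ tri ∣ S ∣ * deg n ∣ S ∣
  𝔼-free {n} S = begin
    𝔼 G[ n ,½] (λ G → free G S)                      ≡⟨ 𝔼-sum G[ n ,½] (ups S) ind ⟩
    sum (ups S) (λ S′ → 𝔼 G[ n ,½] λ G → ind G S′)   ≡⟨ sum-ups-cong S (λ S′ _ e → trans (𝔼-ind S′) (cong (λ j → ½ ^ tri j) e)) ⟩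
    sum (ups S) (λ _ → ½ ^ (∣ S ∣ ℕ.+ tri ∣ S ∣))    ≡⟨ sum-const (ups S) _ ⟩
    nat (length (ups S)) * ½ ^ (∣ S ∣ ℕ.+ tri ∣ S ∣) ≡⟨ cong₂ (λ l p → nat l * p) (length-ups S) (½^+ ∣ S ∣ (tri ∣ S ∣)) ⟩
    nat (n ∸ ∣ S ∣) * (½ ^ ∣ S ∣ * ½ ^ tri ∣ S ∣)    ≡⟨ lemma (nat (n ∸ ∣ S ∣)) (½ ^ ∣ S ∣) (½ ^ tri ∣ S ∣) ⟩
    ½ ^ tri ∣ S ∣ * deg n ∣ S ∣                      ∎
    where
    open ≡-Reasoning
    lemma : ∀ l h p → l * (h * p) ≡ p * (l * h)
    lemma = solve 3 (λ l h p → l ⊗ (h ⊗ p) ⊜ p ⊗ (l ⊗ h)) refl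

  -- Given that `S` is independent, two outside vertices are free independently of each other, each
  -- with probability `h = ½ ^ ∣ S ∣`. The second moment of a binomial variable, `d² + d - l h²`
  -- with `d = l h`, is rounded up by dropping the last term.
  𝔼-free² : ∀ {n} (S : Subset n) → 𝔼 G[ n ,½] (λ G → free G S * free G S)
    ≤ ½ ^ tri ∣ S ∣ * (deg n ∣ S ∣ * deg n ∣ S ∣ + deg n ∣ S ∣)
  𝔼-free² {n} S = begin
    𝔼 G[ n ,½] (λ G → free G S * free G S)
      ≤⟨ sum-square G[ n ,½] proj₂ (λ S′ (G , _) → ind G S′) (h * p) (h * h * p) (ups S)
           (All.map (λ {S′} e → ℚ.≤-reflexive (trans (𝔼-cong G[ n ,½] λ G → ind-idem G S′) (single S′ e))) (ups-size S))
           (pairs (ups S) (ups-size S) (ups-pairs S)) ⟩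
    l * (l - 1ℚ) * (h * h * p) + l * (h * p)
      ≤⟨ ≤-by (l * h * h * p) (0≤* (0≤* (0≤* (0≤nat (length (ups S))) 0≤h) 0≤h) (0≤^ (tri ∣ S ∣) 0≤½)) (lemma l h p) ⟩
    p * (l * h * (l * h) + l * h)
      ≡⟨ cong (λ j → p * (nat j * h * (nat j * h) + nat j * h)) (length-ups S) ⟩
    p * (deg n ∣ S ∣ * deg n ∣ S ∣ + deg n ∣ S ∣) ∎
    where
    open ℚ.≤-Reasoning
    l = nat (length (ups S))
    h = ½ ^ ∣ S ∣
    p = ½ ^ tri ∣ S ∣
    0≤h = 0≤^ ∣ S ∣ 0≤½
    lemma : ∀ l h p → l * (l - 1ℚ) * (h * h * p) + l * (h * p) + l * h * h * p ≡ p * (l * h * (l * h) + l * h)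
    lemma = solve 3 (λ l h p →
      l ⊗ (l ⊖ Κ 1ℚ) ⊗ (h ⊗ h ⊗ p) ⊕ l ⊗ (h ⊗ p) ⊕ l ⊗ h ⊗ h ⊗ p ⊜
      p ⊗ (l ⊗ h ⊗ (l ⊗ h) ⊕ l ⊗ h)) refl
    single : ∀ S′ → ∣ S′ ∣ ≡ suc ∣ S ∣ → 𝔼 G[ n ,½] (λ G → ind G S′) ≡ h * p
    single S′ e = trans (𝔼-ind S′) (trans (cong (λ j → ½ ^ tri j) e) (½^+ ∣ S ∣ (tri ∣ S ∣)))
    lemma₂ : ∀ h p → h * p * (h * p) ≡ h * h * p * p
    lemma₂ = solve 2 (λ h p → h ⊗ p ⊗ (h ⊗ p) ⊜ h ⊗ h ⊗ p ⊗ p) refl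
    pair : ∀ S′ S″ → ∣ S′ ∣ ≡ suc ∣ S ∣ → ∣ S″ ∣ ≡ suc ∣ S ∣ → ∣ S′ ∩ S″ ∣ ≡ ∣ S ∣ →
      𝔼 G[ n ,½] (λ G → ind G S′ * ind G S″) ≡ h * h * p
    pair S′ S″ e′ e″ e = cancel-≡ (0<^ (tri ∣ S ∣) 0<½) (trans
      (cong (λ j → 𝔼 G[ n ,½] (λ G → ind G S′ * ind G S″) * ½ ^ tri j) (sym e))
      (trans (𝔼-ind² S′ S″) (trans (cong₂ (λ i j → ½ ^ tri i * ½ ^ tri j) e′ e″)
        (trans (cong (λ x → x * x) (½^+ ∣ S ∣ (tri ∣ S ∣))) (lemma₂ h p)))))
    pairs : ∀ xs → All (λ S′ → ∣ S′ ∣ ≡ suc ∣ S ∣) xs → AllPairs (λ S′ S″ → ∣ S′ ∩ S″ ∣ ≡ ∣ S ∣) xs →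
      AllPairs (λ S′ S″ → 𝔼 G[ n ,½] (λ G → ind G S′ * ind G S″) ≤ h * h * p) xs
    pairs []        _        []       = []
    pairs (S′ ∷ xs) (e ∷ es) (q ∷ qs) = go es q ∷ pairs xs es qs
      where
      go : ∀ {ys} → All (λ S″ → ∣ S″ ∣ ≡ suc ∣ S ∣) ys → All (λ S″ → ∣ S′ ∩ S″ ∣ ≡ ∣ S ∣) ys →
        All (λ S″ → 𝔼 G[ n ,½] (λ G → ind G S′ * ind G S″) ≤ h * h * p) ys
      go []         []       = []
      go (e′ ∷ es′) (r ∷ rs) = ℚ.≤-reflexive (pair S′ _ e e′ r) ∷ go es′ rs

  -- A binomial variance is at most its mean; the factor `½ ^ tri ∣ S ∣` is the probability that `S`
  -- is independent. Absorbing `ind G S` into `free G S` leaves only moments that are already known.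
  free-variance : ∀ {n} (S : Subset n) →
    𝔼 G[ n ,½] (λ G → ind G S * ((free G S - deg n ∣ S ∣) * (free G S - deg n ∣ S ∣)))
      ≤ ½ ^ tri ∣ S ∣ * deg n ∣ S ∣
  free-variance {n} S = begin
    𝔼 Γ (λ G → ind G S * ((free G S - f) * (free G S - f)))
      ≡⟨ 𝔼-cong Γ (λ G → trans (lemma₁ (ind G S) (free G S) f)
           (cong (λ x → x * free G S + (- (1ℚ + 1ℚ) * f * x + f * f * ind G S)) (ind*free G S))) ⟩
    𝔼 Γ (λ G → free G S * free G S + (- (1ℚ + 1ℚ) * f * free G S + f * f * ind G S))
      ≡⟨ trans (𝔼-+ Γ (λ G → free G S * free G S) (λ G → - (1ℚ + 1ℚ) * f * free G S + f * f * ind G S))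
           (cong (_+_ (𝔼 Γ λ G → free G S * free G S))
             (trans (𝔼-+ Γ (λ G → - (1ℚ + 1ℚ) * f * free G S) (λ G → f * f * ind G S))
               (cong₂ _+_ (𝔼-*ˡ Γ (- (1ℚ + 1ℚ) * f) (λ G → free G S)) (𝔼-*ˡ Γ (f * f) (λ G → ind G S))))) ⟩
    𝔼 Γ (λ G → free G S * free G S) + (- (1ℚ + 1ℚ) * f * 𝔼 Γ (λ G → free G S) + f * f * 𝔼 Γ (λ G → ind G S))
      ≡⟨ cong₂ (λ x y → 𝔼 Γ (λ G → free G S * free G S) + (- (1ℚ + 1ℚ) * f * x + f * f * y)) (𝔼-free S) (𝔼-ind S) ⟩
    𝔼 Γ (λ G → free G S * free G S) + (- (1ℚ + 1ℚ) * f * (p * f) + f * f * p)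
      ≤⟨ ℚ.+-monoˡ-≤ (- (1ℚ + 1ℚ) * f * (p * f) + f * f * p) (𝔼-free² S) ⟩
    p * (f * f + f) + (- (1ℚ + 1ℚ) * f * (p * f) + f * f * p)
      ≡⟨ lemma₂ p f ⟩
    p * f ∎
    where
    open ℚ.≤-Reasoning
    Γ = G[ n ,½]
    f = deg n ∣ S ∣
    p = ½ ^ tri ∣ S ∣
    lemma₁ : ∀ i x f → i * ((x - f) * (x - f)) ≡ i * x * x + (- (1ℚ + 1ℚ) * f * (i * x) + f * f * i)
    lemma₁ = solve 3 (λ i x f →
      i ⊗ ((x ⊖ f) ⊗ (x ⊖ f)) ⊜
      i ⊗ x ⊗ x ⊕ (⊝ (Κ 1ℚ ⊕ Κ 1ℚ) ⊗ f ⊗ (i ⊗ x) ⊕ f ⊗ f ⊗ i)) refl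
    lemma₂ : ∀ p f → p * (f * f + f) + (- (1ℚ + 1ℚ) * f * (p * f) + f * f * p) ≡ p * f
    lemma₂ = solve 2 (λ p f → p ⊗ (f ⊗ f ⊕ f) ⊕ (⊝ (Κ 1ℚ ⊕ Κ 1ℚ) ⊗ f ⊗ (p ⊗ f) ⊕ f ⊗ f ⊗ p) ⊜ p ⊗ f) refl

open RandomGraph

-- Averages over the independent sets of one size, and their change from size to size.

module Levels where

  open Data.Rational.Base using (_+_; _*_; _-_; -_; _≤_; _<_)
  open Data.Fin.Subset using (∣_∣)

  ∣S∣≡0⇒S≡⊥ : ∀ {n} (S : Subset n) → ∣ S ∣ ≡ 0 → S ≡ Subset.⊥
  ∣S∣≡0⇒S≡⊥ []            _ = refl
  ∣S∣≡0⇒S≡⊥ (outside ∷ S) e = cong (outside ∷_) (∣S∣≡0⇒S≡⊥ S e)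

  χ₀ : ∀ {n} (S : Subset n) → χ 0 S ≡ δ S Subset.⊥
  χ₀ {n} S = 𝟙-⇔ (∣ S ∣ ℕ.≟ 0) (S ≟ₛ Subset.⊥) (∣S∣≡0⇒S≡⊥ S) λ e → trans (cong ∣_∣ e) (Subset.∣⊥∣≡0 n)

  sum-χ₀ : ∀ {n} (f : Subset n → ℚ) → sum (subsets n) (λ S → χ 0 S * f S) ≡ f Subset.⊥
  sum-χ₀ {n} f = trans (sum-cong (subsets n) λ S → cong (_* f S) (χ₀ S)) (sum-δʳ Subset.⊥ f)

  ind-⊥ : ∀ {n} (G : Graph n) → ind G Subset.⊥ ≡ 1ℚ
  ind-⊥ G = 𝟙-yes (independent? G Subset.⊥) λ i j i∈⊥ → ⊥-elim (Subset.∉⊥ i∈⊥)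

  -- vol n m is the expected number of independent sets of size m, and wt n m its inverse.
  vol wt : ℕ → ℕ → ℚ
  vol n zero    = 1ℚ
  vol n (suc m) = vol n m * deg n m * nat (suc m) ⁻¹
  wt n zero    = 1ℚ
  wt n (suc m) = wt n m * nat (suc m) * deg n m ⁻¹

  0<deg : ∀ {n m} → m ℕ.< n → 0ℚ < deg n m
  0<deg {n} {m} m<n = 0<* (nat-pos (ℕ.m<n⇒0<n∸m m<n)) (0<^ m 0<½)

  0<vol : ∀ {n m} → m ℕ.≤ n → 0ℚ < vol n m
  0<vol {m = zero}  _   = ℚ.positive⁻¹ 1ℚ
  0<vol {m = suc m} m<n = 0<* (0<* (0<vol (ℕ.<⇒≤ m<n)) (0<deg m<n)) (0<⁻¹ (0<nat m))

  0≤vol : ∀ n m → 0ℚ ≤ vol n m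
  0≤vol n zero    = 0≤1
  0≤vol n (suc m) = 0≤* (0≤* (0≤vol n m) (0≤deg n m)) (0≤⁻¹ (nat (suc m)))

  0≤wt : ∀ n m → 0ℚ ≤ wt n m
  0≤wt n zero    = 0≤1
  0≤wt n (suc m) = 0≤* (0≤* (0≤wt n m) (0≤nat (suc m))) (0≤⁻¹ (deg n m))

  vol*wt : ∀ {n m} → m ℕ.≤ n → vol n m * wt n m ≡ 1ℚ
  vol*wt {m = zero}  _   = refl
  vol*wt {n} {suc m} m<n = begin
    vol n m * deg n m * nat (suc m) ⁻¹ * (wt n m * nat (suc m) * deg n m ⁻¹)
      ≡⟨ lemma (vol n m) (deg n m) (nat (suc m) ⁻¹) (wt n m) (nat (suc m)) (deg n m ⁻¹) ⟩
    vol n m * wt n m * (deg n m * deg n m ⁻¹) * (nat (suc m) * nat (suc m) ⁻¹)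
      ≡⟨ cong₂ _*_ (cong₂ _*_ (vol*wt (ℕ.<⇒≤ m<n)) (*-⁻¹ (0<deg m<n))) (*-⁻¹ (0<nat m)) ⟩
    1ℚ * 1ℚ * 1ℚ ≡⟨⟩
    1ℚ ∎
    where
    open ≡-Reasoning
    lemma : ∀ v d i w m e → v * d * i * (w * m * e) ≡ v * w * (d * e) * (m * i)
    lemma = solve 6 (λ v d i w m e → v ⊗ d ⊗ i ⊗ (w ⊗ m ⊗ e) ⊜ v ⊗ w ⊗ (d ⊗ e) ⊗ (m ⊗ i)) refl

  -- A set of size `m` has `n ∸ m` extensions and a set of size `suc m` has `suc m` restrictions, so
  -- double counting gives exactly the recursion by which `vol` is defined.
  sum-½^tri : ∀ n m → sum (subsets n) (λ S → χ m S * ½ ^ tri ∣ S ∣) ≡ vol n m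
  sum-½^tri n zero    = trans (sum-χ₀ {n} (λ S → ½ ^ tri ∣ S ∣)) (cong (λ j → ½ ^ tri j) (Subset.∣⊥∣≡0 n))
  sum-½^tri n (suc m) = begin
    c (suc m)
      ≡⟨ *⁻¹-cancel (c (suc m)) (0<nat m) ⟨
    c (suc m) * nat (suc m) * nat (suc m) ⁻¹
      ≡⟨ cong (_* nat (suc m) ⁻¹) (begin
        c (suc m) * nat (suc m)
          ≡⟨ sum-*ʳ Ss (nat (suc m)) (λ S → χ (suc m) S * p S) ⟨
        sum Ss (λ S → χ (suc m) S * p S * nat (suc m))
          ≡⟨ sum-cong Ss (λ S → trans (lemma₁ (χ (suc m) S) (p S) (nat (suc m)))
               (𝟙-cong (∣ S ∣ ℕ.≟ suc m) λ e → sym (trans (sum-const (downs S) (p S))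
                 (cong (λ j → nat j * p S) (trans (downs-length S) e))))) ⟩
        sum Ss (λ S → χ (suc m) S * sum (downs S) λ _ → p S)
          ≡⟨ levels m (λ _ S → p S) ⟨
        sum Ss (λ S → χ m S * sum (ups S) p)
          ≡⟨ sum-cong Ss (λ S → trans (𝟙-cong (∣ S ∣ ℕ.≟ m) λ e → trans
               (sum-ups-cong S λ S′ _ e′ → cong (λ j → ½ ^ tri j) (trans e′ (cong suc e)))
               (trans (sum-const (ups S) (½ ^ tri (suc m)))
                 (trans (cong₂ (λ l q → nat l * q) (trans (length-ups S) (cong (n ∸_) e)) (½^+ m (tri m)))
                   (trans (lemma₂ (nat (n ∸ m)) (½ ^ m) (½ ^ tri m)) (cong (λ j → ½ ^ tri j * deg n m) (sym e))))))
               (sym (ℚ.*-assoc (χ m S) (p S) (deg n m)))) ⟩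
        sum Ss (λ S → χ m S * p S * deg n m)
          ≡⟨ sum-*ʳ Ss (deg n m) (λ S → χ m S * p S) ⟩
        c m * deg n m
          ≡⟨ cong (_* deg n m) (sum-½^tri n m) ⟩
        vol n m * deg n m ∎) ⟩
    vol n (suc m) ∎
    where
    open ≡-Reasoning
    Ss = subsets n
    p : Subset n → ℚ
    p S = ½ ^ tri ∣ S ∣
    c = λ m → sum Ss λ S → χ m S * p S
    lemma₁ : ∀ x p m → x * p * m ≡ x * (m * p)
    lemma₁ = solve 3 (λ x p m → x ⊗ p ⊗ m ⊜ x ⊗ (m ⊗ p)) refl
    lemma₂ : ∀ l h p → l * (h * p) ≡ p * (l * h)
    lemma₂ = solve 3 (λ l h p → l ⊗ (h ⊗ p) ⊜ p ⊗ (l ⊗ h)) refl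

  module _ {n : ℕ} (G : Graph n) where

    private Ss = subsets n

    -- Normalized by the expected, not the actual, number of independent sets of size m.
    mean : ℕ → (Subset n → ℚ) → ℚ
    mean m φ = wt n m * sum Ss λ S → χ m S * (ind G S * φ S)

    mean-mono : ∀ m {φ ψ} → (∀ S → ∣ S ∣ ≡ m → φ S ≤ ψ S) → mean m φ ≤ mean m ψ
    mean-mono m h = *-monoˡ (wt n m) (0≤wt n m) (sum-mono Ss λ S →
      𝟙-mono (∣ S ∣ ℕ.≟ m) λ e → *-monoˡ (ind G S) (0≤ind G S) (h S e))

    mean-cong : ∀ m {φ ψ} → (∀ S → ∣ S ∣ ≡ m → φ S ≡ ψ S) → mean m φ ≡ mean m ψ
    mean-cong m h = cong (wt n m *_) (sum-cong Ss λ S →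
      𝟙-cong (∣ S ∣ ℕ.≟ m) λ e → cong (ind G S *_) (h S e))

    mean-+ : ∀ m φ ψ → mean m (λ S → φ S + ψ S) ≡ mean m φ + mean m ψ
    mean-+ m φ ψ = trans (cong (wt n m *_) (trans
        (sum-cong Ss λ S → lemma (χ m S) (ind G S) (φ S) (ψ S))
        (sum-+ Ss (λ S → χ m S * (ind G S * φ S)) (λ S → χ m S * (ind G S * ψ S)))))
      (ℚ.*-distribˡ-+ (wt n m) _ _)
      where
      lemma : ∀ x i a b → x * (i * (a + b)) ≡ x * (i * a) + x * (i * b)
      lemma = solve 4 (λ x i a b → x ⊗ (i ⊗ (a ⊕ b)) ⊜ x ⊗ (i ⊗ a) ⊕ x ⊗ (i ⊗ b)) refl

    mean-*ˡ : ∀ m c φ → mean m (λ S → c * φ S) ≡ c * mean m φ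
    mean-*ˡ m c φ = trans (cong (wt n m *_) (trans
        (sum-cong Ss λ S → lemma₁ (χ m S) (ind G S) c (φ S))
        (sum-*ˡ Ss c (λ S → χ m S * (ind G S * φ S)))))
      (lemma₂ (wt n m) c _)
      where
      lemma₁ : ∀ x i c a → x * (i * (c * a)) ≡ c * (x * (i * a))
      lemma₁ = solve 4 (λ x i c a → x ⊗ (i ⊗ (c ⊗ a)) ⊜ c ⊗ (x ⊗ (i ⊗ a))) refl
      lemma₂ : ∀ w c a → w * (c * a) ≡ c * (w * a)
      lemma₂ = solve 3 (λ w c a → w ⊗ (c ⊗ a) ⊜ c ⊗ (w ⊗ a)) refl

    0≤mean : ∀ m {φ} → (∀ S → 0ℚ ≤ φ S) → 0ℚ ≤ mean m φ
    0≤mean m h = 0≤* (0≤wt n m) (0≤sum Ss λ S → 0≤* (0≤𝟙 (∣ S ∣ ℕ.≟ m)) (0≤* (0≤ind G S) (h S)))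

    mean-sum : ∀ {A : Set} m (ys : List A) (φ : Subset n → A → ℚ) →
      mean m (λ S → sum ys (φ S)) ≡ sum ys λ y → mean m λ S → φ S y
    mean-sum m []       φ = trans (cong (wt n m *_) (trans (sum-cong Ss λ S → lemma (χ m S) (ind G S)) (sum-0 Ss))) (ℚ.*-zeroʳ (wt n m))
      where
      lemma : ∀ x i → x * (i * 0ℚ) ≡ 0ℚ
      lemma = solve 2 (λ x i → x ⊗ (i ⊗ Κ 0ℚ) ⊜ Κ 0ℚ) refl
    mean-sum m (y ∷ ys) φ = trans (mean-+ m (λ S → φ S y) (λ S → sum ys (φ S))) (cong (_+_ (mean m λ S → φ S y)) (mean-sum m ys φ))

    ratio : ℕ → Subset n → ℚ
    ratio m S = free G S * deg n m ⁻¹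

    dev : ℕ → Subset n → ℚ
    dev m S = ℚ.∣ ratio m S - 1ℚ ∣

    -- The mean of `φ` after the removal of a uniformly random vertex, for sets of size `suc m`.
    avg : ℕ → (Subset n → ℚ) → Subset n → ℚ
    avg m φ S = nat (suc m) ⁻¹ * sum (downs S) φ

    -- An exact change of measure: `S` arises by removal once for each of its `free G S` extensions,
    -- the choice of the removed vertex cancels the factor `suc m` of `wt`, and `deg n m` remains as
    -- the normalization.
    mean-avg : ∀ m φ → mean (suc m) (avg m φ) ≡ mean m (λ S → φ S * ratio m S)
    mean-avg m φ = begin
      wt n (suc m) * sum Ss (λ S → χ (suc m) S * (ind G S * (nat (suc m) ⁻¹ * sum (downs S) φ)))
        ≡⟨ cong (wt n (suc m) *_) (trans (sum-cong Ss λ S →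
             trans (lemma₁ (χ (suc m) S) (ind G S) (nat (suc m) ⁻¹) (sum (downs S) φ))
               (cong (λ x → nat (suc m) ⁻¹ * (χ (suc m) S * x)) (sym (sum-*ʳ (downs S) (ind G S) φ))))
             (sum-*ˡ Ss (nat (suc m) ⁻¹) (λ S → χ (suc m) S * sum (downs S) λ S′ → φ S′ * ind G S))) ⟩
      wt n m * nat (suc m) * deg n m ⁻¹ * (nat (suc m) ⁻¹ * sum Ss (λ S → χ (suc m) S * sum (downs S) λ S′ → φ S′ * ind G S))
        ≡⟨ cong (λ x → wt n m * nat (suc m) * deg n m ⁻¹ * (nat (suc m) ⁻¹ * x)) (levels m (λ S S′ → φ S * ind G S′)) ⟨
      wt n m * nat (suc m) * deg n m ⁻¹ * (nat (suc m) ⁻¹ * x)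
        ≡⟨ lemma₂ (wt n m) (nat (suc m)) (deg n m ⁻¹) (nat (suc m) ⁻¹) x ⟩
      wt n m * (x * deg n m ⁻¹) * (nat (suc m) * nat (suc m) ⁻¹)
        ≡⟨ trans (cong (wt n m * (x * deg n m ⁻¹) *_) (*-⁻¹ (0<nat m))) (ℚ.*-identityʳ _) ⟩
      wt n m * (x * deg n m ⁻¹)
        ≡⟨ cong (wt n m *_) (trans (sym (sum-*ʳ Ss (deg n m ⁻¹) (λ S → χ m S * sum (ups S) λ S′ → φ S * ind G S′)))
             (sum-cong Ss λ S → trans (cong (λ y → χ m S * y * deg n m ⁻¹)
                 (trans (sum-*ˡ (ups S) (φ S) (ind G)) (cong (φ S *_) (sym (ind*free G S)))))
               (lemma₃ (χ m S) (φ S) (ind G S) (free G S) (deg n m ⁻¹)))) ⟩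
      mean m (λ S → φ S * ratio m S) ∎
      where
      open ≡-Reasoning
      x = sum Ss λ S → χ m S * sum (ups S) λ S′ → φ S * ind G S′
      lemma₁ : ∀ x i m d → x * (i * (m * d)) ≡ m * (x * (d * i))
      lemma₁ = solve 4 (λ x i m d → x ⊗ (i ⊗ (m ⊗ d)) ⊜ m ⊗ (x ⊗ (d ⊗ i))) refl
      lemma₂ : ∀ w m g m′ x → w * m * g * (m′ * x) ≡ w * (x * g) * (m * m′)
      lemma₂ = solve 5 (λ w m g m′ x → w ⊗ m ⊗ g ⊗ (m′ ⊗ x) ⊜ w ⊗ (x ⊗ g) ⊗ (m ⊗ m′)) refl
      lemma₃ : ∀ x φ i f g → x * (φ * (i * f)) * g ≡ x * (i * (φ * (f * g)))
      lemma₃ = solve 5 (λ x φ i f g → x ⊗ (φ ⊗ (i ⊗ f)) ⊗ g ⊜ x ⊗ (i ⊗ (φ ⊗ (f ⊗ g)))) refl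

    -- The density `ratio m S` differs from 1 by `dev m S`, and nonnegativity of `φ` lets this
    -- pointwise bound pass to the mean.
    mean-avg-lower : ∀ m φ → (∀ S → 0ℚ ≤ φ S) →
      mean m φ ≤ mean (suc m) (avg m φ) + mean m (λ S → φ S * dev m S)
    mean-avg-lower m φ 0≤φ = subst (mean m φ ≤_)
      (trans (mean-+ m (λ S → φ S * ratio m S) (λ S → φ S * dev m S)) (cong (_+ mean m (λ S → φ S * dev m S)) (sym (mean-avg m φ))))
      (mean-mono m λ S _ → subst₂ _≤_ (ℚ.*-identityʳ (φ S)) (ℚ.*-distribˡ-+ (φ S) (ratio m S) (dev m S))
        (*-monoˡ (φ S) (0≤φ S) (dist⇒≤ {1ℚ} {ratio m S} (ℚ.≤-reflexive (∣p-q∣≡∣q-p∣ 1ℚ (ratio m S))))))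

    mean-avg-upper : ∀ m φ → (∀ S → 0ℚ ≤ φ S) →
      mean (suc m) (avg m φ) ≤ mean m φ + mean m (λ S → φ S * dev m S)
    mean-avg-upper m φ 0≤φ = subst₂ _≤_ (sym (mean-avg m φ)) (mean-+ m φ (λ S → φ S * dev m S))
      (mean-mono m λ S _ → subst (φ S * ratio m S ≤_)
        (trans (ℚ.*-distribˡ-+ (φ S) 1ℚ (dev m S)) (cong (_+ φ S * dev m S) (ℚ.*-identityʳ (φ S))))
        (*-monoˡ (φ S) (0≤φ S) (dist⇒≤ {ratio m S} {1ℚ} ℚ.≤-refl)))

    Δ : ℕ → ℚ
    Δ m = mean m (dev m)

    Δsum : ℕ → ℚ
    Δsum m = sum (downFrom m) Δ

    0≤dev : ∀ m S → 0ℚ ≤ dev m S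
    0≤dev m S = ℚ.0≤∣p∣ (ratio m S - 1ℚ)

    0≤Δ : ∀ m → 0ℚ ≤ Δ m
    0≤Δ m = 0≤mean m (0≤dev m)

    -- The actual number of independent sets of size `m` divided by the expected number.
    mass : ℕ → ℚ
    mass m = mean m λ _ → 1ℚ

    mass-suc : ∀ m → mass (suc m) ≡ mean (suc m) (avg m λ _ → 1ℚ)
    mass-suc m = mean-cong (suc m) λ S e → sym (trans
      (cong (nat (suc m) ⁻¹ *_) (trans (sum-const (downs S) 1ℚ) (trans (ℚ.*-identityʳ _) (cong nat (trans (downs-length S) e)))))
      (trans (ℚ.*-comm (nat (suc m) ⁻¹) (nat (suc m))) (*-⁻¹ (0<nat m))))

    1*dev : ∀ m → mean m (λ S → 1ℚ * dev m S) ≡ Δ m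
    1*dev m = mean-cong m λ S _ → ℚ.*-identityˡ (dev m S)

    mass-zero : mass 0 ≡ 1ℚ
    mass-zero = trans (ℚ.*-identityˡ _) (trans (sum-χ₀ (λ S → ind G S * 1ℚ)) (trans (ℚ.*-identityʳ _) (ind-⊥ G)))

    -- The empty set gives `mass 0 = 1`, and passing from one size to the next changes the mass by
    -- at most `Δ`. Together with the upper bound this is the concentration of the number of
    -- independent sets.
    mass-lower : ∀ m → 1ℚ ≤ mass m + Δsum m
    mass-lower zero    = ℚ.≤-reflexive (sym (trans (ℚ.+-identityʳ (mass 0)) mass-zero))
    mass-lower (suc m) = begin
      1ℚ                             ≤⟨ mass-lower m ⟩
      mass m + Δsum m                ≤⟨ ℚ.+-monoˡ-≤ (Δsum m) (mean-avg-lower m (λ _ → 1ℚ) (λ _ → 0≤1)) ⟩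
      mean (suc m) (avg m λ _ → 1ℚ) + mean m (λ S → 1ℚ * dev m S) + Δsum m
                                     ≡⟨ cong₂ (λ x y → x + y + Δsum m) (sym (mass-suc m)) (1*dev m) ⟩
      mass (suc m) + Δ m + Δsum m    ≡⟨ ℚ.+-assoc (mass (suc m)) (Δ m) (Δsum m) ⟩
      mass (suc m) + Δsum (suc m)    ∎
      where open ℚ.≤-Reasoning

    mass-upper : ∀ m → mass m ≤ 1ℚ + Δsum m
    mass-upper zero    = ℚ.≤-reflexive (trans mass-zero (sym (ℚ.+-identityʳ 1ℚ)))
    mass-upper (suc m) = begin
      mass (suc m)                   ≡⟨ mass-suc m ⟩
      mean (suc m) (avg m λ _ → 1ℚ)  ≤⟨ mean-avg-upper m (λ _ → 1ℚ) (λ _ → 0≤1) ⟩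
      mass m + mean m (λ S → 1ℚ * dev m S) ≡⟨ cong (_+_ (mass m)) (1*dev m) ⟩
      mass m + Δ m                   ≤⟨ ℚ.+-monoˡ-≤ (Δ m) (mass-upper m) ⟩
      1ℚ + Δsum m + Δ m              ≡⟨ lemma (Δsum m) (Δ m) ⟩
      1ℚ + Δsum (suc m)              ∎
      where
      open ℚ.≤-Reasoning
      lemma : ∀ x y → 1ℚ + x + y ≡ 1ℚ + (y + x)
      lemma = solve 2 (λ x y → Κ 1ℚ ⊕ x ⊕ y ⊜ Κ 1ℚ ⊕ (y ⊕ x)) refl

  -- Expansion of `(∣ x ∣ - t)² ≥ 0`. It turns a variance into a bound for the mean deviation
  -- without a square root; the best `t` is the standard deviation, but any rational of about that
  -- size will do.
  AM-GM : ∀ x {t} → 0ℚ < t → ℚ.∣ x ∣ ≤ ½ * (t + t ⁻¹ * (x * x))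
  AM-GM x {t} 0<t = 0≤-⇒≤ (subst (0ℚ ≤_) eq
    (0≤* (0≤* 0≤½ (0≤⁻¹ t)) (0≤² (ℚ.∣ x ∣ - t))))
    where
    open ≡-Reasoning
    lemma₁ : ∀ a t s → ½ * s * ((a - t) * (a - t)) ≡ ½ * (t * (t * s) + s * (a * a)) - (t * s) * a
    lemma₁ = solve 3 (λ a t s →
      Κ ½ ⊗ s ⊗ ((a ⊖ t) ⊗ (a ⊖ t)) ⊜
      Κ ½ ⊗ (t ⊗ (t ⊗ s) ⊕ s ⊗ (a ⊗ a)) ⊖ (t ⊗ s) ⊗ a) refl
    lemma₂ : ∀ a t s b → ½ * (t * 1ℚ + s * b) - 1ℚ * a ≡ ½ * (t + s * b) - a
    lemma₂ = solve 4 (λ a t s b → Κ ½ ⊗ (t ⊗ Κ 1ℚ ⊕ s ⊗ b) ⊖ Κ 1ℚ ⊗ a ⊜ Κ ½ ⊗ (t ⊕ s ⊗ b) ⊖ a) refl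
    eq : ½ * t ⁻¹ * ((ℚ.∣ x ∣ - t) * (ℚ.∣ x ∣ - t)) ≡ ½ * (t + t ⁻¹ * (x * x)) - ℚ.∣ x ∣
    eq = begin
      ½ * t ⁻¹ * ((ℚ.∣ x ∣ - t) * (ℚ.∣ x ∣ - t))
        ≡⟨ lemma₁ ℚ.∣ x ∣ t (t ⁻¹) ⟩
      ½ * (t * (t * t ⁻¹) + t ⁻¹ * (ℚ.∣ x ∣ * ℚ.∣ x ∣)) - (t * t ⁻¹) * ℚ.∣ x ∣
        ≡⟨ cong₂ (λ u v → ½ * (t * u + t ⁻¹ * v) - u * ℚ.∣ x ∣) (*-⁻¹ 0<t) (∣∣²≡ x) ⟩
      ½ * (t * 1ℚ + t ⁻¹ * (x * x)) - 1ℚ * ℚ.∣ x ∣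
        ≡⟨ lemma₂ ℚ.∣ x ∣ t (t ⁻¹) (x * x) ⟩
      ½ * (t + t ⁻¹ * (x * x)) - ℚ.∣ x ∣ ∎

  -- After AM-GM the variance bound is the same for all sets of size `m`, relative to the
  -- probability `½ ^ tri m` of their independence. These probabilities add up to `vol n m`, which
  -- `wt n m` cancels.
  𝔼-Δ : ∀ {n m} {t} → m ℕ.< n → 0ℚ < t →
    𝔼 G[ n ,½] (λ G → Δ G m) ≤ ½ * (t + t ⁻¹ * deg n m ⁻¹)
  𝔼-Δ {n} {m} {t} m<n 0<t = begin
    𝔼 Γ (λ G → Δ G m)
      ≡⟨ trans (𝔼-*ˡ Γ (wt n m) (λ G → sum Ss λ S → χ m S * (ind G S * dev G m S)))
           (cong (wt n m *_) (trans (𝔼-sum Γ Ss (λ G S → χ m S * (ind G S * dev G m S)))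
             (sum-cong Ss λ S → 𝔼-*ˡ Γ (χ m S) (λ G → ind G S * dev G m S)))) ⟩
    wt n m * sum Ss (λ S → χ m S * 𝔼 Γ λ G → ind G S * dev G m S)
      ≤⟨ *-monoˡ (wt n m) (0≤wt n m) (sum-mono Ss λ S → 𝟙-mono (∣ S ∣ ℕ.≟ m) (single S)) ⟩
    wt n m * sum Ss (λ S → χ m S * (½ ^ tri ∣ S ∣ * b))
      ≡⟨ cong (wt n m *_) (trans (sum-cong Ss λ S → sym (ℚ.*-assoc (χ m S) (½ ^ tri ∣ S ∣) b))
           (trans (sum-*ʳ Ss b (λ S → χ m S * ½ ^ tri ∣ S ∣)) (cong (_* b) (sum-½^tri n m)))) ⟩
    wt n m * (vol n m * b)
      ≡⟨ lemma₁ (wt n m) (vol n m) b ⟩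
    vol n m * wt n m * b
      ≡⟨ trans (cong (_* b) (vol*wt (ℕ.<⇒≤ m<n))) (ℚ.*-identityˡ b) ⟩
    b ∎
    where
    open ℚ.≤-Reasoning
    Γ = G[ n ,½]
    Ss = subsets n
    f = deg n m
    g = deg n m ⁻¹
    b = ½ * (t + t ⁻¹ * g)
    fg≡1 : f * g ≡ 1ℚ
    fg≡1 = *-⁻¹ (0<deg m<n)
    lemma₁ : ∀ w v b → w * (v * b) ≡ v * w * b
    lemma₁ = solve 3 (λ w v b → w ⊗ (v ⊗ b) ⊜ v ⊗ w ⊗ b) refl
    lemma₂ : ∀ i t s F f g → i * (½ * (t + s * ((F * g - f * g) * (F * g - f * g)))) ≡ ½ * t * i + ½ * s * g * g * (i * ((F - f) * (F - f)))
    lemma₂ = solve 6 (λ i t s F f g →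
      i ⊗ (Κ ½ ⊗ (t ⊕ s ⊗ ((F ⊗ g ⊖ f ⊗ g) ⊗ (F ⊗ g ⊖ f ⊗ g)))) ⊜
      Κ ½ ⊗ t ⊗ i ⊕ Κ ½ ⊗ s ⊗ g ⊗ g ⊗ (i ⊗ ((F ⊖ f) ⊗ (F ⊖ f)))) refl
    lemma₃ : ∀ t s p f g → ½ * t * p + ½ * s * g * g * (p * f) ≡ p * (½ * (t + s * ((f * g) * g)))
    lemma₃ = solve 5 (λ t s p f g →
      Κ ½ ⊗ t ⊗ p ⊕ Κ ½ ⊗ s ⊗ g ⊗ g ⊗ (p ⊗ f) ⊜
      p ⊗ (Κ ½ ⊗ (t ⊕ s ⊗ ((f ⊗ g) ⊗ g)))) refl
    single : ∀ S → ∣ S ∣ ≡ m → 𝔼 Γ (λ G → ind G S * dev G m S) ≤ ½ ^ tri ∣ S ∣ * b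
    single S refl = begin
      𝔼 Γ (λ G → ind G S * dev G m S)
        ≤⟨ 𝔼-mono (NonNeg-G n) (λ G → *-monoˡ (ind G S) (0≤ind G S) (AM-GM (ratio G m S - 1ℚ) 0<t)) ⟩
      𝔼 Γ (λ G → ind G S * (½ * (t + t ⁻¹ * ((free G S * g - 1ℚ) * (free G S * g - 1ℚ)))))
        -- Writing 1 as `f * g` exhibits the deviation as `g` times the difference of `free G S` and
        -- its conditional expectation `f`.
        ≡⟨ 𝔼-cong Γ (λ G → trans
             (cong (λ u → ind G S * (½ * (t + t ⁻¹ * ((free G S * g - u) * (free G S * g - u))))) (sym fg≡1))
             (lemma₂ (ind G S) t (t ⁻¹) (free G S) f g)) ⟩
      𝔼 Γ (λ G → ½ * t * ind G S + ½ * t ⁻¹ * g * g * (ind G S * ((free G S - f) * (free G S - f))))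
        ≡⟨ trans (𝔼-+ Γ (λ G → ½ * t * ind G S) (λ G → ½ * t ⁻¹ * g * g * (ind G S * ((free G S - f) * (free G S - f)))))
             (cong₂ _+_ (trans (𝔼-*ˡ Γ (½ * t) (λ G → ind G S)) (cong (½ * t *_) (𝔼-ind S)))
               (𝔼-*ˡ Γ (½ * t ⁻¹ * g * g) (λ G → ind G S * ((free G S - f) * (free G S - f))))) ⟩
      ½ * t * p + ½ * t ⁻¹ * g * g * 𝔼 Γ (λ G → ind G S * ((free G S - f) * (free G S - f)))
        ≤⟨ ℚ.+-monoʳ-≤ (½ * t * p) (*-monoˡ (½ * t ⁻¹ * g * g)
             (0≤* (0≤* (0≤* 0≤½ (0≤⁻¹ t)) (0≤⁻¹ f)) (0≤⁻¹ f)) (free-variance S)) ⟩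
      ½ * t * p + ½ * t ⁻¹ * g * g * (p * f)
        ≡⟨ lemma₃ t (t ⁻¹) p f g ⟩
      p * (½ * (t + t ⁻¹ * ((f * g) * g)))
        ≡⟨ cong (λ u → p * (½ * (t + t ⁻¹ * u))) (trans (cong (_* g) fg≡1) (ℚ.*-identityˡ g)) ⟩
      p * b ∎
      where p = ½ ^ tri ∣ S ∣

open Levels

-- The random subset of size `k` of a hardcore sample.

module Kernel where

  open Data.Rational.Base using (_+_; _*_; _-_; -_; _≤_; _<_)
  open Data.Fin.Subset using (∣_∣)

  module _ {n : ℕ} (k : ℕ) where

    private Ss = subsets n

    -- The law of a random subset Y of X of size k, when X has size a + k.
    kern : ℕ → Subset n → Subset n → ℚ
    kern zero    X Y = δ X Y
    kern (suc a) X Y = nat (suc (a ℕ.+ k)) ⁻¹ * sum (downs X) λ S → kern a S Y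

    0≤kern : ∀ a X Y → 0ℚ ≤ kern a X Y
    0≤kern zero    X Y = 0≤𝟙 (X ≟ₛ Y)
    0≤kern (suc a) X Y = 0≤* (0≤⁻¹ (nat (suc (a ℕ.+ k)))) (0≤sum (downs X) λ S → 0≤kern a S Y)

    kern-sum : ∀ a X → ∣ X ∣ ≡ a ℕ.+ k → sum Ss (kern a X) ≡ 1ℚ
    kern-sum zero    X e = sum-δˡ X
    kern-sum (suc a) X e = begin
      sum Ss (λ Y → c * sum (downs X) λ S → kern a S Y)
        ≡⟨ trans (sum-*ˡ Ss c (λ Y → sum (downs X) λ S → kern a S Y)) (cong (c *_) (sum-swap Ss (downs X) (λ Y S → kern a S Y))) ⟩
      c * sum (downs X) (λ S → sum Ss (kern a S))
        ≡⟨ cong (c *_) (sum-downs-cong X λ S _ e′ → kern-sum a S (ℕ.suc-injective (trans (sym e′) e))) ⟩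
      c * sum (downs X) (λ _ → 1ℚ)
        ≡⟨ cong (c *_) (trans (sum-const (downs X) 1ℚ) (trans (ℚ.*-identityʳ _) (cong nat (trans (downs-length X) e)))) ⟩
      c * nat (suc (a ℕ.+ k))
        ≡⟨ trans (ℚ.*-comm c _) (*-⁻¹ (0<nat (a ℕ.+ k))) ⟩
      1ℚ ∎
      where
      open ≡-Reasoning
      c = nat (suc (a ℕ.+ k)) ⁻¹

    -- The kernel charges only `Y ⊆ X` of size `k`. As an inequality between weighted overlaps this
    -- passes directly to sums over `X` and `Y`.
    kern-support : ∀ a X Y → ∣ X ∣ ≡ a ℕ.+ k → kern a X Y * nat k ≤ kern a X Y * nat ∣ X ∩ Y ∣
    kern-support zero X Y e = 𝟙-mono (X ≟ₛ Y) λ X≡Y →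
      ℚ.≤-reflexive (cong nat (trans (sym e) (trans (sym (∣S∩S∣ X)) (cong (λ Y → ∣ X ∩ Y ∣) X≡Y))))
    kern-support (suc a) X Y e = begin
      c * sum (downs X) (λ S → kern a S Y) * nat k
        ≡⟨ pull (nat k) ⟩
      c * sum (downs X) (λ S → kern a S Y * nat k)
        ≤⟨ *-monoˡ c (0≤⁻¹ (nat (suc (a ℕ.+ k)))) (sum-downs-mono X λ S S⊆X e′ → ℚ.≤-trans
             (kern-support a S Y (ℕ.suc-injective (trans (sym e′) e)))
             (*-monoˡ (kern a S Y) (0≤kern a S Y) (nat-mono (Subset.p⊆q⇒∣p∣≤∣q∣ λ x∈ →
               let x∈S , x∈Y = Subset.x∈p∩q⁻ S Y x∈ in Subset.x∈p∩q⁺ (S⊆X x∈S , x∈Y))))) ⟩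
      c * sum (downs X) (λ S → kern a S Y * nat ∣ X ∩ Y ∣)
        ≡⟨ pull (nat ∣ X ∩ Y ∣) ⟨
      c * sum (downs X) (λ S → kern a S Y) * nat ∣ X ∩ Y ∣ ∎
      where
      open ℚ.≤-Reasoning
      c = nat (suc (a ℕ.+ k)) ⁻¹
      pull : ∀ x → c * sum (downs X) (λ S → kern a S Y) * x ≡ c * sum (downs X) (λ S → kern a S Y * x)
      pull x = trans (ℚ.*-assoc c _ x) (cong (c *_) (sym (sum-*ʳ (downs X) x (λ S → kern a S Y))))

    -- The indicator of k ≤ ∣ X ∣ < b + k.
    band : ℕ → Subset n → ℚ
    band b X = sum (downFrom b) λ a → χ (a ℕ.+ k) X

    band+below : ∀ b X → band b X + below k X ≡ below (b ℕ.+ k) X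
    band+below zero    X = ℚ.+-identityˡ (below k X)
    band+below (suc b) X = trans (ℚ.+-assoc (χ (b ℕ.+ k) X) (band b X) (below k X))
      (trans (cong (_+_ (χ (b ℕ.+ k) X)) (band+below b X)) (sym (below-suc (b ℕ.+ k) X)))

    band≤1 : ∀ b X → band b X ≤ 1ℚ
    band≤1 b X = ℚ.≤-trans (p≤p+q (0≤𝟙 (∣ X ∣ ℕ.<? k)))
      (subst (_≤ 1ℚ) (sym (band+below b X)) (𝟙≤1 (∣ X ∣ ℕ.<? b ℕ.+ k)))

    volume : ℕ → ℚ
    volume b = sum (downFrom b) λ a → vol n (a ℕ.+ k)

    vol≤volume : ∀ b → vol n k ≤ volume (suc b)
    vol≤volume zero    = p≤p+q ℚ.≤-refl
    vol≤volume (suc b) = ℚ.≤-trans (vol≤volume b)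
      (subst (volume (suc b) ≤_) (ℚ.+-comm (volume (suc b)) (vol n (suc b ℕ.+ k))) (p≤p+q (0≤vol n (suc b ℕ.+ k))))

    0<volume : ∀ {b} → k ℕ.≤ n → 0 ℕ.< b → 0ℚ < volume b
    0<volume {suc b} k≤n _ = ℚ.<-≤-trans (0<vol k≤n) (vol≤volume b)

    module _ (G : Graph n) where

      sum-level : ∀ {m} → m ℕ.≤ n → ∀ φ → sum Ss (λ S → χ m S * (ind G S * φ S)) ≡ vol n m * mean G m φ
      sum-level {m} m≤n φ = begin
        x                          ≡⟨ ℚ.*-identityˡ x ⟨
        1ℚ * x                     ≡⟨ cong (_* x) (vol*wt m≤n) ⟨
        vol n m * wt n m * x       ≡⟨ ℚ.*-assoc (vol n m) (wt n m) x ⟩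
        vol n m * mean G m φ       ∎
        where
        open ≡-Reasoning
        x = sum Ss λ S → χ m S * (ind G S * φ S)

      -- The uniform law on independent sets of size `k`, normalized by their expected number; its
      -- total mass is therefore `mass G k` and not exactly 1.
      target : Subset n → ℚ
      target Y = wt n k * (χ k Y * ind G Y)

      0≤target : ∀ Y → 0ℚ ≤ target Y
      0≤target Y = 0≤* (0≤wt n k) (0≤* (0≤𝟙 (∣ Y ∣ ℕ.≟ k)) (0≤ind G Y))

      target≡mean : ∀ Y → target Y ≡ mean G k λ X → kern 0 X Y
      target≡mean Y = cong (wt n k *_) (sym (trans
        (sum-cong Ss λ X → lemma (χ k X) (ind G X) (δ X Y)) (sum-δʳ Y (λ X → χ k X * ind G X))))
        where
        lemma : ∀ x i d → x * (i * d) ≡ d * (x * i)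
        lemma = solve 3 (λ x i d → x ⊗ (i ⊗ d) ⊜ d ⊗ (x ⊗ i)) refl

      sum-target : sum Ss target ≡ mass G k
      sum-target = trans (sum-*ˡ Ss (wt n k) (λ Y → χ k Y * ind G Y))
        (cong (wt n k *_) (sum-cong Ss λ Y → cong (χ k Y *_) (sym (ℚ.*-identityʳ (ind G Y)))))

      -- The errors made in descending from size `a + k` to `k`, kept as a function of `Y` because
      -- the coupling needs a lower bound at each single `Y`.
      loss : ℕ → Subset n → ℚ
      loss zero    Y = 0ℚ
      loss (suc a) Y = loss a Y + mean G (a ℕ.+ k) λ X → kern a X Y * dev G (a ℕ.+ k) X

      loss-step : ∀ a Y → loss a Y ≤ loss (suc a) Y
      loss-step a Y = p≤p+q (0≤mean G (a ℕ.+ k) λ X → 0≤* (0≤kern a X Y) (0≤dev G (a ℕ.+ k) X))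

      loss-mono : ∀ {a b} → a ℕ.≤′ b → ∀ Y → loss a Y ≤ loss b Y
      loss-mono (ℕ.≤′-reflexive refl) Y = ℚ.≤-refl
      loss-mono (ℕ.≤′-step {b} le)    Y = ℚ.≤-trans (loss-mono le Y) (loss-step b Y)

      0≤loss : ∀ a Y → 0ℚ ≤ loss a Y
      0≤loss a Y = loss-mono {0} {a} (ℕ.≤⇒≤′ z≤n) Y

      -- Averaging `kern a` over the removal of one vertex is by definition `kern (suc a)`, so each
      -- level is one application of `mean-avg-lower`.
      target-lower : ∀ a Y → target Y ≤ mean G (a ℕ.+ k) (λ X → kern a X Y) + loss a Y
      target-lower zero    Y = ℚ.≤-reflexive (trans (target≡mean Y) (sym (ℚ.+-identityʳ _)))
      target-lower (suc a) Y = begin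
        target Y
          ≤⟨ target-lower a Y ⟩
        mean G (a ℕ.+ k) (λ X → kern a X Y) + loss a Y
          ≤⟨ ℚ.+-monoˡ-≤ (loss a Y) (mean-avg-lower G (a ℕ.+ k) (λ X → kern a X Y) (λ X → 0≤kern a X Y)) ⟩
        x + y + loss a Y
          ≡⟨ lemma x y (loss a Y) ⟩
        x + (loss a Y + y) ∎
        where
        open ℚ.≤-Reasoning
        x = mean G (suc a ℕ.+ k) λ X → kern (suc a) X Y
        y = mean G (a ℕ.+ k) λ X → kern a X Y * dev G (a ℕ.+ k) X
        lemma : ∀ x y z → x + y + z ≡ x + (z + y)
        lemma = solve 3 (λ x y z → x ⊕ y ⊕ z ⊜ x ⊕ (z ⊕ y)) refl

      -- Summed over `Y` the kernel has mass 1, so each level contributes just its `Δ`.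
      sum-loss : ∀ a → sum Ss (loss a) ≤ Δsum G (a ℕ.+ k)
      sum-loss zero    = subst (_≤ Δsum G k) (sym (sum-0 Ss)) (0≤sum (downFrom k) (0≤Δ G))
      sum-loss (suc a) = begin
        sum Ss (loss (suc a))
          ≡⟨ trans (sum-+ Ss (loss a) (λ Y → mean G m λ X → kern a X Y * dev G m X)) (cong (_+_ (sum Ss (loss a))) (begin-equality
               sum Ss (λ Y → mean G m λ X → kern a X Y * dev G m X)
                 ≡⟨ mean-sum G m Ss (λ X Y → kern a X Y * dev G m X) ⟨
               mean G m (λ X → sum Ss λ Y → kern a X Y * dev G m X)
                 ≡⟨ mean-cong G m (λ X e → trans (sum-*ʳ Ss (dev G m X) (kern a X))
                      (trans (cong (_* dev G m X) (kern-sum a X e)) (ℚ.*-identityˡ (dev G m X)))) ⟩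
               Δ G m ∎)) ⟩
        sum Ss (loss a) + Δ G m  ≤⟨ ℚ.+-monoˡ-≤ (Δ G m) (sum-loss a) ⟩
        Δsum G m + Δ G m         ≡⟨ ℚ.+-comm (Δsum G m) (Δ G m) ⟩
        Δ G m + Δsum G m         ∎
        where
        open ℚ.≤-Reasoning
        m = a ℕ.+ k

      -- z is the probability of each independent set under the hardcore law.
      module _ (z : ℚ) (0≤z : 0ℚ ≤ z) (b : ℕ) where

        -- A subcoupling: draw `X` from the hardcore law, discard it if its size lies outside the
        -- band, and otherwise let `Y` be a random subset of size `k`.
        plan : Subset n → Subset n → ℚ
        plan X Y = z * (ind G X * sum (downFrom b) λ a → χ (a ℕ.+ k) X * kern a X Y)

        0≤plan : ∀ X Y → 0ℚ ≤ plan X Y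
        0≤plan X Y = 0≤* 0≤z (0≤* (0≤ind G X) (0≤sum (downFrom b) λ a → 0≤* (0≤𝟙 (∣ X ∣ ℕ.≟ a ℕ.+ k)) (0≤kern a X Y)))

        plan-row : ∀ X → sum Ss (plan X) ≤ z * ind G X
        plan-row X = begin
          sum Ss (plan X)
            ≡⟨ trans (sum-*ˡ Ss z (λ Y → ind G X * sum (downFrom b) λ a → χ (a ℕ.+ k) X * kern a X Y))
                 (cong (z *_) (trans (sum-*ˡ Ss (ind G X) (λ Y → sum (downFrom b) λ a → χ (a ℕ.+ k) X * kern a X Y))
                   (cong (ind G X *_) (sum-swap Ss (downFrom b) (λ Y a → χ (a ℕ.+ k) X * kern a X Y))))) ⟩
          z * (ind G X * sum (downFrom b) λ a → sum Ss λ Y → χ (a ℕ.+ k) X * kern a X Y)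
            ≡⟨ cong (λ u → z * (ind G X * u)) (sum-cong (downFrom b) λ a → trans
                 (sum-*ˡ Ss (χ (a ℕ.+ k) X) (kern a X))
                 (trans (𝟙-cong (∣ X ∣ ℕ.≟ a ℕ.+ k) (kern-sum a X)) (ℚ.*-identityʳ _))) ⟩
          z * (ind G X * band b X)
            ≤⟨ *-monoˡ z 0≤z (*-monoˡ (ind G X) (0≤ind G X) (band≤1 b X)) ⟩
          z * (ind G X * 1ℚ)
            ≡⟨ cong (z *_) (ℚ.*-identityʳ (ind G X)) ⟩
          z * ind G X ∎
          where open ℚ.≤-Reasoning

        plan-support : ∀ X Y → plan X Y * nat k ≤ plan X Y * nat ∣ X ∩ Y ∣
        plan-support X Y = subst₂ _≤_ (pull (nat k)) (pull (nat ∣ X ∩ Y ∣))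
          (*-monoˡ z 0≤z (*-monoˡ (ind G X) (0≤ind G X) (sum-mono (downFrom b) λ a →
            𝟙-mono (∣ X ∣ ℕ.≟ a ℕ.+ k) (kern-support a X Y))))
          where
          lemma : ∀ z i s x → z * (i * (s * x)) ≡ z * (i * s) * x
          lemma = solve 4 (λ z i s x → z ⊗ (i ⊗ (s ⊗ x)) ⊜ z ⊗ (i ⊗ s) ⊗ x) refl
          pull : ∀ x → z * (ind G X * sum (downFrom b) λ a → χ (a ℕ.+ k) X * (kern a X Y * x)) ≡ plan X Y * x
          pull x = trans (cong (λ u → z * (ind G X * u)) (trans
              (sum-cong (downFrom b) λ a → sym (ℚ.*-assoc (χ (a ℕ.+ k) X) (kern a X Y) x))
              (sum-*ʳ (downFrom b) x (λ a → χ (a ℕ.+ k) X * kern a X Y))))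
            (lemma z (ind G X) _ x)

        -- Each size in the band contributes its volume times a mean that is at least `target Y`
        -- minus a loss. Since losses increase with the size, `loss b` serves for all of them.
        plan-column : b ℕ.+ k ℕ.≤ suc n → ∀ Y →
          z * volume b * (target Y - loss b Y) ≤ sum Ss (λ X → plan X Y)
        plan-column b+k≤ Y = begin
          z * volume b * (target Y - loss b Y)
            ≡⟨ trans (ℚ.*-assoc z (volume b) _) (cong (z *_) (sym (sum-*ʳ (downFrom b) (target Y - loss b Y) (λ a → vol n (a ℕ.+ k))))) ⟩
          z * sum (downFrom b) (λ a → vol n (a ℕ.+ k) * (target Y - loss b Y))
            ≤⟨ *-monoˡ z 0≤z (sum-monoᴬ (All.map step (downFrom-< b))) ⟩
          z * sum (downFrom b) (λ a → sum Ss λ X → χ (a ℕ.+ k) X * (ind G X * kern a X Y))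
            ≡⟨ cong (z *_) (trans (sum-swap (downFrom b) Ss (λ a X → χ (a ℕ.+ k) X * (ind G X * kern a X Y)))
                 (sum-cong Ss λ X → trans (sum-cong (downFrom b) λ a → lemma (χ (a ℕ.+ k) X) (ind G X) (kern a X Y))
                   (sum-*ˡ (downFrom b) (ind G X) (λ a → χ (a ℕ.+ k) X * kern a X Y)))) ⟩
          z * sum Ss (λ X → ind G X * sum (downFrom b) λ a → χ (a ℕ.+ k) X * kern a X Y)
            ≡⟨ sum-*ˡ Ss z (λ X → ind G X * sum (downFrom b) λ a → χ (a ℕ.+ k) X * kern a X Y) ⟨
          sum Ss (λ X → plan X Y) ∎
          where
          open ℚ.≤-Reasoning
          lemma : ∀ x i d → x * (i * d) ≡ i * (x * d)
          lemma = solve 3 (λ x i d → x ⊗ (i ⊗ d) ⊜ i ⊗ (x ⊗ d)) refl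
          lemma₂ : ∀ x y → x + y - y ≡ x
          lemma₂ = solve 2 (λ x y → x ⊕ y ⊖ y ⊜ x) refl
          step : ∀ {a} → a ℕ.< b →
            vol n (a ℕ.+ k) * (target Y - loss b Y) ≤ sum Ss (λ X → χ (a ℕ.+ k) X * (ind G X * kern a X Y))
          step {a} a<b = begin
            vol n (a ℕ.+ k) * (target Y - loss b Y)
              ≤⟨ *-monoˡ (vol n (a ℕ.+ k)) (0≤vol n (a ℕ.+ k)) (ℚ.≤-trans
                   (neg-mono (target Y) (loss-mono (ℕ.≤⇒≤′ (ℕ.<⇒≤ a<b)) Y))
                   (subst (target Y - loss a Y ≤_) (lemma₂ _ (loss a Y)) (ℚ.+-monoˡ-≤ (- loss a Y) (target-lower a Y)))) ⟩
            vol n (a ℕ.+ k) * mean G (a ℕ.+ k) (λ X → kern a X Y)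
              ≡⟨ sum-level (ℕ.≤-pred (ℕ.≤-trans (ℕ.+-monoˡ-≤ k a<b) b+k≤)) (λ X → kern a X Y) ⟨
            sum Ss (λ X → χ (a ℕ.+ k) X * (ind G X * kern a X Y)) ∎

open Kernel

-- Completing a subcoupling to a coupling.

module Thinning where

  open Data.Rational.Base using (_+_; _*_; _-_; -_; _≤_; _<_)

  module _ {n : ℕ} (μ ν : Subset n → ℚ) where

    private Ss = subsets n

    record RationalCoupling : Set where
      field
        joint     : Subset n → Subset n → ℚ
        nonneg    : ∀ X Y → 0ℚ ≤ joint X Y
        marginalˡ : ∀ X → sum Ss (joint X) ≡ μ X
        marginalʳ : ∀ Y → sum Ss (λ X → joint X Y) ≡ ν Y

    -- The subcoupling κ is thinned so that its second marginal is at most ν, and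
    -- the residual masses are coupled independently.
    module _ (0≤ν : ∀ Y → 0ℚ ≤ ν Y) (∑μ≡1 : sum Ss μ ≡ 1ℚ) (∑ν≡1 : sum Ss ν ≡ 1ℚ)
      (κ : Subset n → Subset n → ℚ) (0≤κ : ∀ X Y → 0ℚ ≤ κ X Y) (row : ∀ X → sum Ss (κ X) ≤ μ X)
      (b : Subset n → ℚ) (b≤κ : ∀ Y → b Y ≤ sum Ss λ X → κ X Y) (b≤ν : ∀ Y → b Y ≤ ν Y)
      where

      private
        τ s a a′ : Subset n → ℚ
        τ Y = sum Ss λ X → κ X Y
        -- The fraction of the column at `Y` that fits under `ν Y`; for an empty column the
        -- convention for `_⁻¹` makes it 0.
        s Y = (τ Y ℚ.⊓ ν Y) * τ Y ⁻¹

        0≤τ : ∀ Y → 0ℚ ≤ τ Y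
        0≤τ Y = 0≤sum Ss λ X → 0≤κ X Y

        0≤s : ∀ Y → 0ℚ ≤ s Y
        0≤s Y = 0≤* (ℚ.⊓-glb (0≤τ Y) (0≤ν Y)) (0≤⁻¹ (τ Y))

        zero-or-pos : ∀ {q} → 0ℚ ≤ q → q ≡ 0ℚ ⊎ 0ℚ < q
        zero-or-pos {q} 0≤q with 0ℚ ℚ.<? q
        ... | yes 0<q = inj₂ 0<q
        ... | no  0≮q = inj₁ (ℚ.≤-antisym (ℚ.≮⇒≥ 0≮q) 0≤q)

        s*τ : ∀ Y → s Y * τ Y ≡ τ Y ℚ.⊓ ν Y
        s*τ Y with zero-or-pos (0≤τ Y)
        ... | inj₁ τ≡0 = trans (cong (s Y *_) τ≡0) (trans (ℚ.*-zeroʳ (s Y))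
                (sym (trans (ℚ.p≤q⇒p⊓q≡p (ℚ.≤-trans (ℚ.≤-reflexive τ≡0) (0≤ν Y))) τ≡0)))
        ... | inj₂ 0<τ = trans (lemma (τ Y ℚ.⊓ ν Y) (τ Y ⁻¹) (τ Y)) (*⁻¹-cancel _ 0<τ)
          where
          lemma : ∀ m i t → m * i * t ≡ m * t * i
          lemma = solve 3 (λ m i t → m ⊗ i ⊗ t ⊜ m ⊗ t ⊗ i) refl

        s≤1 : ∀ Y → s Y ≤ 1ℚ
        s≤1 Y with zero-or-pos (0≤τ Y)
        ... | inj₁ τ≡0 = ℚ.≤-trans (ℚ.≤-trans (*-monoʳ (0≤⁻¹ (τ Y)) (ℚ.≤-trans (ℚ.p⊓q≤p (τ Y) (ν Y)) (ℚ.≤-reflexive τ≡0)))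
                           (ℚ.≤-reflexive (ℚ.*-zeroˡ (τ Y ⁻¹)))) 0≤1
        ... | inj₂ 0<τ = ≤⇒*⁻¹≤ 0<τ (ℚ.≤-trans (ℚ.p⊓q≤p (τ Y) (ν Y)) (ℚ.≤-reflexive (sym (ℚ.*-identityˡ (τ Y)))))

        thin : Subset n → Subset n → ℚ
        thin X Y = s Y * κ X Y

        thin-column : ∀ Y → sum Ss (λ X → thin X Y) ≡ τ Y ℚ.⊓ ν Y
        thin-column Y = trans (sum-*ˡ Ss (s Y) (λ X → κ X Y)) (s*τ Y)

        0≤thin : ∀ X Y → 0ℚ ≤ thin X Y
        0≤thin X Y = 0≤* (0≤s Y) (0≤κ X Y)

        thin-row : ∀ X → sum Ss (thin X) ≤ μ X
        thin-row X = ℚ.≤-trans (sum-mono Ss λ Y → ℚ.≤-trans (*-monoʳ (0≤κ X Y) (s≤1 Y)) (ℚ.≤-reflexive (ℚ.*-identityˡ (κ X Y)))) (row X)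

        a X = μ X - sum Ss (thin X)
        a′ Y = ν Y - sum Ss λ X → thin X Y

        0≤a : ∀ X → 0ℚ ≤ a X
        0≤a X = ≤⇒0≤- (thin-row X)

        0≤a′ : ∀ Y → 0ℚ ≤ a′ Y
        0≤a′ Y = ≤⇒0≤- (ℚ.≤-trans (ℚ.≤-reflexive (thin-column Y)) (ℚ.p⊓q≤q (τ Y) (ν Y)))

        η : ℚ
        η = sum Ss a

        -- Both laws have mass 1 and the thinned plan takes the same mass from either of them.
        η≡ : sum Ss a′ ≡ η
        η≡ = trans (sum-- Ss ν (λ Y → sum Ss λ X → thin X Y)) (trans
          (cong₂ _-_ (trans ∑ν≡1 (sym ∑μ≡1)) (sum-swap Ss Ss (λ Y X → thin X Y))) (sym (sum-- Ss μ (λ X → sum Ss (thin X)))))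

        0≤η : 0ℚ ≤ η
        0≤η = 0≤sum Ss 0≤a

        -- If no mass is left over, `η ⁻¹` is 0, but then the nonnegative residuals vanish
        -- pointwise; so the product coupling is correct in this case too.
        rescale : ∀ {f : Subset n → ℚ} → (∀ X → 0ℚ ≤ f X) → sum Ss f ≡ η → ∀ X → f X * η * η ⁻¹ ≡ f X
        rescale {f} 0≤f ∑f X with zero-or-pos 0≤η
        ... | inj₂ 0<η = *⁻¹-cancel (f X) 0<η
        ... | inj₁ η≡0 = trans (cong (λ u → u * η * η ⁻¹) f≡0) (trans (lemma η (η ⁻¹)) (sym f≡0))
          where
          f≡0 : f X ≡ 0ℚ
          f≡0 = ℚ.≤-antisym (ℚ.≤-trans (all-subsets X (≤sum 0≤f)) (ℚ.≤-reflexive (trans ∑f η≡0))) (0≤f X)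
          lemma : ∀ a b → 0ℚ * a * b ≡ 0ℚ
          lemma = solve 2 (λ a b → Κ 0ℚ ⊗ a ⊗ b ⊜ Κ 0ℚ) refl

        cancel : ∀ x y → y + (x - y) ≡ x
        cancel = solve 2 (λ x y → y ⊕ (x ⊖ y) ⊜ x) refl

      coupling : RationalCoupling
      coupling = record
        { joint     = λ X Y → thin X Y + a X * a′ Y * η ⁻¹
        ; nonneg    = λ X Y → 0≤+ (0≤thin X Y) (0≤* (0≤* (0≤a X) (0≤a′ Y)) (0≤⁻¹ η))
        ; marginalˡ = λ X → trans (sum-+ Ss (thin X) (λ Y → a X * a′ Y * η ⁻¹)) (trans
            (cong (_+_ (sum Ss (thin X))) (trans (sum-*ʳ Ss (η ⁻¹) (λ Y → a X * a′ Y)) (trans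
              (cong (_* η ⁻¹) (trans (sum-*ˡ Ss (a X) a′) (cong (a X *_) η≡)))
              (rescale 0≤a refl X))))
            (cancel (μ X) (sum Ss (thin X))))
        ; marginalʳ = λ Y → trans (sum-+ Ss (λ X → thin X Y) (λ X → a X * a′ Y * η ⁻¹)) (trans
            (cong (_+_ (sum Ss λ X → thin X Y)) (trans (sum-*ʳ Ss (η ⁻¹) (λ X → a X * a′ Y)) (trans
              (cong (_* η ⁻¹) (trans (sum-*ʳ Ss (a′ Y) a) (ℚ.*-comm η (a′ Y))))
              (rescale 0≤a′ η≡ Y))))
            (cancel (ν Y) (sum Ss λ X → thin X Y)))
        }

      -- The thinned part alone carries mass at least `sum Ss b`, and `φ` is at least `c` on its
      -- support; the independent part only adds a nonnegative amount.
      coupling-≥ : ∀ c (φ : Subset n → Subset n → ℚ) → 0ℚ ≤ c → (∀ X Y → 0ℚ ≤ φ X Y) →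
        (∀ X Y → κ X Y * c ≤ κ X Y * φ X Y) →
        sum Ss b * c ≤ sum Ss λ X → sum Ss λ Y → RationalCoupling.joint coupling X Y * φ X Y
      coupling-≥ c φ 0≤c 0≤φ h = begin
        sum Ss b * c
          ≤⟨ *-monoʳ 0≤c (sum-mono Ss λ Y → subst (b Y ≤_) (sym (thin-column Y)) (ℚ.⊓-glb (b≤κ Y) (b≤ν Y))) ⟩
        sum Ss (λ Y → sum Ss λ X → thin X Y) * c
          ≡⟨ trans (cong (_* c) (sum-swap Ss Ss (λ Y X → thin X Y))) (trans (sym (sum-*ʳ Ss c (λ X → sum Ss (thin X))))
               (sum-cong Ss λ X → sym (sum-*ʳ Ss c (thin X)))) ⟩
        sum Ss (λ X → sum Ss λ Y → thin X Y * c)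
          ≤⟨ sum-mono Ss (λ X → sum-mono Ss λ Y → begin
               thin X Y * c             ≡⟨ ℚ.*-assoc (s Y) (κ X Y) c ⟩
               s Y * (κ X Y * c)     ≤⟨ *-monoˡ (s Y) (0≤s Y) (h X Y) ⟩
               s Y * (κ X Y * φ X Y) ≡⟨ ℚ.*-assoc (s Y) (κ X Y) (φ X Y) ⟨
               thin X Y * φ X Y         ≤⟨ *-monoʳ (0≤φ X Y) (p≤p+q {thin X Y} (0≤* (0≤* (0≤a X) (0≤a′ Y)) (0≤⁻¹ η))) ⟩
               (thin X Y + a X * a′ Y * η ⁻¹) * φ X Y ∎) ⟩
        sum Ss (λ X → sum Ss λ Y → (thin X Y + a X * a′ Y * η ⁻¹) * φ X Y) ∎
        where open ℚ.≤-Reasoning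

open Thinning

-- The hardcore law, its partition function and its mean size.

module Hardcore where

  open Data.Rational.Base using (_+_; _*_; _-_; -_; _≤_; _<_)
  open Data.Fin.Subset using (∣_∣)

  nat*frac : ∀ j l → nat j * frac 1 l ≡ frac j l
  nat*frac zero    l = trans (ℚ.*-zeroˡ (frac 1 l)) (ℚ.≤-antisym (0≤frac 0 l) (frac-mono {0} {l} {0} {0} z≤n))
  nat*frac (suc j) l = trans (lemma (nat j) (frac 1 l)) (trans (cong (_+ frac 1 l) (nat*frac j l)) (sym (frac-suc j l)))
    where
    lemma : ∀ a b → (1ℚ + a) * b ≡ a * b + b
    lemma = solve 2 (λ a b → (Κ 1ℚ ⊕ a) ⊗ b ⊜ a ⊗ b ⊕ b) refl

  frac≡⁻¹ : ∀ l → frac 1 l ≡ nat (suc l) ⁻¹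
  frac≡⁻¹ l = ⁻¹-unique (0<nat l) (trans (nat*frac (suc l) l) (ℚ.≤-antisym
    (frac-mono {suc l} {l} {1} {0} (ℕ.≤-reflexive eq)) (frac-mono {1} {0} {suc l} {l} (ℕ.≤-reflexive (sym eq)))))
    where
    eq : suc l ℕ.* 1 ≡ 1 ℕ.* suc l
    eq = ℕ.*-comm (suc l) 1

  𝔼-uniform : ∀ {A : Set} (xs : List A) f → 𝔼 (uniform xs) f ≡ nat (length xs) ⁻¹ * sum xs f
  𝔼-uniform []          f = sym (ℚ.*-zeroʳ (0ℚ ⁻¹))
  𝔼-uniform xs@(_ ∷ ys) f = trans (sum-map (λ x → x , frac 1 (length ys)) xs (λ (a , p) → p * f a))
    (trans (sum-*ˡ xs (frac 1 (length ys)) f) (cong (_* sum xs f) (frac≡⁻¹ (length ys))))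

  sum-filter : ∀ {A : Set} {P : A → Set} (P? : ∀ x → Dec (P x)) xs (f : A → ℚ) →
    sum (filter P? xs) f ≡ sum xs λ x → 𝟙 (P? x) * f x
  sum-filter P? []       f = refl
  sum-filter P? (x ∷ xs) f with P? x
  ... | yes _ = cong₂ _+_ (sym (ℚ.*-identityˡ (f x))) (sum-filter P? xs f)
  ... | no  _ = trans (sum-filter P? xs f) (sym (trans (cong (_+ sum xs _) (ℚ.*-zeroˡ (f x))) (ℚ.+-identityˡ _)))

  module _ {n : ℕ} (G : Graph n) where

    private Ss = subsets n

    partition : ℚ
    partition = sum Ss (ind G)

    0<partition : 0ℚ < partition
    0<partition = ℚ.<-≤-trans (ℚ.positive⁻¹ 1ℚ)
      (subst (_≤ partition) (ind-⊥ G) (all-subsets Subset.⊥ (≤sum (0≤ind G))))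

    hardcore-law : ∀ S → Pr (hardcore G) (λ S′ → does (Vec.≡-dec Bool._≟_ S′ S)) ≡ partition ⁻¹ * ind G S
    hardcore-law S = begin
      Pr (uniform Is) (λ S′ → does (S′ ≟ₛ S))       ≡⟨ Pr≡𝔼 (uniform Is) (λ S′ → does (S′ ≟ₛ S)) ⟩
      𝔼 (uniform Is) (λ S′ → δ S′ S)                ≡⟨ 𝔼-uniform Is (λ S′ → δ S′ S) ⟩
      nat (length Is) ⁻¹ * sum Is (λ S′ → δ S′ S)   ≡⟨ cong₂ (λ x y → x ⁻¹ * y)
        (begin
          nat (length Is)              ≡⟨ trans (sum-const Is 1ℚ) (ℚ.*-identityʳ (nat (length Is))) ⟨
          sum Is (λ _ → 1ℚ)            ≡⟨ sum-filter (independent? G) Ss (λ _ → 1ℚ) ⟩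
          sum Ss (λ S′ → ind G S′ * 1ℚ) ≡⟨ sum-cong Ss (λ S′ → ℚ.*-identityʳ (ind G S′)) ⟩
          partition                    ∎)
        (trans (sum-filter (independent? G) Ss (λ S′ → δ S′ S))
          (trans (sum-cong Ss λ S′ → ℚ.*-comm (ind G S′) (δ S′ S)) (sum-δʳ S (ind G)))) ⟩
      partition ⁻¹ * ind G S                        ∎
      where
      open ≡-Reasoning
      Is = filter (independent? G) Ss

    Δsum-mono : ∀ {l m} → l ℕ.≤′ m → Δsum G l ≤ Δsum G m
    Δsum-mono (ℕ.≤′-reflexive refl) = ℚ.≤-refl
    Δsum-mono (ℕ.≤′-step {m} le)    = ℚ.≤-trans (Δsum-mono le)
      (ℚ.≤-trans (p≤p+q (0≤Δ G m)) (ℚ.≤-reflexive (ℚ.+-comm (Δsum G m) (Δ G m))))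

    module _ (k b : ℕ) (b+k≤ : b ℕ.+ k ℕ.≤ suc n) where

      private
        D = Δsum G (b ℕ.+ k)
        W = volume {n} k b

      -- The weight `nat k + nat ∣ X ∣` serves two estimates at once: the first summand bounds the
      -- number of independent sets outside the band, in units of `k`, and the second their
      -- contribution to the mean size.
      tail : ℚ
      tail = sum Ss λ X → ind G X * ((1ℚ - band k b X) * (nat k + nat ∣ X ∣))

      private
        ∑band : ℚ
        ∑band = sum Ss λ X → ind G X * band k b X

        ∑band≡ : ∑band ≡ sum (downFrom b) λ a → sum Ss λ X → χ (a ℕ.+ k) X * (ind G X * 1ℚ)
        ∑band≡ = trans (sum-cong Ss λ X → trans (sym (sum-*ˡ (downFrom b) (ind G X) (λ a → χ (a ℕ.+ k) X)))
            (sum-cong (downFrom b) λ a → lemma (ind G X) (χ (a ℕ.+ k) X)))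
          (sum-swap Ss (downFrom b) (λ X a → χ (a ℕ.+ k) X * (ind G X * 1ℚ)))
          where
          lemma : ∀ i x → i * x ≡ x * (i * 1ℚ)
          lemma = solve 2 (λ i x → i ⊗ x ⊜ x ⊗ (i ⊗ Κ 1ℚ)) refl

        level≤n : ∀ {a} → a ℕ.< b → a ℕ.+ k ℕ.≤ n
        level≤n a<b = ℕ.≤-pred (ℕ.≤-trans (ℕ.+-monoˡ-≤ k a<b) b+k≤)

        Δ≤D : ∀ {a} → a ℕ.< b → Δsum G (a ℕ.+ k) ≤ D
        Δ≤D a<b = Δsum-mono (ℕ.≤⇒≤′ (ℕ.+-monoˡ-≤ k (ℕ.<⇒≤ a<b)))

        ∑band-upper : ∑band ≤ W * (1ℚ + D)
        ∑band-upper = subst₂ _≤_ (sym ∑band≡) (sum-*ʳ (downFrom b) (1ℚ + D) (λ a → vol n (a ℕ.+ k)))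
          (sum-monoᴬ (All.map (λ {a} a<b → ℚ.≤-trans
            (ℚ.≤-reflexive (sum-level k G (level≤n a<b) (λ _ → 1ℚ)))
            (*-monoˡ (vol n (a ℕ.+ k)) (0≤vol n (a ℕ.+ k)) (ℚ.≤-trans (mass-upper G (a ℕ.+ k)) (ℚ.+-monoʳ-≤ 1ℚ (Δ≤D a<b)))))
            (downFrom-< b)))

        ∑band-lower : W * (1ℚ - D) ≤ ∑band
        ∑band-lower = subst₂ _≤_ (sum-*ʳ (downFrom b) (1ℚ - D) (λ a → vol n (a ℕ.+ k))) (sym ∑band≡)
          (sum-monoᴬ (All.map (λ {a} a<b → ℚ.≤-trans
            (*-monoˡ (vol n (a ℕ.+ k)) (0≤vol n (a ℕ.+ k)) (ℚ.≤-trans (neg-mono 1ℚ (Δ≤D a<b)) (≤+⇒-≤ 1ℚ (mass G (a ℕ.+ k)) (Δsum G (a ℕ.+ k)) (mass-lower G (a ℕ.+ k)))))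
            (ℚ.≤-reflexive (sym (sum-level k G (level≤n a<b) (λ _ → 1ℚ)))))
            (downFrom-< b)))

        0≤out : ∀ (X : Subset n) → 0ℚ ≤ 1ℚ - band k b X
        0≤out X = ≤⇒0≤- (band≤1 k b X)

        split : ∀ (f : Subset n → ℚ) → sum Ss (λ X → ind G X * f X)
          ≡ sum Ss (λ X → ind G X * band k b X * f X) + sum Ss (λ X → ind G X * ((1ℚ - band k b X) * f X))
        split f = trans (sum-cong Ss λ X → lemma (ind G X) (band k b X) (f X))
          (sum-+ Ss (λ X → ind G X * band k b X * f X) (λ X → ind G X * ((1ℚ - band k b X) * f X)))
          where
          lemma : ∀ i c x → i * x ≡ i * c * x + i * ((1ℚ - c) * x)
          lemma = solve 3 (λ i c x → i ⊗ x ⊜ i ⊗ c ⊗ x ⊕ i ⊗ ((Κ 1ℚ ⊖ c) ⊗ x)) refl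

        q≤p+q : ∀ p q → 0ℚ ≤ p → q ≤ p + q
        q≤p+q p q 0≤p = subst (q ≤_) (ℚ.+-comm q p) (p≤p+q 0≤p)

      partition-upper : partition * nat k ≤ W * (1ℚ + D) * nat k + tail
      partition-upper = begin
        partition * nat k                      ≡⟨ sum-*ʳ Ss (nat k) (ind G) ⟨
        sum Ss (λ X → ind G X * nat k)         ≡⟨ split (λ _ → nat k) ⟩
        sum Ss (λ X → ind G X * band k b X * nat k) + sum Ss (λ X → ind G X * ((1ℚ - band k b X) * nat k))
          ≤⟨ ℚ.+-mono-≤
               (ℚ.≤-trans (ℚ.≤-reflexive (sum-*ʳ Ss (nat k) (λ X → ind G X * band k b X))) (*-monoʳ (0≤nat k) ∑band-upper))
               (sum-mono Ss λ X → *-monoˡ (ind G X) (0≤ind G X) (*-monoˡ (1ℚ - band k b X) (0≤out X) (p≤p+q (0≤nat ∣ X ∣)))) ⟩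
        W * (1ℚ + D) * nat k + tail ∎
        where open ℚ.≤-Reasoning

      partition-lower : W * (1ℚ - D) ≤ partition
      partition-lower = ℚ.≤-trans ∑band-lower (sum-mono Ss λ X →
        subst (ind G X * band k b X ≤_) (ℚ.*-identityʳ (ind G X)) (*-monoˡ (ind G X) (0≤ind G X) (band≤1 k b X)))

      total-size : sum Ss (λ X → ind G X * nat ∣ X ∣) ≤ nat (b ℕ.+ k) * partition + tail
      total-size = begin
        sum Ss (λ X → ind G X * nat ∣ X ∣)
          ≡⟨ split (λ X → nat ∣ X ∣) ⟩
        sum Ss (λ X → ind G X * band k b X * nat ∣ X ∣) + sum Ss (λ X → ind G X * ((1ℚ - band k b X) * nat ∣ X ∣))
          ≤⟨ ℚ.+-mono-≤
               (ℚ.≤-trans (sum-mono Ss size) (ℚ.≤-reflexive (sum-*ˡ Ss (nat (b ℕ.+ k)) (ind G))))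
               (sum-mono Ss λ X → *-monoˡ (ind G X) (0≤ind G X) (*-monoˡ (1ℚ - band k b X) (0≤out X) (q≤p+q (nat k) (nat ∣ X ∣) (0≤nat k)))) ⟩
        nat (b ℕ.+ k) * partition + tail ∎
        where
        open ℚ.≤-Reasoning
        size : ∀ X → ind G X * band k b X * nat ∣ X ∣ ≤ nat (b ℕ.+ k) * ind G X
        size X = begin
          ind G X * band k b X * nat ∣ X ∣
            ≡⟨ trans (ℚ.*-assoc (ind G X) (band k b X) (nat ∣ X ∣))
                 (cong (ind G X *_) (sym (sum-*ʳ (downFrom b) (nat ∣ X ∣) (λ a → χ (a ℕ.+ k) X)))) ⟩
          ind G X * sum (downFrom b) (λ a → χ (a ℕ.+ k) X * nat ∣ X ∣)
            ≤⟨ *-monoˡ (ind G X) (0≤ind G X) (sum-monoᴬ (All.map (λ {a} a<b → 𝟙-mono (∣ X ∣ ℕ.≟ a ℕ.+ k) λ e →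
                 nat-mono (subst (ℕ._≤ b ℕ.+ k) (sym e) (ℕ.+-monoˡ-≤ k (ℕ.<⇒≤ a<b)))) (downFrom-< b))) ⟩
          ind G X * sum (downFrom b) (λ a → χ (a ℕ.+ k) X * nat (b ℕ.+ k))
            ≡⟨ cong (ind G X *_) (sum-*ʳ (downFrom b) (nat (b ℕ.+ k)) (λ a → χ (a ℕ.+ k) X)) ⟩
          ind G X * (band k b X * nat (b ℕ.+ k))
            ≤⟨ *-monoˡ (ind G X) (0≤ind G X) (*-monoʳ (0≤nat (b ℕ.+ k)) (band≤1 k b X)) ⟩
          ind G X * (1ℚ * nat (b ℕ.+ k))
            ≡⟨ lemma (ind G X) (nat (b ℕ.+ k)) ⟩
          nat (b ℕ.+ k) * ind G X ∎
          where
          lemma : ∀ i m → i * (1ℚ * m) ≡ m * i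
          lemma = solve 2 (λ i m → i ⊗ (Κ 1ℚ ⊗ m) ⊜ m ⊗ i) refl

      0≤tail : 0ℚ ≤ tail
      0≤tail = 0≤sum Ss λ X → 0≤* (0≤ind G X) (0≤* (0≤out X) (0≤+ (0≤nat k) (0≤nat ∣ X ∣)))

open Hardcore

-- One step of the Glauber dynamics, and the stopped chain.

module Glauber where

  open Data.Rational.Base using (_+_; _*_; _-_; -_; _≤_; _<_)
  open Data.Fin.Subset using (∣_∣)

  sum-allFin : ∀ n (f : Fin (suc n) → ℚ) → sum (allFin (suc n)) f ≡ f zero + sum (allFin n) (f ∘ suc)
  sum-allFin n f = cong (_+_ (f zero)) (trans
    (cong (λ xs → sum xs f) (sym (List.map-tabulate (λ i → i) suc))) (sum-map suc (allFin n) f))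

  S∪⊥ : ∀ {n} (S : Subset n) → S ∪ Subset.⊥ ≡ S
  S∪⊥ S = Subset.∪-identityʳ S

  -- In either case one of the two options of a move is `S` itself, so a move only ever removes or
  -- only ever adds `v`.
  in-or-out : ∀ {n} (S : Subset n) v → (v ∈ S × S ∪ ⁅ v ⁆ ≡ S) ⊎ (v ∉ S × S Subset.- v ≡ S)
  in-or-out (inside  ∷ S) zero    = inj₁ (here , cong (inside ∷_) (S∪⊥ S))
  in-or-out (outside ∷ S) zero    = inj₂ ((λ ()) , cong (outside ∷_) (Subset.p─⊥≡p S))
  in-or-out (b       ∷ S) (suc v) with in-or-out S v
  ... | inj₁ (v∈S , e) = inj₁ (there v∈S , cong₂ _∷_ (Bool.∨-identityʳ b) e)
  ... | inj₂ (v∉S , e) = inj₂ ((λ { (there v∈S) → v∉S v∈S }) , cong (b ∷_) e)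

  sum-∈ : ∀ {n} (S : Subset n) → sum (allFin n) (λ v → 𝟙 (v Subset.∈? S)) ≡ nat ∣ S ∣
  sum-∈ []            = refl
  sum-∈ {suc n} (b ∷ S) = trans (sum-allFin n (λ v → 𝟙 (v Subset.∈? (b ∷ S)))) (trans
    (cong (_+_ (𝟙 (zero Subset.∈? (b ∷ S)))) (trans (sum-cong (allFin n) λ v →
      𝟙-⇔ (suc v Subset.∈? (b ∷ S)) (v Subset.∈? S) Subset.drop-there there) (sum-∈ S)))
    (first b))
    where
    first : ∀ b → 𝟙 (zero Subset.∈? (b ∷ S)) + nat ∣ S ∣ ≡ nat ∣ b ∷ S ∣
    first outside = ℚ.+-identityˡ (nat ∣ S ∣)
    first inside  = refl

  -- The vertices outside `S` correspond to the one-point extensions listed by `ups`; this turns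
  -- steps of the chain into edges of the cube.
  sum-∉ : ∀ {n} (S : Subset n) (q : Subset n → ℚ) →
    sum (allFin n) (λ v → 𝟙 (¬? (v Subset.∈? S)) * q (S ∪ ⁅ v ⁆)) ≡ sum (ups S) q
  sum-∉ []            q = refl
  sum-∉ {suc n} (b ∷ S) q = trans (sum-allFin n (λ v → 𝟙 (¬? (v Subset.∈? (b ∷ S))) * q ((b ∷ S) ∪ ⁅ v ⁆))) (trans
    (cong (_+_ (𝟙 (¬? (zero Subset.∈? (b ∷ S))) * q ((b ∷ S) ∪ ⁅ zero ⁆))) (trans (sum-cong (allFin n) λ v → cong₂ _*_
      (𝟙-⇔ (¬? (suc v Subset.∈? (b ∷ S))) (¬? (v Subset.∈? S)) (λ h v∈S → h (there v∈S)) (λ h v∈ → h (Subset.drop-there v∈)))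
      (cong (λ c → q (c ∷ (S ∪ ⁅ v ⁆))) (Bool.∨-identityʳ b))) (sum-∉ S (q ∘ (b ∷_)))))
    (first b))
    where
    first : ∀ b → 𝟙 (¬? (zero Subset.∈? (b ∷ S))) * q ((b ∷ S) ∪ ⁅ zero ⁆) + sum (ups S) (q ∘ (b ∷_)) ≡ sum (ups (b ∷ S)) q
    first outside = cong₂ _+_ (trans (ℚ.*-identityˡ _) (cong (q ∘ (inside ∷_)) (S∪⊥ S))) (sym (sum-map (outside ∷_) (ups S) q))
    first inside  = trans (cong (_+ sum (ups S) (q ∘ (inside ∷_))) (ℚ.*-zeroˡ (q ((inside ∷ S) ∪ ⁅ zero ⁆))))
      (trans (ℚ.+-identityˡ _) (sym (sum-map (inside ∷_) (ups S) q)))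

  ∣S∪v∣ : ∀ {n} (S : Subset n) v → ∣ S ∪ ⁅ v ⁆ ∣ ℕ.≤ suc ∣ S ∣
  ∣S∪v∣ (outside ∷ S) zero    = s≤s (ℕ.≤-reflexive (cong ∣_∣ (S∪⊥ S)))
  ∣S∪v∣ (inside  ∷ S) zero    = s≤s (ℕ.≤-trans (ℕ.≤-reflexive (cong ∣_∣ (S∪⊥ S))) (ℕ.n≤1+n ∣ S ∣))
  ∣S∪v∣ (outside ∷ S) (suc v) = ∣S∪v∣ S v
  ∣S∪v∣ (inside  ∷ S) (suc v) = s≤s (∣S∪v∣ S v)

  module _ {n : ℕ} (0<n : 0 ℕ.< n) (G : Graph n) where

    -- The conditional expectation of `f` after one step, given the chosen vertex.
    move : (Subset n → ℚ) → Subset n → Fin n → ℚ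
    move f S v = if does (independent? G (S ∪ ⁅ v ⁆))
      then ½ * f (S ∪ ⁅ v ⁆) + ½ * f (S Subset.- v)
      else f S

    private
      0<nat-n : 0ℚ < nat n
      0<nat-n = nat-pos 0<n

      n⁻¹ = nat n ⁻¹
      h = ½ * n⁻¹

      0≤h : 0ℚ ≤ h
      0≤h = 0≤* 0≤½ (0≤⁻¹ (nat n))

      length-allFin : length (allFin n) ≡ n
      length-allFin = List.length-tabulate (λ i → i)

    𝔼-step : ∀ S f → 𝔼 (glauberStep G S) f ≡ n⁻¹ * sum (allFin n) (move f S)
    𝔼-step S f = trans (𝔼->>= (uniform (allFin n)) _ f) (trans (𝔼-uniform (allFin n) _)
      (cong₂ (λ l x → nat l ⁻¹ * x) length-allFin (sum-cong (allFin n) λ v → go v)))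
      where
      go : ∀ v → 𝔼 (if does (independent? G (S ∪ ⁅ v ⁆)) then uniform ((S ∪ ⁅ v ⁆) ∷ (S Subset.- v) ∷ []) else return S) f ≡ move f S v
      go v with does (independent? G (S ∪ ⁅ v ⁆))
      ... | true  = cong (_+_ (½ * f (S ∪ ⁅ v ⁆))) (ℚ.+-identityʳ _)
      ... | false = 𝔼-return S f

    𝔼-step-const : ∀ S c → 𝔼 (glauberStep G S) (λ _ → c) ≡ c
    𝔼-step-const S c = trans (𝔼-step S (λ _ → c)) (trans
      (cong (n⁻¹ *_) (trans (sum-cong (allFin n) go) (trans (sum-const (allFin n) c) (cong (λ l → nat l * c) length-allFin))))
      (trans (lemma n⁻¹ (nat n) c) (trans (cong (_* c) (*-⁻¹ 0<nat-n)) (ℚ.*-identityˡ c))))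
      where
      lemma : ∀ i n c → i * (n * c) ≡ n * i * c
      lemma = solve 3 (λ i n c → i ⊗ (n ⊗ c) ⊜ n ⊗ i ⊗ c) refl
      lemma₂ : ∀ c → ½ * c + ½ * c ≡ c
      lemma₂ = solve 1 (λ c → Κ ½ ⊗ c ⊕ Κ ½ ⊗ c ⊜ c) refl
      go : ∀ v → move (λ _ → c) S v ≡ c
      go v with does (independent? G (S ∪ ⁅ v ⁆))
      ... | true  = lemma₂ c
      ... | false = refl

    -- Discards the transitions that remove a vertex.
    𝔼-step-lower : ∀ S f → (∀ S → 0ℚ ≤ f S) →
      (1ℚ - h * (free G S + nat ∣ S ∣)) * f S + h * sum (ups S) (λ S′ → ind G S′ * f S′) ≤ 𝔼 (glauberStep G S) f
    𝔼-step-lower S f 0≤f = begin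
      (1ℚ - h * (free G S + nat ∣ S ∣)) * f S + h * sum (ups S) (λ S′ → ind G S′ * f S′)
        ≡⟨ cong (λ u → (u - h * (free G S + nat ∣ S ∣)) * f S + h * sum (ups S) (λ S′ → ind G S′ * f S′)) (*-⁻¹ 0<nat-n) ⟨
      (nat n * n⁻¹ - h * (free G S + nat ∣ S ∣)) * f S + h * sum (ups S) (λ S′ → ind G S′ * f S′)
        ≡⟨ lemma₁ (nat n) n⁻¹ (free G S) (nat ∣ S ∣) (f S) _ ⟩
      n⁻¹ * (nat n * f S + nat ∣ S ∣ * (- ½ * f S) + ½ * (sum (ups S) (λ S′ → ind G S′ * f S′) + free G S * (- 1ℚ * f S)))
        ≡⟨ cong (λ u → n⁻¹ * (nat n * f S + nat ∣ S ∣ * (- ½ * f S) + ½ * u)) (trans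
             (cong (_+_ (sum (ups S) λ S′ → ind G S′ * f S′)) (sym (sum-*ʳ (ups S) (- 1ℚ * f S) (ind G))))
             (trans (sym (sum-+ (ups S) (λ S′ → ind G S′ * f S′) (λ S′ → ind G S′ * (- 1ℚ * f S)))) (sym (sum-∉ S q)))) ⟩
      n⁻¹ * (nat n * f S + nat ∣ S ∣ * (- ½ * f S) + ½ * sum (allFin n) (λ v → 𝟙 (¬? (v Subset.∈? S)) * q (S ∪ ⁅ v ⁆)))
        ≡⟨ cong (n⁻¹ *_) (cong₂ _+_ (cong₂ _+_
             (trans (cong (λ l → nat l * f S) (sym length-allFin)) (sym (sum-const (allFin n) (f S))))
             (trans (cong (_* (- ½ * f S)) (sym (sum-∈ S))) (sym (sum-*ʳ (allFin n) (- ½ * f S) (λ v → 𝟙 (v Subset.∈? S))))))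
             (sym (sum-*ˡ (allFin n) ½ (λ v → 𝟙 (¬? (v Subset.∈? S)) * q (S ∪ ⁅ v ⁆))))) ⟩
      n⁻¹ * (sum (allFin n) (λ _ → f S) + sum (allFin n) (λ v → 𝟙 (v Subset.∈? S) * (- ½ * f S))
        + sum (allFin n) (λ v → ½ * (𝟙 (¬? (v Subset.∈? S)) * q (S ∪ ⁅ v ⁆))))
        ≡⟨ cong (n⁻¹ *_) (trans
             (cong (_+ sum (allFin n) (λ v → ½ * (𝟙 (¬? (v Subset.∈? S)) * q (S ∪ ⁅ v ⁆))))
               (sym (sum-+ (allFin n) (λ _ → f S) (λ v → 𝟙 (v Subset.∈? S) * (- ½ * f S)))))
             (sym (sum-+ (allFin n) (λ v → f S + 𝟙 (v Subset.∈? S) * (- ½ * f S)) (λ v → ½ * (𝟙 (¬? (v Subset.∈? S)) * q (S ∪ ⁅ v ⁆)))))) ⟩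
      n⁻¹ * sum (allFin n) (λ v → f S + 𝟙 (v Subset.∈? S) * (- ½ * f S) + ½ * (𝟙 (¬? (v Subset.∈? S)) * q (S ∪ ⁅ v ⁆)))
        ≤⟨ *-monoˡ n⁻¹ (0≤⁻¹ (nat n)) (sum-mono (allFin n) go) ⟩
      n⁻¹ * sum (allFin n) (move f S)
        ≡⟨ 𝔼-step S f ⟨
      𝔼 (glauberStep G S) f ∎
      where
      open ℚ.≤-Reasoning
      q : Subset n → ℚ
      q S′ = ind G S′ * f S′ + ind G S′ * (- 1ℚ * f S)
      lemma₁ : ∀ n i F s x u → (n * i - ½ * i * (F + s)) * x + ½ * i * u
        ≡ i * (n * x + s * (- ½ * x) + ½ * (u + F * (- 1ℚ * x)))
      lemma₁ = solve 6 (λ n i F s x u →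
        (n ⊗ i ⊖ Κ ½ ⊗ i ⊗ (F ⊕ s)) ⊗ x ⊕ Κ ½ ⊗ i ⊗ u ⊜
        i ⊗ (n ⊗ x ⊕ s ⊗ (⊝ Κ ½ ⊗ x) ⊕ Κ ½ ⊗ (u ⊕ F ⊗ (⊝ Κ 1ℚ ⊗ x)))) refl
      stay : ∀ x u → x + 1ℚ * (- ½ * x) + ½ * (0ℚ * u) ≡ ½ * x
      stay = solve 2 (λ x u → x ⊕ Κ 1ℚ ⊗ (⊝ Κ ½ ⊗ x) ⊕ Κ ½ ⊗ (Κ 0ℚ ⊗ u) ⊜ Κ ½ ⊗ x) refl
      half≤ : ∀ x → ½ * x + ½ * x ≡ x
      half≤ = solve 1 (λ x → Κ ½ ⊗ x ⊕ Κ ½ ⊗ x ⊜ x) refl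
      blocked : ∀ x y → x + 0ℚ * (- ½ * x) + ½ * (1ℚ * (0ℚ * y + 0ℚ * (- 1ℚ * x))) ≡ x
      blocked = solve 2 (λ x y →
        x ⊕ Κ 0ℚ ⊗ (⊝ Κ ½ ⊗ x) ⊕ Κ ½ ⊗ (Κ 1ℚ ⊗ (Κ 0ℚ ⊗ y ⊕ Κ 0ℚ ⊗ (⊝ Κ 1ℚ ⊗ x))) ⊜
        x) refl
      add : ∀ x y → x + 0ℚ * (- ½ * x) + ½ * (1ℚ * (1ℚ * y + 1ℚ * (- 1ℚ * x))) ≡ ½ * y + ½ * x
      add = solve 2 (λ x y →
        x ⊕ Κ 0ℚ ⊗ (⊝ Κ ½ ⊗ x) ⊕ Κ ½ ⊗ (Κ 1ℚ ⊗ (Κ 1ℚ ⊗ y ⊕ Κ 1ℚ ⊗ (⊝ Κ 1ℚ ⊗ x))) ⊜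
        Κ ½ ⊗ y ⊕ Κ ½ ⊗ x) refl
      go : ∀ v → f S + 𝟙 (v Subset.∈? S) * (- ½ * f S) + ½ * (𝟙 (¬? (v Subset.∈? S)) * q (S ∪ ⁅ v ⁆)) ≤ move f S v
      go v with in-or-out S v
      ... | inj₁ (v∈S , e) = ℚ.≤-trans (ℚ.≤-reflexive (trans
            (cong₂ (λ x y → f S + x * (- ½ * f S) + ½ * (y * q (S ∪ ⁅ v ⁆)))
              (𝟙-yes (v Subset.∈? S) v∈S) (𝟙-no (¬? (v Subset.∈? S)) λ v∉S → v∉S v∈S))
            (stay (f S) (q (S ∪ ⁅ v ⁆))))) (in-case (does (independent? G (S ∪ ⁅ v ⁆))))
        where
        in-case : ∀ c → ½ * f S ≤ (if c then ½ * f (S ∪ ⁅ v ⁆) + ½ * f (S Subset.- v) else f S)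
        in-case true  = subst (λ S′ → ½ * f S ≤ ½ * f S′ + ½ * f (S Subset.- v)) (sym e) (p≤p+q (0≤* 0≤½ (0≤f (S Subset.- v))))
        in-case false = ≤-by (½ * f S) (0≤* 0≤½ (0≤f S)) (half≤ (f S))
      ... | inj₂ (v∉S , e) = ℚ.≤-trans (ℚ.≤-reflexive
            (cong₂ (λ x y → f S + x * (- ½ * f S) + ½ * (y * q (S ∪ ⁅ v ⁆)))
              (𝟙-no (v Subset.∈? S) v∉S) (𝟙-yes (¬? (v Subset.∈? S)) v∉S)))
          (out-case (does (independent? G (S ∪ ⁅ v ⁆))))
        where
        out-case : ∀ c → f S + 0ℚ * (- ½ * f S) + ½ * (1ℚ * ((if c then 1ℚ else 0ℚ) * f (S ∪ ⁅ v ⁆) + (if c then 1ℚ else 0ℚ) * (- 1ℚ * f S)))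
          ≤ (if c then ½ * f (S ∪ ⁅ v ⁆) + ½ * f (S Subset.- v) else f S)
        out-case true  = ℚ.≤-reflexive (trans (add (f S) (f (S ∪ ⁅ v ⁆))) (cong (λ S′ → ½ * f (S ∪ ⁅ v ⁆) + ½ * f S′) (sym e)))
        out-case false = ℚ.≤-reflexive (blocked (f S) (f (S ∪ ⁅ v ⁆)))

    module _ (k : ℕ) where

      -- The expectation of g at the stopping time, for the dynamics started at S.
      run : ℕ → Subset n → (Subset n → ℚ) → ℚ
      run T S g = 𝔼 (glauberPath G S T) λ path → g (lookup path (stoppingTime k path))

      𝔼-path : ∀ T S (f : Vec (Subset n) (suc (suc T)) → ℚ) → 𝔼 (glauberPath G S (suc T)) f
        ≡ 𝔼 (glauberStep G S) λ S′ → 𝔼 (glauberPath G S′ T) λ path → f (S ∷ path)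
      𝔼-path T S f = trans (𝔼->>= (glauberStep G S) (λ S′ → glauberPath G S′ T >>= λ path → return (S ∷ path)) f)
        (𝔼-cong (glauberStep G S) λ S′ → trans (𝔼->>= (glauberPath G S′ T) (λ path → return (S ∷ path)) f)
          (𝔼-cong (glauberPath G S′ T) λ path → 𝔼-return (S ∷ path) f))

      𝔼-path-const : ∀ T S c → 𝔼 (glauberPath G S T) (λ _ → c) ≡ c
      𝔼-path-const zero    S c = 𝔼-return {Vec (Subset n) 1} (S ∷ []) (λ _ → c)
      𝔼-path-const (suc T) S c = trans (𝔼-path T S (λ _ → c))
        (trans (𝔼-cong (glauberStep G S) λ S′ → 𝔼-path-const T S′ c) (𝔼-step-const S c))

      run-zero : ∀ S g → run 0 S g ≡ g S
      run-zero S g = 𝔼-return {Vec (Subset n) 1} (S ∷ []) (λ path → g (lookup path (stoppingTime k path)))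

      run-suc : ∀ T S g → run (suc T) S g
        ≡ 𝔼 (glauberStep G S) λ S′ → 𝔼 (glauberPath G S′ T) λ path →
            g (lookup (S ∷ path) (if ∣ S ∣ ℕ.≡ᵇ k then zero else suc (stoppingTime k path)))
      run-suc T S g = 𝔼-path T S (λ path → g (lookup path (stoppingTime k path)))

      run-stop : ∀ T S g → ∣ S ∣ ≡ k → run T S g ≡ g S
      run-stop zero    S g e = run-zero S g
      run-stop (suc T) S g e = trans (run-suc T S g) (trans
        (𝔼-cong (glauberStep G S) λ S′ → trans
          (𝔼-cong (glauberPath G S′ T) λ path → cong (λ c → g (lookup (S ∷ path) (if c then zero else suc (stoppingTime k path))))
            (dec-true (∣ S ∣ ℕ.≟ k) e))
          (𝔼-path-const T S′ (g S)))
        (𝔼-step-const S (g S)))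

      run-go : ∀ T S g → ∣ S ∣ ≢ k → run (suc T) S g ≡ 𝔼 (glauberStep G S) λ S′ → run T S′ g
      run-go T S g e = trans (run-suc T S g)
        (𝔼-cong (glauberStep G S) λ S′ → 𝔼-cong (glauberPath G S′ T) λ path →
          cong (λ c → g (lookup (S ∷ path) (if c then zero else suc (stoppingTime k path)))) (dec-false (∣ S ∣ ℕ.≟ k) e))

      NonNeg-step : ∀ S → NonNeg (glauberStep G S)
      NonNeg-step S = NonNeg->>= (NonNeg-uniform (allFin n)) go
        where
        go : ∀ v → NonNeg (if does (independent? G (S ∪ ⁅ v ⁆)) then uniform ((S ∪ ⁅ v ⁆) ∷ (S Subset.- v) ∷ []) else return S)
        go v with does (independent? G (S ∪ ⁅ v ⁆))
        ... | true  = NonNeg-uniform ((S ∪ ⁅ v ⁆) ∷ (S Subset.- v) ∷ [])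
        ... | false = NonNeg-return S

      NonNeg-path : ∀ T S → NonNeg (glauberPath G S T)
      NonNeg-path zero    S = NonNeg-return {Vec (Subset n) 1} (S ∷ [])
      NonNeg-path (suc T) S = NonNeg->>= (NonNeg-step S) λ S′ →
        NonNeg->>= (NonNeg-path T S′) λ path → NonNeg-return (S ∷ path)

      0≤run : ∀ T S {g} → (∀ S → 0ℚ ≤ g S) → 0ℚ ≤ run T S g
      0≤run T S {g} 0≤g = subst (_≤ run T S g) (𝔼-path-const T S 0ℚ)
        (𝔼-mono (NonNeg-path T S) λ path → 0≤g (lookup path (stoppingTime k path)))

      -- A step adds at most one vertex and the chain is frozen at size `k`, so it cannot jump over
      -- `k`.
      run-size : ∀ T S → ∣ S ∣ ℕ.≤ k → run T S (nat ∘ ∣_∣) ≤ nat k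
      run-size zero    S ∣S∣≤k = subst (_≤ nat k) (sym (run-zero S (nat ∘ ∣_∣))) (nat-mono ∣S∣≤k)
      run-size (suc T) S ∣S∣≤k with ∣ S ∣ ℕ.≟ k
      ... | yes e = ℚ.≤-reflexive (trans (run-stop (suc T) S (nat ∘ ∣_∣) e) (cong nat e))
      ... | no ¬e = begin
        run (suc T) S (nat ∘ ∣_∣)           ≡⟨ trans (run-go T S (nat ∘ ∣_∣) ¬e) (𝔼-step S f) ⟩
        n⁻¹ * sum (allFin n) (move f S)     ≤⟨ *-monoˡ n⁻¹ (0≤⁻¹ (nat n)) (sum-mono (allFin n) go) ⟩
        n⁻¹ * sum (allFin n) (move (λ _ → nat k) S) ≡⟨ 𝔼-step S (λ _ → nat k) ⟨
        𝔼 (glauberStep G S) (λ _ → nat k)   ≡⟨ 𝔼-step-const S (nat k) ⟩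
        nat k                               ∎
        where
        open ℚ.≤-Reasoning
        f = λ S′ → run T S′ (nat ∘ ∣_∣)
        ∣S∣<k = ℕ.≤∧≢⇒< ∣S∣≤k ¬e
        go : ∀ v → move f S v ≤ move (λ _ → nat k) S v
        go v with does (independent? G (S ∪ ⁅ v ⁆))
        ... | true  = ℚ.+-mono-≤
          (*-monoˡ ½ 0≤½ (run-size T (S ∪ ⁅ v ⁆) (ℕ.≤-trans (∣S∪v∣ S v) ∣S∣<k)))
          (*-monoˡ ½ 0≤½ (run-size T (S Subset.- v) (ℕ.≤-trans (Subset.∣p─q∣≤∣p∣ S ⁅ v ⁆) ∣S∣≤k)))
        ... | false = run-size T S ∣S∣≤k

      glauber-law : ∀ T S → Pr (glauber G k T) (λ S′ → does (Vec.≡-dec Bool._≟_ S′ S)) ≡ run T Subset.⊥ (λ S′ → δ S′ S)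
      glauber-law T S = trans (Pr≡𝔼 (glauber G k T) (λ S′ → does (S′ ≟ₛ S)))
        (trans (𝔼->>= (glauberPath G Subset.⊥ T) (λ path → return (lookup path (stoppingTime k path))) (λ S′ → δ S′ S))
          (𝔼-cong (glauberPath G Subset.⊥ T) λ path → 𝔼-return (lookup path (stoppingTime k path)) (λ S′ → δ S′ S)))

open Glauber

-- Comparison of the dynamics with a pure birth chain on sizes.

module UpChain where

  open Data.Rational.Base using (_+_; _*_; _-_; -_; _≤_; _<_)
  open Data.Fin.Subset using (∣_∣)

  module _ (n k : ℕ) where

    -- A pure birth chain on sizes, absorbed at k, with the step probabilities
    -- that the Glauber dynamics has when free G S is replaced by its expectation.
    moveRate : ℚ
    moveRate = ½ * nat n ⁻¹

    active : ℕ → ℚ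
    active j = 1ℚ - 𝟙 (j ℕ.≟ k)

    birth : ℕ → ℚ
    birth j = active j * (moveRate * deg n j)

    prob : ℕ → ℕ → ℚ
    inflow : ℕ → ℕ → ℚ
    prob zero    zero    = 1ℚ
    prob zero    (suc j) = 0ℚ
    prob (suc t) j       = prob t j * (1ℚ - birth j) + inflow t j
    inflow t zero    = 0ℚ
    inflow t (suc j) = birth j * prob t j

    cumulative : ℕ → ℕ → ℚ
    cumulative t j = sum (downFrom j) (prob t)

    -- The expected number of times before `t` at which the birth chain has size `j`.
    occupation : ℕ → ℕ → ℚ
    occupation zero    j = 0ℚ
    occupation (suc t) j = occupation t j + prob t j

    0≤active : ∀ j → 0ℚ ≤ active j
    0≤active j = ≤⇒0≤- (𝟙≤1 (j ℕ.≟ k))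

    active≤1 : ∀ j → active j ≤ 1ℚ
    active≤1 j = -≤ (0≤𝟙 (j ℕ.≟ k))

    active-k : active k ≡ 0ℚ
    active-k = cong (_-_ 1ℚ) (𝟙-yes (k ℕ.≟ k) refl)

    active-≢ : ∀ {j} → j ≢ k → active j ≡ 1ℚ
    active-≢ {j} j≢k = cong (_-_ 1ℚ) (𝟙-no (j ℕ.≟ k) j≢k)

    birth-k : birth k ≡ 0ℚ
    birth-k = trans (cong (_* (moveRate * deg n k)) active-k) (ℚ.*-zeroˡ (moveRate * deg n k))

    0≤moveRate : 0ℚ ≤ moveRate
    0≤moveRate = 0≤* 0≤½ (0≤⁻¹ (nat n))

    0≤birth : ∀ j → 0ℚ ≤ birth j
    0≤birth j = 0≤* (0≤active j) (0≤* 0≤moveRate (0≤deg n j))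

    -- Sizes never decrease, so the only mass that leaves the sizes up to `j` is a birth from `j`.
    cumulative-suc : ∀ t j → cumulative (suc t) (suc j) + birth j * prob t j ≡ cumulative t (suc j)
    cumulative-suc t zero    = lemma (prob t 0) (birth 0)
      where
      lemma : ∀ p b → p * (1ℚ - b) + 0ℚ + 0ℚ + b * p ≡ p + 0ℚ
      lemma = solve 2 (λ p b → p ⊗ (Κ 1ℚ ⊖ b) ⊕ Κ 0ℚ ⊕ Κ 0ℚ ⊕ b ⊗ p ⊜ p ⊕ Κ 0ℚ) refl
    cumulative-suc t (suc j) = trans
      (lemma (prob t (suc j)) (birth (suc j)) (birth j * prob t j) (cumulative (suc t) (suc j)))
      (cong (_+_ (prob t (suc j))) (cumulative-suc t j))
      where
      lemma : ∀ p b i c → p * (1ℚ - b) + i + c + b * p ≡ p + (c + i)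
      lemma = solve 4 (λ p b i c → p ⊗ (Κ 1ℚ ⊖ b) ⊕ i ⊕ c ⊕ b ⊗ p ⊜ p ⊕ (c ⊕ i)) refl

    cumulative-zero : ∀ j → cumulative 0 (suc j) ≡ 1ℚ
    cumulative-zero zero    = refl
    cumulative-zero (suc j) = trans (ℚ.+-identityˡ _) (cumulative-zero j)

    cumulative-k : ∀ t → cumulative t (suc k) ≡ 1ℚ
    cumulative-k zero    = cumulative-zero k
    cumulative-k (suc t) = trans (sym (trans
      (cong (λ b → cumulative (suc t) (suc k) + b * prob t k) birth-k)
      (trans (cong (_+_ (cumulative (suc t) (suc k))) (ℚ.*-zeroˡ (prob t k))) (ℚ.+-identityʳ _))))
      (trans (cumulative-suc t k) (cumulative-k t))

    prob-> : ∀ t {j} → k ℕ.< j → prob t j ≡ 0ℚ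
    prob-> zero    {suc j} _ = refl
    prob-> (suc t) {suc j} (s≤s k≤j) = trans
      (cong₂ _+_ (trans (cong (_* (1ℚ - birth (suc j))) (prob-> t (s≤s k≤j))) (ℚ.*-zeroˡ (1ℚ - birth (suc j)))) zero-inflow)
      (ℚ.+-identityˡ 0ℚ)
      where
      zero-inflow : birth j * prob t j ≡ 0ℚ
      zero-inflow with ℕ.m≤n⇒m<n∨m≡n k≤j
      ... | inj₁ k<j  = trans (cong (birth j *_) (prob-> t k<j)) (ℚ.*-zeroʳ (birth j))
      ... | inj₂ refl = trans (cong (_* prob t k) birth-k) (ℚ.*-zeroˡ (prob t k))

    module _ (0<n : 0 ℕ.< n) where

      birth≤1 : ∀ j → birth j ≤ 1ℚ
      birth≤1 j = begin
        active j * (½ * nat n ⁻¹ * (nat (n ∸ j) * ½ ^ j))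
          ≤⟨ *-mono (0≤* 0≤moveRate (0≤deg n j)) 0≤1 (active≤1 j)
               (*-monoˡ (½ * nat n ⁻¹) 0≤moveRate (*-mono (0≤^ j 0≤½) (0≤nat n) (nat-mono (ℕ.m∸n≤m n j)) (½^≤1 j))) ⟩
        1ℚ * (½ * nat n ⁻¹ * (nat n * 1ℚ))
          ≡⟨ lemma (nat n ⁻¹) (nat n) ⟩
        ½ * (nat n * nat n ⁻¹)
          ≡⟨ cong (½ *_) (*-⁻¹ (nat-pos 0<n)) ⟩
        ½ * 1ℚ
          ≤⟨ ≤-by ½ 0≤½ refl ⟩
        1ℚ ∎
        where
        open ℚ.≤-Reasoning
        lemma : ∀ i n → 1ℚ * (½ * i * (n * 1ℚ)) ≡ ½ * (n * i)
        lemma = solve 2 (λ i n → Κ 1ℚ ⊗ (Κ ½ ⊗ i ⊗ (n ⊗ Κ 1ℚ)) ⊜ Κ ½ ⊗ (n ⊗ i)) refl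

      0≤prob : ∀ t j → 0ℚ ≤ prob t j
      0≤prob zero    zero    = 0≤1
      0≤prob zero    (suc j) = ℚ.≤-refl
      0≤prob (suc t) zero    = 0≤+ (0≤* (0≤prob t 0) (≤⇒0≤- (birth≤1 0))) ℚ.≤-refl
      0≤prob (suc t) (suc j) = 0≤+ (0≤* (0≤prob t (suc j)) (≤⇒0≤- (birth≤1 (suc j)))) (0≤* (0≤birth j) (0≤prob t j))

      0≤occupation : ∀ t j → 0ℚ ≤ occupation t j
      0≤occupation zero    j = ℚ.≤-refl
      0≤occupation (suc t) j = 0≤+ (0≤occupation t j) (0≤prob t j)

      -- A pure birth chain leaves size `j` at most once: the expected number of births from `j` is
      -- the probability of being above `j`.
      birth*occupation : ∀ t j → cumulative t (suc j) + birth j * occupation t j ≡ 1ℚ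
      birth*occupation zero    j = trans (cong (_+_ (cumulative 0 (suc j))) (ℚ.*-zeroʳ (birth j))) (trans (ℚ.+-identityʳ _) (cumulative-zero j))
      birth*occupation (suc t) j = trans
        (lemma (cumulative (suc t) (suc j)) (birth j) (occupation t j) (prob t j))
        (trans (cong (_+ birth j * occupation t j) (cumulative-suc t j)) (birth*occupation t j))
        where
        lemma : ∀ c b o p → c + b * (o + p) ≡ c + b * p + b * o
        lemma = solve 4 (λ c b o p → c ⊕ b ⊗ (o ⊕ p) ⊜ c ⊕ b ⊗ p ⊕ b ⊗ o) refl

      birth*occupation≤1 : ∀ t j → birth j * occupation t j ≤ 1ℚ
      birth*occupation≤1 t j = ≤-by (cumulative t (suc j)) (0≤sum (downFrom (suc j)) (0≤prob t))
        (trans (ℚ.+-comm (birth j * occupation t j) _) (birth*occupation t j))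

      remaining : ℕ → ℚ
      remaining t = cumulative t k

      remaining-suc : ∀ t → remaining (suc t) ≤ remaining t
      remaining-suc t = go k
        where
        go : ∀ j → cumulative (suc t) j ≤ cumulative t j
        go zero    = ℚ.≤-refl
        go (suc j) = ≤-by (birth j * prob t j) (0≤* (0≤birth j) (0≤prob t j)) (cumulative-suc t j)

      -- The probability of being below `k` only decreases, so `t` times its last value is at most
      -- the expected time spent there.
      remaining-time : ∀ t → nat t * remaining t ≤ sum (downFrom k) (occupation t)
      remaining-time zero    = ℚ.≤-trans (ℚ.≤-reflexive (ℚ.*-zeroˡ (remaining 0))) (0≤sum (downFrom k) (0≤occupation 0))
      remaining-time (suc t) = begin
        (1ℚ + nat t) * remaining (suc t)
          ≤⟨ *-monoˡ (1ℚ + nat t) (0≤nat (suc t)) (remaining-suc t) ⟩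
        (1ℚ + nat t) * remaining t
          ≡⟨ lemma (nat t) (remaining t) ⟩
        nat t * remaining t + remaining t
          ≤⟨ ℚ.+-monoˡ-≤ (remaining t) (remaining-time t) ⟩
        sum (downFrom k) (occupation t) + remaining t
          ≡⟨ sum-+ (downFrom k) (occupation t) (prob t) ⟨
        sum (downFrom k) (occupation (suc t)) ∎
        where
        open ℚ.≤-Reasoning
        lemma : ∀ t r → (1ℚ + t) * r ≡ t * r + r
        lemma = solve 2 (λ t r → (Κ 1ℚ ⊕ t) ⊗ r ⊜ t ⊗ r ⊕ r) refl

      birth-< : ∀ {j} → j ℕ.< k → birth j ≡ moveRate * deg n j
      birth-< {j} j<k = trans (cong (_* (moveRate * deg n j)) (active-≢ (ℕ.<⇒≢ j<k))) (ℚ.*-identityˡ _)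

      -- The expected time at size `j` is at most `1 / birth j`, where
      -- `birth j = moveRate * deg n j`; with `remaining-time` this is Markov's inequality for the
      -- hitting time of `k`.
      remaining-bound : k ℕ.≤ n → ∀ t → nat t * moveRate * remaining t ≤ sum (downFrom k) (λ j → deg n j ⁻¹)
      remaining-bound k≤n t = begin
        nat t * moveRate * remaining t
          ≡⟨ lemma (nat t) moveRate (remaining t) ⟩
        moveRate * (nat t * remaining t)
          ≤⟨ *-monoˡ moveRate 0≤moveRate (remaining-time t) ⟩
        moveRate * sum (downFrom k) (occupation t)
          ≡⟨ sum-*ˡ (downFrom k) moveRate (occupation t) ⟨
        sum (downFrom k) (λ j → moveRate * occupation t j)
          ≤⟨ sum-monoᴬ (All.map (λ {j} j<k → subst (_≤ deg n j ⁻¹)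
               (trans (cong (λ b → b * occupation t j * deg n j ⁻¹) (birth-< j<k)) (trans
                 (lemma₂ moveRate (deg n j) (occupation t j) (deg n j ⁻¹))
                 (trans (cong (moveRate * occupation t j *_) (*-⁻¹ (0<deg (ℕ.<-≤-trans j<k k≤n)))) (ℚ.*-identityʳ _))))
               (subst (birth j * occupation t j * deg n j ⁻¹ ≤_) (ℚ.*-identityˡ (deg n j ⁻¹))
                 (*-monoʳ (0≤⁻¹ (deg n j)) (birth*occupation≤1 t j)))) (downFrom-< k)) ⟩
        sum (downFrom k) (λ j → deg n j ⁻¹) ∎
        where
        open ℚ.≤-Reasoning
        lemma : ∀ t m r → t * m * r ≡ m * (t * r)
        lemma = solve 3 (λ t m r → t ⊗ m ⊗ r ⊜ m ⊗ (t ⊗ r)) refl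
        lemma₂ : ∀ m d o g → m * d * o * g ≡ m * o * (d * g)
        lemma₂ = solve 4 (λ m d o g → m ⊗ d ⊗ o ⊗ g ⊜ m ⊗ o ⊗ (d ⊗ g)) refl

      module _ (G : Graph n) where

        private
          Ss = subsets n
          h = moveRate

        -- Removals are subtracted from the holding probability but lead nowhere, which makes the
        -- truncated dynamics substochastic.
        stay : Subset n → ℚ
        stay S = 1ℚ - active ∣ S ∣ * (h * (free G S + nat ∣ S ∣))

        -- The substochastic operator acting on functions, and its transpose acting on densities.
        backward forward : (Subset n → ℚ) → Subset n → ℚ
        backward f S = stay S * f S + active ∣ S ∣ * (h * sum (ups S) λ S′ → ind G S′ * f S′)
        forward  ρ S = stay S * ρ S + h * (ind G S * sum (downs S) λ S′ → active ∣ S′ ∣ * ρ S′)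

        -- The transitions run along the edges of the cube, so transposing them is double counting.
        duality : ∀ ρ f → sum Ss (λ S → ρ S * backward f S) ≡ sum Ss (λ S → forward ρ S * f S)
        duality ρ f = begin
          sum Ss (λ S → ρ S * backward f S)
            ≡⟨ trans (sum-cong Ss λ S → trans
                 (lemma₁ (ρ S) (stay S) (f S) (active ∣ S ∣) h (sum (ups S) λ S′ → ind G S′ * f S′))
                 (cong (λ u → stay S * ρ S * f S + h * u) (sym (sum-*ˡ (ups S) (active ∣ S ∣ * ρ S) (λ S′ → ind G S′ * f S′)))))
                 (sum-+ Ss (λ S → stay S * ρ S * f S) (λ S → h * sum (ups S) (φ S))) ⟩
          sum Ss (λ S → stay S * ρ S * f S) + sum Ss (λ S → h * sum (ups S) (φ S))
            ≡⟨ cong (_+_ (sum Ss λ S → stay S * ρ S * f S)) (trans (sum-*ˡ Ss h (λ S → sum (ups S) (φ S)))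
                 (trans (cong (h *_) (double-counting n φ)) (sym (sum-*ˡ Ss h (λ S → sum (downs S) λ S′ → φ S′ S))))) ⟩
          sum Ss (λ S → stay S * ρ S * f S) + sum Ss (λ S → h * sum (downs S) λ S′ → φ S′ S)
            ≡⟨ trans (sum-cong Ss λ S → trans
                 (lemma₂ (stay S * ρ S) (f S) h (ind G S) (sum (downs S) λ S′ → active ∣ S′ ∣ * ρ S′))
                 (cong (λ u → stay S * ρ S * f S + h * u) (sym (sum-*ʳ (downs S) (ind G S * f S) (λ S′ → active ∣ S′ ∣ * ρ S′)))))
                 (sum-+ Ss (λ S → stay S * ρ S * f S) (λ S → h * sum (downs S) λ S′ → φ S′ S)) ⟨
          sum Ss (λ S → forward ρ S * f S) ∎
          where
          open ≡-Reasoning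
          φ : Subset n → Subset n → ℚ
          φ S S′ = active ∣ S ∣ * ρ S * (ind G S′ * f S′)
          lemma₁ : ∀ r c f a h u → r * (c * f + a * (h * u)) ≡ c * r * f + h * (a * r * u)
          lemma₁ = solve 6 (λ r c f a h u → r ⊗ (c ⊗ f ⊕ a ⊗ (h ⊗ u)) ⊜ c ⊗ r ⊗ f ⊕ h ⊗ (a ⊗ r ⊗ u)) refl
          lemma₂ : ∀ c f h i u → (c + h * (i * u)) * f ≡ c * f + h * (u * (i * f))
          lemma₂ = solve 5 (λ c f h i u → (c ⊕ h ⊗ (i ⊗ u)) ⊗ f ⊜ c ⊗ f ⊕ h ⊗ (u ⊗ (i ⊗ f))) refl

        h*n : h * nat n ≡ ½
        h*n = trans (lemma (nat n ⁻¹) (nat n)) (cong (½ *_) (*-⁻¹ (nat-pos 0<n)))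
          where
          lemma : ∀ i n → ½ * i * n ≡ ½ * (n * i)
          lemma = solve 2 (λ i n → Κ ½ ⊗ i ⊗ n ⊜ Κ ½ ⊗ (n ⊗ i)) refl

        free+size≤n : ∀ S → free G S + nat ∣ S ∣ ≤ nat n
        free+size≤n S = begin
          free G S + nat ∣ S ∣                   ≤⟨ ℚ.+-monoˡ-≤ (nat ∣ S ∣) (sum-mono (ups S) λ S′ → 𝟙≤1 (independent? G S′)) ⟩
          sum (ups S) (λ _ → 1ℚ) + nat ∣ S ∣     ≡⟨ cong (_+ nat ∣ S ∣) (trans (sum-const (ups S) 1ℚ) (ℚ.*-identityʳ (nat (length (ups S))))) ⟩
          nat (length (ups S)) + nat ∣ S ∣       ≡⟨ nat-+ (length (ups S)) ∣ S ∣ ⟨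
          nat (length (ups S) ℕ.+ ∣ S ∣)         ≡⟨ cong nat (ups-length S) ⟩
          nat n                                  ∎
          where open ℚ.≤-Reasoning

        0≤stay : ∀ S → 0ℚ ≤ stay S
        0≤stay S = ≤⇒0≤- (begin
          active ∣ S ∣ * (h * (free G S + nat ∣ S ∣))
            ≤⟨ *-mono (0≤* 0≤moveRate (0≤+ (0≤free G S) (0≤nat ∣ S ∣))) 0≤1 (active≤1 ∣ S ∣) (*-monoˡ h 0≤moveRate (free+size≤n S)) ⟩
          1ℚ * (h * nat n)  ≡⟨ trans (ℚ.*-identityˡ (h * nat n)) h*n ⟩
          ½                 ≤⟨ ≤-by ½ 0≤½ refl ⟩
          1ℚ                ∎)
          where open ℚ.≤-Reasoning

        0≤forward : ∀ {ρ} → (∀ S → 0ℚ ≤ ρ S) → ∀ S → 0ℚ ≤ forward ρ S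
        0≤forward 0≤ρ S = 0≤+ (0≤* (0≤stay S) (0≤ρ S)) (0≤* 0≤moveRate (0≤* (0≤ind G S)
          (0≤sum (downs S) λ S′ → 0≤* (0≤active ∣ S′ ∣) (0≤ρ S′))))

        forward-mono : ∀ {ρ σ} → (∀ S → ρ S ≤ σ S) → ∀ S → forward ρ S ≤ forward σ S
        forward-mono h′ S = ℚ.+-mono-≤ (*-monoˡ (stay S) (0≤stay S) (h′ S)) (*-monoˡ h 0≤moveRate (*-monoˡ (ind G S) (0≤ind G S)
          (sum-mono (downs S) λ S′ → *-monoˡ (active ∣ S′ ∣) (0≤active ∣ S′ ∣) (h′ S′))))

        forward-+ : ∀ ρ σ S → forward (λ S → ρ S + σ S) S ≡ forward ρ S + forward σ S
        forward-+ ρ σ S = trans (cong (λ u → stay S * (ρ S + σ S) + h * (ind G S * u)) (trans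
            (sum-cong (downs S) λ S′ → ℚ.*-distribˡ-+ (active ∣ S′ ∣) (ρ S′) (σ S′))
            (sum-+ (downs S) (λ S′ → active ∣ S′ ∣ * ρ S′) (λ S′ → active ∣ S′ ∣ * σ S′))))
          (lemma (stay S) (ρ S) (σ S) h (ind G S) _ _)
          where
          lemma : ∀ c r s h i u v → c * (r + s) + h * (i * (u + v)) ≡ c * r + h * (i * u) + (c * s + h * (i * v))
          lemma = solve 7 (λ c r s h i u v →
            c ⊗ (r ⊕ s) ⊕ h ⊗ (i ⊗ (u ⊕ v)) ⊜
            c ⊗ r ⊕ h ⊗ (i ⊗ u) ⊕ (c ⊗ s ⊕ h ⊗ (i ⊗ v))) refl

        -- By duality it is enough that the constant 1 does not increase under `backward`; what it
        -- loses is the probability of a removal.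
        sum-forward : ∀ {ρ} → (∀ S → 0ℚ ≤ ρ S) → sum Ss (forward ρ) ≤ sum Ss ρ
        sum-forward {ρ} 0≤ρ = begin
          sum Ss (forward ρ)                      ≡⟨ sum-cong Ss (λ S → ℚ.*-identityʳ (forward ρ S)) ⟨
          sum Ss (λ S → forward ρ S * 1ℚ)         ≡⟨ duality ρ (λ _ → 1ℚ) ⟨
          sum Ss (λ S → ρ S * backward (λ _ → 1ℚ) S) ≤⟨ sum-mono Ss (λ S → subst (ρ S * backward (λ _ → 1ℚ) S ≤_) (ℚ.*-identityʳ (ρ S))
            (*-monoˡ (ρ S) (0≤ρ S) (≤-by (active ∣ S ∣ * (h * nat ∣ S ∣)) (0≤* (0≤active ∣ S ∣) (0≤* 0≤moveRate (0≤nat ∣ S ∣)))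
              (trans (cong (λ u → stay S * 1ℚ + active ∣ S ∣ * (h * u) + active ∣ S ∣ * (h * nat ∣ S ∣))
                (sum-cong (ups S) λ S′ → ℚ.*-identityʳ (ind G S′)))
                (lemma (active ∣ S ∣) h (free G S) (nat ∣ S ∣)))))) ⟩
          sum Ss ρ ∎
          where
          open ℚ.≤-Reasoning
          lemma : ∀ a h F s → (1ℚ - a * (h * (F + s))) * 1ℚ + a * (h * F) + a * (h * s) ≡ 1ℚ
          lemma = solve 4 (λ a h F s → (Κ 1ℚ ⊖ a ⊗ (h ⊗ (F ⊕ s))) ⊗ Κ 1ℚ ⊕ a ⊗ (h ⊗ F) ⊕ a ⊗ (h ⊗ s) ⊜ Κ 1ℚ) refl

        flow : ℕ → (Subset n → ℚ) → Subset n → ℚ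
        flow zero    ρ = ρ
        flow (suc T) ρ = forward (flow T ρ)

        flow-suc : ∀ T ρ → flow T (forward ρ) ≡ forward (flow T ρ)
        flow-suc zero    ρ = refl
        flow-suc (suc T) ρ = cong forward (flow-suc T ρ)

        -- At size `k` both chains are frozen; elsewhere dropping the removals can only lower the
        -- expectation of a nonnegative function.
        run-backward : ∀ T {g} → (∀ S → 0ℚ ≤ g S) → ∀ S → backward (λ S′ → run 0<n G k T S′ g) S ≤ run 0<n G k (suc T) S g
        run-backward T {g} 0≤g S = go (∣ S ∣ ℕ.≟ k)
          where
          f = λ S′ → run 0<n G k T S′ g
          u = sum (ups S) λ S′ → ind G S′ * f S′
          lemma₀ : ∀ x y u f → (1ℚ - 0ℚ * x) * f + 0ℚ * (y * u) ≡ f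
          lemma₀ = solve 4 (λ x y u f → (Κ 1ℚ ⊖ Κ 0ℚ ⊗ x) ⊗ f ⊕ Κ 0ℚ ⊗ (y ⊗ u) ⊜ f) refl
          lemma₁ : ∀ h x u f → (1ℚ - 1ℚ * (h * x)) * f + 1ℚ * (h * u) ≡ (1ℚ - h * x) * f + h * u
          lemma₁ = solve 4 (λ h x u f →
            (Κ 1ℚ ⊖ Κ 1ℚ ⊗ (h ⊗ x)) ⊗ f ⊕ Κ 1ℚ ⊗ (h ⊗ u) ⊜
            (Κ 1ℚ ⊖ h ⊗ x) ⊗ f ⊕ h ⊗ u) refl
          expand : ∀ {c} → active ∣ S ∣ ≡ c → backward f S ≡ (1ℚ - c * (h * (free G S + nat ∣ S ∣))) * f S + c * (h * u)
          expand refl = refl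
          go : Dec (∣ S ∣ ≡ k) → backward f S ≤ run 0<n G k (suc T) S g
          go (yes e) = ℚ.≤-reflexive (trans (expand (trans (cong active e) active-k))
            (trans (lemma₀ (h * (free G S + nat ∣ S ∣)) h u (f S))
              (trans (run-stop 0<n G k T S g e) (sym (run-stop 0<n G k (suc T) S g e)))))
          go (no ¬e) = ℚ.≤-trans (ℚ.≤-reflexive (trans (expand (active-≢ ¬e)) (lemma₁ h (free G S + nat ∣ S ∣) u (f S))))
            (ℚ.≤-trans (𝔼-step-lower 0<n G S f (λ S′ → 0≤run 0<n G k T S′ 0≤g)) (ℚ.≤-reflexive (sym (run-go 0<n G k T S g ¬e))))

        run-flow : ∀ T {ρ g} → (∀ S → 0ℚ ≤ ρ S) → (∀ S → 0ℚ ≤ g S) →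
          sum Ss (λ S → flow T ρ S * g S) ≤ sum Ss (λ S → ρ S * run 0<n G k T S g)
        run-flow zero    {ρ} {g} 0≤ρ 0≤g = ℚ.≤-reflexive (sum-cong Ss λ S → cong (ρ S *_) (sym (run-zero 0<n G k S g)))
        run-flow (suc T) {ρ} {g} 0≤ρ 0≤g = begin
          sum Ss (λ S → forward (flow T ρ) S * g S)
            ≡⟨ cong (λ σ → sum Ss λ S → σ S * g S) (flow-suc T ρ) ⟨
          sum Ss (λ S → flow T (forward ρ) S * g S)
            ≤⟨ run-flow T (0≤forward 0≤ρ) 0≤g ⟩
          sum Ss (λ S → forward ρ S * run 0<n G k T S g)
            ≡⟨ duality ρ (λ S → run 0<n G k T S g) ⟨
          sum Ss (λ S → ρ S * backward (λ S → run 0<n G k T S g) S)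
            ≤⟨ sum-mono Ss (λ S → *-monoˡ (ρ S) (0≤ρ S) (run-backward T 0≤g S)) ⟩
          sum Ss (λ S → ρ S * run 0<n G k (suc T) S g) ∎
          where open ℚ.≤-Reasoning

        reached : ℕ → Subset n → ℚ
        reached t = flow t (λ S → δ S Subset.⊥)

        reached≤run : ∀ T Y → reached T Y ≤ run 0<n G k T Subset.⊥ (λ S → δ S Y)
        reached≤run T Y = subst₂ _≤_
          (trans (sum-cong Ss λ S → ℚ.*-comm (reached T S) (δ S Y)) (sum-δʳ Y (reached T)))
          (sum-δʳ Subset.⊥ (λ S → run 0<n G k T S (λ S → δ S Y)))
          (run-flow T (λ S → 0≤𝟙 (S ≟ₛ Subset.⊥)) (λ S → 0≤𝟙 (S ≟ₛ Y)))

        -- `ideal` spreads the birth chain evenly over the independent sets of each size, with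
        -- deterministic weights. `discrepancy` is its error in one step of the truncated dynamics,
        -- and `deficit` accumulates these errors as they are carried along.
        ideal discrepancy deficit : ℕ → Subset n → ℚ
        ideal t S = prob t ∣ S ∣ * (wt n ∣ S ∣ * ind G S)
        discrepancy t S = active ∣ S ∣ * (h * (ideal t S * (ℚ.∣ free G S - deg n ∣ S ∣ ∣ + nat ∣ S ∣)))
        deficit zero    S = 0ℚ
        deficit (suc t) S = forward (deficit t) S + discrepancy t S

        0≤ideal : ∀ t S → 0ℚ ≤ ideal t S
        0≤ideal t S = 0≤* (0≤prob t ∣ S ∣) (0≤* (0≤wt n ∣ S ∣) (0≤ind G S))

        0≤discrepancy : ∀ t S → 0ℚ ≤ discrepancy t S
        0≤discrepancy t S = 0≤* (0≤active ∣ S ∣) (0≤* 0≤moveRate (0≤* (0≤ideal t S)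
          (0≤+ (ℚ.0≤∣p∣ (free G S - deg n ∣ S ∣)) (0≤nat ∣ S ∣))))

        0≤deficit : ∀ t S → 0ℚ ≤ deficit t S
        0≤deficit zero    S = ℚ.≤-refl
        0≤deficit (suc t) S = 0≤+ (0≤forward (0≤deficit t) S) (0≤discrepancy t S)

        -- An independent set of size `suc j` has `suc j` predecessors, all independent and of equal
        -- ideal density; the recursion of `wt` is made to absorb this factor together with
        -- `deg n j`.
        ideal-inflow : ∀ t S → h * (ind G S * sum (downs S) λ S′ → active ∣ S′ ∣ * ideal t S′)
          ≡ inflow t ∣ S ∣ * (wt n ∣ S ∣ * ind G S)
        ideal-inflow t S = go ∣ S ∣ refl
          where
          open ≡-Reasoning
          go : ∀ j → ∣ S ∣ ≡ j → h * (ind G S * sum (downs S) λ S′ → active ∣ S′ ∣ * ideal t S′)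
            ≡ inflow t j * (wt n j * ind G S)
          go zero    e = trans (cong (λ u → h * (ind G S * u)) (trans
              (sum-downs-cong S λ S′ _ e′ → ⊥-elim (ℕ.1+n≢0 (trans (sym e′) e))) (sum-0 (downs S))))
            (lemma h (ind G S) (wt n 0))
            where
            lemma : ∀ h i w → h * (i * 0ℚ) ≡ 0ℚ * (w * i)
            lemma = solve 3 (λ h i w → h ⊗ (i ⊗ Κ 0ℚ) ⊜ Κ 0ℚ ⊗ (w ⊗ i)) refl
          go (suc j) e = begin
            h * (ind G S * sum (downs S) λ S′ → active ∣ S′ ∣ * ideal t S′)
              ≡⟨ cong (h *_) (sym (sum-*ˡ (downs S) (ind G S) (λ S′ → active ∣ S′ ∣ * ideal t S′))) ⟩
            h * sum (downs S) (λ S′ → ind G S * (active ∣ S′ ∣ * ideal t S′))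
              ≡⟨ cong (h *_) (sum-downs-cong S λ S′ S′⊆S e′ → trans
                   (lemma₁ (ind G S) (active ∣ S′ ∣) (prob t ∣ S′ ∣) (wt n ∣ S′ ∣) (ind G S′))
                   (cong₂ _*_ (cong (λ j → active j * (prob t j * wt n j)) (ℕ.suc-injective (trans (sym e′) e))) (ind-⊆ G S′⊆S))) ⟩
            h * sum (downs S) (λ _ → active j * (prob t j * wt n j) * ind G S)
              ≡⟨ cong (h *_) (trans (sum-const (downs S) (active j * (prob t j * wt n j) * ind G S))
                   (cong (λ l → nat l * (active j * (prob t j * wt n j) * ind G S)) (trans (downs-length S) e))) ⟩
            h * (nat (suc j) * (active j * (prob t j * wt n j) * ind G S))
              ≡⟨ ℚ.*-identityʳ _ ⟨
            h * (nat (suc j) * (active j * (prob t j * wt n j) * ind G S)) * 1ℚ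
              ≡⟨ cong (h * (nat (suc j) * (active j * (prob t j * wt n j) * ind G S)) *_) (*-⁻¹ (0<deg j<n)) ⟨
            h * (nat (suc j) * (active j * (prob t j * wt n j) * ind G S)) * (deg n j * deg n j ⁻¹)
              ≡⟨ lemma₂ h (nat (suc j)) (active j) (prob t j) (wt n j) (ind G S) (deg n j) (deg n j ⁻¹) ⟩
            birth j * prob t j * (wt n j * nat (suc j) * deg n j ⁻¹ * ind G S) ∎
            where
            j<n : j ℕ.< n
            j<n = subst (ℕ._≤ n) e (Subset.∣p∣≤n S)
            lemma₁ : ∀ i a p w i′ → i * (a * (p * (w * i′))) ≡ a * (p * w) * (i′ * i)
            lemma₁ = solve 5 (λ i a p w i′ → i ⊗ (a ⊗ (p ⊗ (w ⊗ i′))) ⊜ a ⊗ (p ⊗ w) ⊗ (i′ ⊗ i)) refl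
            lemma₂ : ∀ h m a p w i d g → h * (m * (a * (p * w) * i)) * (d * g) ≡ a * (h * d) * p * (w * m * g * i)
            lemma₂ = solve 8 (λ h m a p w i d g →
              h ⊗ (m ⊗ (a ⊗ (p ⊗ w) ⊗ i)) ⊗ (d ⊗ g) ⊜
              a ⊗ (h ⊗ d) ⊗ p ⊗ (w ⊗ m ⊗ g ⊗ i)) refl

        -- The inflow matches exactly, so the two evolutions differ only in their holding
        -- probabilities: by the difference of `free` and `deg`, rounded up to its absolute value,
        -- and by the removals.
        ideal-suc : ∀ t S → ideal (suc t) S ≤ forward (ideal t) S + discrepancy t S
        ideal-suc t S = begin
          (prob t j * (1ℚ - birth j) + inflow t j) * (wt n j * ind G S)
            ≡⟨ lemma₁ (prob t j) (active j) (h) (deg n j) (inflow t j) (wt n j * ind G S) (free G S) (nat j) ⟩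
          stay S * ideal t S + inflow t j * (wt n j * ind G S)
            + active j * (h * (ideal t S * (free G S - deg n j + nat j)))
            ≡⟨ cong (λ u → stay S * ideal t S + u + active j * (h * (ideal t S * (free G S - deg n j + nat j)))) (ideal-inflow t S) ⟨
          forward (ideal t) S + active j * (h * (ideal t S * (free G S - deg n j + nat j)))
            ≤⟨ ℚ.+-monoʳ-≤ (forward (ideal t) S) (*-monoˡ (active j) (0≤active j) (*-monoˡ h 0≤moveRate (*-monoˡ (ideal t S) (0≤ideal t S)
                 (ℚ.+-monoˡ-≤ (nat j) (p≤∣p∣ (free G S - deg n j)))))) ⟩
          forward (ideal t) S + discrepancy t S ∎
          where
          open ℚ.≤-Reasoning
          j = ∣ S ∣
          lemma₁ : ∀ p a h d f w F s → (p * (1ℚ - a * (h * d)) + f) * w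
            ≡ (1ℚ - a * (h * (F + s))) * (p * w) + f * w + a * (h * (p * w * (F - d + s)))
          lemma₁ = solve 8 (λ p a h d f w F s →
            (p ⊗ (Κ 1ℚ ⊖ a ⊗ (h ⊗ d)) ⊕ f) ⊗ w ⊜
            (Κ 1ℚ ⊖ a ⊗ (h ⊗ (F ⊕ s))) ⊗ (p ⊗ w) ⊕ f ⊗ w ⊕ a ⊗ (h ⊗ (p ⊗ w ⊗ (F ⊖ d ⊕ s)))) refl

        ideal-zero : ∀ S → ideal 0 S ≤ δ S Subset.⊥
        ideal-zero S = go ∣ S ∣ refl
          where
          go : ∀ j → ∣ S ∣ ≡ j → prob 0 j * (wt n j * ind G S) ≤ δ S Subset.⊥
          go zero    e = subst (1ℚ * (1ℚ * ind G S) ≤_) (sym (𝟙-yes (S ≟ₛ Subset.⊥) (∣S∣≡0⇒S≡⊥ S e)))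
            (ℚ.≤-trans (ℚ.≤-reflexive (trans (ℚ.*-identityˡ _) (ℚ.*-identityˡ _))) (𝟙≤1 (independent? G S)))
          go (suc j) e = subst (_≤ δ S Subset.⊥) (sym (ℚ.*-zeroˡ (wt n (suc j) * ind G S))) (0≤𝟙 (S ≟ₛ Subset.⊥))

        -- Duhamel's principle: one-step errors are propagated by the same positive linear operator.
        ideal≤reached : ∀ t S → ideal t S ≤ reached t S + deficit t S
        ideal≤reached zero    S = ℚ.≤-trans (ideal-zero S) (p≤p+q ℚ.≤-refl)
        ideal≤reached (suc t) S = begin
          ideal (suc t) S
            ≤⟨ ideal-suc t S ⟩
          forward (ideal t) S + discrepancy t S
            ≤⟨ ℚ.+-monoˡ-≤ (discrepancy t S) (forward-mono (ideal≤reached t) S) ⟩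
          forward (λ S → reached t S + deficit t S) S + discrepancy t S
            ≡⟨ trans (cong (_+ discrepancy t S) (forward-+ (reached t) (deficit t) S))
                 (ℚ.+-assoc (reached (suc t) S) (forward (deficit t) S) (discrepancy t S)) ⟩
          reached (suc t) S + deficit (suc t) S ∎
          where open ℚ.≤-Reasoning

        -- The error per birth from size `j`: the relative fluctuation of `free`, and the chance of
        -- order `j / deg n j` that a removal comes first.
        cost : ℕ → ℚ
        cost j = Δ G j + nat j * (deg n j ⁻¹ * mass G j)

        -- Nothing moves at size `k`, and larger sizes have probability 0. Below `k`, pulling
        -- `deg n j` out of both error terms turns the move rate into `birth j` and leaves the
        -- relative errors of `cost`.
        sum-discrepancy : k ℕ.≤ n → ∀ t → sum Ss (discrepancy t) ≡ sum (downFrom k) λ j → birth j * prob t j * cost j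
        sum-discrepancy k≤n t = begin
          sum Ss (discrepancy t)
            ≡⟨ sum-cong Ss restrict ⟩
          sum Ss (λ S → below k S * discrepancy t S)
            ≡⟨ sum-below k (discrepancy t) ⟩
          sum (downFrom k) (λ j → sum Ss λ S → χ j S * discrepancy t S)
            ≡⟨ sum-congᴬ (All.map level (downFrom-< k)) ⟩
          sum (downFrom k) (λ j → birth j * prob t j * cost j) ∎
          where
          open ≡-Reasoning
          restrict : ∀ S → discrepancy t S ≡ below k S * discrepancy t S
          restrict S with ℕ.<-cmp ∣ S ∣ k
          ... | tri< l _ _ = sym (trans (cong (_* discrepancy t S) (𝟙-yes (∣ S ∣ ℕ.<? k) l)) (ℚ.*-identityˡ _))
          ... | tri≈ ¬l e _ = trans
                  (trans (cong (_* (h * (ideal t S * (ℚ.∣ free G S - deg n ∣ S ∣ ∣ + nat ∣ S ∣)))) (trans (cong active e) active-k))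
                    (ℚ.*-zeroˡ (h * (ideal t S * (ℚ.∣ free G S - deg n ∣ S ∣ ∣ + nat ∣ S ∣)))))
                  (sym (trans (cong (_* discrepancy t S) (𝟙-no (∣ S ∣ ℕ.<? k) ¬l)) (ℚ.*-zeroˡ (discrepancy t S))))
          ... | tri> ¬l _ g = trans
                  (trans (cong (λ p → active ∣ S ∣ * (h * (p * (wt n ∣ S ∣ * ind G S) * x))) (prob-> t g)) (lemma (active ∣ S ∣) h (wt n ∣ S ∣ * ind G S) x))
                  (sym (trans (cong (_* discrepancy t S) (𝟙-no (∣ S ∣ ℕ.<? k) ¬l)) (ℚ.*-zeroˡ (discrepancy t S))))
            where
            x = ℚ.∣ free G S - deg n ∣ S ∣ ∣ + nat ∣ S ∣
            lemma : ∀ a h w x → a * (h * (0ℚ * w * x)) ≡ 0ℚ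
            lemma = solve 4 (λ a h w x → a ⊗ (h ⊗ (Κ 0ℚ ⊗ w ⊗ x)) ⊜ Κ 0ℚ) refl
          level : ∀ {j} → j ℕ.< k → sum Ss (λ S → χ j S * discrepancy t S) ≡ birth j * prob t j * cost j
          level {j} j<k = begin
            sum Ss (λ S → χ j S * discrepancy t S)
              ≡⟨ trans (sum-cong Ss λ S → trans (𝟙-cong (∣ S ∣ ℕ.≟ j) (single S)) (lemma₁ (χ j S) (birth j) (prob t j) (wt n j) (ind G S) _))
                   (trans (sum-*ˡ Ss (birth j * prob t j * wt n j) (λ S → χ j S * (ind G S * (dev G j S + nat j * (deg n j ⁻¹ * 1ℚ)))))
                     (ℚ.*-assoc (birth j * prob t j) (wt n j) _)) ⟩
            birth j * prob t j * mean G j (λ S → dev G j S + nat j * (deg n j ⁻¹ * 1ℚ))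
              ≡⟨ cong (birth j * prob t j *_) (trans (mean-+ G j (dev G j) (λ S → nat j * (deg n j ⁻¹ * 1ℚ)))
                   (cong (_+_ (Δ G j)) (trans (mean-*ˡ G j (nat j) (λ _ → deg n j ⁻¹ * 1ℚ)) (cong (nat j *_) (mean-*ˡ G j (deg n j ⁻¹) (λ _ → 1ℚ)))))) ⟩
            birth j * prob t j * cost j ∎
            where
            f = deg n j
            fg≡1 : deg n j * deg n j ⁻¹ ≡ 1ℚ
            fg≡1 = *-⁻¹ (0<deg (ℕ.<-≤-trans j<k k≤n))
            lemma₁ : ∀ x b p w i u → x * (b * (p * w) * (i * u)) ≡ b * p * w * (x * (i * u))
            lemma₁ = solve 6 (λ x b p w i u → x ⊗ (b ⊗ (p ⊗ w) ⊗ (i ⊗ u)) ⊜ b ⊗ p ⊗ w ⊗ (x ⊗ (i ⊗ u))) refl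
            lemma₂ : ∀ F f g → f * (F * g - 1ℚ) ≡ F * (f * g) - f
            lemma₂ = solve 3 (λ F f g → f ⊗ (F ⊗ g ⊖ Κ 1ℚ) ⊜ F ⊗ (f ⊗ g) ⊖ f) refl
            lemma₃ : ∀ s f g → s * (f * g) ≡ f * (s * (g * 1ℚ))
            lemma₃ = solve 3 (λ s f g → s ⊗ (f ⊗ g) ⊜ f ⊗ (s ⊗ (g ⊗ Κ 1ℚ))) refl
            lemma₄ : ∀ a h p w i f x y → a * (h * (p * (w * i) * (f * x + f * y))) ≡ a * (h * f) * (p * w) * (i * (x + y))
            lemma₄ = solve 8 (λ a h p w i f x y →
              a ⊗ (h ⊗ (p ⊗ (w ⊗ i) ⊗ (f ⊗ x ⊕ f ⊗ y))) ⊜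
              a ⊗ (h ⊗ f) ⊗ (p ⊗ w) ⊗ (i ⊗ (x ⊕ y))) refl
            abs : ∀ S → ℚ.∣ free G S - f ∣ ≡ f * dev G j S
            abs S = trans (cong ℚ.∣_∣ (sym (trans (lemma₂ (free G S) f (f ⁻¹)) (cong (_- f) (trans (cong (free G S *_) fg≡1) (ℚ.*-identityʳ (free G S)))))))
              (trans (ℚ.∣p*q∣≡∣p∣*∣q∣ f (ratio G j S - 1ℚ)) (cong (_* dev G j S) (ℚ.0≤p⇒∣p∣≡p (0≤deg n j))))
            single : ∀ S → ∣ S ∣ ≡ j → discrepancy t S ≡ birth j * (prob t j * wt n j) * (ind G S * (dev G j S + nat j * (f ⁻¹ * 1ℚ)))
            single S refl = trans
              (cong₂ (λ x y → active j * (h * (prob t j * (wt n j * ind G S) * (x + y)))) (abs S)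
                (trans (sym (trans (cong (nat j *_) fg≡1) (ℚ.*-identityʳ (nat j)))) (lemma₃ (nat j) f (f ⁻¹))))
              (lemma₄ (active j) h (prob t j) (wt n j) (ind G S) f (dev G j S) (nat j * (f ⁻¹ * 1ℚ)))

        0≤cost : ∀ j → 0ℚ ≤ cost j
        0≤cost j = 0≤+ (0≤Δ G j) (0≤* (0≤nat j) (0≤* (0≤⁻¹ (deg n j)) (0≤mean G j λ _ → 0≤1)))

        -- `forward` does not increase mass, so the discrepancies simply add up over time. Each size
        -- is left at most once, which makes the bound independent of `T`.
        sum-deficit : k ℕ.≤ n → ∀ T → sum Ss (deficit T) ≤ sum (downFrom k) cost
        sum-deficit k≤n T = ℚ.≤-trans (go T) (sum-mono (downFrom k) λ j →
          subst (birth j * occupation T j * cost j ≤_) (ℚ.*-identityˡ (cost j)) (*-monoʳ (0≤cost j) (birth*occupation≤1 T j)))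
          where
          open ℚ.≤-Reasoning
          lemma : ∀ b o p c → b * o * c + b * p * c ≡ b * (o + p) * c
          lemma = solve 4 (λ b o p c → b ⊗ o ⊗ c ⊕ b ⊗ p ⊗ c ⊜ b ⊗ (o ⊕ p) ⊗ c) refl
          go : ∀ T → sum Ss (deficit T) ≤ sum (downFrom k) λ j → birth j * occupation T j * cost j
          go zero    = ℚ.≤-trans (ℚ.≤-reflexive (sum-0 Ss)) (0≤sum (downFrom k) λ j → 0≤* (0≤* (0≤birth j) ℚ.≤-refl) (0≤cost j))
          go (suc T) = begin
            sum Ss (deficit (suc T))
              ≡⟨ sum-+ Ss (forward (deficit T)) (discrepancy T) ⟩
            sum Ss (forward (deficit T)) + sum Ss (discrepancy T)
              ≤⟨ ℚ.+-mono-≤ (ℚ.≤-trans (sum-forward (0≤deficit T)) (go T)) (ℚ.≤-reflexive (sum-discrepancy k≤n T)) ⟩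
            sum (downFrom k) (λ j → birth j * occupation T j * cost j) + sum (downFrom k) (λ j → birth j * prob T j * cost j)
              ≡⟨ trans (sym (sum-+ (downFrom k) (λ j → birth j * occupation T j * cost j) (λ j → birth j * prob T j * cost j)))
                   (sum-cong (downFrom k) λ j → lemma (birth j) (occupation T j) (prob T j) (cost j)) ⟩
            sum (downFrom k) (λ j → birth j * occupation (suc T) j * cost j) ∎

        -- At size `k` the ideal density is `prob T k` times `target`, and the birth chain, absorbed
        -- at `k`, is there with probability `1ℚ - remaining T`.
        run-lower : ∀ T Y → (1ℚ - remaining T) * target k G Y - deficit T Y ≤ run 0<n G k T Subset.⊥ (λ S → δ S Y)
        run-lower T Y = ≤+⇒-≤ _ _ (deficit T Y) (begin
          (1ℚ - remaining T) * (wt n k * (χ k Y * ind G Y))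
            ≡⟨ cong (_* (wt n k * (χ k Y * ind G Y))) (trans (cong (_- remaining T) (sym (cumulative-k T))) (lemma₁ (prob T k) (remaining T))) ⟩
          prob T k * (wt n k * (χ k Y * ind G Y))
            ≡⟨ trans (lemma₂ (prob T k) (wt n k) (χ k Y) (ind G Y)) (sym (χ-cong k Y (λ j → prob T j * (wt n j * ind G Y)))) ⟩
          χ k Y * ideal T Y
            ≤⟨ *-monoʳ (0≤ideal T Y) (𝟙≤1 (∣ Y ∣ ℕ.≟ k)) ⟩
          1ℚ * ideal T Y
            ≡⟨ ℚ.*-identityˡ (ideal T Y) ⟩
          ideal T Y
            ≤⟨ ideal≤reached T Y ⟩
          reached T Y + deficit T Y
            ≤⟨ ℚ.+-monoˡ-≤ (deficit T Y) (reached≤run T Y) ⟩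
          run 0<n G k T Subset.⊥ (λ S → δ S Y) + deficit T Y ∎)
          where
          open ℚ.≤-Reasoning
          lemma₁ : ∀ p r → p + r - r ≡ p
          lemma₁ = solve 2 (λ p r → p ⊕ r ⊖ r ⊜ p) refl
          lemma₂ : ∀ p w x i → p * (w * (x * i)) ≡ x * (p * (w * i))
          lemma₂ = solve 4 (λ p w x i → p ⊗ (w ⊗ (x ⊗ i)) ⊜ x ⊗ (p ⊗ (w ⊗ i))) refl

open UpChain

-- The coupling of the hardcore law with the stopped dynamics.

module Assembly where

  open Data.Rational.Base using (_+_; _*_; _-_; -_; _≤_; _<_)
  open Data.Fin.Subset using (∣_∣)

  module _ {n : ℕ} (0<n : 0 ℕ.< n) (k b : ℕ) (0<k : 0 ℕ.< k) (0<b : 0 ℕ.< b) (b+k≤n : b ℕ.+ k ℕ.≤ n) (G : Graph n) where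

    private
      Ss = subsets n
      b+k≤1+n = ℕ.≤-trans b+k≤n (ℕ.n≤1+n n)
      k≤n : k ℕ.≤ n
      k≤n = ℕ.≤-trans (ℕ.m≤n+m k b) b+k≤n
      D = Δsum G (b ℕ.+ k)
      W = volume {n} k b
      Z = partition G
      z = Z ⁻¹

      0<Wk : 0ℚ < W * nat k
      0<Wk = 0<* (0<volume k k≤n 0<b) (nat-pos 0<k)

    -- The one quantity of the graph that has to be small. It is a combination of nonnegative terms
    -- with deterministic coefficients, so Markov's inequality applies to it directly.
    badness : ℚ
    badness = D + tail G k b b+k≤1+n * (W * nat k) ⁻¹

    module _ (T : ℕ) (q K : ℚ) (bad≤q : badness ≤ q) (q≤½ : q ≤ ½)
      (P≤½ : remaining n k 0<n T ≤ ½) (K≥ : sum (downFrom k) (λ j → nat j * deg n j ⁻¹) ≤ K) where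

      private
        P = remaining n k 0<n T
        V = tail G k b b+k≤1+n
        v = V * (W * nat k) ⁻¹
        -- One `q` each for `θ`, for `mass G k` and for the fluctuations in `deficit`, and two for
        -- the doubled `loss`; `P` is the chance of not having reached `k`, and `2 K` pays for the
        -- removals.
        η = (1ℚ + 1ℚ + 1ℚ + 1ℚ + 1ℚ) * q + P + (1ℚ + 1ℚ) * K

        μ ν : Subset n → ℚ
        μ X = z * ind G X
        ν Y = run 0<n G k T Subset.⊥ λ S → δ S Y

        0≤D : 0ℚ ≤ D
        0≤D = 0≤sum (downFrom (b ℕ.+ k)) (0≤Δ G)

        0≤v : 0ℚ ≤ v
        0≤v = 0≤* (0≤tail G k b b+k≤1+n) (0≤⁻¹ (W * nat k))

        D≤q : D ≤ q
        D≤q = ℚ.≤-trans (p≤p+q 0≤v) bad≤q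

        v≤q : v ≤ q
        v≤q = ℚ.≤-trans (subst (v ≤_) (ℚ.+-comm v D) (p≤p+q 0≤D)) bad≤q

        0≤q : 0ℚ ≤ q
        0≤q = ℚ.≤-trans 0≤D D≤q

        0<Z = 0<partition G
        0≤z = 0≤⁻¹ Z

        0≤W : 0ℚ ≤ W
        0≤W = 0≤sum (downFrom b) λ a → 0≤vol n (a ℕ.+ k)

        V≡ : V ≡ v * (W * nat k)
        V≡ = sym (trans (lemma V ((W * nat k) ⁻¹) (W * nat k)) (*⁻¹-cancel V 0<Wk))
          where
          lemma : ∀ v i w → v * i * w ≡ v * w * i
          lemma = solve 3 (λ v i w → v ⊗ i ⊗ w ⊜ v ⊗ w ⊗ i) refl

        Z≤ : Z ≤ W * (1ℚ + q)
        Z≤ = cancel-≤ (nat-pos 0<k) (begin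
          Z * nat k                                     ≤⟨ partition-upper G k b b+k≤1+n ⟩
          W * (1ℚ + D) * nat k + V                      ≡⟨ cong (_+_ (W * (1ℚ + D) * nat k)) V≡ ⟩
          W * (1ℚ + D) * nat k + v * (W * nat k)        ≡⟨ lemma W D v (nat k) ⟩
          W * (1ℚ + (D + v)) * nat k                    ≤⟨ *-monoʳ (0≤nat k) (*-monoˡ W 0≤W (ℚ.+-monoʳ-≤ 1ℚ bad≤q)) ⟩
          W * (1ℚ + q) * nat k                          ∎)
          where
          open ℚ.≤-Reasoning
          lemma : ∀ w d v k → w * (1ℚ + d) * k + v * (w * k) ≡ w * (1ℚ + (d + v)) * k
          lemma = solve 4 (λ w d v k → w ⊗ (Κ 1ℚ ⊕ d) ⊗ k ⊕ v ⊗ (w ⊗ k) ⊜ w ⊗ (Κ 1ℚ ⊕ (d ⊕ v)) ⊗ k) refl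

        -- The expected number of independent sets in the band relative to the actual partition
        -- function; close to 1 on good graphs.
        θ = z * W

        θ-lower : 1ℚ - q ≤ θ
        θ-lower = subst (1ℚ - q ≤_) (ℚ.*-comm W z) (≤⇒≤*⁻¹ 0<Z (begin
          (1ℚ - q) * Z               ≤⟨ *-monoˡ (1ℚ - q) (≤⇒0≤- (ℚ.≤-trans q≤½ (≤-by ½ 0≤½ refl))) Z≤ ⟩
          (1ℚ - q) * (W * (1ℚ + q))  ≤⟨ ≤-by (W * (q * q)) (0≤* 0≤W (0≤² q)) (lemma W q) ⟩
          W                          ∎))
          where
          open ℚ.≤-Reasoning
          lemma : ∀ w q → (1ℚ - q) * (w * (1ℚ + q)) + w * (q * q) ≡ w
          lemma = solve 2 (λ w q → (Κ 1ℚ ⊖ q) ⊗ (w ⊗ (Κ 1ℚ ⊕ q)) ⊕ w ⊗ (q ⊗ q) ⊜ w) refl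

        θ-upper : θ ≤ 1ℚ + 1ℚ
        θ-upper = subst (_≤ 1ℚ + 1ℚ) (ℚ.*-comm W z) (≤⇒*⁻¹≤ 0<Z (begin
          W                            ≡⟨ lemma W ⟩
          (1ℚ + 1ℚ) * (W * (1ℚ - ½))   ≤⟨ *-monoˡ (1ℚ + 1ℚ) (0≤+ 0≤1 0≤1) (ℚ.≤-trans
            (*-monoˡ W 0≤W (neg-mono 1ℚ (ℚ.≤-trans D≤q q≤½))) (partition-lower G k b b+k≤1+n)) ⟩
          (1ℚ + 1ℚ) * Z                ∎))
          where
          open ℚ.≤-Reasoning
          lemma : ∀ w → w ≡ (1ℚ + 1ℚ) * (w * (1ℚ - ½))
          lemma = solve 1 (λ w → w ⊜ (Κ 1ℚ ⊕ Κ 1ℚ) ⊗ (w ⊗ (Κ 1ℚ ⊖ Κ ½))) refl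

        c = 1ℚ - q - P

        -- A common lower bound for `ν` and for the second marginal of `plan`, hence carrying the
        -- errors of both. `c` lies below both `θ` and `1ℚ - P`; `loss` is doubled because `θ` is
        -- only known to be at most 2.
        lower : Subset n → ℚ
        lower Y = c * target k G Y - ((1ℚ + 1ℚ) * loss k G b Y + deficit n k 0<n G T Y)

        0≤P : 0ℚ ≤ P
        0≤P = 0≤sum (downFrom k) (0≤prob n k 0<n T)

        lower≤ν : ∀ Y → lower Y ≤ ν Y
        lower≤ν Y = begin
          lower Y
            ≤⟨ ≤-by (q * t + (1ℚ + 1ℚ) * l) (0≤+ (0≤* 0≤q (0≤target k G Y)) (0≤* (0≤+ 0≤1 0≤1) (0≤loss k G b Y))) (lemma q P t l d) ⟩
          (1ℚ - P) * t - d
            ≤⟨ run-lower n k 0<n G T Y ⟩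
          ν Y ∎
          where
          open ℚ.≤-Reasoning
          t = target k G Y
          l = loss k G b Y
          d = deficit n k 0<n G T Y
          lemma : ∀ q P t l d → (1ℚ - q - P) * t - ((1ℚ + 1ℚ) * l + d) + (q * t + (1ℚ + 1ℚ) * l) ≡ (1ℚ - P) * t - d
          lemma = solve 5 (λ q P t l d →
            (Κ 1ℚ ⊖ q ⊖ P) ⊗ t ⊖ ((Κ 1ℚ ⊕ Κ 1ℚ) ⊗ l ⊕ d) ⊕ (q ⊗ t ⊕ (Κ 1ℚ ⊕ Κ 1ℚ) ⊗ l) ⊜
            (Κ 1ℚ ⊖ P) ⊗ t ⊖ d) refl

        lower≤plan : ∀ Y → lower Y ≤ sum Ss (λ X → plan k G z 0≤z b X Y)
        lower≤plan Y = begin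
          lower Y
            ≤⟨ ≤-by ((θ - (1ℚ - q)) * t + P * t + (1ℚ + 1ℚ - θ) * l + d)
                 (0≤+ (0≤+ (0≤+ (0≤* (≤⇒0≤- θ-lower) 0≤t) (0≤* 0≤P 0≤t)) (0≤* (≤⇒0≤- θ-upper) (0≤loss k G b Y))) (0≤deficit n k 0<n G T Y))
                 (lemma q P t l d θ) ⟩
          θ * (t - l)
            ≤⟨ plan-column k G z 0≤z b b+k≤1+n Y ⟩
          sum Ss (λ X → plan k G z 0≤z b X Y) ∎
          where
          open ℚ.≤-Reasoning
          t = target k G Y
          l = loss k G b Y
          d = deficit n k 0<n G T Y
          0≤t = 0≤target k G Y
          lemma : ∀ q P t l d θ → (1ℚ - q - P) * t - ((1ℚ + 1ℚ) * l + d)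
            + ((θ - (1ℚ - q)) * t + P * t + (1ℚ + 1ℚ - θ) * l + d) ≡ θ * (t - l)
          lemma = solve 6 (λ q P t l d θ →
            (Κ 1ℚ ⊖ q ⊖ P) ⊗ t ⊖ ((Κ 1ℚ ⊕ Κ 1ℚ) ⊗ l ⊕ d) ⊕ ((θ ⊖ (Κ 1ℚ ⊖ q)) ⊗ t ⊕ P ⊗ t ⊕ (Κ 1ℚ ⊕ Κ 1ℚ ⊖ θ) ⊗ l ⊕ d) ⊜
            θ ⊗ (t ⊖ l)) refl

        sum-cost : sum (downFrom k) (cost n k 0<n G) ≤ q + (1ℚ + 1ℚ) * K
        sum-cost = begin
          sum (downFrom k) (cost n k 0<n G)
            ≡⟨ sum-+ (downFrom k) (Δ G) (λ j → nat j * (deg n j ⁻¹ * mass G j)) ⟩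
          Δsum G k + sum (downFrom k) (λ j → nat j * (deg n j ⁻¹ * mass G j))
            ≤⟨ ℚ.+-mono-≤ (ℚ.≤-trans (Δsum-mono G (ℕ.≤⇒≤′ (ℕ.m≤n+m k b))) D≤q) (sum-monoᴬ (All.map term (downFrom-< k))) ⟩
          q + sum (downFrom k) (λ j → (1ℚ + 1ℚ) * (nat j * deg n j ⁻¹))
            ≡⟨ cong (_+_ q) (sum-*ˡ (downFrom k) (1ℚ + 1ℚ) (λ j → nat j * deg n j ⁻¹)) ⟩
          q + (1ℚ + 1ℚ) * sum (downFrom k) (λ j → nat j * deg n j ⁻¹)
            ≤⟨ ℚ.+-monoʳ-≤ q (*-monoˡ (1ℚ + 1ℚ) (0≤+ 0≤1 0≤1) K≥) ⟩
          q + (1ℚ + 1ℚ) * K ∎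
          where
          open ℚ.≤-Reasoning
          lemma : ∀ j g → j * (g * (1ℚ + 1ℚ)) ≡ (1ℚ + 1ℚ) * (j * g)
          lemma = solve 2 (λ j g → j ⊗ (g ⊗ (Κ 1ℚ ⊕ Κ 1ℚ)) ⊜ (Κ 1ℚ ⊕ Κ 1ℚ) ⊗ (j ⊗ g)) refl
          term : ∀ {j} → j ℕ.< k → nat j * (deg n j ⁻¹ * mass G j) ≤ (1ℚ + 1ℚ) * (nat j * deg n j ⁻¹)
          term {j} j<k = subst (nat j * (deg n j ⁻¹ * mass G j) ≤_) (lemma (nat j) (deg n j ⁻¹))
            (*-monoˡ (nat j) (0≤nat j) (*-monoˡ (deg n j ⁻¹) (0≤⁻¹ (deg n j)) (ℚ.≤-trans (mass-upper G j)
              (ℚ.+-monoʳ-≤ 1ℚ (ℚ.≤-trans (Δsum-mono G (ℕ.≤⇒≤′ (ℕ.≤-trans (ℕ.<⇒≤ j<k) (ℕ.m≤n+m k b))))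
                (ℚ.≤-trans D≤q (ℚ.≤-trans q≤½ (≤-by ½ 0≤½ refl))))))))

        sum-lower : 1ℚ - η ≤ sum Ss lower
        sum-lower = begin
          1ℚ - η
            ≤⟨ ≤-by (q * (q + P)) (0≤* 0≤q (0≤+ 0≤q 0≤P)) (lemma q P K) ⟩
          c * (1ℚ - q) - ((1ℚ + 1ℚ) * q + (q + (1ℚ + 1ℚ) * K))
            ≤⟨ ℚ.+-mono-≤
                 (*-monoˡ c 0≤c (ℚ.≤-trans (≤+⇒-≤ 1ℚ (mass G k) (Δsum G k) (mass-lower G k) ▹) (ℚ.≤-reflexive (sym (sum-target k G)))))
                 (ℚ.neg-antimono-≤ (ℚ.+-mono-≤ (*-monoˡ (1ℚ + 1ℚ) (0≤+ 0≤1 0≤1) (ℚ.≤-trans (sum-loss k G b) D≤q))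
                   (ℚ.≤-trans (sum-deficit n k 0<n G k≤n T) sum-cost))) ⟩
          c * sum Ss (target k G) - ((1ℚ + 1ℚ) * sum Ss (loss k G b) + sum Ss (deficit n k 0<n G T))
            ≡⟨ cong₂ _-_ (sum-*ˡ Ss c (target k G)) (trans (sum-+ Ss (λ Y → (1ℚ + 1ℚ) * loss k G b Y) (deficit n k 0<n G T))
                 (cong (_+ sum Ss (deficit n k 0<n G T)) (sum-*ˡ Ss (1ℚ + 1ℚ) (loss k G b)))) ⟨
          sum Ss (λ Y → c * target k G Y) - sum Ss (λ Y → (1ℚ + 1ℚ) * loss k G b Y + deficit n k 0<n G T Y)
            ≡⟨ sum-- Ss (λ Y → c * target k G Y) (λ Y → (1ℚ + 1ℚ) * loss k G b Y + deficit n k 0<n G T Y) ⟨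
          sum Ss lower ∎
          where
          open ℚ.≤-Reasoning
          _▹ : 1ℚ - Δsum G k ≤ mass G k → 1ℚ - q ≤ mass G k
          _▹ = ℚ.≤-trans (neg-mono 1ℚ (ℚ.≤-trans (Δsum-mono G (ℕ.≤⇒≤′ (ℕ.m≤n+m k b))) D≤q))
          0≤c : 0ℚ ≤ c
          0≤c = subst (0ℚ ≤_) (lemma₂ q P) (0≤+ (≤⇒0≤- q≤½) (≤⇒0≤- P≤½))
            where
            lemma₂ : ∀ q P → ½ - q + (½ - P) ≡ 1ℚ - q - P
            lemma₂ = solve 2 (λ q P → Κ ½ ⊖ q ⊕ (Κ ½ ⊖ P) ⊜ Κ 1ℚ ⊖ q ⊖ P) refl
          lemma : ∀ q P K → 1ℚ - ((1ℚ + 1ℚ + 1ℚ + 1ℚ + 1ℚ) * q + P + (1ℚ + 1ℚ) * K) + q * (q + P)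
            ≡ (1ℚ - q - P) * (1ℚ - q) - ((1ℚ + 1ℚ) * q + (q + (1ℚ + 1ℚ) * K))
          lemma = solve 3 (λ q P K →
            Κ 1ℚ ⊖ ((Κ 1ℚ ⊕ Κ 1ℚ ⊕ Κ 1ℚ ⊕ Κ 1ℚ ⊕ Κ 1ℚ) ⊗ q ⊕ P ⊕ (Κ 1ℚ ⊕ Κ 1ℚ) ⊗ K) ⊕ q ⊗ (q ⊕ P) ⊜
            (Κ 1ℚ ⊖ q ⊖ P) ⊗ (Κ 1ℚ ⊖ q) ⊖ ((Κ 1ℚ ⊕ Κ 1ℚ) ⊗ q ⊕ (q ⊕ (Κ 1ℚ ⊕ Κ 1ℚ) ⊗ K))) refl

        ∑μ≡1 : sum Ss μ ≡ 1ℚ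
        ∑μ≡1 = trans (sum-*ˡ Ss z (ind G)) (trans (ℚ.*-comm z Z) (*-⁻¹ 0<Z))

        sum-run : ∀ (g : Subset n → ℚ) → sum Ss (λ Y → ν Y * g Y) ≡ run 0<n G k T Subset.⊥ g
        sum-run g = trans
          (sum-cong Ss λ Y → sym (𝔼-*ʳ (glauberPath G Subset.⊥ T) (g Y) (λ path → δ (lookup path (stoppingTime k path)) Y)))
          (trans (sym (𝔼-sum (glauberPath G Subset.⊥ T) Ss (λ path Y → δ (lookup path (stoppingTime k path)) Y * g Y)))
            (𝔼-cong (glauberPath G Subset.⊥ T) λ path → sum-δ (lookup path (stoppingTime k path)) g))

        ∑ν≡1 : sum Ss ν ≡ 1ℚ
        ∑ν≡1 = trans (sum-cong Ss λ Y → sym (ℚ.*-identityʳ (ν Y))) (trans (sum-run (λ _ → 1ℚ)) (𝔼-path-const 0<n G k T Subset.⊥ 1ℚ))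

        0≤ν : ∀ Y → 0ℚ ≤ ν Y
        0≤ν Y = 0≤run 0<n G k T Subset.⊥ λ S → 0≤𝟙 (S ≟ₛ Y)

      good-coupling : RationalCoupling μ ν
      good-coupling = coupling μ ν 0≤ν ∑μ≡1 ∑ν≡1 (plan k G z 0≤z b) (0≤plan k G z 0≤z b)
        (plan-row k G z 0≤z b) lower lower≤plan lower≤ν

      overlap-lower : (1ℚ - η) * nat k ≤ sum Ss λ X → sum Ss λ Y → RationalCoupling.joint good-coupling X Y * nat ∣ X ∩ Y ∣
      overlap-lower = ℚ.≤-trans (*-monoʳ (0≤nat k) sum-lower)
        (coupling-≥ μ ν 0≤ν ∑μ≡1 ∑ν≡1 (plan k G z 0≤z b) (0≤plan k G z 0≤z b)
          (plan-row k G z 0≤z b) lower lower≤plan lower≤ν (nat k) (λ X Y → nat ∣ X ∩ Y ∣)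
          (0≤nat k) (λ X Y → 0≤nat ∣ X ∩ Y ∣) (plan-support k G z 0≤z b))

      -- Sets in the band have size at most `b + k`; all others contribute at most `θ * v * nat k`,
      -- with `θ ≤ 2` and `v ≤ q`.
      size-hardcore : sum Ss (λ X → μ X * nat ∣ X ∣) ≤ nat (b ℕ.+ k) + (1ℚ + 1ℚ) * q * nat k
      size-hardcore = begin
        sum Ss (λ X → z * ind G X * nat ∣ X ∣)
          ≡⟨ trans (sum-cong Ss λ X → ℚ.*-assoc z (ind G X) (nat ∣ X ∣)) (sum-*ˡ Ss z (λ X → ind G X * nat ∣ X ∣)) ⟩
        z * sum Ss (λ X → ind G X * nat ∣ X ∣)
          ≤⟨ *-monoˡ z 0≤z (total-size G k b b+k≤1+n) ⟩
        z * (nat (b ℕ.+ k) * Z + V)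
          ≡⟨ trans (cong (λ u → z * (nat (b ℕ.+ k) * Z + u)) V≡) (lemma z (nat (b ℕ.+ k)) Z v W (nat k)) ⟩
        nat (b ℕ.+ k) * (Z * z) + θ * v * nat k
          ≡⟨ cong (λ u → nat (b ℕ.+ k) * u + θ * v * nat k) (*-⁻¹ 0<Z) ⟩
        nat (b ℕ.+ k) * 1ℚ + θ * v * nat k
          ≤⟨ ℚ.+-mono-≤ (ℚ.≤-reflexive (ℚ.*-identityʳ (nat (b ℕ.+ k)))) (*-monoʳ (0≤nat k) (*-mono 0≤v (0≤+ 0≤1 0≤1) θ-upper v≤q)) ⟩
        nat (b ℕ.+ k) + (1ℚ + 1ℚ) * q * nat k ∎
        where
        open ℚ.≤-Reasoning
        lemma : ∀ z m Z v W k → z * (m * Z + v * (W * k)) ≡ m * (Z * z) + z * W * v * k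
        lemma = solve 6 (λ z m Z v W k → z ⊗ (m ⊗ Z ⊕ v ⊗ (W ⊗ k)) ⊜ m ⊗ (Z ⊗ z) ⊕ z ⊗ W ⊗ v ⊗ k) refl

      size-glauber : sum Ss (λ Y → ν Y * nat ∣ Y ∣) ≤ nat k
      size-glauber = ℚ.≤-trans (ℚ.≤-reflexive (sum-run (nat ∘ ∣_∣)))
        (run-size 0<n G k T Subset.⊥ (ℕ.≤-trans (ℕ.≤-reflexive (Subset.∣⊥∣≡0 n)) z≤n))

open Assembly

-- From the mean overlap of a coupling to the Wasserstein distance.

module Wasserstein where

  open Data.Rational.Base using (_+_; _*_; _-_; -_; _≤_; _<_)
  open Data.Fin.Subset using (∣_∣)

  -- Real operations act on approximations index by index, so the transport cost is estimated
  -- through a rational formula at each index.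
  approx-∑ : ∀ {A : Set} (xs : List A) (f : A → ℝ) m → approx (Defs.∑ xs f) m ≡ sum xs λ x → approx (f x) m
  approx-∑ []       f m = refl
  approx-∑ (x ∷ xs) f m = cong (_+_ (approx (f x) m)) (approx-∑ xs f m)

  4ℚ 8ℚ 16ℚ : ℚ
  4ℚ  = frac 4 0
  8ℚ  = frac 8 0
  16ℚ = frac 16 0

  approx-∑∑ : ∀ {A B : Set} (xs : List A) (ys : List B) (f : A → B → ℝ) m →
    approx (Defs.∑ xs λ x → Defs.∑ ys (f x)) m ≡ sum xs λ x → sum ys λ y → approx (f x y) m
  approx-∑∑ xs ys f m = trans (approx-∑ xs (λ x → Defs.∑ ys (f x)) m) (sum-cong xs λ x → approx-∑ ys (f x) m)

  pointwise-≤ : ∀ {x y} → (∀ m → approx x m ≤ approx y m) → x Defs.≤ y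
  pointwise-≤ h δ 0<δ = 0 , λ m _ → ℚ.≤-trans (h m) (p≤p+q (ℚ.<⇒≤ 0<δ))

  pointwise-≈ : ∀ {x y} → (∀ m → approx x m ≡ approx y m) → x Defs.≈ y
  pointwise-≈ {x} {y} h = pointwise-≤ {x} {y} (λ m → ℚ.≤-reflexive (h m)) , pointwise-≤ {y} {x} (λ m → ℚ.≤-reflexive (sym (h m)))

  square-cancel-≤ : ∀ {p q} → 0ℚ ≤ q → p * p ≤ q * q → p ≤ q
  square-cancel-≤ {p} {q} 0≤q h = ℚ.≮⇒≥ λ q<p → ℚ.<-irrefl refl (ℚ.≤-<-trans h
    (ℚ.≤-<-trans (*-monoˡ q 0≤q (ℚ.<⇒≤ q<p)) (ℚ.*-monoˡ-<-pos p {{ℚ.positive (ℚ.≤-<-trans 0≤q q<p)}} q<p)))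

  bit : ∀ {n} → Subset n → Fin n → ℚ
  bit S i = if lookup S i then 1ℚ else 0ℚ

  approx-indicator : ∀ {n} (S : Subset n) i m → approx (indicator S i) m ≡ bit S i
  approx-indicator S i m with lookup S i
  ... | true  = refl
  ... | false = refl

  sum-bits : ∀ {n} (S S′ : Subset n) → sum (allFin n) (λ i → bit S i * bit S′ i) ≡ nat ∣ S ∩ S′ ∣
  sum-bits []      []        = refl
  sum-bits {suc n} (b ∷ S) (b′ ∷ S′) = trans (sum-allFin n (λ i → bit (b ∷ S) i * bit (b′ ∷ S′) i))
    (trans (cong (_+_ (bit (b ∷ S) zero * bit (b′ ∷ S′) zero)) (sum-bits S S′)) (first b b′))
    where
    first : ∀ b b′ → bit (b ∷ S) zero * bit (b′ ∷ S′) zero + nat ∣ S ∩ S′ ∣ ≡ nat ∣ (b ∷ S) ∩ (b′ ∷ S′) ∣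
    first true  true  = refl
    first true  false = ℚ.+-identityˡ _
    first false true  = ℚ.+-identityˡ _
    first false false = ℚ.+-identityˡ _

  sum-bits² : ∀ {n} (S : Subset n) → sum (allFin n) (λ i → bit S i * bit S i) ≡ nat ∣ S ∣
  sum-bits² S = trans (sum-bits S S) (cong nat (∣S∩S∣ S))

  root-bound : ∀ r t → 0ℚ ≤ r → 0ℚ ≤ t → t ≤ ½ → 1ℚ ≤ (r + t) * (r + t) → ½ ≤ r
  root-bound r t 0≤r 0≤t t≤½ h = ℚ.≤-trans (neg-mono 1ℚ t≤½)
    (≤+⇒-≤ 1ℚ r t (square-cancel-≤ {1ℚ} {r + t} (0≤+ 0≤r 0≤t) h))

  inverse-bound : ∀ a r → 0ℚ ≤ a → ½ ≤ r → r * a ≡ 1ℚ → a ≤ 1ℚ + 1ℚ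
  inverse-bound a r 0≤a ½≤r ra≡1 = cancel-≤ {a} {1ℚ + 1ℚ} 0<½ (begin
    a * ½   ≤⟨ *-monoˡ a 0≤a ½≤r ⟩
    a * r   ≡⟨ trans (ℚ.*-comm a r) ra≡1 ⟩
    1ℚ      ∎)
    where open ℚ.≤-Reasoning

  -- Here `r` approximates the root of `A` from below with error `t`, and `a` is its reciprocal. The
  -- normalized second moment then exceeds 1 only by the discretization error.
  square-bound : ∀ A a r t → 0ℚ ≤ a → 0ℚ ≤ t → t ≤ 1ℚ → a ≤ 1ℚ + 1ℚ → r * a ≡ 1ℚ →
    A ≤ (r + t) * (r + t) → a * a * A ≤ 1ℚ + 8ℚ * t
  square-bound A a r t 0≤a 0≤t t≤1 a≤2 ra≡1 A≤ = begin
    a * a * A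
      ≤⟨ *-monoˡ (a * a) (0≤² a) A≤ ⟩
    a * a * ((r + t) * (r + t))
      ≡⟨ lemma₁ a r t ⟩
    (r * a + a * t) * (r * a + a * t)
      ≡⟨ cong (λ u → (u + a * t) * (u + a * t)) ra≡1 ⟩
    (1ℚ + a * t) * (1ℚ + a * t)
      ≤⟨ *-mono 0≤1+at (ℚ.≤-trans 0≤1+at 1+at≤) 1+at≤ 1+at≤ ⟩
    (1ℚ + (1ℚ + 1ℚ) * t) * (1ℚ + (1ℚ + 1ℚ) * t)
      ≤⟨ ≤-by (4ℚ * t * (1ℚ - t)) (0≤* (0≤* (ℚ.nonNegative⁻¹ 4ℚ) 0≤t) (≤⇒0≤- t≤1)) (lemma₂ t) ⟩
    1ℚ + 8ℚ * t ∎
    where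
    open ℚ.≤-Reasoning
    0≤1+at = 0≤+ 0≤1 (0≤* 0≤a 0≤t)
    1+at≤ : 1ℚ + a * t ≤ 1ℚ + (1ℚ + 1ℚ) * t
    1+at≤ = ℚ.+-monoʳ-≤ 1ℚ (*-monoʳ 0≤t a≤2)
    lemma₁ : ∀ a r t → a * a * ((r + t) * (r + t)) ≡ (r * a + a * t) * (r * a + a * t)
    lemma₁ = solve 3 (λ a r t → a ⊗ a ⊗ ((r ⊕ t) ⊗ (r ⊕ t)) ⊜ (r ⊗ a ⊕ a ⊗ t) ⊗ (r ⊗ a ⊕ a ⊗ t)) refl
    lemma₂ : ∀ t → (1ℚ + (1ℚ + 1ℚ) * t) * (1ℚ + (1ℚ + 1ℚ) * t) + 4ℚ * t * (1ℚ - t) ≡ 1ℚ + 8ℚ * t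
    lemma₂ = solve 1 (λ t →
      (Κ 1ℚ ⊕ (Κ 1ℚ ⊕ Κ 1ℚ) ⊗ t) ⊗ (Κ 1ℚ ⊕ (Κ 1ℚ ⊕ Κ 1ℚ) ⊗ t) ⊕ Κ 4ℚ ⊗ t ⊗ (Κ 1ℚ ⊖ t) ⊜
      Κ 1ℚ ⊕ Κ 8ℚ ⊗ t) refl

  -- From `2 r s ≤ r² + s² ≤ A + B`. The geometric mean of `A` and `B` in the cross term of the cost
  -- gives way to the arithmetic mean, which is rational.
  product-bound : ∀ A B a b r s → 0ℚ ≤ a → 0ℚ ≤ b → 0ℚ < A + B → r * a ≡ 1ℚ → s * b ≡ 1ℚ →
    r * r ≤ A → s * s ≤ B → (1ℚ + 1ℚ) * (A + B) ⁻¹ ≤ a * b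
  product-bound A B a b r s 0≤a 0≤b 0<A+B ra≡1 sb≡1 r²≤A s²≤B = ≤⇒*⁻¹≤ {1ℚ + 1ℚ} {a * b} {A + B} 0<A+B (begin
    (1ℚ + 1ℚ) * (1ℚ * 1ℚ)
      ≡⟨ cong₂ (λ u v → (1ℚ + 1ℚ) * (u * v)) ra≡1 sb≡1 ⟨
    (1ℚ + 1ℚ) * (r * a * (s * b))
      ≡⟨ lemma₁ r s a b ⟩
    a * b * ((1ℚ + 1ℚ) * (r * s))
      ≤⟨ *-monoˡ (a * b) (0≤* 0≤a 0≤b) (≤-by ((r - s) * (r - s)) (0≤² (r - s)) (lemma₂ r s)) ⟩
    a * b * (r * r + s * s)
      ≤⟨ *-monoˡ (a * b) (0≤* 0≤a 0≤b) (ℚ.+-mono-≤ r²≤A s²≤B) ⟩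
    a * b * (A + B) ∎)
    where
    open ℚ.≤-Reasoning
    lemma₁ : ∀ r s a b → (1ℚ + 1ℚ) * (r * a * (s * b)) ≡ a * b * ((1ℚ + 1ℚ) * (r * s))
    lemma₁ = solve 4 (λ r s a b → (Κ 1ℚ ⊕ Κ 1ℚ) ⊗ (r ⊗ a ⊗ (s ⊗ b)) ⊜ a ⊗ b ⊗ ((Κ 1ℚ ⊕ Κ 1ℚ) ⊗ (r ⊗ s))) refl
    lemma₂ : ∀ r s → (1ℚ + 1ℚ) * (r * s) + (r - s) * (r - s) ≡ r * r + s * s
    lemma₂ = solve 2 (λ r s → (Κ 1ℚ ⊕ Κ 1ℚ) ⊗ (r ⊗ s) ⊕ (r ⊖ s) ⊗ (r ⊖ s) ⊜ r ⊗ r ⊕ s ⊗ s) refl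

  -- Each of the two normalized second moments has an error `8 t`. Together they make `16 t ≤ ε²`,
  -- and `e² + ε²` is at most `(e + ε)²`.
  cost-bound : ∀ A B C a b t e ε → 0ℚ ≤ C → 0ℚ ≤ e → 0ℚ ≤ ε →
    a * a * A ≤ 1ℚ + 8ℚ * t → b * b * B ≤ 1ℚ + 8ℚ * t → (1ℚ + 1ℚ) * (A + B) ⁻¹ ≤ a * b →
    t ≤ ε * ε * 16ℚ ⁻¹ → (1ℚ + 1ℚ) - 4ℚ * C * (A + B) ⁻¹ ≤ e * e →
    a * a * A + b * b * B - (1ℚ + 1ℚ) * (a * b) * C ≤ (e + ε) * (e + ε)
  cost-bound A B C a b t e ε 0≤C 0≤e 0≤ε a²A b²B ab t≤ h = begin
    a * a * A + b * b * B - (1ℚ + 1ℚ) * (a * b) * C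
      ≤⟨ ℚ.+-mono-≤ (ℚ.+-mono-≤ a²A b²B)
           (ℚ.neg-antimono-≤ (*-monoʳ 0≤C (*-monoˡ (1ℚ + 1ℚ) (0≤+ 0≤1 0≤1) ab))) ⟩
    1ℚ + 8ℚ * t + (1ℚ + 8ℚ * t) - (1ℚ + 1ℚ) * ((1ℚ + 1ℚ) * i) * C
      ≡⟨ lemma₁ t C i ⟩
    (1ℚ + 1ℚ) - 4ℚ * C * i + 16ℚ * t
      ≤⟨ ℚ.+-mono-≤ h (*-monoˡ 16ℚ (ℚ.nonNegative⁻¹ 16ℚ) t≤) ⟩
    e * e + 16ℚ * (ε * ε * 16ℚ ⁻¹)
      ≡⟨ cong (_+_ (e * e)) (trans (lemma₃ 16ℚ (ε * ε) (16ℚ ⁻¹)) (trans (cong (ε * ε *_) (*-⁻¹ (ℚ.positive⁻¹ 16ℚ))) (ℚ.*-identityʳ (ε * ε)))) ⟩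
    e * e + ε * ε
      ≤⟨ ≤-by ((1ℚ + 1ℚ) * (e * ε)) (0≤* (0≤+ 0≤1 0≤1) (0≤* 0≤e 0≤ε)) (lemma₂ e ε) ⟩
    (e + ε) * (e + ε) ∎
    where
    open ℚ.≤-Reasoning
    i = (A + B) ⁻¹
    lemma₁ : ∀ t C i → 1ℚ + 8ℚ * t + (1ℚ + 8ℚ * t) - (1ℚ + 1ℚ) * ((1ℚ + 1ℚ) * i) * C
      ≡ (1ℚ + 1ℚ) - 4ℚ * C * i + 16ℚ * t
    lemma₁ = solve 3 (λ t C i →
      Κ 1ℚ ⊕ Κ 8ℚ ⊗ t ⊕ (Κ 1ℚ ⊕ Κ 8ℚ ⊗ t) ⊖ (Κ 1ℚ ⊕ Κ 1ℚ) ⊗ ((Κ 1ℚ ⊕ Κ 1ℚ) ⊗ i) ⊗ C ⊜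
      (Κ 1ℚ ⊕ Κ 1ℚ) ⊖ Κ 4ℚ ⊗ C ⊗ i ⊕ Κ 16ℚ ⊗ t) refl
    lemma₂ : ∀ e ε → e * e + ε * ε + (1ℚ + 1ℚ) * (e * ε) ≡ (e + ε) * (e + ε)
    lemma₂ = solve 2 (λ e ε → e ⊗ e ⊕ ε ⊗ ε ⊕ (Κ 1ℚ ⊕ Κ 1ℚ) ⊗ (e ⊗ ε) ⊜ (e ⊕ ε) ⊗ (e ⊕ ε)) refl
    lemma₃ : ∀ s ε i → s * (ε * i) ≡ ε * (s * i)
    lemma₃ = solve 3 (λ s ε i → s ⊗ (ε ⊗ i) ⊜ ε ⊗ (s ⊗ i)) refl

  √-approx : ∀ x {q} m → approx x m ≡ q → approx (√ x) m ≡ frac (√-index m q) m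
  √-approx x m refl = refl

  inv-approx : ∀ x 0<x {q} m → approx x m ≡ q → approx (inv x 0<x) m ≡ recip (proj₁ 0<x) (proj₁ (proj₂ 0<x)) q
  inv-approx x 0<x m refl = refl

  approx-* : ∀ x y {p q} m → approx x m ≡ p → approx y m ≡ q → approx (x Defs.* y) m ≡ p * q
  approx-* x y m refl refl = refl

  approx-- : ∀ x y {p q} m → approx x m ≡ p → approx y m ≡ q → approx (x Defs.- y) m ≡ p - q
  approx-- x y m refl refl = refl

  approx-norm : ∀ {n} (x : Fin n → ℝ) {f : Fin n → ℚ} m → (∀ i → approx (x i) m ≡ f i) →
    approx ‖ x ‖² m ≡ sum (allFin n) λ i → f i * f i
  approx-norm {n} x m h = trans (approx-∑ (allFin n) (λ i → x i Defs.* x i) m)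
    (sum-cong (allFin n) λ i → approx-* (x i) (x i) m (h i) (h i))

  approx-difference : ∀ {n} (S S′ : Subset n) i a b m →
    approx (indicator S i Defs.* a Defs.- indicator S′ i Defs.* b) m ≡ bit S i * approx a m - bit S′ i * approx b m
  approx-difference S S′ i a b m = approx-- (indicator S i Defs.* a) (indicator S′ i Defs.* b) m
    (approx-* (indicator S i) a m (approx-indicator S i m) refl)
    (approx-* (indicator S′ i) b m (approx-indicator S′ i m) refl)

  √-≤ : ∀ x m q → 0ℚ ≤ q → approx x m ≤ q * q → approx (√ x) m ≤ q
  √-≤ x m q 0≤q h = square-cancel-≤ 0≤q (ℚ.≤-trans (√-lower m (approx x m)) (ℚ.⊔-lub (0≤² q) h))

  module Root {A : ℚ} (1≤A : 1ℚ ≤ A) where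

    abstract
      root inverse : ℕ → ℚ
      root m = frac (√-index m A) m
      inverse m = recip ½ 0<½ (root m)

      √-root : ∀ x m → approx x m ≡ A → approx (√ x) m ≡ root m
      √-root x m = √-approx x m

      inv-inverse : ∀ x (h : ∃ λ N → ∀ n → N ℕ.≤ n → 0ℚ + ½ ≤ approx x n) m →
        approx x m ≡ root m → approx (inv x (½ , 0<½ , h)) m ≡ inverse m
      inv-inverse x h m = inv-approx x (½ , 0<½ , h) m

      0≤root : ∀ m → 0ℚ ≤ root m
      0≤root m = 0≤frac (√-index m A) m

      root² : ∀ m → root m * root m ≤ A
      root² m = ℚ.≤-trans (√-lower m A) (ℚ.≤-reflexive (ℚ.p≤q⇒p⊔q≡q (ℚ.≤-trans 0≤1 1≤A)))

      root-upper : ∀ m → A ≤ (root m + frac 1 m) * (root m + frac 1 m)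
      root-upper m = ℚ.≤-trans (ℚ.p≤q⊔p 0ℚ A) (√-upper m A)

      0≤inverse : ∀ m → 0ℚ ≤ inverse m
      0≤inverse m = recip-nonNeg ½ 0<½ (root m)

      truncated-inverse : ∀ m → (½ ℚ.⊔ root m) * inverse m ≡ 1ℚ
      truncated-inverse m = recip-inverse ½ 0<½ (root m)

    -- The root of `A ≥ 1` is approximated within `1 / (m + 1) ≤ ½`. So from index 1 on the cut-off
    -- `½` inside the reciprocal has no effect.
    ½≤root : ∀ m → 1 ℕ.≤ m → ½ ≤ root m
    ½≤root m 1≤m = root-bound (root m) (frac 1 m) (0≤root m) (0≤frac 1 m)
      (frac-mono {1} {m} {1} {1} (ℕ.*-monoʳ-≤ 1 (s≤s 1≤m))) (ℚ.≤-trans 1≤A (root-upper m))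

    root*inverse : ∀ m → 1 ℕ.≤ m → root m * inverse m ≡ 1ℚ
    root*inverse m 1≤m = trans (cong (_* inverse m) (sym (ℚ.p≤q⇒p⊔q≡q {½} {root m} (½≤root m 1≤m))))
      (truncated-inverse m)

    inverse≤2 : ∀ m → 1 ℕ.≤ m → inverse m ≤ 1ℚ + 1ℚ
    inverse≤2 m 1≤m = inverse-bound (inverse m) (root m) (0≤inverse m) (½≤root m 1≤m) (root*inverse m 1≤m)

    inverse²*A : ∀ m → 1 ℕ.≤ m → inverse m * inverse m * A ≤ 1ℚ + 8ℚ * frac 1 m
    inverse²*A m 1≤m = square-bound A (inverse m) (root m) (frac 1 m) (0≤inverse m) (0≤frac 1 m)
      (frac-mono {1} {m} {1} {0} (s≤s z≤n)) (inverse≤2 m 1≤m) (root*inverse m 1≤m) (root-upper m)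

  inverse*inverse : ∀ {A B} (1≤A : 1ℚ ≤ A) (1≤B : 1ℚ ≤ B) m → 1 ℕ.≤ m →
    (1ℚ + 1ℚ) * (A + B) ⁻¹ ≤ Root.inverse 1≤A m * Root.inverse 1≤B m
  inverse*inverse {A} {B} 1≤A 1≤B m 1≤m = product-bound A B (inverse 1≤A m) (inverse 1≤B m) (root 1≤A m) (root 1≤B m)
    (0≤inverse 1≤A m) (0≤inverse 1≤B m)
    (ℚ.<-≤-trans (ℚ.positive⁻¹ 1ℚ) (ℚ.≤-trans 1≤A (p≤p+q (ℚ.≤-trans 0≤1 1≤B))))
    (root*inverse 1≤A m 1≤m) (root*inverse 1≤B m 1≤m) (root² 1≤A m) (root² 1≤B m)
    where open Root

  module _ {n : ℕ} (M N : Subset n → ℝ) (0<rmsM : 0ℝ Defs.< rms M) (0<rmsN : 0ℝ Defs.< rms N) where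

    private
      a = inv (rms M) 0<rmsM
      b = inv (rms N) 0<rmsN

    squaredCost : Coupling M N → ℝ
    squaredCost π = Defs.∑ (subsets n) λ S → Defs.∑ (subsets n) λ S′ → Coupling.joint π S S′ Defs.*
      ‖ (λ i → indicator S i Defs.* inv (rms M) 0<rmsM Defs.- indicator S′ i Defs.* inv (rms N) 0<rmsN) ‖²

    transportCost-≤ : ∀ π m q → 0ℚ ≤ q → approx (squaredCost π) m ≤ q * q →
      approx (transportCost M N 0<rmsM 0<rmsN π) m ≤ q
    transportCost-≤ π m q 0≤q h = unfold (√-≤ (squaredCost π) m q 0≤q h)
      where
      unfold : approx (√ (squaredCost π)) m ≤ q → approx (transportCost M N 0<rmsM 0<rmsN π) m ≤ q
      unfold h = h

    squaredCost-approx : ∀ π m → approx (squaredCost π) m ≡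
      sum (subsets n) λ S → sum (subsets n) λ S′ → approx (Coupling.joint π S S′) m *
        sum (allFin n) λ i → (bit S i * approx a m - bit S′ i * approx b m) * (bit S i * approx a m - bit S′ i * approx b m)
    squaredCost-approx π m = trans
      (approx-∑∑ (subsets n) (subsets n) (λ S S′ → Coupling.joint π S S′ Defs.*
        ‖ (λ i → indicator S i Defs.* inv (rms M) 0<rmsM Defs.- indicator S′ i Defs.* inv (rms N) 0<rmsN) ‖²) m)
      (sum-cong (subsets n) λ S → sum-cong (subsets n) λ S′ → approx-* (Coupling.joint π S S′)
        ‖ (λ i → indicator S i Defs.* inv (rms M) 0<rmsM Defs.- indicator S′ i Defs.* inv (rms N) 0<rmsN) ‖² m refl
        (approx-norm (λ i → indicator S i Defs.* inv (rms M) 0<rmsM Defs.- indicator S′ i Defs.* inv (rms N) 0<rmsN) m λ i →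
          approx-difference S S′ i (inv (rms M) 0<rmsM) (inv (rms N) 0<rmsN) m))

  expand-square : ∀ {n} (S S′ : Subset n) a b →
    sum (allFin n) (λ i → (bit S i * a - bit S′ i * b) * (bit S i * a - bit S′ i * b))
      ≡ a * a * nat ∣ S ∣ + b * b * nat ∣ S′ ∣ + - (1ℚ + 1ℚ) * (a * b) * nat ∣ S ∩ S′ ∣
  expand-square {n} S S′ a b = begin
    sum (allFin n) (λ i → (bit S i * a - bit S′ i * b) * (bit S i * a - bit S′ i * b))
      ≡⟨ sum-cong (allFin n) (λ i → lemma (bit S i) (bit S′ i) a b) ⟩
    sum (allFin n) (λ i → f i + g i + h i)
      ≡⟨ trans (sum-+ (allFin n) (λ i → f i + g i) h) (cong (_+ sum (allFin n) h) (sum-+ (allFin n) f g)) ⟩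
    sum (allFin n) f + sum (allFin n) g + sum (allFin n) h
      ≡⟨ cong₂ _+_ (cong₂ _+_
           (trans (sum-*ˡ (allFin n) (a * a) (λ i → bit S i * bit S i)) (cong (a * a *_) (sum-bits² S)))
           (trans (sum-*ˡ (allFin n) (b * b) (λ i → bit S′ i * bit S′ i)) (cong (b * b *_) (sum-bits² S′))))
           (trans (sum-*ˡ (allFin n) (- (1ℚ + 1ℚ) * (a * b)) (λ i → bit S i * bit S′ i))
             (cong (- (1ℚ + 1ℚ) * (a * b) *_) (sum-bits S S′))) ⟩
    a * a * nat ∣ S ∣ + b * b * nat ∣ S′ ∣ + - (1ℚ + 1ℚ) * (a * b) * nat ∣ S ∩ S′ ∣ ∎
    where
    open ≡-Reasoning
    f g h : Fin n → ℚ
    f i = a * a * (bit S i * bit S i)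
    g i = b * b * (bit S′ i * bit S′ i)
    h i = - (1ℚ + 1ℚ) * (a * b) * (bit S i * bit S′ i)
    lemma : ∀ x y a b → (x * a - y * b) * (x * a - y * b) ≡ a * a * (x * x) + b * b * (y * y) + - (1ℚ + 1ℚ) * (a * b) * (x * y)
    lemma = solve 4 (λ x y a b →
      (x ⊗ a ⊖ y ⊗ b) ⊗ (x ⊗ a ⊖ y ⊗ b) ⊜
      a ⊗ a ⊗ (x ⊗ x) ⊕ b ⊗ b ⊗ (y ⊗ y) ⊕ ⊝ (Κ 1ℚ ⊕ Κ 1ℚ) ⊗ (a ⊗ b) ⊗ (x ⊗ y)) refl

  module _ {n : ℕ} (M N : Subset n → ℝ) (μ ν : Subset n → ℚ)
    (M≡μ : ∀ S m → approx (M S) m ≡ μ S) (N≡ν : ∀ S m → approx (N S) m ≡ ν S)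
    (π : RationalCoupling μ ν)
    where

    private
      open RationalCoupling π
      Ss = subsets n
      A = sum Ss λ S → μ S * nat ∣ S ∣
      B = sum Ss λ S → ν S * nat ∣ S ∣
      C = sum Ss λ S → sum Ss λ S′ → joint S S′ * nat ∣ S ∩ S′ ∣

    weighted-sum : ∀ p q r →
      sum Ss (λ S → sum Ss λ S′ → joint S S′ * (p * nat ∣ S ∣ + q * nat ∣ S′ ∣ + r * nat ∣ S ∩ S′ ∣)) ≡ p * A + q * B + r * C
    weighted-sum p q r = begin
      sum Ss (λ S → sum Ss λ S′ → joint S S′ * (p * nat ∣ S ∣ + q * nat ∣ S′ ∣ + r * nat ∣ S ∩ S′ ∣))
        ≡⟨ sum-cong Ss (λ S → begin
          sum Ss (λ S′ → joint S S′ * (p * nat ∣ S ∣ + q * nat ∣ S′ ∣ + r * nat ∣ S ∩ S′ ∣))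
            ≡⟨ sum-cong Ss (λ S′ → lemma (joint S S′) p q r (nat ∣ S ∣) (nat ∣ S′ ∣) (nat ∣ S ∩ S′ ∣)) ⟩
          sum Ss (λ S′ → f S S′ + g S S′ + h S S′)
            ≡⟨ sum-+ Ss (λ S′ → f S S′ + g S S′) (h S) ⟩
          sum Ss (λ S′ → f S S′ + g S S′) + sum Ss (h S)
            ≡⟨ cong (_+ sum Ss (h S)) (sum-+ Ss (f S) (g S)) ⟩
          sum Ss (f S) + sum Ss (g S) + sum Ss (h S) ∎) ⟩
      sum Ss (λ S → sum Ss (f S) + sum Ss (g S) + sum Ss (h S))
        ≡⟨ sum-+ Ss (λ S → sum Ss (f S) + sum Ss (g S)) (λ S → sum Ss (h S)) ⟩
      sum Ss (λ S → sum Ss (f S) + sum Ss (g S)) + sum Ss (λ S → sum Ss (h S))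
        ≡⟨ cong (_+ sum Ss (λ S → sum Ss (h S))) (sum-+ Ss (λ S → sum Ss (f S)) (λ S → sum Ss (g S))) ⟩
      sum Ss (λ S → sum Ss (f S)) + sum Ss (λ S → sum Ss (g S)) + sum Ss (λ S → sum Ss (h S))
        ≡⟨ cong₂ _+_ (cong₂ _+_ first second) third ⟩
      p * A + q * B + r * C ∎
      where
      open ≡-Reasoning
      f g h : Subset n → Subset n → ℚ
      f S S′ = p * (joint S S′ * nat ∣ S ∣)
      g S S′ = q * (joint S S′ * nat ∣ S′ ∣)
      h S S′ = r * (joint S S′ * nat ∣ S ∩ S′ ∣)
      lemma : ∀ j p q r s s′ i → j * (p * s + q * s′ + r * i) ≡ p * (j * s) + q * (j * s′) + r * (j * i)
      lemma = solve 7 (λ j p q r s s′ i →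
        j ⊗ (p ⊗ s ⊕ q ⊗ s′ ⊕ r ⊗ i) ⊜
        p ⊗ (j ⊗ s) ⊕ q ⊗ (j ⊗ s′) ⊕ r ⊗ (j ⊗ i)) refl
      scale : ∀ c (F : Subset n → Subset n → ℚ) → sum Ss (λ S → sum Ss λ S′ → c * F S S′) ≡ c * sum Ss (λ S → sum Ss (F S))
      scale c F = trans (sum-cong Ss λ S → sum-*ˡ Ss c (F S)) (sum-*ˡ Ss c (λ S → sum Ss (F S)))
      first : sum Ss (λ S → sum Ss (f S)) ≡ p * A
      first = trans (scale p (λ S S′ → joint S S′ * nat ∣ S ∣)) (cong (p *_) (sum-cong Ss λ S →
        trans (sum-*ʳ Ss (nat ∣ S ∣) (joint S)) (cong (_* nat ∣ S ∣) (marginalˡ S))))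
      second : sum Ss (λ S → sum Ss (g S)) ≡ q * B
      second = trans (scale q (λ S S′ → joint S S′ * nat ∣ S′ ∣)) (cong (q *_) (trans
        (sum-swap Ss Ss (λ S S′ → joint S S′ * nat ∣ S′ ∣)) (sum-cong Ss λ S′ →
          trans (sum-*ʳ Ss (nat ∣ S′ ∣) (λ S → joint S S′)) (cong (_* nat ∣ S′ ∣) (marginalʳ S′)))))
      third : sum Ss (λ S → sum Ss (h S)) ≡ r * C
      third = scale r (λ S S′ → joint S S′ * nat ∣ S ∩ S′ ∣)

    realCoupling : Coupling M N
    realCoupling = record
      { joint     = λ S S′ → fromℚ (joint S S′)
      ; nonneg    = λ S S′ → pointwise-≤ {0ℝ} {fromℚ (joint S S′)} λ m → nonneg S S′
      ; marginalˡ = λ S → pointwise-≈ {Defs.∑ Ss λ S′ → fromℚ (joint S S′)} {M S} λ m →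
          trans (approx-∑ Ss (λ S′ → fromℚ (joint S S′)) m) (trans (marginalˡ S) (sym (M≡μ S m)))
      ; marginalʳ = λ S′ → pointwise-≈ {Defs.∑ Ss λ S → fromℚ (joint S S′)} {N S′} λ m →
          trans (approx-∑ Ss (λ S → fromℚ (joint S S′)) m) (trans (marginalʳ S′) (sym (N≡ν S′ m)))
      }

    mean-square : ∀ (L : Subset n → ℝ) (l : Subset n → ℚ) → (∀ S m → approx (L S) m ≡ l S) → ∀ m →
      approx (Defs.∑ Ss λ S → L S Defs.* ‖ indicator S ‖²) m ≡ sum Ss λ S → l S * nat ∣ S ∣
    mean-square L l L≡l m = trans (approx-∑ Ss (λ S → L S Defs.* ‖ indicator S ‖²) m)
      (sum-cong Ss λ S → cong₂ _*_ (L≡l S m) (trans (approx-∑ (allFin n) (λ i → indicator S i Defs.* indicator S i) m)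
        (trans (sum-cong (allFin n) λ i → cong (λ x → x * x) (approx-indicator S i m)) (sum-bits² S))))

    module _ (1≤A : 1ℚ ≤ A) (1≤B : 1ℚ ≤ B) where

      rmsM : ∀ m → approx (rms M) m ≡ Root.root 1≤A m
      rmsM m = Root.√-root 1≤A (Defs.∑ Ss λ S → M S Defs.* ‖ indicator S ‖²) m (mean-square M μ M≡μ m)

      rmsN : ∀ m → approx (rms N) m ≡ Root.root 1≤B m
      rmsN m = Root.√-root 1≤B (Defs.∑ Ss λ S → N S Defs.* ‖ indicator S ‖²) m (mean-square N ν N≡ν m)

      0<rmsM : 0ℝ Defs.< rms M
      0<rmsM = ½ , 0<½ , 1 , λ m 1≤m → ℚ.≤-trans (Root.½≤root 1≤A m 1≤m) (ℚ.≤-reflexive (sym (rmsM m)))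

      0<rmsN : 0ℝ Defs.< rms N
      0<rmsN = ½ , 0<½ , 1 , λ m 1≤m → ℚ.≤-trans (Root.½≤root 1≤B m 1≤m) (ℚ.≤-reflexive (sym (rmsN m)))

      private
        a b Q : ℕ → ℚ
        a = Root.inverse 1≤A
        b = Root.inverse 1≤B
        Q m = a m * a m * A + b m * b m * B - (1ℚ + 1ℚ) * (a m * b m) * C

      squaredCost≡ : ∀ m → approx (squaredCost M N 0<rmsM 0<rmsN realCoupling) m ≡ Q m
      squaredCost≡ m = trans (squaredCost-approx M N 0<rmsM 0<rmsN realCoupling m)
        (trans (sum-cong Ss λ S → sum-cong Ss λ S′ → cong (joint S S′ *_)
            (trans (cong₂ (λ a b → sum (allFin n) λ i → (bit S i * a - bit S′ i * b) * (bit S i * a - bit S′ i * b))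
                (Root.inv-inverse 1≤A (rms M) (proj₂ (proj₂ 0<rmsM)) m (rmsM m))
                (Root.inv-inverse 1≤B (rms N) (proj₂ (proj₂ 0<rmsN)) m (rmsN m)))
              (expand-square S S′ (a m) (b m))))
          (trans (weighted-sum (a m * a m) (b m * b m) (- (1ℚ + 1ℚ) * (a m * b m))) (lemma (a m) (b m) A B C)))
        where
        lemma : ∀ a b A B C → a * a * A + b * b * B + - (1ℚ + 1ℚ) * (a * b) * C ≡ a * a * A + b * b * B - (1ℚ + 1ℚ) * (a * b) * C
        lemma = solve 5 (λ a b A B C →
          a ⊗ a ⊗ A ⊕ b ⊗ b ⊗ B ⊕ ⊝ (Κ 1ℚ ⊕ Κ 1ℚ) ⊗ (a ⊗ b) ⊗ C ⊜
          a ⊗ a ⊗ A ⊕ b ⊗ b ⊗ B ⊖ (Κ 1ℚ ⊕ Κ 1ℚ) ⊗ (a ⊗ b) ⊗ C) refl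

      -- The squared cost of the coupling is `2 - 2 C / √(A B)`, hence at most `2 - 4 C / (A + B)`.
      -- One coupling serves all tolerances, since the discretization errors vanish with the index.
      w₂-bound : ∀ {e} → 0ℚ ≤ e → 0ℚ ≤ C → (1ℚ + 1ℚ) - 4ℚ * C * (A + B) ⁻¹ ≤ e * e →
        w₂[ M , N ]≤ fromℚ e
      w₂-bound {e} 0≤e 0≤C h = 0<rmsM , 0<rmsN , λ { δ (c , 0<c , N₀ , c≤δ) → realCoupling , λ ε 0<ε →
        let N₁ , hN₁ = archimedean 1 {ε * ε * 16ℚ ⁻¹} (0<* (0<* 0<ε 0<ε) (0<⁻¹ (ℚ.positive⁻¹ 16ℚ)))
        -- Index 1 makes the cut-off of the reciprocals harmless, `N₁` makes the discretization
        -- error small, and from `N₀` on the approximations of `δ` are positive.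
        in 1 ℕ.⊔ N₁ ℕ.⊔ N₀ , λ m le → ℚ.≤-trans
             (bound m ε (ℚ.<⇒≤ 0<ε) (ℕ.m⊔n≤o⇒m≤o 1 N₁ (ℕ.m⊔n≤o⇒m≤o (1 ℕ.⊔ N₁) N₀ le))
               (hN₁ m (ℕ.m⊔n≤o⇒n≤o 1 N₁ (ℕ.m⊔n≤o⇒m≤o (1 ℕ.⊔ N₁) N₀ le))))
             (ℚ.+-monoˡ-≤ ε (p≤p+q {e} (ℚ.≤-trans (ℚ.<⇒≤ 0<c) (ℚ.≤-trans (ℚ.≤-reflexive (sym (ℚ.+-identityˡ c)))
               (c≤δ m (ℕ.m⊔n≤o⇒n≤o (1 ℕ.⊔ N₁) N₀ le)))))) }
        where
        Q≤ : ∀ m ε → 0ℚ ≤ ε → 1 ℕ.≤ m → frac 1 m ≤ ε * ε * 16ℚ ⁻¹ → Q m ≤ (e + ε) * (e + ε)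
        Q≤ m ε 0≤ε 1≤m t≤ = cost-bound A B C (a m) (b m) (frac 1 m) e ε 0≤C 0≤e 0≤ε
          (Root.inverse²*A 1≤A m 1≤m) (Root.inverse²*A 1≤B m 1≤m) (inverse*inverse 1≤A 1≤B m 1≤m) t≤ h
        bound : ∀ m ε → 0ℚ ≤ ε → 1 ℕ.≤ m → frac 1 m ≤ ε * ε * 16ℚ ⁻¹ →
          approx (transportCost M N 0<rmsM 0<rmsN realCoupling) m ≤ e + ε
        bound m ε 0≤ε 1≤m t≤ = transportCost-≤ M N 0<rmsM 0<rmsN realCoupling m (e + ε) (0≤+ 0≤e 0≤ε)
          (ℚ.≤-trans (ℚ.≤-reflexive (squaredCost≡ m)) (Q≤ m ε 0≤ε 1≤m t≤))

open Wasserstein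

-- Estimates of expected degrees, of the expected deviations, and of volumes outside the band.

module Numerics where

  open Data.Rational.Base using (_+_; _*_; _-_; -_; _≤_; _<_)
  open Data.Fin.Subset using (∣_∣)

  ¾ 6ℚ : ℚ
  ¾  = frac 3 3
  6ℚ = frac 6 0

  0<¾ : 0ℚ < ¾
  0<¾ = ℚ.positive⁻¹ ¾

  nat-2^*½^ : ∀ l → nat (2 ℕ.^ l) * ½ ^ l ≡ 1ℚ
  nat-2^*½^ l = trans (cong (_* ½ ^ l) (nat-^ 2 l)) (trans (ℚ.*-comm (2ℚ ^ l) (½ ^ l)) (½^*2^ l))

  ½^-antimono : ∀ {i j} → i ℕ.≤ j → ½ ^ j ≤ ½ ^ i
  ½^-antimono {i} {j} i≤j = subst₂ _≤_
    (trans (sym (½^+ i (j ∸ i))) (cong (½ ^_) (ℕ.m+[n∸m]≡n i≤j))) (ℚ.*-identityʳ (½ ^ i))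
    (*-monoˡ (½ ^ i) (0≤^ i 0≤½) (½^≤1 (j ∸ i)))

  1≤*⇒⁻¹≤ : ∀ {p c} → 0ℚ < p → 1ℚ ≤ p * c → p ⁻¹ ≤ c
  1≤*⇒⁻¹≤ {p} {c} 0<p h = subst₂ _≤_ (ℚ.*-identityʳ (p ⁻¹))
    (trans (lemma (p ⁻¹) p c) (trans (cong (c *_) (*-⁻¹ 0<p)) (ℚ.*-identityʳ c))) (*-monoˡ (p ⁻¹) (0≤⁻¹ p) h)
    where
    lemma : ∀ i p c → i * (p * c) ≡ c * (p * i)
    lemma = solve 3 (λ i p c → i ⊗ (p ⊗ c) ⊜ c ⊗ (p ⊗ i)) refl

  module _ {n l : ℕ} (2^l≤n : 2 ℕ.^ l ℕ.≤ n) (l+l≤n : l ℕ.+ l ℕ.≤ n) (0<l : 0 ℕ.< l) where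

    private
      Γ = G[ n ,½]
      Ss = subsets n

      l<n : l ℕ.< n
      l<n = ℕ.<-≤-trans (ℕ.m<m+n l 0<l) l+l≤n

    -- Since `j ≤ l ≤ n / 2`, at least `n / 2 ≥ 2 ^ (l - 1)` vertices lie outside a set of size `j`.
    deg⁻¹-upper : ∀ {j i} → j ℕ.+ i ≡ l → deg n j ⁻¹ ≤ 2ℚ * ½ ^ i
    deg⁻¹-upper {j} {i} refl = 1≤*⇒⁻¹≤ (0<deg (ℕ.≤-<-trans (ℕ.m≤m+n j i) l<n)) (begin
      1ℚ
        ≡⟨ nat-2^*½^ (j ℕ.+ i) ⟨
      nat (2 ℕ.^ (j ℕ.+ i)) * ½ ^ (j ℕ.+ i)
        ≤⟨ *-monoʳ (0≤^ (j ℕ.+ i) 0≤½) (nat-mono (ℕ.≤-trans 2^l≤n n≤)) ⟩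
      nat ((n ∸ j) ℕ.+ (n ∸ j)) * ½ ^ (j ℕ.+ i)
        ≡⟨ cong₂ _*_ (nat-+ (n ∸ j) (n ∸ j)) (½^+ j i) ⟩
      (nat (n ∸ j) + nat (n ∸ j)) * (½ ^ j * ½ ^ i)
        ≡⟨ lemma (nat (n ∸ j)) (½ ^ j) (½ ^ i) ⟩
      deg n j * (2ℚ * ½ ^ i) ∎)
      where
      open ℚ.≤-Reasoning
      lemma : ∀ d x y → (d + d) * (x * y) ≡ d * x * ((1ℚ + 1ℚ) * y)
      lemma = solve 3 (λ d x y → (d ⊕ d) ⊗ (x ⊗ y) ⊜ d ⊗ x ⊗ ((Κ 1ℚ ⊕ Κ 1ℚ) ⊗ y)) refl
      j+j≤n : j ℕ.+ j ℕ.≤ n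
      j+j≤n = ℕ.≤-trans (ℕ.+-mono-≤ (ℕ.m≤m+n j i) (ℕ.m≤m+n j i)) l+l≤n
      n≤ : n ℕ.≤ (n ∸ j) ℕ.+ (n ∸ j)
      n≤ = subst (ℕ._≤ (n ∸ j) ℕ.+ (n ∸ j)) (ℕ.m∸n+n≡m (ℕ.≤-trans (ℕ.m≤m+n j j) j+j≤n))
        (ℕ.+-monoʳ-≤ (n ∸ j) (ℕ.m+n≤o⇒m≤o∸n j j+j≤n))

    sum-deg⁻¹ : ∀ m i → m ℕ.+ i ≡ l → sum (downFrom m) (λ j → deg n j ⁻¹) ≤ 2ℚ * ½ ^ i
    sum-deg⁻¹ zero    i e = 0≤* {2ℚ} (ℚ.<⇒≤ (ℚ.positive⁻¹ 2ℚ)) (0≤^ i 0≤½)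
    sum-deg⁻¹ (suc m) i e = ℚ.≤-trans
      (ℚ.+-mono-≤ (deg⁻¹-upper {m} {suc i} e′) (sum-deg⁻¹ m (suc i) e′))
      (ℚ.≤-reflexive (lemma (½ ^ i)))
      where
      e′ = trans (ℕ.+-suc m i) e
      lemma : ∀ x → 2ℚ * (½ * x) + 2ℚ * (½ * x) ≡ 2ℚ * x
      lemma = solve 1 (λ x → Κ 2ℚ ⊗ (Κ ½ ⊗ x) ⊕ Κ 2ℚ ⊗ (Κ ½ ⊗ x) ⊜ Κ 2ℚ ⊗ x) refl

    -- t = (3/4)ⁱ keeps both terms of 𝔼-Δ geometric in i.
    𝔼-Δ-geometric : ∀ {j i} → j ℕ.+ i ≡ l → 𝔼 Γ (λ G → Δ G j) ≤ ½ * (¾ ^ i + 2ℚ * ¾ ^ i)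
    𝔼-Δ-geometric {j} {i} e = ℚ.≤-trans
      (𝔼-Δ (ℕ.≤-<-trans (subst (j ℕ.≤_) e (ℕ.m≤m+n j i)) l<n) 0<t)
      (*-monoˡ ½ 0≤½ (ℚ.+-monoʳ-≤ t (begin
        t ⁻¹ * deg n j ⁻¹        ≤⟨ *-monoˡ (t ⁻¹) (0≤⁻¹ t) (deg⁻¹-upper {j} {i} e) ⟩
        t ⁻¹ * (2ℚ * ½ ^ i)      ≡⟨ lemma (t ⁻¹) (½ ^ i) ⟩
        2ℚ * (½ ^ i * t ⁻¹)      ≤⟨ *-monoˡ 2ℚ (ℚ.<⇒≤ (ℚ.positive⁻¹ 2ℚ)) (≤⇒*⁻¹≤ {q = t} 0<t ½^i≤t²) ⟩
        2ℚ * t                   ∎)))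
      where
      open ℚ.≤-Reasoning
      t = ¾ ^ i
      0<t = 0<^ i 0<¾
      lemma : ∀ a x → a * (2ℚ * x) ≡ 2ℚ * (x * a)
      lemma = solve 2 (λ a x → a ⊗ (Κ 2ℚ ⊗ x) ⊜ Κ 2ℚ ⊗ (x ⊗ a)) refl
      ½^i≤t² : ½ ^ i ≤ t * t
      ½^i≤t² = subst (½ ^ i ≤_) (*-^ ¾ ¾ i) (^-mono {½} {¾ * ¾} i 0≤½ (frac-mono {1} {1} {9} {15} (ℕ.m≤m+n 16 2)))

    -- A geometric series: the terms `3/2 · ¾ ^ i` with `i > s` add up to at most `4.5 · ¾ ^ s`, and
    -- 6 leaves some room.
    𝔼-Δsum : ∀ m s → m ℕ.+ s ≡ l → 𝔼 Γ (λ G → Δsum G m) ≤ 6ℚ * ¾ ^ s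
    𝔼-Δsum m s e = ℚ.≤-trans (ℚ.≤-reflexive (𝔼-sum Γ (downFrom m) Δ)) (go m s e)
      where
      go : ∀ m s → m ℕ.+ s ≡ l → sum (downFrom m) (λ j → 𝔼 Γ λ G → Δ G j) ≤ 6ℚ * ¾ ^ s
      go zero    s e = 0≤* {6ℚ} (ℚ.<⇒≤ (ℚ.positive⁻¹ 6ℚ)) (0≤^ s (ℚ.<⇒≤ 0<¾))
      go (suc m) s e = ℚ.≤-trans (ℚ.+-mono-≤ (𝔼-Δ-geometric {m} {suc s} e′) (go m (suc s) e′))
        (≤-by (frac 3 7 * ¾ ^ s) (0≤* (0≤frac 3 7) (0≤^ s (ℚ.<⇒≤ 0<¾))) (lemma (¾ ^ s)))
        where
        e′ = trans (ℕ.+-suc m s) e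
        lemma : ∀ x → ½ * (¾ * x + 2ℚ * (¾ * x)) + 6ℚ * (¾ * x) + frac 3 7 * x ≡ 6ℚ * x
        lemma = solve 1 (λ x →
          Κ ½ ⊗ (Κ ¾ ⊗ x ⊕ Κ 2ℚ ⊗ (Κ ¾ ⊗ x)) ⊕ Κ 6ℚ ⊗ (Κ ¾ ⊗ x) ⊕ Κ (frac 3 7) ⊗ x ⊜
          Κ 6ℚ ⊗ x) refl

  module _ (n k : ℕ) where

    private
      Γ = G[ n ,½]
      Ss = subsets n

    partialVolume : ℕ → ℚ
    partialVolume m = sum (downFrom m) λ j → vol n j * (nat k + nat j)

    private
      g : Subset n → ℚ
      g X = ½ ^ tri ∣ X ∣ * (nat k + nat ∣ X ∣)

      level : ∀ j → sum Ss (λ X → χ j X * g X) ≡ vol n j * (nat k + nat j)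
      level j = trans (sum-cong Ss λ X → trans (χ-cong j X (λ i → ½ ^ tri i * (nat k + nat i)))
          (trans (sym (ℚ.*-assoc (χ j X) (½ ^ tri j) (nat k + nat j)))
            (cong (_* (nat k + nat j)) (sym (χ-cong j X (λ i → ½ ^ tri i))))))
        (trans (sum-*ʳ Ss (nat k + nat j) (λ X → χ j X * ½ ^ tri ∣ X ∣)) (cong (_* (nat k + nat j)) (sum-½^tri n j)))

    -- The complement of the band consists of the sizes below `k` and those not below `b + k`; each
    -- set contributes its probability of independence, collected by size.
    𝔼-tail : ∀ b (b+k≤ : b ℕ.+ k ℕ.≤ suc n) → 𝔼 Γ (λ G → tail G k b b+k≤)
      ≡ partialVolume k + (partialVolume (suc n) - partialVolume (b ℕ.+ k))
    𝔼-tail b b+k≤ = begin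
      𝔼 Γ (λ G → sum Ss λ X → ind G X * out X)
        ≡⟨ trans (𝔼-sum Γ Ss (λ G X → ind G X * out X))
             (sum-cong Ss λ X → trans (𝔼-*ʳ Γ (out X) (λ G → ind G X)) (cong (_* out X) (𝔼-ind X))) ⟩
      sum Ss (λ X → ½ ^ tri ∣ X ∣ * out X)
        ≡⟨ sum-cong Ss (λ X → trans
             (lemma₁ (½ ^ tri ∣ X ∣) (band k b X) (below k X) (nat k + nat ∣ X ∣))
             (cong (λ u → below k X * g X + (g X - u * g X)) (band+below k b X))) ⟩
      sum Ss (λ X → below k X * g X + (g X - below (b ℕ.+ k) X * g X))
        ≡⟨ trans (sum-+ Ss (λ X → below k X * g X) (λ X → g X - below (b ℕ.+ k) X * g X))
             (cong₂ _+_ (L k) (trans (sum-- Ss g (λ X → below (b ℕ.+ k) X * g X))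
               (cong₂ _-_ (trans (sum-levels g) (sum-cong (downFrom (suc n)) level)) (L (b ℕ.+ k))))) ⟩
      partialVolume k + (partialVolume (suc n) - partialVolume (b ℕ.+ k)) ∎
      where
      open ≡-Reasoning
      out : Subset n → ℚ
      out X = (1ℚ - band k b X) * (nat k + nat ∣ X ∣)
      L : ∀ m → sum Ss (λ X → below m X * g X) ≡ partialVolume m
      L m = trans (sum-below m g) (sum-cong (downFrom m) level)
      lemma₁ : ∀ p c d s → p * ((1ℚ - c) * s) ≡ d * (p * s) + (p * s - (c + d) * (p * s))
      lemma₁ = solve 4 (λ p c d s → p ⊗ ((Κ 1ℚ ⊖ c) ⊗ s) ⊜ d ⊗ (p ⊗ s) ⊕ (p ⊗ s ⊖ (c ⊕ d) ⊗ (p ⊗ s))) refl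

    module _ (y : ℚ) (0≤y : 0ℚ ≤ y) (y≤½ : y ≤ ½) (k≤n : k ℕ.≤ n)
      (ratio≤y : ∀ j → j ℕ.< k → nat (suc j) * deg n j ⁻¹ ≤ y) where

      vol-step : ∀ j → j ℕ.< k → vol n j ≤ y * vol n (suc j)
      vol-step j j<k = begin
        vol n j
          ≡⟨ trans (cong₂ (λ u v → vol n j * u * v) (*-⁻¹ (0<deg (ℕ.<-≤-trans j<k k≤n))) (*-⁻¹ (0<nat j)))
               (trans (ℚ.*-identityʳ _) (ℚ.*-identityʳ _)) ⟨
        vol n j * (deg n j * deg n j ⁻¹) * (nat (suc j) * nat (suc j) ⁻¹)
          ≡⟨ lemma (vol n j) (deg n j) (deg n j ⁻¹) (nat (suc j)) (nat (suc j) ⁻¹) ⟩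
        nat (suc j) * deg n j ⁻¹ * vol n (suc j)
          ≤⟨ *-monoʳ (0≤vol n (suc j)) (ratio≤y j j<k) ⟩
        y * vol n (suc j) ∎
        where
        open ℚ.≤-Reasoning
        lemma : ∀ v d d′ m m′ → v * (d * d′) * (m * m′) ≡ m * d′ * (v * d * m′)
        lemma = solve 5 (λ v d d′ m m′ → v ⊗ (d ⊗ d′) ⊗ (m ⊗ m′) ⊜ m ⊗ d′ ⊗ (v ⊗ d ⊗ m′)) refl

      -- Below `k` the volume grows by a factor of at least `1 / y ≥ 2` per level, so the next level
      -- dominates all earlier ones.
      sum-vol : ∀ m → m ℕ.≤ k → sum (downFrom m) (vol n) ≤ 2ℚ * y * vol n m
      sum-vol zero    _   = 0≤* {2ℚ * y} (0≤* {2ℚ} (ℚ.<⇒≤ (ℚ.positive⁻¹ 2ℚ)) 0≤y) (0≤vol n 0)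
      sum-vol (suc m) m<k = begin
        vol n m + sum (downFrom m) (vol n)
          ≤⟨ ℚ.+-monoʳ-≤ (vol n m) (sum-vol m (ℕ.<⇒≤ m<k)) ⟩
        vol n m + 2ℚ * y * vol n m
          ≤⟨ ≤-by (2ℚ * (½ - y) * vol n m) (0≤* {2ℚ * (½ - y)} (0≤* {2ℚ} (ℚ.<⇒≤ (ℚ.positive⁻¹ 2ℚ)) (≤⇒0≤- y≤½)) (0≤vol n m)) (lemma y (vol n m)) ⟩
        2ℚ * vol n m
          ≤⟨ *-monoˡ 2ℚ (ℚ.<⇒≤ (ℚ.positive⁻¹ 2ℚ)) (vol-step m m<k) ⟩
        2ℚ * (y * vol n (suc m))
          ≡⟨ ℚ.*-assoc 2ℚ y (vol n (suc m)) ⟨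
        2ℚ * y * vol n (suc m) ∎
        where
        open ℚ.≤-Reasoning
        lemma : ∀ y v → v + 2ℚ * y * v + 2ℚ * (½ - y) * v ≡ 2ℚ * v
        lemma = solve 2 (λ y v → v ⊕ Κ 2ℚ ⊗ y ⊗ v ⊕ Κ 2ℚ ⊗ (Κ ½ ⊖ y) ⊗ v ⊜ Κ 2ℚ ⊗ v) refl

      lower-tail : partialVolume k ≤ 4ℚ * y * vol n k * nat k
      lower-tail = begin
        partialVolume k
          ≤⟨ sum-monoᴬ (All.map (λ {j} j<k → *-monoˡ (vol n j) (0≤vol n j) (ℚ.+-monoʳ-≤ (nat k) (nat-mono (ℕ.<⇒≤ j<k)))) (downFrom-< k)) ⟩
        sum (downFrom k) (λ j → vol n j * (nat k + nat k))
          ≡⟨ sum-*ʳ (downFrom k) (nat k + nat k) (vol n) ⟩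
        sum (downFrom k) (vol n) * (nat k + nat k)
          ≤⟨ *-monoʳ (0≤+ (0≤nat k) (0≤nat k)) (sum-vol k ℕ.≤-refl) ⟩
        2ℚ * y * vol n k * (nat k + nat k)
          ≡⟨ lemma y (vol n k) (nat k) ⟩
        4ℚ * y * vol n k * nat k ∎
        where
        open ℚ.≤-Reasoning
        lemma : ∀ y v k → 2ℚ * y * v * (k + k) ≡ 4ℚ * y * v * k
        lemma = solve 3 (λ y v k → Κ 2ℚ ⊗ y ⊗ v ⊗ (k ⊕ k) ⊜ Κ 4ℚ ⊗ y ⊗ v ⊗ k) refl

    module _ (x : ℚ) (0≤x : 0ℚ ≤ x) (4x≤1 : 4ℚ * x ≤ 1ℚ) (M : ℕ) (1≤k+M : 1 ℕ.≤ k ℕ.+ M)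
      (ratio≤x : nat n * ½ ^ M * nat (suc M) ⁻¹ ≤ x) where

      vol-decay : ∀ m → M ℕ.≤ m → vol n (suc m) ≤ x * vol n m
      vol-decay m M≤m = begin
        vol n m * deg n m * nat (suc m) ⁻¹
          ≡⟨ ℚ.*-assoc (vol n m) (deg n m) (nat (suc m) ⁻¹) ⟩
        vol n m * (nat (n ∸ m) * ½ ^ m * nat (suc m) ⁻¹)
          ≤⟨ *-monoˡ (vol n m) (0≤vol n m) (ℚ.≤-trans (*-mono (0≤⁻¹ (nat (suc m))) (0≤* (0≤nat n) (0≤^ M 0≤½))
               (*-mono (0≤^ m 0≤½) (0≤nat n) (nat-mono (ℕ.m∸n≤m n m)) (½^-antimono M≤m))
               (⁻¹-antimono (0<nat M) (nat-mono (s≤s M≤m)))) ratio≤x) ⟩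
        vol n m * x
          ≡⟨ ℚ.*-comm (vol n m) x ⟩
        x * vol n m ∎
        where open ℚ.≤-Reasoning

      -- Beyond `M` the volume shrinks by the factor `x` per level while the weight `k + m` at most
      -- doubles; `4 x ≤ 1` closes the induction. It generalizes over `m`, peeling off the lowest
      -- level first.
      upper-tail : ∀ d m → M ℕ.≤ m →
        partialVolume (d ℕ.+ suc m) ≤ partialVolume (suc m) + 4ℚ * x * (nat k + nat m) * vol n m
      upper-tail zero    m M≤m = p≤p+q (0≤* {4ℚ * x * (nat k + nat m)} (0≤* {4ℚ * x} (0≤* {4ℚ} (ℚ.nonNegative⁻¹ 4ℚ) 0≤x) (0≤+ (0≤nat k) (0≤nat m))) (0≤vol n m))
      upper-tail (suc d) m M≤m = begin
        partialVolume (suc d ℕ.+ suc m)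
          ≡⟨ cong partialVolume (ℕ.+-suc d (suc m)) ⟨
        partialVolume (d ℕ.+ suc (suc m))
          ≤⟨ upper-tail d (suc m) (ℕ.m≤n⇒m≤1+n M≤m) ⟩
        vol n (suc m) * (nat k + nat (suc m)) + partialVolume (suc m) + 4ℚ * x * (nat k + nat (suc m)) * vol n (suc m)
          ≡⟨ lemma₁ (vol n (suc m)) (nat k + nat (suc m)) (partialVolume (suc m)) x ⟩
        partialVolume (suc m) + vol n (suc m) * (nat k + nat (suc m)) * (1ℚ + 4ℚ * x)
          ≤⟨ ℚ.+-monoʳ-≤ (partialVolume (suc m)) (*-mono {_} {_} {1ℚ + 4ℚ * x} {2ℚ}
               (0≤+ {1ℚ} {4ℚ * x} 0≤1 (0≤* {4ℚ} (ℚ.nonNegative⁻¹ 4ℚ) 0≤x))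
               (0≤* {x * vol n m} (0≤* 0≤x (0≤vol n m)) (0≤* {2ℚ} (ℚ.<⇒≤ (ℚ.positive⁻¹ 2ℚ)) 0≤k+m))
               (*-mono {_} {_} {nat k + nat (suc m)} {2ℚ * (nat k + nat m)} (0≤+ (0≤nat k) (0≤nat (suc m))) (0≤* 0≤x (0≤vol n m)) (vol-decay m M≤m) k+m)
               (ℚ.+-monoʳ-≤ 1ℚ 4x≤1)) ⟩
        partialVolume (suc m) + x * vol n m * (2ℚ * (nat k + nat m)) * 2ℚ
          ≡⟨ cong (_+_ (partialVolume (suc m))) (lemma₂ x (vol n m) (nat k + nat m)) ⟩
        partialVolume (suc m) + 4ℚ * x * (nat k + nat m) * vol n m ∎
        where
        open ℚ.≤-Reasoning
        0≤k+m = 0≤+ (0≤nat k) (0≤nat m)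
        lemma₁ : ∀ v s p x → v * s + p + 4ℚ * x * s * v ≡ p + v * s * (1ℚ + 4ℚ * x)
        lemma₁ = solve 4 (λ v s p x → v ⊗ s ⊕ p ⊕ Κ 4ℚ ⊗ x ⊗ s ⊗ v ⊜ p ⊕ v ⊗ s ⊗ (Κ 1ℚ ⊕ Κ 4ℚ ⊗ x)) refl
        lemma₂ : ∀ x v s → x * v * (2ℚ * s) * 2ℚ ≡ 4ℚ * x * s * v
        lemma₂ = solve 3 (λ x v s → x ⊗ v ⊗ (Κ 2ℚ ⊗ s) ⊗ Κ 2ℚ ⊜ Κ 4ℚ ⊗ x ⊗ s ⊗ v) refl
        lemma₃ : ∀ k m → k + (1ℚ + m) + (k + m - 1ℚ) ≡ 2ℚ * (k + m)
        lemma₃ = solve 2 (λ k m → k ⊕ (Κ 1ℚ ⊕ m) ⊕ (k ⊕ m ⊖ Κ 1ℚ) ⊜ Κ 2ℚ ⊗ (k ⊕ m)) refl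
        k+m : nat k + nat (suc m) ≤ 2ℚ * (nat k + nat m)
        k+m = ≤-by (nat k + nat m - 1ℚ) (≤⇒0≤- (subst (1ℚ ≤_) (nat-+ k m) (nat-mono {1} (ℕ.≤-trans 1≤k+M (ℕ.+-monoʳ-≤ k M≤m)))))
          (lemma₃ (nat k) (nat m))

open Numerics

-- The choice of constants, and the bound for one graph size.

module Parameters where

  open Data.Rational.Base using (_+_; _*_; _-_; -_; _≤_; _<_)
  open Data.Fin.Subset using (∣_∣)

  n<2^n : ∀ n → n ℕ.< 2 ℕ.^ n
  n<2^n zero    = s≤s z≤n
  n<2^n (suc n) = ℕ.+-mono-≤ (ℕ.m^n>0 2 n) (ℕ.≤-trans (n<2^n n) (ℕ.≤-reflexive (sym (ℕ.+-identityʳ (2 ℕ.^ n)))))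

  n+n≤2^n : ∀ n → 0 ℕ.< n → n ℕ.+ n ℕ.≤ 2 ℕ.^ n
  n+n≤2^n (suc zero)    _ = ℕ.≤-refl
  n+n≤2^n (suc (suc n)) _ = ℕ.≤-trans (ℕ.≤-reflexive (lemma n))
    (ℕ.+-mono-≤ (ℕ.^-monoʳ-≤ 2 {1} {suc n} (s≤s z≤n)) (ℕ.≤-trans (n+n≤2^n (suc n) (s≤s z≤n)) (ℕ.≤-reflexive (sym (ℕ.+-identityʳ (2 ℕ.^ suc n))))))
    where
    lemma : ∀ n → suc (suc n) ℕ.+ suc (suc n) ≡ 2 ℕ.+ (suc n ℕ.+ suc n)
    lemma = ℕ-Solver.solve-∀

  -- Per step the right side quadruples and the left side grows by less. This makes the gap between
  -- `k` and `l` at most half of `l`.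
  linear≤2^ : ∀ {s} → 6 ℕ.≤ s → (60 ℕ.* s ℕ.+ 62) ℕ.+ (60 ℕ.* s ℕ.+ 62) ℕ.≤ 2 ℕ.^ (s ℕ.+ s)
  linear≤2^ 6≤s = go (ℕ.≤⇒≤′ 6≤s)
    where
    lemma₁ : ∀ s → (60 ℕ.* suc s ℕ.+ 62) ℕ.+ (60 ℕ.* suc s ℕ.+ 62) ℕ.+ (360 ℕ.* s ℕ.+ 252) ≡ 4 ℕ.* ((60 ℕ.* s ℕ.+ 62) ℕ.+ (60 ℕ.* s ℕ.+ 62))
    lemma₁ = ℕ-Solver.solve-∀
    lemma₂ : ∀ x → 4 ℕ.* x ≡ 2 ℕ.* (2 ℕ.* x)
    lemma₂ = ℕ-Solver.solve-∀
    go : ∀ {s} → 6 ℕ.≤′ s → (60 ℕ.* s ℕ.+ 62) ℕ.+ (60 ℕ.* s ℕ.+ 62) ℕ.≤ 2 ℕ.^ (s ℕ.+ s)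
    go (ℕ.≤′-reflexive refl) = ℕ.≤ᵇ⇒≤ 844 4096 _
    go (ℕ.≤′-step {s} le)    = ℕ.≤-trans (ℕ.m≤m+n _ (360 ℕ.* s ℕ.+ 252)) (ℕ.≤-trans (ℕ.≤-reflexive (lemma₁ s))
      (ℕ.≤-trans (ℕ.*-monoʳ-≤ 4 (go le)) (ℕ.≤-reflexive (trans (lemma₂ (2 ℕ.^ (s ℕ.+ s))) (cong (λ j → 2 ℕ.* 2 ℕ.^ j) (sym (ℕ.+-suc s s)))))))

  ⅞ 15/16 100ℚ 106ℚ : ℚ
  ⅞     = frac 7 7
  15/16 = frac 15 15
  100ℚ  = frac 100 0
  106ℚ  = frac 106 0

  24ℚ 30ℚ 488ℚ : ℚ
  24ℚ    = frac 24 0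
  30ℚ    = frac 30 0
  488ℚ   = frac 488 0

  -- The coefficients 5, 8 and 2 add up to 15.
  η-bound : ∀ q h P → P ≤ 8ℚ * h → h ≤ q → (1ℚ + 1ℚ + 1ℚ + 1ℚ + 1ℚ) * q + P + (1ℚ + 1ℚ) * h ≤ frac 15 0 * q
  η-bound q h P P≤ h≤q = begin
    (1ℚ + 1ℚ + 1ℚ + 1ℚ + 1ℚ) * q + P + (1ℚ + 1ℚ) * h
      ≤⟨ ℚ.+-mono-≤ (ℚ.+-monoʳ-≤ ((1ℚ + 1ℚ + 1ℚ + 1ℚ + 1ℚ) * q) (ℚ.≤-trans P≤ (*-monoˡ 8ℚ (ℚ.nonNegative⁻¹ 8ℚ) h≤q)))
           (*-monoˡ (1ℚ + 1ℚ) (0≤+ 0≤1 0≤1) h≤q) ⟩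
    (1ℚ + 1ℚ + 1ℚ + 1ℚ + 1ℚ) * q + 8ℚ * q + (1ℚ + 1ℚ) * q
      ≡⟨ lemma q ⟩
    frac 15 0 * q ∎
    where
    open ℚ.≤-Reasoning
    lemma : ∀ q → (1ℚ + 1ℚ + 1ℚ + 1ℚ + 1ℚ) * q + 8ℚ * q + (1ℚ + 1ℚ) * q ≡ frac 15 0 * q
    lemma = solve 1 (λ q →
      (Κ 1ℚ ⊕ Κ 1ℚ ⊕ Κ 1ℚ ⊕ Κ 1ℚ ⊕ Κ 1ℚ) ⊗ q ⊕ Κ 8ℚ ⊗ q ⊕ (Κ 1ℚ ⊕ Κ 1ℚ) ⊗ q ⊜
      Κ (frac 15 0) ⊗ q) refl

  overlap-bound : ∀ C k q η → 0ℚ ≤ k → η ≤ frac 15 0 * q → (1ℚ - η) * k ≤ C → (1ℚ - frac 15 0 * q) * k ≤ C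
  overlap-bound C k q η 0≤k η≤ h = ℚ.≤-trans (*-monoʳ 0≤k (neg-mono 1ℚ η≤)) h

  overlap-half : ∀ C k q → 0ℚ ≤ k → 30ℚ * q ≤ 1ℚ → (1ℚ - frac 15 0 * q) * k ≤ C → ½ * k ≤ C
  overlap-half C k q 0≤k 30q≤1 h = ℚ.≤-trans (*-monoʳ 0≤k
    (≤-by {½} (½ * (1ℚ - 30ℚ * q)) (0≤* 0≤½ (≤⇒0≤- 30q≤1)) (lemma q))) h
    where
    lemma : ∀ q → ½ + ½ * (1ℚ - 30ℚ * q) ≡ 1ℚ - frac 15 0 * q
    lemma = solve 1 (λ q → Κ ½ ⊕ Κ ½ ⊗ (Κ 1ℚ ⊖ Κ 30ℚ ⊗ q) ⊜ Κ 1ℚ ⊖ Κ (frac 15 0) ⊗ q) refl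

  -- Clear the denominator: `2 (A + B) - 4 C` is at most `2 b + 64 q k`, where 64 is 4 from the mean
  -- size plus 60 from the overlap. With `488 q k` for `2 b` this makes 552, below `24²`, and
  -- `k ≤ A + B` because the overlap is at least `k / 2`.
  final-bound : ∀ A B C b k q r → 0ℚ < k → 0ℚ ≤ q → 30ℚ * q ≤ 1ℚ → q ≤ r * r →
    A ≤ b + k + (1ℚ + 1ℚ) * q * k → B ≤ k → (1ℚ - frac 15 0 * q) * k ≤ C → C ≤ A → C ≤ B → b + b ≤ 488ℚ * q * k →
    (1ℚ + 1ℚ) - 4ℚ * C * (A + B) ⁻¹ ≤ 24ℚ * r * (24ℚ * r)
  final-bound A B C b k q r 0<k 0≤q 30q≤1 q≤r² A≤ B≤ C≥ C≤A C≤B b≤ = begin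
    (1ℚ + 1ℚ) - 4ℚ * C * (A + B) ⁻¹
      ≡⟨ trans (lemma₁ C ((A + B) ⁻¹)) (trans (cong (λ u → (1ℚ + 1ℚ) * u - 4ℚ * C * (A + B) ⁻¹) (sym (*-⁻¹ 0<A+B)))
           (lemma₂ (A + B) C ((A + B) ⁻¹))) ⟩
    ((1ℚ + 1ℚ) * (A + B) - 4ℚ * C) * (A + B) ⁻¹
      ≤⟨ ≤⇒*⁻¹≤ {(1ℚ + 1ℚ) * (A + B) - 4ℚ * C} {24ℚ * r * (24ℚ * r)} {A + B} 0<A+B main ⟩
    24ℚ * r * (24ℚ * r) ∎
    where
    open ℚ.≤-Reasoning
    k≤A+B : k ≤ A + B
    k≤A+B = ℚ.≤-trans (ℚ.≤-reflexive (lemma k)) (ℚ.+-mono-≤ (ℚ.≤-trans half≤ C≤A) (ℚ.≤-trans half≤ C≤B))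
      where
      half≤ = overlap-half C k q (ℚ.<⇒≤ 0<k) 30q≤1 C≥
      lemma : ∀ k → k ≡ ½ * k + ½ * k
      lemma = solve 1 (λ k → k ⊜ Κ ½ ⊗ k ⊕ Κ ½ ⊗ k) refl
    0<A+B = ℚ.<-≤-trans 0<k k≤A+B
    lemma₁ : ∀ C i → (1ℚ + 1ℚ) - 4ℚ * C * i ≡ (1ℚ + 1ℚ) * 1ℚ - 4ℚ * C * i
    lemma₁ = solve 2 (λ C i → (Κ 1ℚ ⊕ Κ 1ℚ) ⊖ Κ 4ℚ ⊗ C ⊗ i ⊜ (Κ 1ℚ ⊕ Κ 1ℚ) ⊗ Κ 1ℚ ⊖ Κ 4ℚ ⊗ C ⊗ i) refl
    lemma₂ : ∀ X C i → (1ℚ + 1ℚ) * (X * i) - 4ℚ * C * i ≡ ((1ℚ + 1ℚ) * X - 4ℚ * C) * i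
    lemma₂ = solve 3 (λ X C i → (Κ 1ℚ ⊕ Κ 1ℚ) ⊗ (X ⊗ i) ⊖ Κ 4ℚ ⊗ C ⊗ i ⊜ ((Κ 1ℚ ⊕ Κ 1ℚ) ⊗ X ⊖ Κ 4ℚ ⊗ C) ⊗ i) refl
    lemma₃ : ∀ b k q → (1ℚ + 1ℚ) * (b + k + (1ℚ + 1ℚ) * q * k + k) - 4ℚ * ((1ℚ - frac 15 0 * q) * k) ≡ b + b + frac 64 0 * q * k
    lemma₃ = solve 3 (λ b k q →
      (Κ 1ℚ ⊕ Κ 1ℚ) ⊗ (b ⊕ k ⊕ (Κ 1ℚ ⊕ Κ 1ℚ) ⊗ q ⊗ k ⊕ k) ⊖ Κ 4ℚ ⊗ ((Κ 1ℚ ⊖ Κ (frac 15 0) ⊗ q) ⊗ k) ⊜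
      b ⊕ b ⊕ Κ (frac 64 0) ⊗ q ⊗ k) refl
    lemma₄ : ∀ a b q k → a * q * k + b * q * k ≡ (a + b) * (q * k)
    lemma₄ = solve 4 (λ a b q k → a ⊗ q ⊗ k ⊕ b ⊗ q ⊗ k ⊜ (a ⊕ b) ⊗ (q ⊗ k)) refl
    lemma₅ : ∀ c r X → c * c * (r * r * X) ≡ c * r * (c * r) * X
    lemma₅ = solve 3 (λ c r X → c ⊗ c ⊗ (r ⊗ r ⊗ X) ⊜ c ⊗ r ⊗ (c ⊗ r) ⊗ X) refl
    main : (1ℚ + 1ℚ) * (A + B) - 4ℚ * C ≤ 24ℚ * r * (24ℚ * r) * (A + B)
    main = begin
      (1ℚ + 1ℚ) * (A + B) - 4ℚ * C
        ≤⟨ ℚ.+-mono-≤ (*-monoˡ (1ℚ + 1ℚ) (0≤+ 0≤1 0≤1) (ℚ.+-mono-≤ A≤ B≤)) (ℚ.neg-antimono-≤ (*-monoˡ 4ℚ (ℚ.nonNegative⁻¹ 4ℚ) C≥)) ⟩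
      (1ℚ + 1ℚ) * (b + k + (1ℚ + 1ℚ) * q * k + k) - 4ℚ * ((1ℚ - frac 15 0 * q) * k)
        ≡⟨ lemma₃ b k q ⟩
      b + b + frac 64 0 * q * k
        ≤⟨ ℚ.+-monoˡ-≤ (frac 64 0 * q * k) b≤ ⟩
      488ℚ * q * k + frac 64 0 * q * k
        ≡⟨ lemma₄ 488ℚ (frac 64 0) q k ⟩
      (488ℚ + frac 64 0) * (q * k)
        ≤⟨ *-monoʳ (0≤* 0≤q (ℚ.<⇒≤ 0<k)) (frac-mono {552} {0} {576} {0} (ℕ.m≤m+n 552 24)) ⟩
      24ℚ * 24ℚ * (q * k)
        ≤⟨ *-monoˡ (24ℚ * 24ℚ) (ℚ.nonNegative⁻¹ (24ℚ * 24ℚ)) (*-mono (ℚ.<⇒≤ 0<k) (0≤² r) q≤r² k≤A+B) ⟩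
      24ℚ * 24ℚ * (r * r * (A + B))
        ≡⟨ lemma₅ 24ℚ r (A + B) ⟩
      24ℚ * r * (24ℚ * r) * (A + B) ∎

  module _ {n : ℕ} {μ ν : Subset n → ℚ} (π : RationalCoupling μ ν) where

    open RationalCoupling π

    meanOverlap : ℚ
    meanOverlap = sum (subsets n) λ X → sum (subsets n) λ Y → joint X Y * nat ∣ X ∩ Y ∣

    overlap≤ˡ : meanOverlap ≤ sum (subsets n) λ X → μ X * nat ∣ X ∣
    overlap≤ˡ = sum-mono (subsets n) λ X → ℚ.≤-trans
      (sum-mono (subsets n) λ Y → *-monoˡ (joint X Y) (nonneg X Y) (nat-mono (Subset.∣p∩q∣≤∣p∣ X Y)))
      (ℚ.≤-reflexive (trans (sum-*ʳ (subsets n) (nat ∣ X ∣) (joint X)) (cong (_* nat ∣ X ∣) (marginalˡ X))))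

    overlap≤ʳ : meanOverlap ≤ sum (subsets n) λ Y → ν Y * nat ∣ Y ∣
    overlap≤ʳ = ℚ.≤-trans (ℚ.≤-reflexive (sum-swap (subsets n) (subsets n) (λ X Y → joint X Y * nat ∣ X ∩ Y ∣)))
      (sum-mono (subsets n) λ Y → ℚ.≤-trans
        (sum-mono (subsets n) λ X → *-monoˡ (joint X Y) (nonneg X Y) (nat-mono (Subset.∣p∩q∣≤∣q∣ X Y)))
        (ℚ.≤-reflexive (trans (sum-*ʳ (subsets n) (nat ∣ Y ∣) (λ X → joint X Y)) (cong (_* nat ∣ Y ∣) (marginalʳ Y)))))

  -- Markov's inequality before taking expectations: for `x > q` the left side is at most 0.
  markov : ∀ {x q} → 0ℚ < q → 0ℚ ≤ x → (d : Dec (x ≤ q)) → 1ℚ - q ⁻¹ * x ≤ 𝟙 d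
  markov {x} {q} 0<q 0≤x (yes _)  = -≤ {1ℚ} (0≤* (0≤⁻¹ q) 0≤x)
  markov {x} {q} 0<q 0≤x (no x≰q) = neg-mono 1ℚ (subst (1ℚ ≤_) (ℚ.*-comm x (q ⁻¹))
    (≤⇒≤*⁻¹ {x} {1ℚ} 0<q (ℚ.≤-trans (ℚ.≤-reflexive (ℚ.*-identityˡ q)) (ℚ.<⇒≤ (ℚ.≰⇒> x≰q)))))

  -- l and s are the integer parts of log₂ n and of ½ log₂ log₂ n, so that 2^(s + s) ≈ log₂ n.
  record Regime (n l s k b T : ℕ) : Set where
    field
      2^l≤n  : 2 ℕ.^ l ℕ.≤ n
      n≤2^   : n ℕ.≤ 2 ℕ.^ suc l
      4^s≤l  : 2 ℕ.^ (s ℕ.+ s) ℕ.≤ l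
      l≤4^   : l ℕ.≤ 2 ℕ.^ (s ℕ.+ s ℕ.+ 2)
      l≤     : l ℕ.≤ k ℕ.+ (60 ℕ.* s ℕ.+ 62)
      k≤     : k ℕ.+ 60 ℕ.* s ℕ.≤ l ℕ.+ 62
      T≥     : l ℕ.* 2 ℕ.^ k ℕ.≤ T
      6≤s    : 6 ℕ.≤ s
      b+k+s  : b ℕ.+ k ℕ.+ s ≡ l

  module _ {n l s k b T : ℕ} (regime : Regime n l s k b T) where

    open Regime regime

    private
      h = ½ ^ s
      0≤h = 0≤^ s 0≤½

      i = b ℕ.+ s

      k+i : k ℕ.+ i ≡ l
      k+i = trans (lemma k b s) b+k+s
        where
        lemma : ∀ k b s → k ℕ.+ (b ℕ.+ s) ≡ b ℕ.+ k ℕ.+ s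
        lemma = ℕ-Solver.solve-∀

      0<l : 0 ℕ.< l
      0<l = ℕ.<-≤-trans (ℕ.m^n>0 2 (s ℕ.+ s)) 4^s≤l

      l+l≤n : l ℕ.+ l ℕ.≤ n
      l+l≤n = ℕ.≤-trans (n+n≤2^n l 0<l) 2^l≤n

      0<n′ : 0 ℕ.< n
      0<n′ = ℕ.<-≤-trans (ℕ.m^n>0 2 l) 2^l≤n

      l≤n : l ℕ.≤ n
      l≤n = ℕ.≤-trans (ℕ.m≤m+n l l) l+l≤n

      k≤l : k ℕ.≤ l
      k≤l = subst (k ℕ.≤_) k+i (ℕ.m≤m+n k i)

      k≤n : k ℕ.≤ n
      k≤n = ℕ.≤-trans k≤l l≤n

      -- `l - k` is at most `60 s + 62`, which is at most `4ˢ / 2` and so at most `l / 2`.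
      l≤k+k : l ℕ.≤ k ℕ.+ k
      l≤k+k = ℕ.+-cancelʳ-≤ l l (k ℕ.+ k) (ℕ.≤-trans (ℕ.+-mono-≤ l≤ l≤) (ℕ.≤-trans (ℕ.≤-reflexive (lemma k (60 ℕ.* s ℕ.+ 62)))
        (ℕ.+-monoʳ-≤ (k ℕ.+ k) (ℕ.≤-trans (linear≤2^ 6≤s) 4^s≤l))))
        where
        lemma : ∀ k a → k ℕ.+ a ℕ.+ (k ℕ.+ a) ≡ k ℕ.+ k ℕ.+ (a ℕ.+ a)
        lemma = ℕ-Solver.solve-∀

      2≤k : 2 ℕ.≤ k
      2≤k = ℕ.≮⇒≥ λ { (s≤s k≤1) → ℕ.<⇒≱ (ℕ.<-≤-trans (ℕ.s≤s (ℕ.s≤s (ℕ.s≤s z≤n))) (ℕ.^-monoʳ-≤ 2 {2} {s ℕ.+ s} (ℕ.≤-trans (ℕ.≤-trans (s≤s (s≤s z≤n)) 6≤s) (ℕ.m≤m+n s s))))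
        (ℕ.≤-trans 4^s≤l (ℕ.≤-trans l≤k+k (ℕ.+-mono-≤ k≤1 k≤1))) }

      0<k : 0 ℕ.< k
      0<k = ℕ.≤-trans (s≤s z≤n) 2≤k

      3s+3≤i : s ℕ.+ s ℕ.+ 3 ℕ.+ s ℕ.≤ i
      3s+3≤i = ℕ.+-cancelʳ-≤ 62 _ i (ℕ.≤-trans (large s 6≤s) (ℕ.+-cancelˡ-≤ k _ _ (subst (k ℕ.+ 60 ℕ.* s ℕ.≤_)
        (trans (cong (ℕ._+ 62) (sym k+i)) (ℕ.+-assoc k i 62)) k≤)))
        where
        lemma : ∀ t → (6 ℕ.+ t) ℕ.+ (6 ℕ.+ t) ℕ.+ 3 ℕ.+ (6 ℕ.+ t) ℕ.+ 62 ℕ.+ (277 ℕ.+ 57 ℕ.* t) ≡ 60 ℕ.* (6 ℕ.+ t)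
        lemma = ℕ-Solver.solve-∀
        large : ∀ s → 6 ℕ.≤ s → s ℕ.+ s ℕ.+ 3 ℕ.+ s ℕ.+ 62 ℕ.≤ 60 ℕ.* s
        large s 6≤s = subst (λ s → s ℕ.+ s ℕ.+ 3 ℕ.+ s ℕ.+ 62 ℕ.≤ 60 ℕ.* s) (ℕ.m+[n∸m]≡n 6≤s)
          (ℕ.≤-trans (ℕ.m≤m+n _ (277 ℕ.+ 57 ℕ.* (s ∸ 6))) (ℕ.≤-reflexive (lemma (s ∸ 6))))

      0<b : 0 ℕ.< b
      0<b = ℕ.+-cancelʳ-≤ s 1 b (ℕ.≤-trans (ℕ.+-monoˡ-≤ s (ℕ.≤-trans (s≤s z≤n) (ℕ.m≤n+m 3 (s ℕ.+ s)))) 3s+3≤i)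

      b≤ : b ℕ.≤ 60 ℕ.* s ℕ.+ 62
      b≤ = ℕ.≤-trans (ℕ.m≤m+n b s) (ℕ.+-cancelˡ-≤ k _ _ (subst (ℕ._≤ k ℕ.+ (60 ℕ.* s ℕ.+ 62)) (sym k+i) l≤))

      b+k≤n : b ℕ.+ k ℕ.≤ n
      b+k≤n = ℕ.≤-trans (subst (b ℕ.+ k ℕ.≤_) b+k+s (ℕ.m≤m+n (b ℕ.+ k) s)) l≤n

      b+k≤1+n = ℕ.≤-trans b+k≤n (ℕ.n≤1+n n)

      0≤2 : 0ℚ ≤ 2ℚ
      0≤2 = ℚ.<⇒≤ (ℚ.positive⁻¹ 2ℚ)

      -- Since `2 k ≤ 2 l ≤ 2 ^ (2 s + 3)`, the gap `i ≥ 3 s + 3` between `k` and `l` outweighs the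
      -- factor `k` and leaves `½ ^ s`. It settles both the cost of removals and the growth of
      -- volumes below `k`.
      small : nat k * (2ℚ * ½ ^ i) ≤ h
      small = begin
        nat k * (2ℚ * ½ ^ i)
          ≡⟨ lemma₁ (nat k) (½ ^ i) ⟩
        (1ℚ + 1ℚ) * nat k * ½ ^ i
          ≤⟨ *-mono (0≤^ i 0≤½) (0≤nat (2 ℕ.^ (s ℕ.+ s ℕ.+ 3))) 2k≤ (½^-antimono 3s+3≤i) ⟩
        nat (2 ℕ.^ (s ℕ.+ s ℕ.+ 3)) * ½ ^ (s ℕ.+ s ℕ.+ 3 ℕ.+ s)
          ≡⟨ cong (nat (2 ℕ.^ (s ℕ.+ s ℕ.+ 3)) *_) (½^+ (s ℕ.+ s ℕ.+ 3) s) ⟩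
        nat (2 ℕ.^ (s ℕ.+ s ℕ.+ 3)) * (½ ^ (s ℕ.+ s ℕ.+ 3) * h)
          ≡⟨ trans (sym (ℚ.*-assoc (nat (2 ℕ.^ (s ℕ.+ s ℕ.+ 3))) (½ ^ (s ℕ.+ s ℕ.+ 3)) h))
               (trans (cong (_* h) (nat-2^*½^ (s ℕ.+ s ℕ.+ 3))) (ℚ.*-identityˡ h)) ⟩
        h ∎
        where
        open ℚ.≤-Reasoning
        lemma₁ : ∀ k x → k * (2ℚ * x) ≡ (1ℚ + 1ℚ) * k * x
        lemma₁ = solve 2 (λ k x → k ⊗ (Κ 2ℚ ⊗ x) ⊜ (Κ 1ℚ ⊕ Κ 1ℚ) ⊗ k ⊗ x) refl
        lemma₂ : ∀ k → (1ℚ + 1ℚ) * k ≡ k + k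
        lemma₂ = solve 1 (λ k → (Κ 1ℚ ⊕ Κ 1ℚ) ⊗ k ⊜ k ⊕ k) refl
        lemma₃ : ∀ x → x ℕ.+ x ≡ 2 ℕ.* x
        lemma₃ = ℕ-Solver.solve-∀
        2k≤ : (1ℚ + 1ℚ) * nat k ≤ nat (2 ℕ.^ (s ℕ.+ s ℕ.+ 3))
        2k≤ = subst (_≤ nat (2 ℕ.^ (s ℕ.+ s ℕ.+ 3))) (trans (nat-+ k k) (sym (lemma₂ (nat k))))
          (nat-mono (ℕ.≤-trans (ℕ.+-mono-≤ k≤4^ k≤4^) (ℕ.≤-reflexive (trans (lemma₃ (2 ℕ.^ (s ℕ.+ s ℕ.+ 2))) (cong (2 ℕ.^_) (sym (ℕ.+-suc (s ℕ.+ s) 2)))))))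
          where
          k≤4^ : k ℕ.≤ 2 ℕ.^ (s ℕ.+ s ℕ.+ 2)
          k≤4^ = ℕ.≤-trans k≤l l≤4^

      ∑deg⁻¹ : sum (downFrom k) (λ j → deg n j ⁻¹) ≤ 2ℚ * ½ ^ i
      ∑deg⁻¹ = sum-deg⁻¹ 2^l≤n l+l≤n 0<l k i k+i

      K≥ : sum (downFrom k) (λ j → nat j * deg n j ⁻¹) ≤ h
      K≥ = begin
        sum (downFrom k) (λ j → nat j * deg n j ⁻¹)
          ≤⟨ sum-monoᴬ (All.map (λ {j} j<k → *-monoʳ (0≤⁻¹ (deg n j)) (nat-mono (ℕ.<⇒≤ j<k))) (downFrom-< k)) ⟩
        sum (downFrom k) (λ j → nat k * deg n j ⁻¹)
          ≡⟨ sum-*ˡ (downFrom k) (nat k) (λ j → deg n j ⁻¹) ⟩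
        nat k * sum (downFrom k) (λ j → deg n j ⁻¹)
          ≤⟨ *-monoˡ (nat k) (0≤nat k) ∑deg⁻¹ ⟩
        nat k * (2ℚ * ½ ^ i)
          ≤⟨ small ⟩
        h ∎
        where open ℚ.≤-Reasoning

      ratio≤h : ∀ j → j ℕ.< k → nat (suc j) * deg n j ⁻¹ ≤ h
      ratio≤h j j<k = begin
        nat (suc j) * deg n j ⁻¹
          ≤⟨ *-mono (0≤⁻¹ (deg n j)) (0≤nat k) (nat-mono j<k) (deg⁻¹-upper 2^l≤n l+l≤n 0<l {j} {l ∸ j} (ℕ.m+[n∸m]≡n (ℕ.≤-trans (ℕ.<⇒≤ j<k) k≤l))) ⟩
        nat k * (2ℚ * ½ ^ (l ∸ j))
          ≤⟨ *-monoˡ (nat k) (0≤nat k) (*-monoˡ 2ℚ 0≤2 (½^-antimono i≤l∸j)) ⟩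
        nat k * (2ℚ * ½ ^ i)
          ≤⟨ small ⟩
        h ∎
        where
        open ℚ.≤-Reasoning
        i≤l∸j : i ℕ.≤ l ∸ j
        i≤l∸j = ℕ.m+n≤o⇒m≤o∸n i (subst (i ℕ.+ j ℕ.≤_) (trans (ℕ.+-comm i k) k+i) (ℕ.+-monoʳ-≤ i (ℕ.<⇒≤ j<k)))

      2^s≤l : 2 ℕ.^ s ℕ.≤ l
      2^s≤l = ℕ.≤-trans (ℕ.^-monoʳ-≤ 2 (ℕ.m≤m+n s s)) 4^s≤l

      -- From `T ≥ l 2ᵏ` and `n ≤ 2 ^ (l + 1)`, the time `T` times the move rate is at least
      -- `l ½ⁱ / 4`, while `∑ 1 / deg j` is at most `2 · ½ⁱ`. Hence `l P ≤ 8`, and `l ≥ 2ˢ`.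
      remaining≤ : remaining n k 0<n′ T ≤ 8ℚ * h
      remaining≤ = begin
        P
          ≡⟨ trans (sym (ℚ.*-identityˡ P)) (cong (_* P) (sym (nat-2^*½^ s))) ⟩
        nat (2 ℕ.^ s) * h * P
          ≤⟨ *-monoʳ 0≤P (*-monoʳ 0≤h (nat-mono 2^s≤l)) ⟩
        nat l * h * P
          ≡⟨ lemma₁ (nat l) h P ⟩
        nat l * P * h
          ≤⟨ *-monoʳ 0≤h (cancel-≤ {nat l * P} {8ℚ} (0<* {½ * ½} (0<* 0<½ 0<½) (0<^ i 0<½)) lP≤8) ⟩
        8ℚ * h ∎
        where
        open ℚ.≤-Reasoning
        P = remaining n k 0<n′ T
        0≤P : 0ℚ ≤ P
        0≤P = 0≤sum (downFrom k) (0≤prob n k 0<n′ T)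
        lemma₁ : ∀ l h P → l * h * P ≡ l * P * h
        lemma₁ = solve 3 (λ l h P → l ⊗ h ⊗ P ⊜ l ⊗ P ⊗ h) refl
        lemma₂ : ∀ l P x → l * P * (½ * ½ * x) ≡ l * 1ℚ * (½ * (½ * (1ℚ * x))) * P
        lemma₂ = solve 3 (λ l P x → l ⊗ P ⊗ (Κ ½ ⊗ Κ ½ ⊗ x) ⊜ l ⊗ Κ 1ℚ ⊗ (Κ ½ ⊗ (Κ ½ ⊗ (Κ 1ℚ ⊗ x))) ⊗ P) refl
        lemma₃ : ∀ l P x t z → l * (t * z) * (½ * (½ * (1ℚ * x))) * P ≡ l * t * (½ * (½ * (z * x))) * P
        lemma₃ = solve 5 (λ l P x t z →
          l ⊗ (t ⊗ z) ⊗ (Κ ½ ⊗ (Κ ½ ⊗ (Κ 1ℚ ⊗ x))) ⊗ P ⊜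
          l ⊗ t ⊗ (Κ ½ ⊗ (Κ ½ ⊗ (z ⊗ x))) ⊗ P) refl
        lemma₄ : ∀ x → 2ℚ * x ≡ 8ℚ * (½ * ½ * x)
        lemma₄ = solve 1 (λ x → Κ 2ℚ ⊗ x ⊜ Κ 8ℚ ⊗ (Κ ½ ⊗ Κ ½ ⊗ x)) refl
        ½^l≤n⁻¹ : ½ ^ suc l ≤ nat n ⁻¹
        ½^l≤n⁻¹ = subst (½ ^ suc l ≤_) (ℚ.*-identityˡ (nat n ⁻¹)) (≤⇒≤*⁻¹ {1ℚ} {½ ^ suc l} {nat n} (nat-pos 0<n′)
          (ℚ.≤-trans (*-monoˡ (½ ^ suc l) (0≤^ (suc l) 0≤½) (nat-mono n≤2^))
            (ℚ.≤-reflexive (trans (ℚ.*-comm (½ ^ suc l) (nat (2 ℕ.^ suc l))) (nat-2^*½^ (suc l))))))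
        lP≤8 : nat l * P * (½ * ½ * ½ ^ i) ≤ 8ℚ * (½ * ½ * ½ ^ i)
        lP≤8 = begin
          nat l * P * (½ * ½ * ½ ^ i)
            ≡⟨ lemma₂ (nat l) P (½ ^ i) ⟩
          nat l * 1ℚ * (½ * (½ * (1ℚ * ½ ^ i))) * P
            ≡⟨ cong (λ u → nat l * u * (½ * (½ * (1ℚ * ½ ^ i))) * P) (nat-2^*½^ k) ⟨
          nat l * (nat (2 ℕ.^ k) * ½ ^ k) * (½ * (½ * (1ℚ * ½ ^ i))) * P
            ≡⟨ lemma₃ (nat l) P (½ ^ i) (nat (2 ℕ.^ k)) (½ ^ k) ⟩
          nat l * nat (2 ℕ.^ k) * (½ * (½ * (½ ^ k * ½ ^ i))) * P
            ≡⟨ cong₂ (λ u v → u * (½ * (½ * v)) * P) (nat-* l (2 ℕ.^ k)) (trans (cong (½ ^_) (sym k+i)) (½^+ k i)) ⟨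
          nat (l ℕ.* 2 ℕ.^ k) * (½ * ½ ^ suc l) * P
            ≤⟨ *-monoʳ 0≤P (*-mono (0≤* 0≤½ (0≤^ (suc l) 0≤½)) (0≤nat T) (nat-mono T≥) (*-monoˡ ½ 0≤½ ½^l≤n⁻¹)) ⟩
          nat T * (½ * nat n ⁻¹) * P
            ≤⟨ remaining-bound n k 0<n′ k≤n T ⟩
          sum (downFrom k) (λ j → deg n j ⁻¹)
            ≤⟨ ∑deg⁻¹ ⟩
          2ℚ * ½ ^ i
            ≡⟨ lemma₄ (½ ^ i) ⟩
          8ℚ * (½ * ½ * ½ ^ i) ∎

      h≤ : ∀ j → j ℕ.≤ 6 → h ≤ ½ ^ j
      h≤ j j≤6 = ½^-antimono (ℕ.≤-trans j≤6 6≤s)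

      0≤8h : 0ℚ ≤ 8ℚ * h
      0≤8h = 0≤* {8ℚ} (ℚ.nonNegative⁻¹ 8ℚ) 0≤h

    bad : Graph n → ℚ
    bad = badness 0<n′ k b 0<k 0<b b+k≤n

    0≤bad : ∀ G → 0ℚ ≤ bad G
    0≤bad G = 0≤+ (0≤sum (downFrom (b ℕ.+ k)) (0≤Δ G)) (0≤* (0≤tail G k b b+k≤1+n) (0≤⁻¹ _))

    private
      -- The constant is 4 from below the band plus 96 from above it: `4 · 8 h` times the weight
      -- `k + M ≤ 3 k` at the top size `M` of the band.
      tail-bound : ∀ b (0<b : 0 ℕ.< b) (b+k+s : b ℕ.+ k ℕ.+ s ≡ l) (b+k≤ : b ℕ.+ k ℕ.≤ suc n) →
        𝔼 G[ n ,½] (λ G → tail G k b b+k≤) ≤ 100ℚ * h * (volume {n} k b * nat k)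
      tail-bound (suc b) _ b+k+s b+k≤ = begin
        𝔼 G[ n ,½] (λ G → tail G k (suc b) b+k≤)
          ≡⟨ 𝔼-tail n k (suc b) b+k≤ ⟩
        partialVolume n k k + (partialVolume n k (suc n) - partialVolume n k (suc M))
          ≤⟨ ℚ.+-mono-≤ (lower-tail n k h 0≤h (h≤ 1 (s≤s z≤n)) k≤n ratio≤h) (≤+⇒-≤ _ _ _ (ℚ.≤-trans
               (ℚ.≤-reflexive (cong (partialVolume n k) (sym (ℕ.m∸n+n≡m b+k≤))))
               (subst (partialVolume n k (suc n ∸ suc M ℕ.+ suc M) ≤_) (ℚ.+-comm (partialVolume n k (suc M)) _)
                 (upper-tail n k (8ℚ * h) 0≤8h 32h≤1 M (ℕ.≤-trans 0<k (ℕ.m≤m+n k M)) ratio≤8h (suc n ∸ suc M) M ℕ.≤-refl)))) ⟩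
        4ℚ * h * vol n k * nat k + 4ℚ * (8ℚ * h) * (nat k + nat M) * vol n M
          ≤⟨ ℚ.+-mono-≤ (*-monoʳ (0≤nat k) (*-monoˡ (4ℚ * h) 0≤4h vol-k≤)) (*-mono (0≤vol n M) (0≤* {4ℚ * (8ℚ * h)} 0≤32h 0≤3k) (*-monoˡ (4ℚ * (8ℚ * h)) 0≤32h k+M≤3k) vol-M≤) ⟩
        4ℚ * h * W * nat k + 4ℚ * (8ℚ * h) * (nat k + (nat k + nat k)) * W
          ≡⟨ lemma h W (nat k) ⟩
        100ℚ * h * (W * nat k) ∎
        where
        open ℚ.≤-Reasoning
        M = b ℕ.+ k
        W = volume {n} k (suc b)
        0≤3k : 0ℚ ≤ nat k + (nat k + nat k)
        0≤3k = 0≤+ (0≤nat k) (0≤+ (0≤nat k) (0≤nat k))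
        0≤4h : 0ℚ ≤ 4ℚ * h
        0≤4h = 0≤* {4ℚ} (ℚ.nonNegative⁻¹ 4ℚ) 0≤h
        0≤32h : 0ℚ ≤ 4ℚ * (8ℚ * h)
        0≤32h = 0≤* {4ℚ} (ℚ.nonNegative⁻¹ 4ℚ) 0≤8h
        lemma : ∀ h W k → 4ℚ * h * W * k + 4ℚ * (8ℚ * h) * (k + (k + k)) * W ≡ 100ℚ * h * (W * k)
        lemma = solve 3 (λ h W k →
          Κ 4ℚ ⊗ h ⊗ W ⊗ k ⊕ Κ 4ℚ ⊗ (Κ 8ℚ ⊗ h) ⊗ (k ⊕ (k ⊕ k)) ⊗ W ⊜
          Κ 100ℚ ⊗ h ⊗ (W ⊗ k)) refl
        32h≤1 : 4ℚ * (8ℚ * h) ≤ 1ℚ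
        32h≤1 = ℚ.≤-trans (*-monoˡ 4ℚ (ℚ.nonNegative⁻¹ 4ℚ) (*-monoˡ 8ℚ (ℚ.nonNegative⁻¹ 8ℚ) (h≤ 5 (ℕ.n≤1+n 5)))) ℚ.≤-refl
        0≤volume : ∀ b → 0ℚ ≤ volume {n} k b
        0≤volume b = 0≤sum (downFrom b) λ a → 0≤vol n (a ℕ.+ k)
        vol-M≤ : vol n M ≤ W
        vol-M≤ = p≤p+q (0≤volume b)
        vol-k≤ : vol n k ≤ W
        vol-k≤ = vol≤volume k b
        M≤k+k : M ℕ.≤ k ℕ.+ k
        M≤k+k = ℕ.≤-trans (ℕ.≤-trans (ℕ.n≤1+n M) (subst (suc M ℕ.≤_) b+k+s (ℕ.m≤m+n (suc M) s))) l≤k+k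
        k+M≤3k : nat k + nat M ≤ nat k + (nat k + nat k)
        k+M≤3k = ℚ.+-monoʳ-≤ (nat k) (ℚ.≤-trans (nat-mono M≤k+k) (ℚ.≤-reflexive (nat-+ k k)))
        -- As `l = M + 1 + s`, the numerator is at most `2 ^ (s + 2)`, while `M + 1` is at least
        -- `l / 2` and so at least `4ˢ / 2`. The cut `s` levels below `l` is what leaves the factor
        -- `2⁻ˢ`.
        ratio≤8h : nat n * ½ ^ M * nat (suc M) ⁻¹ ≤ 8ℚ * h
        ratio≤8h = ≤⇒*⁻¹≤ {nat n * ½ ^ M} {8ℚ * h} (0<nat M) (begin
          nat n * ½ ^ M
            ≤⟨ *-monoʳ (0≤^ M 0≤½) (nat-mono n≤2^) ⟩
          nat (2 ℕ.^ suc l) * ½ ^ M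
            ≡⟨ cong (λ j → nat (2 ℕ.^ j) * ½ ^ M) (trans (cong suc (sym b+k+s)) (lemma₁ M s)) ⟩
          nat (2 ℕ.^ (2 ℕ.+ s ℕ.+ M)) * ½ ^ M
            ≡⟨ cong (_* ½ ^ M) (trans (cong nat (ℕ.^-distribˡ-+-* 2 (2 ℕ.+ s) M)) (nat-* (2 ℕ.^ (2 ℕ.+ s)) (2 ℕ.^ M))) ⟩
          nat (2 ℕ.^ (2 ℕ.+ s)) * nat (2 ℕ.^ M) * ½ ^ M
            ≡⟨ trans (ℚ.*-assoc (nat (2 ℕ.^ (2 ℕ.+ s))) (nat (2 ℕ.^ M)) (½ ^ M))
                 (trans (cong (nat (2 ℕ.^ (2 ℕ.+ s)) *_) (nat-2^*½^ M)) (ℚ.*-identityʳ _)) ⟩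
          nat (2 ℕ.^ (2 ℕ.+ s))
            ≡⟨ trans (cong nat (ℕ.^-distribˡ-+-* 2 2 s)) (trans (nat-* 4 (2 ℕ.^ s)) (lemma₂ (nat (2 ℕ.^ s)))) ⟩
          4ℚ * (1ℚ * nat (2 ℕ.^ s))
            ≡⟨ cong (λ u → 4ℚ * (u * nat (2 ℕ.^ s))) (nat-2^*½^ s) ⟨
          4ℚ * (nat (2 ℕ.^ s) * h * nat (2 ℕ.^ s))
            ≡⟨ lemma₃ h (nat (2 ℕ.^ s)) ⟩
          4ℚ * h * (nat (2 ℕ.^ s) * nat (2 ℕ.^ s))
            ≡⟨ cong (4ℚ * h *_) (trans (cong nat (ℕ.^-distribˡ-+-* 2 s s)) (nat-* (2 ℕ.^ s) (2 ℕ.^ s))) ⟨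
          4ℚ * h * nat (2 ℕ.^ (s ℕ.+ s))
            ≤⟨ *-monoˡ (4ℚ * h) 0≤4h (nat-mono 4^s≤) ⟩
          4ℚ * h * nat (suc M ℕ.+ suc M)
            ≡⟨ trans (cong (4ℚ * h *_) (nat-+ (suc M) (suc M))) (lemma₄ h (nat (suc M))) ⟩
          8ℚ * h * nat (suc M) ∎)
          where
          lemma₁ : ∀ M s → suc (suc M ℕ.+ s) ≡ 2 ℕ.+ s ℕ.+ M
          lemma₁ = ℕ-Solver.solve-∀
          lemma₂ : ∀ x → nat 4 * x ≡ 4ℚ * (1ℚ * x)
          lemma₂ x = cong (4ℚ *_) (sym (ℚ.*-identityˡ x))
          lemma₃ : ∀ h x → 4ℚ * (x * h * x) ≡ 4ℚ * h * (x * x)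
          lemma₃ = solve 2 (λ h x → Κ 4ℚ ⊗ (x ⊗ h ⊗ x) ⊜ Κ 4ℚ ⊗ h ⊗ (x ⊗ x)) refl
          lemma₄ : ∀ h x → 4ℚ * h * (x + x) ≡ 8ℚ * h * x
          lemma₄ = solve 2 (λ h x → Κ 4ℚ ⊗ h ⊗ (x ⊕ x) ⊜ Κ 8ℚ ⊗ h ⊗ x) refl
          lemma₅ : ∀ M s → suc M ℕ.+ s ℕ.+ (suc M ℕ.+ s) ≡ suc M ℕ.+ suc M ℕ.+ (s ℕ.+ s)
          lemma₅ = ℕ-Solver.solve-∀
          4^s≤ : 2 ℕ.^ (s ℕ.+ s) ℕ.≤ suc M ℕ.+ suc M
          4^s≤ = ℕ.≤-trans 4^s≤l (ℕ.+-cancelʳ-≤ l l (suc M ℕ.+ suc M) (ℕ.≤-trans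
            (ℕ.≤-reflexive (trans (cong (λ l → l ℕ.+ l) (sym b+k+s)) (lemma₅ M s)))
            (ℕ.+-monoʳ-≤ (suc M ℕ.+ suc M) (ℕ.≤-trans (ℕ.<⇒≤ (n<2^n (s ℕ.+ s))) 4^s≤l))))

      0<Wk : ∀ b → 0 ℕ.< b → 0ℚ < volume {n} k b * nat k
      0<Wk b 0<b = 0<* (0<volume k k≤n 0<b) (nat-pos 0<k)

    𝔼-bad : 𝔼 G[ n ,½] bad ≤ 106ℚ * ¾ ^ s
    𝔼-bad = begin
      𝔼 G[ n ,½] (λ G → Δsum G (b ℕ.+ k) + tail G k b b+k≤1+n * (W * nat k) ⁻¹)
        ≡⟨ trans (𝔼-+ G[ n ,½] (λ G → Δsum G (b ℕ.+ k)) (λ G → tail G k b b+k≤1+n * (W * nat k) ⁻¹))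
             (cong (_+_ (𝔼 G[ n ,½] λ G → Δsum G (b ℕ.+ k))) (𝔼-*ʳ G[ n ,½] ((W * nat k) ⁻¹) (λ G → tail G k b b+k≤1+n))) ⟩
      𝔼 G[ n ,½] (λ G → Δsum G (b ℕ.+ k)) + 𝔼 G[ n ,½] (λ G → tail G k b b+k≤1+n) * (W * nat k) ⁻¹
        ≤⟨ ℚ.+-mono-≤ (𝔼-Δsum 2^l≤n l+l≤n 0<l (b ℕ.+ k) s b+k+s)
             (≤⇒*⁻¹≤ {𝔼 G[ n ,½] λ G → tail G k b b+k≤1+n} {100ℚ * h} (0<Wk b 0<b) (tail-bound b 0<b b+k+s b+k≤1+n)) ⟩
      6ℚ * ¾ ^ s + 100ℚ * h
        ≤⟨ ℚ.+-monoʳ-≤ (6ℚ * ¾ ^ s) (*-monoˡ 100ℚ (ℚ.nonNegative⁻¹ 100ℚ) (^-mono s 0≤½ (frac-mono {1} {1} {3} {3} (ℕ.m≤m+n 4 2)))) ⟩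
      6ℚ * ¾ ^ s + 100ℚ * ¾ ^ s
        ≡⟨ lemma (¾ ^ s) ⟩
      106ℚ * ¾ ^ s ∎
      where
      open ℚ.≤-Reasoning
      W = volume {n} k b
      lemma : ∀ x → 6ℚ * x + 100ℚ * x ≡ 106ℚ * x
      lemma = solve 1 (λ x → Κ 6ℚ ⊗ x ⊕ Κ 100ℚ ⊗ x ⊜ Κ 106ℚ ⊗ x) refl

    private
      q = ⅞ ^ s
      r = 15/16 ^ s

      0≤⅞ : 0ℚ ≤ ⅞
      0≤⅞ = ℚ.nonNegative⁻¹ ⅞

      0≤r : 0ℚ ≤ r
      0≤r = 0≤^ s (ℚ.nonNegative⁻¹ 15/16)

      0<q : 0ℚ < q
      0<q = 0<^ s (ℚ.positive⁻¹ ⅞)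

      h≤q : h ≤ q
      h≤q = ^-mono {½} {⅞} s 0≤½ (frac-mono {1} {1} {7} {7} (ℕ.m≤m+n 8 6))

      q≤r² : q ≤ r * r
      q≤r² = subst (q ≤_) (*-^ 15/16 15/16 s) (^-mono {⅞} {15/16 * 15/16} s 0≤⅞ (frac-mono {7} {7} {225} {255} (ℕ.m≤m+n 1792 8)))

      q≤r : q ≤ r
      q≤r = ^-mono {⅞} {15/16} s 0≤⅞ (frac-mono {7} {7} {15} {15} (ℕ.m≤m+n 112 8))

      ¾^s≤q² : ¾ ^ s ≤ q * q
      ¾^s≤q² = subst (¾ ^ s ≤_) (*-^ ⅞ ⅞ s) (^-mono {¾} {⅞ * ⅞} s (ℚ.<⇒≤ 0<¾) (frac-mono {3} {3} {49} {63} (ℕ.m≤m+n 192 4)))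

      -- The width of the band is only of order `log log n`: `2 b` is at most
      -- `244 · 2ˢ = 244 · 4ˢ h`, and `4ˢ ≤ l ≤ 2 k`.
      b+b≤ : nat b + nat b ≤ 488ℚ * q * nat k
      b+b≤ = begin
        nat b + nat b
          ≡⟨ nat-+ b b ⟨
        nat (b ℕ.+ b)
          ≤⟨ nat-mono (ℕ.≤-trans (ℕ.+-mono-≤ b≤ b≤) linear) ⟩
        nat (244 ℕ.* 2 ℕ.^ s)
          ≡⟨ nat-* 244 (2 ℕ.^ s) ⟩
        nat 244 * nat (2 ℕ.^ s)
          ≡⟨ cong (nat 244 *_) (trans (sym (ℚ.*-identityʳ x)) (cong (x *_) (sym (nat-2^*½^ s)))) ⟩
        nat 244 * (x * (x * h))
          ≡⟨ cong (nat 244 *_) (trans (sym (ℚ.*-assoc x x h)) (cong (_* h) (sym (trans (cong nat (ℕ.^-distribˡ-+-* 2 s s)) (nat-* (2 ℕ.^ s) (2 ℕ.^ s)))))) ⟩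
        nat 244 * (nat (2 ℕ.^ (s ℕ.+ s)) * h)
          ≤⟨ *-monoˡ (nat 244) (0≤nat 244) (*-mono 0≤h (0≤nat (k ℕ.+ k)) (nat-mono (ℕ.≤-trans 4^s≤l l≤k+k)) h≤q) ⟩
        nat 244 * (nat (k ℕ.+ k) * q)
          ≡⟨ cong (λ u → nat 244 * (u * q)) (nat-+ k k) ⟩
        nat 244 * ((nat k + nat k) * q)
          ≡⟨ lemma₂ (nat k) q ⟩
        488ℚ * q * nat k ∎
        where
        open ℚ.≤-Reasoning
        x = nat (2 ℕ.^ s)
        lemma₁ : ∀ y → (60 ℕ.* y ℕ.+ 62 ℕ.* y) ℕ.+ (60 ℕ.* y ℕ.+ 62 ℕ.* y) ≡ 244 ℕ.* y
        lemma₁ = ℕ-Solver.solve-∀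
        lemma₃ : ∀ k q → frac 244 0 * ((k + k) * q) ≡ 488ℚ * q * k
        lemma₃ = solve 2 (λ k q → Κ (frac 244 0) ⊗ ((k ⊕ k) ⊗ q) ⊜ Κ 488ℚ ⊗ q ⊗ k) refl
        lemma₂ : ∀ k q → nat 244 * ((k + k) * q) ≡ 488ℚ * q * k
        lemma₂ k q = trans (cong (_* ((k + k) * q)) (nat≡frac 244)) (lemma₃ k q)
        half≤ : 60 ℕ.* s ℕ.+ 62 ℕ.≤ 60 ℕ.* 2 ℕ.^ s ℕ.+ 62 ℕ.* 2 ℕ.^ s
        half≤ = ℕ.+-mono-≤ (ℕ.*-monoʳ-≤ 60 (ℕ.<⇒≤ (n<2^n s))) (ℕ.m≤m*n 62 (2 ℕ.^ s) {{ℕ.m^n≢0 2 s}})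
        linear : (60 ℕ.* s ℕ.+ 62) ℕ.+ (60 ℕ.* s ℕ.+ 62) ℕ.≤ 244 ℕ.* 2 ℕ.^ s
        linear = ℕ.≤-trans (ℕ.+-mono-≤ half≤ half≤) (ℕ.≤-reflexive (lemma₁ (2 ℕ.^ s)))

    module _ (30q≤1 : 30ℚ * q ≤ 1ℚ) (G : Graph n) (bad≤q : bad G ≤ q) where

      private
        P = remaining n k 0<n′ T
        η = (1ℚ + 1ℚ + 1ℚ + 1ℚ + 1ℚ) * q + P + (1ℚ + 1ℚ) * h

        q≤½ : q ≤ ½
        q≤½ = cancel-≤ {q} {½} (ℚ.positive⁻¹ 30ℚ) (ℚ.≤-trans (ℚ.≤-reflexive (ℚ.*-comm q 30ℚ)) (ℚ.≤-trans 30q≤1 (frac-mono {1} {0} {15} {0} (s≤s z≤n))))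

        P≤½ : P ≤ ½
        P≤½ = ℚ.≤-trans remaining≤ (ℚ.≤-trans (*-monoˡ 8ℚ (ℚ.nonNegative⁻¹ 8ℚ) (h≤ 4 (ℕ.m≤m+n 4 2))) ℚ.≤-refl)

        μ ν : Subset n → ℚ
        μ X = partition G ⁻¹ * ind G X
        ν Y = run 0<n′ G k T Subset.⊥ λ S → δ S Y

        π : RationalCoupling μ ν
        π = good-coupling 0<n′ k b 0<k 0<b b+k≤n G T q h bad≤q q≤½ P≤½ K≥

        A B C : ℚ
        A = sum (subsets n) λ X → μ X * nat ∣ X ∣
        B = sum (subsets n) λ Y → ν Y * nat ∣ Y ∣
        C = meanOverlap π

        C≥ : (1ℚ - frac 15 0 * q) * nat k ≤ C
        C≥ = overlap-bound C (nat k) q η (0≤nat k) (η-bound q h P remaining≤ h≤q)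
          (overlap-lower 0<n′ k b 0<k 0<b b+k≤n G T q h bad≤q q≤½ P≤½ K≥)

        A≤ : A ≤ nat b + nat k + (1ℚ + 1ℚ) * q * nat k
        A≤ = subst (λ u → A ≤ u + (1ℚ + 1ℚ) * q * nat k) (nat-+ b k)
          (size-hardcore 0<n′ k b 0<k 0<b b+k≤n G T q h bad≤q q≤½ P≤½ K≥)

        1≤C : 1ℚ ≤ C
        1≤C = ℚ.≤-trans (*-monoˡ ½ 0≤½ (nat-mono 2≤k)) (overlap-half C (nat k) q (0≤nat k) 30q≤1 C≥)

      close : w₂[ law (hardcore G) , law (glauber G k T) ]≤ fromℚ (24ℚ * r)
      close = w₂-bound (law (hardcore G)) (law (glauber G k T)) μ ν (λ S m → hardcore-law G S) (λ S m → glauber-law 0<n′ G k T S) π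
        (ℚ.≤-trans 1≤C (overlap≤ˡ π)) (ℚ.≤-trans 1≤C (overlap≤ʳ π))
        (0≤* {24ℚ} (ℚ.nonNegative⁻¹ 24ℚ) 0≤r) (ℚ.≤-trans 0≤1 1≤C)
        (final-bound A B C (nat b) (nat k) q r (nat-pos 0<k) (ℚ.<⇒≤ 0<q) 30q≤1 q≤r² A≤
          (size-glauber 0<n′ k b 0<k 0<b b+k≤n G T q h bad≤q q≤½ P≤½ K≥) C≥ (overlap≤ˡ π) (overlap≤ʳ π) b+b≤)

    -- Markov's inequality with threshold `q`: the mean of `bad` is of order `¾ ^ s ≤ q²`, so both
    -- the threshold and the failure probability are of order `q`.
    close-with-high-probability : 30ℚ * 15/16 ^ s ≤ 1ℚ → ProbAtLeast G[ n ,½]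
      (λ G → w₂[ law (hardcore G) , law (glauber G k T) ]≤ fromℚ (24ℚ * 15/16 ^ s)) (1ℝ Defs.- fromℚ (24ℚ * 15/16 ^ s))
    close-with-high-probability 30r≤1 = E , (λ G e → close 30q≤1 G (does⇒ (bad G ℚ.≤? q) e)) ,
      pointwise-≤ {1ℝ Defs.- fromℚ (24ℚ * r)} {fromℚ (Pr Γ E)} λ _ → likely
      where
      Γ = G[ n ,½]
      30q≤1 : 30ℚ * q ≤ 1ℚ
      30q≤1 = ℚ.≤-trans (*-monoˡ 30ℚ (ℚ.nonNegative⁻¹ 30ℚ) q≤r) 30r≤1
      E : Graph n → Bool
      E G = does (bad G ℚ.≤? q)
      does⇒ : ∀ {P : Set} (d : Dec P) → does d ≡ true → P
      does⇒ (yes p) _ = p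
      open ℚ.≤-Reasoning
      likely : 1ℚ - 24ℚ * r ≤ Pr Γ E
      likely = begin
        1ℚ - 24ℚ * r
          ≤⟨ neg-mono 1ℚ (begin
            q ⁻¹ * 𝔼 Γ bad         ≤⟨ *-monoˡ (q ⁻¹) (0≤⁻¹ q) 𝔼-bad ⟩
            q ⁻¹ * (106ℚ * ¾ ^ s)  ≡⟨ lemma (q ⁻¹) (¾ ^ s) ⟩
            106ℚ * (¾ ^ s * q ⁻¹)  ≤⟨ *-monoˡ 106ℚ (ℚ.nonNegative⁻¹ 106ℚ) (≤⇒*⁻¹≤ {¾ ^ s} {q} 0<q ¾^s≤q²) ⟩
            106ℚ * q               ≤⟨ *-monoˡ 106ℚ (ℚ.nonNegative⁻¹ 106ℚ) q≤r² ⟩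
            -- Smallness of `r` brings the failure probability below the same error `24 r` that
            -- bounds the distance.
            106ℚ * (r * r)         ≤⟨ ≤-by (4ℚ * r * (1ℚ - 30ℚ * r) + (20ℚ * r + 14ℚ * (r * r))) (0≤+ (0≤* {4ℚ * r} (0≤* {4ℚ} (ℚ.nonNegative⁻¹ 4ℚ) 0≤r) (≤⇒0≤- 30r≤1))
              (0≤+ (0≤* {20ℚ} (ℚ.nonNegative⁻¹ 20ℚ) 0≤r) (0≤* {14ℚ} (ℚ.nonNegative⁻¹ 14ℚ) (0≤² r)))) (lemma₃ r) ⟩
            24ℚ * r                ∎) ⟩
        1ℚ - q ⁻¹ * 𝔼 Γ bad
          ≡⟨ trans (𝔼-+ Γ (λ _ → 1ℚ) (λ G → - (q ⁻¹ * bad G)))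
               (cong₂ _+_ (𝔼-G-1 n) (trans (𝔼-cong Γ λ G → lemma₂ (q ⁻¹) (bad G)) (trans (𝔼-*ˡ Γ (- 1ℚ * q ⁻¹) bad) (sym (lemma₂ (q ⁻¹) (𝔼 Γ bad)))))) ⟨
        𝔼 Γ (λ G → 1ℚ - q ⁻¹ * bad G)
          ≤⟨ 𝔼-mono (NonNeg-G n) (λ G → markov 0<q (0≤bad G) (bad G ℚ.≤? q)) ⟩
        𝔼 Γ (λ G → 𝟙 (bad G ℚ.≤? q))
          ≡⟨ Pr≡𝔼 Γ E ⟨
        Pr Γ E ∎
        where
        14ℚ 20ℚ : ℚ
        14ℚ = frac 14 0
        20ℚ = frac 20 0
        lemma₃ : ∀ r → 106ℚ * (r * r) + (4ℚ * r * (1ℚ - 30ℚ * r) + (20ℚ * r + 14ℚ * (r * r))) ≡ 24ℚ * r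
        lemma₃ = solve 1 (λ r →
          Κ 106ℚ ⊗ (r ⊗ r) ⊕ (Κ 4ℚ ⊗ r ⊗ (Κ 1ℚ ⊖ Κ 30ℚ ⊗ r) ⊕ (Κ 20ℚ ⊗ r ⊕ Κ 14ℚ ⊗ (r ⊗ r))) ⊜
          Κ 24ℚ ⊗ r) refl
        lemma : ∀ i x → i * (106ℚ * x) ≡ 106ℚ * (x * i)
        lemma = solve 2 (λ i x → i ⊗ (Κ 106ℚ ⊗ x) ⊜ Κ 106ℚ ⊗ (x ⊗ i)) refl
        lemma₂ : ∀ i x → - (i * x) ≡ - 1ℚ * i * x
        lemma₂ = solve 2 (λ i x → ⊝ (i ⊗ x) ⊜ ⊝ Κ 1ℚ ⊗ i ⊗ x) refl

open Parameters

-- Integer bounds from the real logarithms, and convergence of the error.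

module Extraction where

  open Data.Rational.Base using (_+_; _*_; _-_; -_; _≤_; _<_)

  lg : ℕ → ℕ
  lg n = greatest (λ j → 2 ℕ.^ j ℕ.≤? n) n

  lg₄ : ℕ → ℕ
  lg₄ l = greatest (λ j → 2 ℕ.^ (j ℕ.+ j) ℕ.≤? l) l

  2^lg≤ : ∀ {n} → 1 ℕ.≤ n → 2 ℕ.^ lg n ℕ.≤ n
  2^lg≤ {n} 1≤n = greatest-holds (λ j → 2 ℕ.^ j ℕ.≤? n) n 1≤n

  <2^lg : ∀ n → n ℕ.< 2 ℕ.^ suc (lg n)
  <2^lg n = ℕ.≰⇒> (greatest-maximal (λ j → 2 ℕ.^ j ℕ.≤? n) n (ℕ.<⇒≱ (ℕ.<-≤-trans (n<2^n n) (ℕ.^-monoʳ-≤ 2 (ℕ.n≤1+n n)))))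

  4^lg₄≤ : ∀ {l} → 1 ℕ.≤ l → 2 ℕ.^ (lg₄ l ℕ.+ lg₄ l) ℕ.≤ l
  4^lg₄≤ {l} 1≤l = greatest-holds (λ j → 2 ℕ.^ (j ℕ.+ j) ℕ.≤? l) l 1≤l

  <4^lg₄ : ∀ l → l ℕ.< 2 ℕ.^ (suc (lg₄ l) ℕ.+ suc (lg₄ l))
  <4^lg₄ l = ℕ.≰⇒> (greatest-maximal (λ j → 2 ℕ.^ (j ℕ.+ j) ℕ.≤? l) l
    (ℕ.<⇒≱ (ℕ.<-≤-trans (n<2^n l) (ℕ.^-monoʳ-≤ 2 (ℕ.≤-trans (ℕ.n≤1+n l) (ℕ.m≤m+n (suc l) (suc l)))))))

  2^-cancel-< : ∀ {i j} → 2 ℕ.^ i ℕ.< 2 ℕ.^ j → i ℕ.< j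
  2^-cancel-< {i} {j} h = ℕ.≰⇒> λ j≤i → ℕ.<⇒≱ h (ℕ.^-monoʳ-≤ 2 j≤i)

  lg-large : ∀ {L n} → 2 ℕ.^ L ℕ.≤ n → L ℕ.≤ lg n
  lg-large {L} {n} h = ℕ.≤-pred (2^-cancel-< {L} {suc (lg n)} (ℕ.≤-<-trans h (<2^lg n)))

  lg₄-large : ∀ {S l} → 2 ℕ.^ (S ℕ.+ S) ℕ.≤ l → S ℕ.≤ lg₄ l
  lg₄-large {S} {l} h = ℕ.≮⇒≥ λ lt → ℕ.<⇒≱
    (2^-cancel-< {S ℕ.+ S} {suc (lg₄ l) ℕ.+ suc (lg₄ l)} (ℕ.≤-<-trans h (<4^lg₄ l))) (ℕ.+-mono-≤ lt lt)

  nat-cancel-≤ : ∀ {i j} → nat i ≤ nat j → i ℕ.≤ j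
  nat-cancel-≤ {i} {j} h = ℕ.≮⇒≥ λ j<i → ℚ.<-irrefl refl (ℚ.<-≤-trans
    (subst₂ _<_ (ℚ.+-identityˡ (nat j)) refl (ℚ.+-monoˡ-< (nat j) (ℚ.positive⁻¹ 1ℚ))) (ℚ.≤-trans (nat-mono j<i) h))

  frac*nat : ∀ j m → frac j m * nat (suc m) ≡ nat j
  frac*nat j m = trans (cong (_* nat (suc m)) (sym (nat*frac j m))) (trans (lemma (nat j) (frac 1 m) (nat (suc m)))
    (trans (cong (nat j *_) (trans (cong (nat (suc m) *_) (frac≡⁻¹ m)) (*-⁻¹ (0<nat m)))) (ℚ.*-identityʳ (nat j))))
    where
    lemma : ∀ a b c → a * b * c ≡ a * (c * b)
    lemma = solve 3 (λ a b c → a ⊗ b ⊗ c ⊜ a ⊗ (c ⊗ b)) refl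

  2ℚ^≡nat : ∀ l → 2ℚ ^ l ≡ frac (2 ℕ.^ l) 0
  2ℚ^≡nat l = trans (sym (nat-^ 2 l)) (nat≡frac (2 ℕ.^ l))

  -- The index is a numerator over `suc m`, rounded down; the `suc` on the right is thus an error of
  -- `1 / (m + 1)` in the logarithm.
  log-index-lower : ∀ q m a → 2ℚ ^ a ≤ 1ℚ ℚ.⊔ q → a ℕ.* suc m ℕ.≤ suc (log-index m q)
  log-index-lower q m a h = 2^-cancel (subst (_≤ 2ℚ ^ suc (log-index m q)) (ℚ^.^-assocʳ 2ℚ a (suc m))
    (ℚ.≤-trans (^-mono (suc m) (0≤^ a (ℚ.<⇒≤ (ℚ.positive⁻¹ 2ℚ))) h) (log-upper m q)))

  log-index-upper : ∀ q m u → 1ℚ ℚ.⊔ q ≤ 2ℚ ^ u → log-index m q ℕ.≤ u ℕ.* suc m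
  log-index-upper q m u h = 2^-cancel (subst (2ℚ ^ log-index m q ≤_) (ℚ^.^-assocʳ 2ℚ u (suc m))
    (ℚ.≤-trans (log-lower m q) (^-mono (suc m) (ℚ.≤-trans 0≤1 (ℚ.p≤p⊔q 1ℚ q)) h)))

  log₂-approx : ∀ x {q} m → approx x m ≡ q → approx (log₂ x) m ≡ frac (log-index m q) m
  log₂-approx x m refl = refl

  -- Numerators of the m-th approximations of log₂ q and log₂ (log₂ q); index is kept
  -- abstract, since the search in log-index must not be unfolded.
  abstract
    index : ℚ → ℕ → ℕ
    index q m = log-index m q

    index≡ : ∀ q m → index q m ≡ log-index m q
    index≡ q m = refl

  loglog-index : ℚ → ℕ → ℕ
  loglog-index q m = index (frac (index q m) m) m

  log₂-index : ∀ x q m → approx x m ≡ q → approx (log₂ x) m ≡ frac (index q m) m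
  log₂-index x q m h = trans (log₂-approx x {q} m h) (cong (λ j → frac j m) (sym (index≡ q m)))

  loglog₂-index : ∀ x q m → approx x m ≡ q → approx (log₂ (log₂ x)) m ≡ frac (loglog-index q m) m
  loglog₂-index x q m h = log₂-index (log₂ x) (frac (index q m) m) m (log₂-index x q m h)

  index-lower : ∀ j d m a → 2 ℕ.^ a ℕ.* suc d ℕ.≤ j → a ℕ.* suc m ℕ.≤ suc (index (frac j d) m)
  index-lower j d m a h = subst (λ i → a ℕ.* suc m ℕ.≤ suc i) (sym (index≡ (frac j d) m)) (log-index-lower (frac j d) m a (ℚ.≤-trans (ℚ.≤-reflexive (2ℚ^≡nat a))
    (ℚ.≤-trans (frac-mono {2 ℕ.^ a} {0} {j} {d} (subst (2 ℕ.^ a ℕ.* suc d ℕ.≤_) (sym (ℕ.*-identityʳ j)) h)) (ℚ.p≤q⊔p 1ℚ (frac j d)))))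

  index-upper : ∀ j d m u → j ℕ.≤ 2 ℕ.^ u ℕ.* suc d → index (frac j d) m ℕ.≤ u ℕ.* suc m
  index-upper j d m u h = subst (ℕ._≤ u ℕ.* suc m) (sym (index≡ (frac j d) m)) (log-index-upper (frac j d) m u (ℚ.≤-trans (ℚ.⊔-lub
    (frac-mono {1} {0} {2 ℕ.^ u} {0} (ℕ.*-monoˡ-≤ 1 (ℕ.m^n>0 2 u)))
    (frac-mono {j} {d} {2 ℕ.^ u} {0} (subst (ℕ._≤ 2 ℕ.^ u ℕ.* suc d) (sym (ℕ.*-identityʳ j)) h)))
    (ℚ.≤-reflexive (sym (2ℚ^≡nat u)))))

  loglog-lower : ∀ q m a → 2 ℕ.^ a ℕ.* suc m ℕ.≤ index q m → a ℕ.* suc m ℕ.≤ suc (loglog-index q m)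
  loglog-lower q m a h = index-lower (index q m) m m a h

  loglog-upper : ∀ q m u → index q m ℕ.≤ 2 ℕ.^ u ℕ.* suc m → loglog-index q m ℕ.≤ u ℕ.* suc m
  loglog-upper q m u h = index-upper (index q m) m m u h

  -- A single index is enough, because the bounds on the index functions hold at every `m`. The
  -- tolerance `½` on top of the rounding error `½` gives 1.
  nearest-at : ∀ x y k → k NearestTo (x Defs.- fromℕ 30 Defs.* y) →
    ∃ λ m → ℚ.∣ approx x m - frac 30 0 * approx y m - frac k 0 ∣ ≤ 1ℚ
  nearest-at x y k h = let N , close = h ½ 0<½ in N , close N ℕ.≤-refl

  rounding-at : ∀ x p T → T RoundingOf (fromℕ 100 Defs.* x Defs.* fromℕ p) →
    ∃ λ m → ℚ.∣ frac 100 0 * approx x m * frac p 0 - frac T 0 ∣ ≤ 1ℚ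
  rounding-at x p T (δ , 0<δ , N , close) = N , ℚ.≤-trans (p≤p+q (ℚ.<⇒≤ 0<δ)) (close N ℕ.≤-refl)

  nearest-log : ∀ x q k → (∀ m → approx x m ≡ q) → k NearestTo (log₂ x Defs.- fromℕ 30 Defs.* log₂ (log₂ x)) →
    ∃ λ m → ℚ.∣ frac (index q m) m - frac 30 0 * frac (loglog-index q m) m - frac k 0 ∣ ≤ 1ℚ
  nearest-log x q k x≡q near = let m , h = nearest-at (log₂ x) (log₂ (log₂ x)) k near in
    m , subst₂ (λ x y → ℚ.∣ x - frac 30 0 * y - frac k 0 ∣ ≤ 1ℚ)
          (log₂-index x q m (x≡q m)) (loglog₂-index x q m (x≡q m)) h

  rounding-log : ∀ x q p T → (∀ m → approx x m ≡ q) → T RoundingOf (fromℕ 100 Defs.* log₂ x Defs.* fromℕ p) →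
    ∃ λ m → ℚ.∣ frac 100 0 * frac (index q m) m * frac p 0 - frac T 0 ∣ ≤ 1ℚ
  rounding-log x q p T x≡q round = let m , h = rounding-at (log₂ x) p T round in
    m , subst (λ x → ℚ.∣ frac 100 0 * x * frac p 0 - frac T 0 ∣ ≤ 1ℚ) (log₂-index x q m (x≡q m)) h

  nearest-bounds : ∀ j i k m → ℚ.∣ frac j m - frac 30 0 * frac i m - frac k 0 ∣ ≤ 1ℚ →
    j ℕ.≤ 30 ℕ.* i ℕ.+ (k ℕ.+ 1) ℕ.* suc m × 30 ℕ.* i ℕ.+ k ℕ.* suc m ℕ.≤ j ℕ.+ suc m
  nearest-bounds j i k m h = nat-cancel-≤ (subst₂ _≤_ (frac*nat j m) upper (*-monoʳ 0≤m₁ x≤))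
                           , nat-cancel-≤ (subst₂ _≤_ lower₁ lower₂ (*-monoʳ 0≤m₁ ≤x))
    where
    x = frac j m
    y = frac i m
    z = frac k 0
    m₁ = nat (suc m)
    0≤m₁ = 0≤nat (suc m)
    x≤ : x ≤ frac 30 0 * y + (z + 1ℚ)
    x≤ = subst₂ _≤_ (cancel₁ x (frac 30 0 * y)) (cancel₂ (frac 30 0 * y) z)
      (ℚ.+-monoˡ-≤ (frac 30 0 * y) (dist⇒≤ {x - frac 30 0 * y} {z} h))
      where
      cancel₁ : ∀ x y → x - y + y ≡ x
      cancel₁ = solve 2 (λ x y → x ⊖ y ⊕ y ⊜ x) refl
      cancel₂ : ∀ y z → z + 1ℚ + y ≡ y + (z + 1ℚ)
      cancel₂ = solve 2 (λ y z → z ⊕ Κ 1ℚ ⊕ y ⊜ y ⊕ (z ⊕ Κ 1ℚ)) refl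
    ≤x : frac 30 0 * y + z ≤ x + 1ℚ
    ≤x = subst (frac 30 0 * y + z ≤_) (cancel x (frac 30 0 * y))
      (ℚ.+-monoʳ-≤ (frac 30 0 * y) (dist⇒≤ {z} {x - frac 30 0 * y}
        (ℚ.≤-trans (ℚ.≤-reflexive (∣p-q∣≡∣q-p∣ z (x - frac 30 0 * y))) h)))
      where
      cancel : ∀ x y → y + (x - y + 1ℚ) ≡ x + 1ℚ
      cancel = solve 2 (λ x y → y ⊕ (x ⊖ y ⊕ Κ 1ℚ) ⊜ x ⊕ Κ 1ℚ) refl
    distrib₁ : ∀ a y z m → (a * y + (z + 1ℚ)) * m ≡ a * (y * m) + (z + 1ℚ) * m
    distrib₁ = solve 4 (λ a y z m → (a ⊗ y ⊕ (z ⊕ Κ 1ℚ)) ⊗ m ⊜ a ⊗ (y ⊗ m) ⊕ (z ⊕ Κ 1ℚ) ⊗ m) refl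
    distrib₂ : ∀ a y z m → (a * y + z) * m ≡ a * (y * m) + z * m
    distrib₂ = solve 4 (λ a y z m → (a ⊗ y ⊕ z) ⊗ m ⊜ a ⊗ (y ⊗ m) ⊕ z ⊗ m) refl
    distrib₃ : ∀ x m → (x + 1ℚ) * m ≡ x * m + m
    distrib₃ = solve 2 (λ x m → (x ⊕ Κ 1ℚ) ⊗ m ⊜ x ⊗ m ⊕ m) refl
    30i : frac 30 0 * nat i ≡ nat (30 ℕ.* i)
    30i = trans (cong (_* nat i) (sym (nat≡frac 30))) (sym (nat-* 30 i))
    upper : (frac 30 0 * y + (z + 1ℚ)) * m₁ ≡ nat (30 ℕ.* i ℕ.+ (k ℕ.+ 1) ℕ.* suc m)
    upper = trans (distrib₁ (frac 30 0) y z m₁) (trans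
      (cong₂ _+_ (trans (cong (frac 30 0 *_) (frac*nat i m)) 30i)
        (trans (cong (_* m₁) (trans (cong (_+ 1ℚ) (sym (nat≡frac k))) (sym (nat-+ k 1)))) (sym (nat-* (k ℕ.+ 1) (suc m)))))
      (sym (nat-+ (30 ℕ.* i) ((k ℕ.+ 1) ℕ.* suc m))))
    lower₁ : (frac 30 0 * y + z) * m₁ ≡ nat (30 ℕ.* i ℕ.+ k ℕ.* suc m)
    lower₁ = trans (distrib₂ (frac 30 0) y z m₁) (trans
      (cong₂ _+_ (trans (cong (frac 30 0 *_) (frac*nat i m)) 30i)
        (trans (cong (_* m₁) (sym (nat≡frac k))) (sym (nat-* k (suc m)))))
      (sym (nat-+ (30 ℕ.* i) (k ℕ.* suc m))))
    lower₂ : (x + 1ℚ) * m₁ ≡ nat (j ℕ.+ suc m)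
    lower₂ = trans (distrib₃ x m₁) (trans (cong (_+ m₁) (frac*nat j m)) (sym (nat-+ j (suc m))))

  rounding-bound : ∀ j p T m → ℚ.∣ frac 100 0 * frac j m * frac p 0 - frac T 0 ∣ ≤ 1ℚ →
    100 ℕ.* j ℕ.* p ℕ.≤ (T ℕ.+ 1) ℕ.* suc m
  rounding-bound j p T m h = nat-cancel-≤ (subst₂ _≤_ left right
    (*-monoʳ (0≤nat (suc m)) (dist⇒≤ {frac 100 0 * frac j m * frac p 0} {frac T 0} h)))
    where
    lemma : ∀ a x p m → a * x * p * m ≡ a * (x * m) * p
    lemma = solve 4 (λ a x p m → a ⊗ x ⊗ p ⊗ m ⊜ a ⊗ (x ⊗ m) ⊗ p) refl
    left : frac 100 0 * frac j m * frac p 0 * nat (suc m) ≡ nat (100 ℕ.* j ℕ.* p)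
    left = trans (lemma (frac 100 0) (frac j m) (frac p 0) (nat (suc m))) (trans
      (cong₂ (λ u v → u * v * frac p 0) (sym (nat≡frac 100)) (frac*nat j m))
      (trans (cong₂ _*_ (sym (nat-* 100 j)) (sym (nat≡frac p))) (sym (nat-* (100 ℕ.* j) p))))
    right : (frac T 0 + 1ℚ) * nat (suc m) ≡ nat ((T ℕ.+ 1) ℕ.* suc m)
    right = trans (cong (_* nat (suc m)) (trans (cong (_+ 1ℚ) (sym (nat≡frac T))) (sym (nat-+ T 1)))) (sym (nat-* (T ℕ.+ 1) (suc m)))

  module _ {n l s k T : ℕ} (2^l≤n : 2 ℕ.^ l ℕ.≤ n) (n<2^ : n ℕ.< 2 ℕ.^ suc l)
    (4^s≤l : 2 ℕ.^ (s ℕ.+ s) ℕ.≤ l) (l<4^′ : l ℕ.< 2 ℕ.^ (suc s ℕ.+ suc s)) (6≤s : 6 ℕ.≤ s) where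

    private
      -- One less than `2 s`: the approximation of `log₂ n` may fall short of `l` by `1 / (m + 1)`,
      -- hence just below `4ˢ`, and then only this power of two is sure to lie below it.
      a = ℕ.pred (s ℕ.+ s)

      1+a : suc a ≡ s ℕ.+ s
      1+a = ℕ.suc-pred (s ℕ.+ s) {{ℕ.>-nonZero (ℕ.≤-trans (ℕ.≤-trans (s≤s z≤n) 6≤s) (ℕ.m≤m+n s s))}}

      index₁ index₂ : ℕ → ℕ
      index₁ = index (frac n 0)
      index₂ = loglog-index (frac n 0)

      index₁-lower : ∀ m → l ℕ.* suc m ℕ.≤ suc (index₁ m)
      index₁-lower m = index-lower n 0 m l (subst (ℕ._≤ n) (sym (ℕ.*-identityʳ (2 ℕ.^ l))) 2^l≤n)

      index₁-upper : ∀ m → index₁ m ℕ.≤ suc l ℕ.* suc m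
      index₁-upper m = index-upper n 0 m (suc l) (subst (n ℕ.≤_) (sym (ℕ.*-identityʳ (2 ℕ.^ suc l))) (ℕ.<⇒≤ n<2^))

      s+s+2 : suc s ℕ.+ suc s ≡ s ℕ.+ s ℕ.+ 2
      s+s+2 = lemma s
        where
        lemma : ∀ s → suc s ℕ.+ suc s ≡ s ℕ.+ s ℕ.+ 2
        lemma = ℕ-Solver.solve-∀

      l<4^ : l ℕ.< 2 ℕ.^ (s ℕ.+ s ℕ.+ 2)
      l<4^ = subst (λ j → l ℕ.< 2 ℕ.^ j) s+s+2 l<4^′

      index₂-lower : ∀ m → a ℕ.* suc m ℕ.≤ suc (index₂ m)
      index₂-lower m = loglog-lower (frac n 0) m a (ℕ.≤-pred (begin
        suc (2 ℕ.^ a ℕ.* suc m)                ≤⟨ ℕ.+-monoˡ-≤ (2 ℕ.^ a ℕ.* suc m) (ℕ.*-mono-≤ (ℕ.m^n>0 2 a) (s≤s (z≤n {m}))) ⟩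
        2 ℕ.^ a ℕ.* suc m ℕ.+ 2 ℕ.^ a ℕ.* suc m ≡⟨ lemma (2 ℕ.^ a) (suc m) ⟩
        2 ℕ.^ suc a ℕ.* suc m                  ≡⟨ cong (λ j → 2 ℕ.^ j ℕ.* suc m) 1+a ⟩
        2 ℕ.^ (s ℕ.+ s) ℕ.* suc m              ≤⟨ ℕ.*-monoˡ-≤ (suc m) 4^s≤l ⟩
        l ℕ.* suc m                            ≤⟨ index₁-lower m ⟩
        suc (index₁ m)                         ∎))
        where
        open ℕ.≤-Reasoning
        lemma : ∀ x y → x ℕ.* y ℕ.+ x ℕ.* y ≡ 2 ℕ.* x ℕ.* y
        lemma = ℕ-Solver.solve-∀

      index₂-upper : ∀ m → index₂ m ℕ.≤ (s ℕ.+ s ℕ.+ 2) ℕ.* suc m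
      index₂-upper m = loglog-upper (frac n 0) m (s ℕ.+ s ℕ.+ 2) (ℕ.≤-trans (index₁-upper m) (ℕ.*-monoˡ-≤ (suc m) l<4^))

    module _ (near : k NearestTo (log₂ (fromℕ n) Defs.- fromℕ 30 Defs.* log₂ (log₂ (fromℕ n))))
      (round : T RoundingOf (fromℕ 100 Defs.* log₂ (fromℕ n) Defs.* fromℕ (2 ℕ.^ k))) where

      private
        near′ : ∃ λ m → ℚ.∣ frac (index₁ m) m - frac 30 0 * frac (index₂ m) m - frac k 0 ∣ ≤ 1ℚ
        near′ = nearest-log (fromℕ n) (frac n 0) k (λ _ → refl) near

        -- The constant 62 is `30 · 2` from the upper bound `2 s + 2` for the iterated logarithm, 1
        -- from rounding, and 1 from the index of `log₂ n`.
        l≤′ : l ℕ.≤ k ℕ.+ (60 ℕ.* s ℕ.+ 62)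
        l≤′ = let m , h = near′ in go m (proj₁ (nearest-bounds (index₁ m) (index₂ m) k m h))
          where
          open ℕ.≤-Reasoning
          lemma : ∀ s k m → suc m ℕ.+ (30 ℕ.* ((s ℕ.+ s ℕ.+ 2) ℕ.* suc m) ℕ.+ (k ℕ.+ 1) ℕ.* suc m) ≡ (k ℕ.+ (60 ℕ.* s ℕ.+ 62)) ℕ.* suc m
          lemma = ℕ-Solver.solve-∀
          go : ∀ m → index₁ m ℕ.≤ 30 ℕ.* index₂ m ℕ.+ (k ℕ.+ 1) ℕ.* suc m → l ℕ.≤ k ℕ.+ (60 ℕ.* s ℕ.+ 62)
          go m h = ℕ.*-cancelʳ-≤ l (k ℕ.+ (60 ℕ.* s ℕ.+ 62)) (suc m) (begin
            l ℕ.* suc m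
              ≤⟨ index₁-lower m ⟩
            1 ℕ.+ index₁ m
              ≤⟨ ℕ.+-mono-≤ (s≤s (z≤n {m})) (ℕ.≤-trans h (ℕ.+-monoˡ-≤ ((k ℕ.+ 1) ℕ.* suc m) (ℕ.*-monoʳ-≤ 30 (index₂-upper m)))) ⟩
            suc m ℕ.+ (30 ℕ.* ((s ℕ.+ s ℕ.+ 2) ℕ.* suc m) ℕ.+ (k ℕ.+ 1) ℕ.* suc m)
              ≡⟨ lemma s k m ⟩
            (k ℕ.+ (60 ℕ.* s ℕ.+ 62)) ℕ.* suc m ∎)

        -- Here 62 is 30 for the use of `2 s - 1` instead of `2 s`, 30 for the rounded index of the
        -- iterated logarithm, 1 for rounding, and 1 for `log₂ n ≤ l + 1`.
        k≤′ : k ℕ.+ 60 ℕ.* s ℕ.≤ l ℕ.+ 62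
        k≤′ = let m , h = near′ in go m (proj₂ (nearest-bounds (index₁ m) (index₂ m) k m h))
          where
          open ℕ.≤-Reasoning
          lemma₁ : ∀ k a m → (k ℕ.+ 30 ℕ.* a) ℕ.* suc m ≡ k ℕ.* suc m ℕ.+ 30 ℕ.* (a ℕ.* suc m)
          lemma₁ = ℕ-Solver.solve-∀
          lemma₂ : ∀ x i → x ℕ.+ 30 ℕ.* suc i ≡ 30 ℕ.* i ℕ.+ x ℕ.+ 30
          lemma₂ = ℕ-Solver.solve-∀
          lemma₃ : ∀ l m → suc l ℕ.* suc m ℕ.+ suc m ℕ.+ 30 ℕ.* suc m ≡ (l ℕ.+ 32) ℕ.* suc m
          lemma₃ = ℕ-Solver.solve-∀
          lemma₄ : ∀ s → 60 ℕ.* s ≡ 30 ℕ.* (s ℕ.+ s)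
          lemma₄ = ℕ-Solver.solve-∀
          lemma₅ : ∀ k a → k ℕ.+ 30 ℕ.* suc a ≡ k ℕ.+ 30 ℕ.* a ℕ.+ 30
          lemma₅ = ℕ-Solver.solve-∀
          go : ∀ m → 30 ℕ.* index₂ m ℕ.+ k ℕ.* suc m ℕ.≤ index₁ m ℕ.+ suc m → k ℕ.+ 60 ℕ.* s ℕ.≤ l ℕ.+ 62
          go m h = begin
            k ℕ.+ 60 ℕ.* s          ≡⟨ cong (k ℕ.+_) (trans (lemma₄ s) (cong (30 ℕ.*_) (sym 1+a))) ⟩
            k ℕ.+ 30 ℕ.* suc a      ≡⟨ lemma₅ k a ⟩
            k ℕ.+ 30 ℕ.* a ℕ.+ 30   ≤⟨ ℕ.+-monoˡ-≤ 30 (ℕ.*-cancelʳ-≤ (k ℕ.+ 30 ℕ.* a) (l ℕ.+ 32) (suc m) (begin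
              (k ℕ.+ 30 ℕ.* a) ℕ.* suc m                      ≡⟨ lemma₁ k a m ⟩
              k ℕ.* suc m ℕ.+ 30 ℕ.* (a ℕ.* suc m)            ≤⟨ ℕ.+-monoʳ-≤ (k ℕ.* suc m) (ℕ.*-monoʳ-≤ 30 (index₂-lower m)) ⟩
              k ℕ.* suc m ℕ.+ 30 ℕ.* suc (index₂ m)           ≡⟨ lemma₂ (k ℕ.* suc m) (index₂ m) ⟩
              30 ℕ.* index₂ m ℕ.+ k ℕ.* suc m ℕ.+ 30          ≤⟨ ℕ.+-mono-≤ h (ℕ.m≤m*n 30 (suc m)) ⟩
              index₁ m ℕ.+ suc m ℕ.+ 30 ℕ.* suc m             ≤⟨ ℕ.+-monoˡ-≤ (30 ℕ.* suc m) (ℕ.+-monoˡ-≤ (suc m) (index₁-upper m)) ⟩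
              suc l ℕ.* suc m ℕ.+ suc m ℕ.+ 30 ℕ.* suc m      ≡⟨ lemma₃ l m ⟩
              (l ℕ.+ 32) ℕ.* suc m                            ∎)) ⟩
            l ℕ.+ 32 ℕ.+ 30         ≡⟨ ℕ.+-assoc l 32 30 ⟩
            l ℕ.+ 62                ∎

        round′ : ∃ λ m → ℚ.∣ frac 100 0 * frac (index₁ m) m * frac (2 ℕ.^ k) 0 - frac T 0 ∣ ≤ 1ℚ
        round′ = rounding-log (fromℕ n) (frac n 0) (2 ℕ.^ k) T (λ _ → refl) round

        2≤l : 2 ℕ.≤ l
        2≤l = ℕ.≤-trans (ℕ.^-monoʳ-≤ 2 {1} {s ℕ.+ s} (ℕ.≤-trans (ℕ.≤-trans (s≤s z≤n) 6≤s) (ℕ.m≤m+n s s))) 4^s≤l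

        -- The factor 100 leaves `99 l 2ᵏ` to spare, and rounding together with the index error
        -- costs at most `1 + 100 · 2ᵏ`.
        T≥′ : l ℕ.* 2 ℕ.^ k ℕ.≤ T
        T≥′ = let m , h = round′ in go m (rounding-bound (index₁ m) p T m h)
          where
          open ℕ.≤-Reasoning
          p = 2 ℕ.^ k
          lemma₁ : ∀ l p m → 100 ℕ.* (l ℕ.* m) ℕ.* p ≡ 100 ℕ.* l ℕ.* p ℕ.* m
          lemma₁ = ℕ-Solver.solve-∀
          lemma₂ : ∀ j p → 100 ℕ.* suc j ℕ.* p ≡ 100 ℕ.* j ℕ.* p ℕ.+ 100 ℕ.* p
          lemma₂ = ℕ-Solver.solve-∀
          lemma₃ : ∀ l p → 100 ℕ.* l ℕ.* p ≡ l ℕ.* p ℕ.+ 99 ℕ.* (l ℕ.* p)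
          lemma₃ = ℕ-Solver.solve-∀
          lemma₄ : ∀ p → 99 ℕ.* (2 ℕ.* p) ≡ p ℕ.+ 100 ℕ.* p ℕ.+ 97 ℕ.* p
          lemma₄ = ℕ-Solver.solve-∀
          lemma₅ : ∀ x p → x ℕ.+ (1 ℕ.+ 100 ℕ.* p) ≡ x ℕ.+ 1 ℕ.+ 100 ℕ.* p
          lemma₅ = ℕ-Solver.solve-∀
          go : ∀ m → 100 ℕ.* index₁ m ℕ.* p ℕ.≤ (T ℕ.+ 1) ℕ.* suc m → l ℕ.* p ℕ.≤ T
          go m h = ℕ.+-cancelʳ-≤ (1 ℕ.+ 100 ℕ.* p) (l ℕ.* p) T (begin
            l ℕ.* p ℕ.+ (1 ℕ.+ 100 ℕ.* p)
              ≤⟨ ℕ.+-monoʳ-≤ (l ℕ.* p) (ℕ.≤-trans (ℕ.+-monoˡ-≤ (100 ℕ.* p) (ℕ.m^n>0 2 k))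
                   (ℕ.≤-trans (ℕ.m≤m+n (p ℕ.+ 100 ℕ.* p) (97 ℕ.* p)) (ℕ.≤-trans (ℕ.≤-reflexive (sym (lemma₄ p)))
                     (ℕ.*-monoʳ-≤ 99 (ℕ.*-monoˡ-≤ p 2≤l))))) ⟩
            l ℕ.* p ℕ.+ 99 ℕ.* (l ℕ.* p)
              ≡⟨ lemma₃ l p ⟨
            100 ℕ.* l ℕ.* p
              ≤⟨ ℕ.*-cancelʳ-≤ (100 ℕ.* l ℕ.* p) (T ℕ.+ 1 ℕ.+ 100 ℕ.* p) (suc m) (begin
                100 ℕ.* l ℕ.* p ℕ.* suc m               ≡⟨ lemma₁ l p (suc m) ⟨
                100 ℕ.* (l ℕ.* suc m) ℕ.* p             ≤⟨ ℕ.*-monoˡ-≤ p (ℕ.*-monoʳ-≤ 100 (index₁-lower m)) ⟩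
                100 ℕ.* suc (index₁ m) ℕ.* p            ≡⟨ lemma₂ (index₁ m) p ⟩
                100 ℕ.* index₁ m ℕ.* p ℕ.+ 100 ℕ.* p    ≤⟨ ℕ.+-mono-≤ h (ℕ.m≤m*n (100 ℕ.* p) (suc m)) ⟩
                (T ℕ.+ 1) ℕ.* suc m ℕ.+ 100 ℕ.* p ℕ.* suc m ≡⟨ ℕ.*-distribʳ-+ (suc m) (T ℕ.+ 1) (100 ℕ.* p) ⟨
                (T ℕ.+ 1 ℕ.+ 100 ℕ.* p) ℕ.* suc m       ∎) ⟩
            T ℕ.+ 1 ℕ.+ 100 ℕ.* p
              ≡⟨ lemma₅ T p ⟨
            T ℕ.+ (1 ℕ.+ 100 ℕ.* p) ∎)

        k+s≤l : k ℕ.+ s ℕ.≤ l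
        k+s≤l = ℕ.+-cancelʳ-≤ 62 (k ℕ.+ s) l (ℕ.≤-trans (ℕ.≤-trans (ℕ.≤-reflexive (ℕ.+-assoc k s 62))
          (ℕ.+-monoʳ-≤ k (large s 6≤s))) k≤′)
          where
          lemma : ∀ t → 6 ℕ.+ t ℕ.+ 62 ℕ.+ (292 ℕ.+ 59 ℕ.* t) ≡ 60 ℕ.* (6 ℕ.+ t)
          lemma = ℕ-Solver.solve-∀
          large : ∀ s → 6 ℕ.≤ s → s ℕ.+ 62 ℕ.≤ 60 ℕ.* s
          large s 6≤s = subst (λ s → s ℕ.+ 62 ℕ.≤ 60 ℕ.* s) (ℕ.m+[n∸m]≡n 6≤s)
            (ℕ.≤-trans (ℕ.m≤m+n _ (292 ℕ.+ 59 ℕ.* (s ∸ 6))) (ℕ.≤-reflexive (lemma (s ∸ 6))))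

      regime : Regime n l s k (l ∸ (k ℕ.+ s)) T
      regime = record
        { 2^l≤n = 2^l≤n
        ; n≤2^  = ℕ.<⇒≤ n<2^
        ; 4^s≤l = 4^s≤l
        ; l≤4^  = ℕ.<⇒≤ l<4^
        ; l≤    = l≤′
        ; k≤    = k≤′
        ; T≥    = T≥′
        ; 6≤s   = 6≤s
        ; b+k+s = trans (ℕ.+-assoc (l ∸ (k ℕ.+ s)) k s) (ℕ.m∸n+n≡m k+s≤l)
        }

  15ℚ : ℚ
  15ℚ = frac 15 0

  -- Bernoulli's inequality `(1 + 1/15)ˢ ≥ 1 + s/15`, cleared of denominators; it gives a decay rate
  -- that the Archimedean property can handle.
  bernoulli : ∀ s → 15/16 ^ s * (15ℚ + nat s) ≤ 15ℚ
  bernoulli zero    = ℚ.≤-refl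
  bernoulli (suc s) = ℚ.≤-trans
    (≤-by (15/16 ^ s * (frac 1 15 * nat s)) (0≤* (0≤^ s (ℚ.nonNegative⁻¹ 15/16)) (0≤* {frac 1 15} (0≤frac 1 15) (0≤nat s)))
      (lemma (15/16 ^ s) (nat s)))
    (bernoulli s)
    where
    lemma : ∀ x s → 15/16 * x * (15ℚ + (1ℚ + s)) + x * (frac 1 15 * s) ≡ x * (15ℚ + s)
    lemma = solve 2 (λ x s → Κ 15/16 ⊗ x ⊗ (Κ 15ℚ ⊕ (Κ 1ℚ ⊕ s)) ⊕ x ⊗ (Κ (frac 1 15) ⊗ s) ⊜ x ⊗ (Κ 15ℚ ⊕ s)) refl

  -- The numerator 360 is `24 · 15`, with the summand 15 in `bernoulli` dropped from the
  -- denominator.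
  decay-bound : ∀ t → 24ℚ * 15/16 ^ suc t ≤ frac 360 t
  decay-bound t = cancel-≤ {24ℚ * 15/16 ^ suc t} {frac 360 t} (0<nat t) (begin
    24ℚ * 15/16 ^ suc t * nat (suc t)
      ≡⟨ ℚ.*-assoc 24ℚ (15/16 ^ suc t) (nat (suc t)) ⟩
    24ℚ * (15/16 ^ suc t * nat (suc t))
      ≤⟨ *-monoˡ 24ℚ (ℚ.nonNegative⁻¹ 24ℚ) (ℚ.≤-trans (*-monoˡ (15/16 ^ suc t) (0≤^ (suc t) (ℚ.nonNegative⁻¹ 15/16))
           (≤-by {nat (suc t)} 15ℚ (ℚ.nonNegative⁻¹ 15ℚ) (ℚ.+-comm (nat (suc t)) 15ℚ))) (bernoulli (suc t))) ⟩
    24ℚ * 15ℚ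
      ≡⟨ nat≡frac 360 ⟨
    nat 360
      ≡⟨ frac*nat 360 t ⟨
    frac 360 t * nat (suc t) ∎)
    where open ℚ.≤-Reasoning

  abstract
    decay : ∀ {c} → 0ℚ < c → ∃ λ S → ∀ s → S ℕ.≤ s → 24ℚ * 15/16 ^ s ≤ c
    decay {c} 0<c = let N , h = archimedean 360 0<c in suc N , λ { (suc t) (s≤s N≤t) → ℚ.≤-trans (decay-bound t) (h t N≤t) }

  lg₄-lg-large : ∀ S {n} → 2 ℕ.^ (2 ℕ.^ (S ℕ.+ S)) ℕ.≤ n → S ℕ.≤ lg₄ (lg n)
  lg₄-lg-large S h = lg₄-large (lg-large h)

  error⟶0 : (λ n → fromℚ (24ℚ * 15/16 ^ lg₄ (lg n))) ⟶0
  error⟶0 δ (c , 0<c , M , c≤δ) = let S , h = decay 0<c in 2 ℕ.^ (2 ℕ.^ (S ℕ.+ S)) , λ n N≤n → λ η 0<η → M , λ m M≤m → begin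
    ℚ.∣ 24ℚ * 15/16 ^ lg₄ (lg n) ∣
      ≡⟨ ℚ.0≤p⇒∣p∣≡p (0≤* {24ℚ} (ℚ.nonNegative⁻¹ 24ℚ) (0≤^ (lg₄ (lg n)) (ℚ.nonNegative⁻¹ 15/16))) ⟩
    24ℚ * 15/16 ^ lg₄ (lg n)
      ≤⟨ h (lg₄ (lg n)) (lg₄-lg-large S N≤n) ⟩
    c
      ≡⟨ ℚ.+-identityˡ c ⟨
    0ℚ + c
      ≤⟨ c≤δ m M≤m ⟩
    approx δ m
      ≤⟨ p≤p+q (ℚ.<⇒≤ 0<η) ⟩
    approx δ m + η ∎
    where open ℚ.≤-Reasoning

  scaled : ∀ x → frac 5 3 * (24ℚ * x) ≡ 30ℚ * x
  scaled = solve 1 (λ x → Κ (frac 5 3) ⊗ (Κ 24ℚ ⊗ x) ⊜ Κ 30ℚ ⊗ x) refl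

  abstract
    threshold : ∃ λ S → 6 ℕ.≤ S × ∀ s → S ℕ.≤ s → 30ℚ * 15/16 ^ s ≤ 1ℚ
    -- `decay` bounds `24 r`, so the requirement `30 r ≤ 1` asks for the tolerance
    -- `24 / 30 = 4 / 5`.
    threshold = let S , h = decay {frac 4 4} (ℚ.positive⁻¹ (frac 4 4)) in 6 ℕ.⊔ S , ℕ.m≤m⊔n 6 S , λ s le →
      subst (_≤ 1ℚ) (scaled (15/16 ^ s)) (*-monoˡ (frac 5 3) (ℚ.nonNegative⁻¹ (frac 5 3)) (h s (ℕ.m⊔n≤o⇒n≤o 6 S le)))

open Extraction

open Defs using (_*_; _-_)

theorem1p3 : ∃ λ (ε : ℕ → ℝ) → ε ⟶0 × ∃ λ (N : ℕ) →
    ∀ (n : ℕ) → N ℕ.≤ n →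
    ∀ (k T : ℕ) →
    k NearestTo (log₂ (fromℕ n) - fromℕ 30 * log₂ (log₂ (fromℕ n))) →
    T RoundingOf (fromℕ 100 * log₂ (fromℕ n) * fromℕ (2 ℕ.^ k)) →
    ProbAtLeast G[ n ,½] (λ G → w₂[ law (hardcore G) , law (glauber G k T) ]≤ ε n) (1ℝ - ε n)
-- The error is a negative power of `log₂ n` up to constants. The threshold is doubly exponential
-- because half the iterated logarithm of `n` has to reach `S`.
theorem1p3 = (λ n → fromℚ (24ℚ ℚ.* 15/16 ^ lg₄ (lg n))) , error⟶0 , 2 ℕ.^ (2 ℕ.^ (S ℕ.+ S)) , λ n N≤n k T near round →
  let S≤s = lg₄-lg-large S N≤n
      1≤n = ℕ.≤-trans (ℕ.m^n>0 2 (2 ℕ.^ (S ℕ.+ S))) N≤n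
      6≤s = ℕ.≤-trans (proj₁ (proj₂ threshold)) S≤s
  in close-with-high-probability
       (regime {n} {lg n} {lg₄ (lg n)} {k} {T} (2^lg≤ 1≤n) (<2^lg n) (4^lg₄≤ (0<lg 6≤s)) (<4^lg₄ (lg n)) 6≤s near round)
       (proj₂ (proj₂ threshold) (lg₄ (lg n)) S≤s)
  where
  S = proj₁ threshold
  0<lg : ∀ {l} → 6 ℕ.≤ lg₄ l → 1 ℕ.≤ l
  0<lg {suc l} _ = s≤s z≤n
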